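{- Let $i,k,\ell\in\mathbb{Z}$ with $k\ge 1$ and $0\le i\le k$, and write $N_j:=n_j+n_{j+1}+\cdots+n_k$ for $1\le j\le k$. Then $$\frac{(-q)_\infty}{(q)_\infty}\left(\sum_{n\ge|\ell|}-\sum_{n\le-|\ell|-1}\right)q^{\left(k+\frac12\right)\left(n+\frac{2i-1}{4k+2}\right)^2-\frac{\left(2k\ell+i+\ell-\frac12\right)^2}{4k+2}}\,(1+q^n)$$ $$=\sum_{n_1,n_2,\dots,n_k\ge0}\frac{q^{\frac{N_1(N_1+1)}{2}+N_2^2+N_3^2+\cdots+N_k^2+\ell N_1+(2\ell+1)(N_2+N_3+\cdots+N_k)-N_1-N_2-\cdots-N_{k-i}}\,(-q)_{N_1+\ell}}{(q)_{n_1}(q)_{n_2}\cdots(q)_{n_k}\,(q)_{n_k+2\ell}}.$$ Furthermore, the case $i=k$ simplifies as $$\frac{(-q)_\infty}{(q)_\infty}\left(\sum_{n\ge|\ell|}-\sum_{n\le-|\ell|-1}\right)q^{\left(k+\frac12\right)\left(n+\frac{2k-1}{4k+2}\right)^2-\frac{\left(2k\ell+k+\ell-\frac12\right)^2}{4k+2}}$$ $$=\sum_{n_1,n_2,\dots,n_k\ge0}\frac{q^{\frac{N_1(N_1+1)}{2}+N_2^2+N_3^2+\cdots+N_k^2+\ell N_1+(2\ell+1)(N_2+N_3+\cdots+N_k)}\,(-q)_{N_1+\ell}}{(q)_{n_1}(q)_{n_2}\cdots(q)_{n_k}\,(q)_{n_k+2\ell}}.$$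
   Context: Conventions: $q=e^{2\pi i\tau}$ with $\operatorname{Im}\tau>0$ (so $|q|<1$), and $q^r:=e^{2\pi i r\tau}$ for rational $r$ (here, in $e^{2\pi i\tau}$, $i$ is the imaginary unit; elsewhere $i$ is an integer index). The $q$-Pochhammer symbols are $(a)_n=(a;q)_n:=\prod_{j=1}^n(1-aq^{j-1})$ for $n\ge0$, $(a)_\infty:=\prod_{j\ge1}(1-aq^{j-1})$. By convention $1/(q)_m=0$ for integers $m<0$, so that summands on the right with $n_k+2\ell<0$ are zero. The expression $-N_1-N_2-\cdots-N_{k-i}$ means $-\sum_{j=1}^{k-i}N_j$, which is empty (zero) when $i=k$; likewise $N_2^2+\cdots+N_k^2$ and $N_2+\cdots+N_k$ are zero when $k=1$. The notation $\left(\sum_{n\ge|\ell|}-\sum_{n\le-|\ell|-1}\right)f(n)$ means $\sum_{n\ge|\ell|}f(n)-\sum_{n\le-|\ell|-1}f(n)$ with $n\in\mathbb{Z}$. -}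

module Defs where

open import Data.Integer as ℤ using (ℤ; +_; -[1+_])
import Data.Integer.Properties as ℤₚ
open import Data.List using (List; []; _∷_; map; upTo)
import Data.List as List
import Data.Nat.ListAction as ℕ
open import Data.List.Relation.Binary.Subset.Propositional using (_⊆_)
open import Data.List.Relation.Unary.Unique.Propositional using (Unique)
open import Data.Nat as ℕ using (ℕ; zero; suc; _≤_; _∸_)
import Data.Nat.Properties as ℕₚ
open import Data.Product using (Σ-syntax; ∃-syntax; _×_; _,_; proj₁; proj₂)
import Data.Rational as ℚ
open import Data.Rational using (ℚ; 0ℚ; 1ℚ; ½; _/_)
import Data.Rational.Properties as ℚₚ
import Data.Rational.Unnormalised as ℚᵘ
import Data.Rational.Unnormalised.Properties as ℚᵘₚ
open import Data.Rational.Literals using (fromℤ)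
open import Data.Rational.Solver using (module +-*-Solver)
open import Data.Sum using (inj₁; inj₂)
open import Data.Vec using (Vec; []; _∷_)
open import Function using (_∘_)
open import Relation.Binary.PropositionalEquality using (_≡_; refl; sym; trans; cong; cong₂; subst; subst₂)

module Estimates where

  open import Data.Rational using (_+_; _*_; _-_; -_; _<_; ∣_∣; 1/_) renaming (_≤_ to _≤q_)
  open +-*-Solver using (solve; _:+_; _:*_; _:-_; :-_; _:=_; con)

  half-pos : ∀ {ε} → 0ℚ < ε → 0ℚ < ½ * ε
  half-pos {ε} p = subst (_< ½ * ε) (ℚₚ.*-zeroʳ ½) (ℚₚ.*-monoʳ-<-pos ½ p)

  halves : ∀ ε → ½ * ε + ½ * ε ≡ ε
  halves = solve 1 (λ e → con ½ :* e :+ con ½ :* e := e) refl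

  half-< : ∀ {ε} → 0ℚ < ε → ½ * ε < ε
  half-< {ε} p = subst₂ _<_ (ℚₚ.+-identityʳ (½ * ε)) (halves ε)
    (ℚₚ.+-monoʳ-< (½ * ε) (half-pos p))

  swap-∣-∣ : ∀ x y → ∣ x - y ∣ ≡ ∣ y - x ∣
  swap-∣-∣ x y = trans (sym (ℚₚ.∣-p∣≡∣p∣ (x - y)))
    (cong ∣_∣ (solve 2 (λ a b → :- (a :- b) := b :- a) refl x y))

  triangle : ∀ x y z → ∣ x - z ∣ ≤q ∣ x - y ∣ + ∣ y - z ∣
  triangle x y z = subst (λ w → ∣ w ∣ ≤q ∣ x - y ∣ + ∣ y - z ∣)
    (solve 3 (λ a b c → (a :- b) :+ (b :- c) := a :- c) refl x y z)
    (ℚₚ.∣p+q∣≤∣p∣+∣q∣ (x - y) (y - z))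

  move-right : ∀ {x y z} → x ≤q y + z → x - z ≤q y
  move-right {x} {y} {z} p = subst (x - z ≤q_)
    (solve 2 (λ a b → (a :+ b) :- b := a) refl y z) (ℚₚ.+-monoˡ-≤ (- z) p)

  ∣-∣-difference : ∀ x y → ∣ x ∣ - ∣ y ∣ ≤q ∣ x - y ∣
  ∣-∣-difference x y = move-right (subst (λ w → ∣ w ∣ ≤q ∣ x - y ∣ + ∣ y ∣)
    (solve 2 (λ a b → (a :- b) :+ b := a) refl x y) (ℚₚ.∣p+q∣≤∣p∣+∣q∣ (x - y) y))

  ∣-∣-Lipschitz : ∀ x y → ∣ ∣ x ∣ - ∣ y ∣ ∣ ≤q ∣ x - y ∣
  ∣-∣-Lipschitz x y with ℚₚ.∣p∣≡p∨∣p∣≡-p (∣ x ∣ - ∣ y ∣)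
  ... | inj₁ e = subst (_≤q ∣ x - y ∣) (sym e) (∣-∣-difference x y)
  ... | inj₂ e = subst₂ _≤q_
    (sym (trans e (solve 2 (λ a b → :- (a :- b) := b :- a) refl ∣ x ∣ ∣ y ∣)))
    (swap-∣-∣ y x) (∣-∣-difference y x)

  *-mono-nonNeg : ∀ {a b c d} → 0ℚ ≤q c → 0ℚ ≤q b → a ≤q b → c ≤q d → a * c ≤q b * d
  *-mono-nonNeg {a} {b} {c} {d} 0≤c 0≤b a≤b c≤d = ℚₚ.≤-trans
    (ℚₚ.*-monoʳ-≤-nonNeg c {{ℚ.nonNegative 0≤c}} a≤b)
    (ℚₚ.*-monoˡ-≤-nonNeg b {{ℚ.nonNegative 0≤b}} c≤d)

  0≤∣_∣ : ∀ x → 0ℚ ≤q ∣ x ∣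
  0≤∣ x ∣ = ℚₚ.nonNegative⁻¹ ∣ x ∣ {{ℚₚ.∣-∣-nonNeg x}}

  unit-fraction : ℕ → ℚ
  unit-fraction n = + 1 / suc n

  unit-fraction-pos : ∀ n → 0ℚ < unit-fraction n
  unit-fraction-pos n = ℚₚ.positive⁻¹ _ {{ℚₚ.normalize-pos 1 (suc n)}}

  toℚᵘ-/ : ∀ i n → ℚ.toℚᵘ (i / suc n) ℚᵘ.≃ ℚᵘ.mkℚᵘ i n
  toℚᵘ-/ i n = ℚₚ.toℚᵘ-fromℚᵘ (ℚᵘ.mkℚᵘ i n)

  archimedean : ∀ a ε → 0ℚ < ε → ∃[ N ] ∀ n → N ≤ n → + a / suc n < ε
  archimedean a ε@(ℚ.mkℚ (+ suc p) d _) _ = a ℕ.* suc d , λ n le →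
    ℚₚ.toℚᵘ-cancel-< (ℚᵘₚ.<-respˡ-≃ (ℚᵘₚ.≃-sym (toℚᵘ-/ (+ a) n))
      (ℚᵘ.*<* (subst₂ ℤ._<_ (ℤₚ.pos-* a (suc d)) (ℤₚ.pos-* (suc p) (suc n))
        (ℤ.+<+ (ℕ.s≤s (ℕₚ.≤-trans le (ℕₚ.m≤m+n n _)))))))
  archimedean a (ℚ.mkℚ (+ 0) d _) (ℚ.*<* (ℤ.+<+ ()))
  archimedean a (ℚ.mkℚ -[1+ _ ] d _) (ℚ.*<* ())

  /-antitone : ∀ a {m n} → m ≤ n → + a / suc n ≤q + a / suc m
  /-antitone a {m} {n} m≤n = ℚₚ.toℚᵘ-cancel-≤
    (ℚᵘₚ.≤-respˡ-≃ (ℚᵘₚ.≃-sym (toℚᵘ-/ (+ a) n)) (ℚᵘₚ.≤-respʳ-≃ (ℚᵘₚ.≃-sym (toℚᵘ-/ (+ a) m))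
      (ℚᵘ.*≤* (subst₂ ℤ._≤_ (ℤₚ.pos-* a (suc m)) (ℤₚ.pos-* a (suc n))
        (ℤ.+≤+ (ℕₚ.*-monoʳ-≤ a (ℕ.s≤s m≤n)))))))

  sum : (ℕ → ℚ) → ℕ → ℚ
  sum u zero    = 0ℚ
  sum u (suc n) = sum u n + u n

  module _ (u g : ℕ → ℚ) (J : ℕ) (bound : ∀ j → J ≤ j → ∣ u j ∣ ≤q g j - g (suc j)) where

    telescope : ∀ m d → J ≤ m → ∣ sum u (d ℕ.+ m) - sum u m ∣ ≤q g m - g (d ℕ.+ m)
    telescope m zero J≤m = ℚₚ.≤-reflexive (trans
      (cong ∣_∣ (ℚₚ.+-inverseʳ (sum u m))) (sym (ℚₚ.+-inverseʳ (g m))))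
    telescope m (suc d) J≤m = begin
      ∣ (S + v) - sum u m ∣                    ≡⟨ cong ∣_∣ (solve 3 (λ a b c → (a :+ b) :- c := (a :- c) :+ b) refl S v (sum u m)) ⟩
      ∣ (S - sum u m) + v ∣                    ≤⟨ ℚₚ.∣p+q∣≤∣p∣+∣q∣ (S - sum u m) v ⟩
      ∣ S - sum u m ∣ + ∣ v ∣                  ≤⟨ ℚₚ.+-mono-≤ (telescope m d J≤m) (bound (d ℕ.+ m) (ℕₚ.≤-trans J≤m (ℕₚ.m≤n+m m d))) ⟩
      (g m - g (d ℕ.+ m)) + (g (d ℕ.+ m) - g (suc d ℕ.+ m))
        ≡⟨ solve 3 (λ a b c → (a :- b) :+ (b :- c) := a :- c) refl (g m) (g (d ℕ.+ m)) (g (suc d ℕ.+ m)) ⟩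
      g m - g (suc d ℕ.+ m) ∎
      where
      open ℚₚ.≤-Reasoning
      S = sum u (d ℕ.+ m)
      v = u (d ℕ.+ m)

    module _ (g≥0 : ∀ j → J ≤ j → 0ℚ ≤q g j) where

      tail-≤ : ∀ m n → J ≤ m → m ≤ n → ∣ sum u n - sum u m ∣ ≤q g m
      tail-≤ m n J≤m m≤n = subst (λ k → ∣ sum u k - sum u m ∣ ≤q g m) (ℕₚ.m∸n+n≡m m≤n)
        (ℚₚ.≤-trans (telescope m (n ∸ m) J≤m)
          (subst (g m - g k ≤q_) (ℚₚ.+-identityʳ (g m))
            (ℚₚ.+-monoʳ-≤ (g m) (ℚₚ.neg-antimono-≤ (g≥0 k (ℕₚ.≤-trans J≤m (ℕₚ.m≤n+m m (n ∸ m))))))))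
        where k = n ∸ m ℕ.+ m

      tail-< : ∀ {ε} m n → J ≤ m → J ≤ n → g m < ε → g n < ε → ∣ sum u m - sum u n ∣ < ε
      tail-< {ε} m n J≤m J≤n gm gn with ℕₚ.≤-total m n
      ... | inj₁ m≤n = subst (_< ε) (swap-∣-∣ (sum u n) (sum u m)) (ℚₚ.≤-<-trans (tail-≤ m n J≤m m≤n) gm)
      ... | inj₂ n≤m = ℚₚ.≤-<-trans (tail-≤ n m J≤n n≤m) gn

open Estimates

-- Real numbers: Cauchy sequences of rationals, compared by _≈ᴿ_.

IsCauchy : (ℕ → ℚ) → Set
IsCauchy x = ∀ ε → 0ℚ ℚ.< ε → ∃[ N ] ∀ m n → N ≤ m → N ≤ n → ℚ.∣ x m ℚ.- x n ∣ ℚ.< ε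

record ℝ : Set where
  constructor mkℝ
  field
    seq    : ℕ → ℚ
    cauchy : IsCauchy seq

open ℝ

infix 4 _≈ᴿ_ _<ᴿ_

_≈ᴿ_ : ℝ → ℝ → Set
x ≈ᴿ y = ∀ ε → 0ℚ ℚ.< ε → ∃[ N ] ∀ n → N ≤ n → ℚ.∣ seq x n ℚ.- seq y n ∣ ℚ.< ε

_<ᴿ_ : ℝ → ℝ → Set
x <ᴿ y = ∃[ δ ] (0ℚ ℚ.< δ × ∃[ N ] ∀ n → N ≤ n → seq x n ℚ.+ δ ℚ.< seq y n)

module RealArithmetic where

  open import Data.Rational using (_+_; _*_; _-_; -_; _<_; ∣_∣; 1/_) renaming (_≤_ to _≤q_)
  open +-*-Solver using (solve; _:+_; _:*_; _:-_; :-_; _:=_; con)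

  eventually-bounded : (x : ℝ) → ∃[ B ] (0ℚ < B × ∃[ N ] ∀ n → N ≤ n → ∣ seq x n ∣ < B)
  eventually-bounded x with cauchy x 1ℚ (ℚₚ.positive⁻¹ 1ℚ)
  ... | N , close = ∣ seq x N ∣ + 1ℚ
      , ℚₚ.+-mono-≤-< (0≤∣ seq x N ∣) (ℚₚ.positive⁻¹ 1ℚ)
      , N , λ n N≤n → subst (_< ∣ seq x N ∣ + 1ℚ)
          (solve 2 (λ a b → b :+ (a :- b) := a) refl ∣ seq x n ∣ ∣ seq x N ∣)
          (ℚₚ.+-monoʳ-< ∣ seq x N ∣ (ℚₚ.≤-<-trans (∣-∣-difference (seq x n) (seq x N))
            (close n N N≤n ℕₚ.≤-refl)))

  constant : ℚ → ℝ
  constant r = mkℝ (λ _ → r) λ ε ε>0 → 0 , λ _ _ _ _ →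
    subst (_< ε) (cong ∣_∣ (sym (ℚₚ.+-inverseʳ r))) ε>0

  add : ℝ → ℝ → ℝ
  add x y = mkℝ (λ n → seq x n + seq y n) λ ε ε>0 →
    let (M , p) = cauchy x (½ * ε) (half-pos ε>0)
        (N , q) = cauchy y (½ * ε) (half-pos ε>0)
    in M ℕ.⊔ N , λ m n ≤m ≤n → subst₂ _<_
         (cong ∣_∣ refl) (halves ε)
         (ℚₚ.≤-<-trans
           (subst (λ w → ∣ w ∣ ≤q ∣ seq x m - seq x n ∣ + ∣ seq y m - seq y n ∣)
             (solve 4 (λ a b c d → (a :- b) :+ (c :- d) := (a :+ c) :- (b :+ d)) refl
               (seq x m) (seq x n) (seq y m) (seq y n))
             (ℚₚ.∣p+q∣≤∣p∣+∣q∣ (seq x m - seq x n) (seq y m - seq y n)))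
           (ℚₚ.+-mono-< (p m n (ℕₚ.m⊔n≤o⇒m≤o M N ≤m) (ℕₚ.m⊔n≤o⇒m≤o M N ≤n))
                        (q m n (ℕₚ.m⊔n≤o⇒n≤o M N ≤m) (ℕₚ.m⊔n≤o⇒n≤o M N ≤n))))

  negate : ℝ → ℝ
  negate x = mkℝ (λ n → - seq x n) λ ε ε>0 →
    let (N , p) = cauchy x ε ε>0
    in N , λ m n ≤m ≤n → subst (_< ε)
         (trans (swap-∣-∣ (seq x m) (seq x n))
           (cong ∣_∣ (solve 2 (λ a b → b :- a := :- a :- (:- b)) refl (seq x m) (seq x n))))
         (p m n ≤m ≤n)

  absolute : ℝ → ℝ
  absolute x = mkℝ (λ n → ∣ seq x n ∣) λ ε ε>0 →
    let (N , p) = cauchy x ε ε>0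
    in N , λ m n ≤m ≤n → ℚₚ.≤-<-trans (∣-∣-Lipschitz (seq x m) (seq x n)) (p m n ≤m ≤n)

  -- A modulus for one factor of a product: δ with δ * B = ½ * ε.
  module _ {ε B : ℚ} (ε>0 : 0ℚ < ε) (B>0 : 0ℚ < B) where

    private instance
      B-pos : ℚ.Positive B
      B-pos = ℚ.positive B>0

      B-nonZero : ℚ.NonZero B
      B-nonZero = ℚₚ.pos⇒nonZero B

    modulus : ℚ
    modulus = ½ * ε * 1/ B

    modulus-pos : 0ℚ < modulus
    modulus-pos = subst (_< modulus) (ℚₚ.*-zeroʳ (½ * ε))
      (ℚₚ.*-monoʳ-<-pos (½ * ε) {{ℚ.positive (half-pos ε>0)}}
        (ℚₚ.positive⁻¹ (1/ B) {{ℚₚ.1/pos⇒pos B}}))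

    modulus-* : modulus * B ≡ ½ * ε
    modulus-* = trans (ℚₚ.*-assoc (½ * ε) (1/ B) B)
      (trans (cong (½ * ε *_) (ℚₚ.*-inverseˡ B)) (ℚₚ.*-identityʳ (½ * ε)))

    modulus-bound : ∀ u v → ∣ u ∣ < modulus → ∣ v ∣ < B → ∣ u * v ∣ < ½ * ε
    modulus-bound u v p q = begin-strict
      ∣ u * v ∣       ≡⟨ ℚₚ.∣p*q∣≡∣p∣*∣q∣ u v ⟩
      ∣ u ∣ * ∣ v ∣   ≤⟨ ℚₚ.*-monoˡ-≤-nonNeg ∣ u ∣ {{ℚₚ.∣-∣-nonNeg u}} (ℚₚ.<⇒≤ q) ⟩
      ∣ u ∣ * B       <⟨ ℚₚ.*-monoˡ-<-pos B p ⟩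
      modulus * B     ≡⟨ modulus-* ⟩
      ½ * ε           ∎
      where open ℚₚ.≤-Reasoning

  multiply : ℝ → ℝ → ℝ
  multiply x y = mkℝ (λ n → seq x n * seq y n) λ ε ε>0 →
    let (A , A>0 , M₁ , bx) = eventually-bounded x
        (B , B>0 , M₂ , by) = eventually-bounded y
        (N₁ , cx) = cauchy x (modulus ε>0 B>0) (modulus-pos ε>0 B>0)
        (N₂ , cy) = cauchy y (modulus ε>0 A>0) (modulus-pos ε>0 A>0)
        N = (M₁ ℕ.⊔ M₂) ℕ.⊔ (N₁ ℕ.⊔ N₂)
        M₁≤ : M₁ ≤ N
        M₁≤ = ℕₚ.≤-trans (ℕₚ.m≤m⊔n M₁ M₂) (ℕₚ.m≤m⊔n _ _)
        M₂≤ : M₂ ≤ N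
        M₂≤ = ℕₚ.≤-trans (ℕₚ.m≤n⊔m M₁ M₂) (ℕₚ.m≤m⊔n _ _)
        N₁≤ : N₁ ≤ N
        N₁≤ = ℕₚ.≤-trans (ℕₚ.m≤m⊔n N₁ N₂) (ℕₚ.m≤n⊔m (M₁ ℕ.⊔ M₂) _)
        N₂≤ : N₂ ≤ N
        N₂≤ = ℕₚ.≤-trans (ℕₚ.m≤n⊔m N₁ N₂) (ℕₚ.m≤n⊔m (M₁ ℕ.⊔ M₂) _)
    in N , λ m n ≤m ≤n →
         let dx = seq x m - seq x n
             dy = seq y m - seq y n
         in subst₂ _<_ refl (halves ε)
         (ℚₚ.≤-<-trans
           (subst (λ w → ∣ w ∣ ≤q ∣ dx * seq y m ∣ + ∣ dy * seq x n ∣)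
             (solve 4 (λ a b c d → (a :- b) :* c :+ (c :- d) :* b := a :* c :- b :* d) refl
               (seq x m) (seq x n) (seq y m) (seq y n))
             (ℚₚ.∣p+q∣≤∣p∣+∣q∣ (dx * seq y m) (dy * seq x n)))
           (ℚₚ.+-mono-<
             (modulus-bound ε>0 B>0 dx (seq y m)
               (cx m n (ℕₚ.≤-trans N₁≤ ≤m) (ℕₚ.≤-trans N₁≤ ≤n)) (by m (ℕₚ.≤-trans M₂≤ ≤m)))
             (modulus-bound ε>0 A>0 dy (seq x n)
               (cy m n (ℕₚ.≤-trans N₂≤ ≤m) (ℕₚ.≤-trans N₂≤ ≤n)) (bx n (ℕₚ.≤-trans M₁≤ ≤n)))))

open RealArithmetic public using () renaming
  (constant to ofℚ; add to infixl 6 _+ᴿ_; multiply to infixl 7 _*ᴿ_; negate to infix 8 -ᴿ_;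
   absolute to ∣_∣ᴿ)

infixl 6 _-ᴿ_

_-ᴿ_ : ℝ → ℝ → ℝ
x -ᴿ y = x +ᴿ -ᴿ y

0ᴿ : ℝ
0ᴿ = ofℚ 0ℚ

IsCauchyᴿ : (ℕ → ℝ) → Set
IsCauchyᴿ x = ∀ ε → 0ℚ ℚ.< ε → ∃[ N ] ∀ m n → N ≤ m → N ≤ n → ∣ x m -ᴿ x n ∣ᴿ <ᴿ ofℚ ε

module Completeness (x : ℕ → ℝ) (c : IsCauchyᴿ x) where

  open import Data.Rational using (_+_; _*_; _-_; -_; _<_; ∣_∣) renaming (_≤_ to _≤q_)
  open +-*-Solver using (solve; _:+_; _:*_; _:-_; :-_; _:=_; con)

  index : ℕ → ℕ
  index k = proj₁ (cauchy (x k) (unit-fraction k) (unit-fraction-pos k))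

  diagonal : ℕ → ℚ
  diagonal k = seq (x k) (index k)

  diagonal-close : ∀ k t → index k ≤ t → ∣ seq (x k) t - diagonal k ∣ < unit-fraction k
  diagonal-close k t le =
    proj₂ (cauchy (x k) (unit-fraction k) (unit-fraction-pos k)) t (index k) le ℕₚ.≤-refl

  quarters : ∀ ε → ½ * (½ * ε) + ½ * ε + ½ * (½ * ε) ≡ ε
  quarters = solve 1 (λ e → con ½ :* (con ½ :* e) :+ con ½ :* e :+ con ½ :* (con ½ :* e) := e) refl

  diagonal-cauchy : IsCauchy diagonal
  diagonal-cauchy ε ε>0 =
    let (N₁ , p) = c (½ * ε) (half-pos ε>0)
        (N₂ , a) = archimedean 1 (½ * (½ * ε)) (half-pos (half-pos ε>0))
    in N₁ ℕ.⊔ N₂ , λ m n ≤m ≤n →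
      let (δ , δ>0 , M , close) = p m n (ℕₚ.m⊔n≤o⇒m≤o N₁ N₂ ≤m) (ℕₚ.m⊔n≤o⇒m≤o N₁ N₂ ≤n)
          t = (index m ℕ.⊔ index n) ℕ.⊔ M
          ym = diagonal m
          yn = diagonal n
          xm = seq (x m) t
          xn = seq (x n) t
          ym-xm : ∣ ym - xm ∣ < ½ * (½ * ε)
          ym-xm = subst (_< ½ * (½ * ε)) (swap-∣-∣ xm ym) (ℚₚ.<-trans
            (diagonal-close m t (ℕₚ.≤-trans (ℕₚ.m≤m⊔n (index m) (index n)) (ℕₚ.m≤m⊔n _ M)))
            (a m (ℕₚ.m⊔n≤o⇒n≤o N₁ N₂ ≤m)))
          xn-yn : ∣ xn - yn ∣ < ½ * (½ * ε)
          xn-yn = ℚₚ.<-trans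
            (diagonal-close n t (ℕₚ.≤-trans (ℕₚ.m≤n⊔m (index m) (index n)) (ℕₚ.m≤m⊔n _ M)))
            (a n (ℕₚ.m⊔n≤o⇒n≤o N₁ N₂ ≤n))
          xm-xn : ∣ xm - xn ∣ < ½ * ε
          xm-xn = ℚₚ.≤-<-trans
            (subst (_≤q ∣ xm - xn ∣ + δ) (ℚₚ.+-identityʳ _) (ℚₚ.+-monoʳ-≤ ∣ xm - xn ∣ (ℚₚ.<⇒≤ δ>0)))
            (close t (ℕₚ.m≤n⊔m (index m ℕ.⊔ index n) M))
      in subst (∣ ym - yn ∣ <_) (quarters ε) (ℚₚ.≤-<-trans
           (ℚₚ.≤-trans (triangle ym xn yn) (ℚₚ.+-monoˡ-≤ ∣ xn - yn ∣ (triangle ym xm xn)))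
           (ℚₚ.+-mono-< (ℚₚ.+-mono-< ym-xm xm-xn) xn-yn))

  limit : ℝ
  limit = mkℝ diagonal diagonal-cauchy

  limit-correct : ∀ ε → 0ℚ < ε → ∃[ N ] ∀ n → N ≤ n → ∣ x n -ᴿ limit ∣ᴿ <ᴿ ofℚ ε
  limit-correct ε ε>0 =
    let ε/2 = ½ * ε
        ε/4 = ½ * ε/2
        ε/4>0 = half-pos (half-pos ε>0)
        (N₁ , p) = diagonal-cauchy ε/4 ε/4>0
        (N₂ , a) = archimedean 1 ε/4 ε/4>0
    in N₁ ℕ.⊔ N₂ , λ n ≤n → ε/2 , half-pos ε>0 , index n ℕ.⊔ N₁ , λ t ≤t →
      let near : ∣ seq (x n) t - diagonal t ∣ < ε/4 + ε/4
          near = ℚₚ.≤-<-trans (triangle (seq (x n) t) (diagonal n) (diagonal t)) (ℚₚ.+-mono-<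
            (ℚₚ.<-trans (diagonal-close n t (ℕₚ.m⊔n≤o⇒m≤o (index n) N₁ ≤t)) (a n (ℕₚ.m⊔n≤o⇒n≤o N₁ N₂ ≤n)))
            (p n t (ℕₚ.m⊔n≤o⇒m≤o N₁ N₂ ≤n) (ℕₚ.m⊔n≤o⇒n≤o (index n) N₁ ≤t)))
      in subst (∣ seq (x n) t - diagonal t ∣ + ε/2 <_)
           (solve 1 (λ e → con ½ :* (con ½ :* e) :+ con ½ :* (con ½ :* e) :+ con ½ :* e := e) refl ε)
           (ℚₚ.+-monoˡ-< ε/2 near)

open Completeness public using () renaming (limit to lim)

record ℂ : Set where
  constructor mkℂ
  field
    re : ℝ
    im : ℝ

open ℂ public

infix  4 _≈_ _⟶_
infixl 6 _⋯_
infixl 9 _‼_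
infixl 6 _+_ _-_
infixl 7 _*_ _·_
infix  8 -_
infixr 8 _^_

_≈_ : ℂ → ℂ → Set
z ≈ w = re z ≈ᴿ re w × im z ≈ᴿ im w

_+_ : ℂ → ℂ → ℂ
z + w = mkℂ (re z +ᴿ re w) (im z +ᴿ im w)

-_ : ℂ → ℂ
- z = mkℂ (-ᴿ re z) (-ᴿ im z)

_-_ : ℂ → ℂ → ℂ
z - w = z + - w

_*_ : ℂ → ℂ → ℂ
z * w = mkℂ (re z *ᴿ re w -ᴿ im z *ᴿ im w) (re z *ᴿ im w +ᴿ im z *ᴿ re w)

_·_ : ℚ → ℂ → ℂ
r · z = mkℂ (ofℚ r *ᴿ re z) (ofℚ r *ᴿ im z)

0ℂ 1ℂ : ℂ
0ℂ = mkℂ 0ᴿ 0ᴿ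
1ℂ = mkℂ (ofℚ 1ℚ) 0ᴿ

_^_ : ℂ → ℕ → ℂ
z ^ zero  = 1ℂ
z ^ suc n = z ^ n * z

partialSum : (ℕ → ℝ) → ℕ → ℝ
partialSum u zero    = 0ᴿ
partialSum u (suc n) = partialSum u n +ᴿ u n

-- expTerm z j is z ^ j / j !.
expTerm : ℂ → ℕ → ℂ
expTerm z zero    = 1ℂ
expTerm z (suc j) = (+ 1 / suc j) · (expTerm z j * z)

-- The j-th term is 4 / (4j + 1) − 4 / (4j + 3).
leibnizTerm : ℕ → ℚ
leibnizTerm j = + 4 / suc (4 ℕ.* j) ℚ.- + 4 / suc (2 ℕ.+ 4 ℕ.* j)

module Convergence where

  open import Data.Rational using (∣_∣; 1/_; _<_)
    renaming (_≤_ to _≤q_; _+_ to _⊕_; _*_ to _⊗_; _-_ to _⊖_; -_ to ⊖_)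
  open RealArithmetic using (eventually-bounded; modulus; modulus-pos; modulus-*)
  open +-*-Solver using (solve; _:+_; _:*_; _:-_; :-_; _:=_; con)

  leibniz-bound : ∀ j → 0 ≤ j → ∣ leibnizTerm j ∣ ≤q + 4 / suc (4 ℕ.* j) ⊖ + 4 / suc (4 ℕ.* suc j)
  leibniz-bound j _ = subst (_≤q g ⊖ g′) (sym (ℚₚ.0≤p⇒∣p∣≡p nonneg))
    (ℚₚ.+-monoʳ-≤ g (ℚₚ.neg-antimono-≤ (/-antitone 4
      (subst (2 ℕ.+ 4 ℕ.* j ≤_) (sym (ℕₚ.*-suc 4 j)) (ℕₚ.+-monoˡ-≤ (4 ℕ.* j) (ℕₚ.m≤m+n 2 2))))))
    where
    g  = + 4 / suc (4 ℕ.* j)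
    h  = + 4 / suc (2 ℕ.+ 4 ℕ.* j)
    g′ = + 4 / suc (4 ℕ.* suc j)
    nonneg : 0ℚ ≤q g ⊖ h
    nonneg = subst (_≤q g ⊖ h) (ℚₚ.+-inverseʳ h)
      (ℚₚ.+-monoˡ-≤ (⊖ h) (/-antitone 4 (ℕₚ.m≤n+m (4 ℕ.* j) 2)))

  leibniz-cauchy : IsCauchy (sum leibnizTerm)
  leibniz-cauchy ε ε>0 =
    let (N , small) = archimedean 4 ε ε>0
        g = λ j → + 4 / suc (4 ℕ.* j)
        small′ : ∀ n → N ≤ n → g n < ε
        small′ n N≤n = small (4 ℕ.* n) (ℕₚ.≤-trans N≤n (ℕₚ.m≤m+n n _))
    in N , λ m n ≤m ≤n → tail-< leibnizTerm g 0 leibniz-bound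
         (λ j _ → ℚₚ.nonNegative⁻¹ _ {{ℚₚ.normalize-nonNeg 4 (suc (4 ℕ.* j))}})
         m n ℕ.z≤n ℕ.z≤n (small′ m ≤m) (small′ n ≤n)

  module _ (u : ℕ → ℝ) (g : ℕ → ℚ) (J T : ℕ)
    (bound : ∀ t → T ≤ t → ∀ j → J ≤ j → ∣ ℝ.seq (u j) t ∣ ≤q g j ⊖ g (suc j))
    (g≥0 : ∀ j → J ≤ j → 0ℚ ≤q g j)
    (g→0 : ∀ ε → 0ℚ < ε → ∃[ N ] ∀ n → N ≤ n → g n < ε)
    where

    seq-partialSum : ∀ n t → ℝ.seq (partialSum u n) t ≡ sum (λ j → ℝ.seq (u j) t) n
    seq-partialSum zero    t = refl
    seq-partialSum (suc n) t = cong (_⊕ ℝ.seq (u n) t) (seq-partialSum n t)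

    series-cauchy : IsCauchyᴿ (partialSum u)
    series-cauchy ε ε>0 =
      let (N , small) = g→0 (½ ⊗ ε) (half-pos ε>0)
      in N ℕ.⊔ J , λ m n ≤m ≤n → ½ ⊗ ε , half-pos ε>0 , T , λ t T≤t →
        subst₂ (λ a b → ∣ a ⊖ b ∣ ⊕ ½ ⊗ ε < ε) (sym (seq-partialSum m t)) (sym (seq-partialSum n t))
          (subst (∣ sum (λ j → ℝ.seq (u j) t) m ⊖ sum (λ j → ℝ.seq (u j) t) n ∣ ⊕ ½ ⊗ ε <_)
            (halves ε)
            (ℚₚ.+-monoˡ-< (½ ⊗ ε)
              (tail-< (λ j → ℝ.seq (u j) t) g J (bound t T≤t) g≥0 m n
                (ℕₚ.m⊔n≤o⇒n≤o N J ≤m) (ℕₚ.m⊔n≤o⇒n≤o N J ≤n)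
                (small m (ℕₚ.m⊔n≤o⇒m≤o N J ≤m)) (small n (ℕₚ.m⊔n≤o⇒m≤o N J ≤n)))))

  half-power : ℕ → ℚ
  half-power zero    = 1ℚ
  half-power (suc d) = half-power d ⊗ ½

  half-power-nonNeg : ∀ d → 0ℚ ≤q half-power d
  half-power-nonNeg zero    = ℚₚ.nonNegative⁻¹ 1ℚ
  half-power-nonNeg (suc d) = subst (_≤q half-power d ⊗ ½) (ℚₚ.*-zeroˡ ½)
    (ℚₚ.*-monoʳ-≤-nonNeg ½ (half-power-nonNeg d))

  half-power-≤ : ∀ d → half-power d ≤q unit-fraction d
  half-power-≤ zero    = ℚₚ.≤-refl
  half-power-≤ (suc d) = ℚₚ.≤-trans (ℚₚ.*-monoʳ-≤-nonNeg ½ (half-power-≤ d))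
    (ℚₚ.toℚᵘ-cancel-≤ (ℚᵘₚ.≤-respˡ-≃
      (ℚᵘₚ.≃-sym (ℚᵘₚ.≃-trans (ℚₚ.toℚᵘ-homo-* (unit-fraction d) ½)
        (ℚᵘₚ.*-congʳ {ℚ.toℚᵘ ½} (toℚᵘ-/ (+ 1) d))))
      (ℚᵘₚ.≤-respʳ-≃ (ℚᵘₚ.≃-sym (toℚᵘ-/ (+ 1) (suc d)))
        (ℚᵘ.*≤* (ℤ.+≤+ (ℕ.s≤s (ℕ.s≤s le)))))))
    where
    le : d ℕ.+ 0 ≤ ℕ.pred (ℕ.pred (suc d ℕ.* 2 ℕ.+ 0))
    le = ℕₚ.+-monoˡ-≤ 0 (ℕₚ.m≤m*n d 2)

  module _ (J : ℕ) (C : ℚ) (C>0 : 0ℚ < C) where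

    majorant : ℕ → ℚ
    majorant j = half-power (j ∸ J) ⊗ (C ⊕ C)

    2C>0 : 0ℚ < C ⊕ C
    2C>0 = ℚₚ.+-mono-< C>0 C>0

    majorant-nonNeg : ∀ j → J ≤ j → 0ℚ ≤q majorant j
    majorant-nonNeg j _ = subst (_≤q majorant j) (ℚₚ.*-zeroˡ (C ⊕ C))
      (ℚₚ.*-monoʳ-≤-nonNeg (C ⊕ C) {{ℚ.nonNegative (ℚₚ.<⇒≤ 2C>0)}} (half-power-nonNeg (j ∸ J)))

    majorant→0 : ∀ ε → 0ℚ < ε → ∃[ N ] ∀ n → N ≤ n → majorant n < ε
    majorant→0 ε ε>0 =
      let (N , small) = archimedean 1 (modulus ε>0 2C>0) (modulus-pos ε>0 2C>0)
      in N ℕ.+ J , λ n ≤n → ℚₚ.<-trans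
           (subst (majorant n <_) (modulus-* ε>0 2C>0)
             (ℚₚ.*-monoˡ-<-pos (C ⊕ C) {{ℚ.positive 2C>0}}
               (ℚₚ.≤-<-trans (half-power-≤ (n ∸ J))
                 (small (n ∸ J) (subst (_≤ n ∸ J) (ℕₚ.m+n∸n≡m N J) (ℕₚ.∸-monoˡ-≤ J ≤n))))))
           (half-< ε>0)

    majorant-step : ∀ j → J ≤ j → C ⊗ half-power (j ∸ J) ≡ majorant j ⊖ majorant (suc j)
    majorant-step j J≤j = trans (split C (half-power (j ∸ J)))
      (cong (λ i → majorant j ⊖ half-power i ⊗ (C ⊕ C)) (sym (ℕₚ.+-∸-assoc 1 J≤j)))
      where
      split : ∀ c h → c ⊗ h ≡ h ⊗ (c ⊕ c) ⊖ h ⊗ ½ ⊗ (c ⊕ c)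
      split = solve 2 (λ c h → c :* h := h :* (c :+ c) :- h :* con ½ :* (c :+ c)) refl

  complex-product : ∀ r p s a b → 0ℚ ≤q r →
    ∣ r ⊗ (p ⊗ a ⊖ s ⊗ b) ∣ ⊕ ∣ r ⊗ (p ⊗ b ⊕ s ⊗ a) ∣ ≤q (∣ p ∣ ⊕ ∣ s ∣) ⊗ (r ⊗ (∣ a ∣ ⊕ ∣ b ∣))
  complex-product r p s a b r≥0 = begin
    ∣ r ⊗ (p ⊗ a ⊖ s ⊗ b) ∣ ⊕ ∣ r ⊗ (p ⊗ b ⊕ s ⊗ a) ∣
      ≡⟨ cong₂ _⊕_ (scale (p ⊗ a ⊖ s ⊗ b)) (scale (p ⊗ b ⊕ s ⊗ a)) ⟩
    r ⊗ ∣ p ⊗ a ⊖ s ⊗ b ∣ ⊕ r ⊗ ∣ p ⊗ b ⊕ s ⊗ a ∣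
      ≤⟨ ℚₚ.+-mono-≤ (r-mono (ℚₚ.∣p-q∣≤∣p∣+∣q∣ (p ⊗ a) (s ⊗ b))) (r-mono (ℚₚ.∣p+q∣≤∣p∣+∣q∣ (p ⊗ b) (s ⊗ a))) ⟩
    r ⊗ (∣ p ⊗ a ∣ ⊕ ∣ s ⊗ b ∣) ⊕ r ⊗ (∣ p ⊗ b ∣ ⊕ ∣ s ⊗ a ∣)
      ≡⟨ cong₂ (λ x y → r ⊗ x ⊕ r ⊗ y)
           (cong₂ _⊕_ (ℚₚ.∣p*q∣≡∣p∣*∣q∣ p a) (ℚₚ.∣p*q∣≡∣p∣*∣q∣ s b))
           (cong₂ _⊕_ (ℚₚ.∣p*q∣≡∣p∣*∣q∣ p b) (ℚₚ.∣p*q∣≡∣p∣*∣q∣ s a)) ⟩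
    r ⊗ (∣ p ∣ ⊗ ∣ a ∣ ⊕ ∣ s ∣ ⊗ ∣ b ∣) ⊕ r ⊗ (∣ p ∣ ⊗ ∣ b ∣ ⊕ ∣ s ∣ ⊗ ∣ a ∣)
      ≡⟨ regroup r (∣ p ∣) (∣ s ∣) (∣ a ∣) (∣ b ∣) ⟩
    (∣ p ∣ ⊕ ∣ s ∣) ⊗ (r ⊗ (∣ a ∣ ⊕ ∣ b ∣)) ∎
    where
    open ℚₚ.≤-Reasoning
    scale : ∀ x → ∣ r ⊗ x ∣ ≡ r ⊗ ∣ x ∣
    scale x = trans (ℚₚ.∣p*q∣≡∣p∣*∣q∣ r x) (cong (_⊗ ∣ x ∣) (ℚₚ.0≤p⇒∣p∣≡p r≥0))
    r-mono : ∀ {x y} → x ≤q y → r ⊗ x ≤q r ⊗ y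
    r-mono = ℚₚ.*-monoˡ-≤-nonNeg r {{ℚ.nonNegative r≥0}}
    regroup : ∀ r p s a b → r ⊗ (p ⊗ a ⊕ s ⊗ b) ⊕ r ⊗ (p ⊗ b ⊕ s ⊗ a) ≡ (p ⊕ s) ⊗ (r ⊗ (a ⊕ b))
    regroup = solve 5 (λ r p s a b → r :* (p :* a :+ s :* b) :+ r :* (p :* b :+ s :* a)
                                     := (p :+ s) :* (r :* (a :+ b))) refl

  module _ (z : ℂ) where

    size : ℕ → ℕ → ℚ
    size j t = ∣ ℝ.seq (re (expTerm z j)) t ∣ ⊕ ∣ ℝ.seq (im (expTerm z j)) t ∣

    arg : ℕ → ℚ
    arg t = ∣ ℝ.seq (re z) t ∣ ⊕ ∣ ℝ.seq (im z) t ∣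

    size-nonNeg : ∀ j t → 0ℚ ≤q size j t
    size-nonNeg j t = ℚₚ.+-mono-≤ (0≤∣ ℝ.seq (re (expTerm z j)) t ∣) (0≤∣ ℝ.seq (im (expTerm z j)) t ∣)

    size-suc : ∀ j t → size (suc j) t ≤q size j t ⊗ (unit-fraction j ⊗ arg t)
    size-suc j t = complex-product (unit-fraction j)
      (ℝ.seq (re (expTerm z j)) t) (ℝ.seq (im (expTerm z j)) t) (ℝ.seq (re z) t) (ℝ.seq (im z) t)
      (ℚₚ.<⇒≤ (unit-fraction-pos j))

    norm-bounded : ∀ w → ∃[ B ] (0ℚ < B × ∃[ N ] ∀ t → N ≤ t → ∣ ℝ.seq (re w) t ∣ ⊕ ∣ ℝ.seq (im w) t ∣ < B)
    norm-bounded w =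
      let (A , A>0 , M , a) = eventually-bounded (re w)
          (B , B>0 , N , b) = eventually-bounded (im w)
      in A ⊕ B , ℚₚ.+-mono-< A>0 B>0 , M ℕ.⊔ N , λ t ≤t →
           ℚₚ.+-mono-< (a t (ℕₚ.m⊔n≤o⇒m≤o M N ≤t)) (b t (ℕₚ.m⊔n≤o⇒n≤o M N ≤t))

    B : ℚ
    B = proj₁ (norm-bounded z)

    B>0 : 0ℚ < B
    B>0 = proj₁ (proj₂ (norm-bounded z))

    T₀ : ℕ
    T₀ = proj₁ (proj₂ (proj₂ (norm-bounded z)))

    arg-bound : ∀ t → T₀ ≤ t → arg t < B
    arg-bound = proj₂ (proj₂ (proj₂ (norm-bounded z)))

    1>0 : 0ℚ < 1ℚ
    1>0 = ℚₚ.positive⁻¹ 1ℚ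

    J : ℕ
    J = proj₁ (archimedean 1 (modulus 1>0 B>0) (modulus-pos 1>0 B>0))

    ratio : ∀ j t → J ≤ j → T₀ ≤ t → unit-fraction j ⊗ arg t ≤q ½
    ratio j t J≤j T≤t = ℚₚ.≤-trans
      (*-mono-nonNeg (ℚₚ.+-mono-≤ (0≤∣ ℝ.seq (re z) t ∣) (0≤∣ ℝ.seq (im z) t ∣))
        (ℚₚ.<⇒≤ (modulus-pos 1>0 B>0))
        (ℚₚ.<⇒≤ (proj₂ (archimedean 1 (modulus 1>0 B>0) (modulus-pos 1>0 B>0)) j J≤j))
        (ℚₚ.<⇒≤ (arg-bound t T≤t)))
      (ℚₚ.≤-reflexive (modulus-* 1>0 B>0))

    C : ℚ
    C = proj₁ (norm-bounded (expTerm z J))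

    C>0 : 0ℚ < C
    C>0 = proj₁ (proj₂ (norm-bounded (expTerm z J)))

    T₁ : ℕ
    T₁ = proj₁ (proj₂ (proj₂ (norm-bounded (expTerm z J))))

    size-bound : ∀ d t → T₀ ℕ.⊔ T₁ ≤ t → size (d ℕ.+ J) t ≤q C ⊗ half-power d
    size-bound zero t ≤t = subst (size J t ≤q_) (sym (ℚₚ.*-identityʳ C))
      (ℚₚ.<⇒≤ (proj₂ (proj₂ (proj₂ (norm-bounded (expTerm z J)))) t (ℕₚ.m⊔n≤o⇒n≤o T₀ T₁ ≤t)))
    size-bound (suc d) t ≤t = begin
      size (suc d ℕ.+ J) t                                    ≤⟨ size-suc (d ℕ.+ J) t ⟩
      size (d ℕ.+ J) t ⊗ (unit-fraction (d ℕ.+ J) ⊗ arg t)    ≤⟨ ℚₚ.*-monoˡ-≤-nonNeg (size (d ℕ.+ J) t)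
                                                                   {{ℚ.nonNegative (size-nonNeg (d ℕ.+ J) t)}}
                                                                   (ratio (d ℕ.+ J) t (ℕₚ.m≤n+m J d) (ℕₚ.m⊔n≤o⇒m≤o T₀ T₁ ≤t)) ⟩
      size (d ℕ.+ J) t ⊗ ½                                    ≤⟨ ℚₚ.*-monoʳ-≤-nonNeg ½ (size-bound d t ≤t) ⟩
      C ⊗ half-power d ⊗ ½                                    ≡⟨ ℚₚ.*-assoc C (half-power d) ½ ⟩
      C ⊗ half-power (suc d)                                  ∎
      where open ℚₚ.≤-Reasoning

    size-majorant : ∀ t → T₀ ℕ.⊔ T₁ ≤ t → ∀ j → J ≤ j →
      size j t ≤q majorant J C C>0 j ⊖ majorant J C C>0 (suc j)
    size-majorant t ≤t j J≤j = subst₂ _≤q_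
      (cong (λ i → size i t) (ℕₚ.m∸n+n≡m J≤j)) (majorant-step J C C>0 j J≤j)
      (size-bound (j ∸ J) t ≤t)

    exp-re-cauchy : IsCauchyᴿ (partialSum (re ∘ expTerm z))
    exp-re-cauchy = series-cauchy (re ∘ expTerm z) (majorant J C C>0) J (T₀ ℕ.⊔ T₁)
      (λ t ≤t j J≤j → ℚₚ.≤-trans
        (subst (_≤q size j t) (ℚₚ.+-identityʳ _) (ℚₚ.+-monoʳ-≤ ∣ ℝ.seq (re (expTerm z j)) t ∣ (0≤∣ ℝ.seq (im (expTerm z j)) t ∣)))
        (size-majorant t ≤t j J≤j))
      (majorant-nonNeg J C C>0) (majorant→0 J C C>0)

    exp-im-cauchy : IsCauchyᴿ (partialSum (im ∘ expTerm z))
    exp-im-cauchy = series-cauchy (im ∘ expTerm z) (majorant J C C>0) J (T₀ ℕ.⊔ T₁)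
      (λ t ≤t j J≤j → ℚₚ.≤-trans
        (subst (_≤q size j t) (ℚₚ.+-identityˡ _) (ℚₚ.+-monoˡ-≤ ∣ ℝ.seq (im (expTerm z j)) t ∣ (0≤∣ ℝ.seq (re (expTerm z j)) t ∣)))
        (size-majorant t ≤t j J≤j))
      (majorant-nonNeg J C C>0) (majorant→0 J C C>0)

exp : ℂ → ℂ
exp z = mkℂ (lim (partialSum (re ∘ expTerm z)) (Convergence.exp-re-cauchy z))
            (lim (partialSum (im ∘ expTerm z)) (Convergence.exp-im-cauchy z))

π : ℝ
π = mkℝ (sum leibnizTerm) Convergence.leibniz-cauchy

2πi : ℂ
2πi = mkℂ 0ᴿ (ofℚ (fromℤ (+ 2)) *ᴿ π)

Close : ℚ → ℂ → ℂ → Set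
Close ε z w = ∣ re z -ᴿ re w ∣ᴿ <ᴿ ofℚ ε × ∣ im z -ᴿ im w ∣ᴿ <ᴿ ofℚ ε

_⟶_ : (ℕ → ℂ) → ℂ → Set
z ⟶ w = ∀ ε → 0ℚ ℚ.< ε → ∃[ N ] ∀ n → N ≤ n → Close ε (z n) w

-- Unconditional summation of an arbitrary family: S is the limit of the finite
-- partial sums along the finite subsets of I, which are lists without repetition.
HasSum : {I : Set} → (I → ℂ) → ℂ → Set
HasSum {I} f S = ∀ ε → 0ℚ ℚ.< ε →
  Σ[ F ∈ List I ] ∀ G → Unique G → F ⊆ G → Close ε (List.foldr _+_ 0ℂ (map f G)) S

-- a ⋯ b lists a, a + 1, …, b; it is empty when b < a.
_⋯_ : ℕ → ℕ → List ℕ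
a ⋯ b = map (a ℕ.+_) (upTo (suc b ∸ a))

∑ : List ℕ → (ℕ → ℕ) → ℕ
∑ js f = ℕ.sum (map f js)

∏ : List ℕ → (ℕ → ℂ) → ℂ
∏ js f = List.foldr _*_ 1ℂ (map f js)

-- (a ; q)ₙ for n ≥ 0.
poch : ℂ → ℂ → ℕ → ℂ
poch a q zero    = 1ℂ
poch a q (suc n) = poch a q n * (1ℂ - a * q ^ n)

-- The value at negative n is immaterial: (-q)_{N₁+ℓ} occurs with N₁ + ℓ < 0 only
-- when n_k + 2ℓ < 0 too (n_k ≤ N₁), and that summand vanishes through 1/(q)_{n_k+2ℓ}.
pochℤ : ℂ → ℂ → ℤ → ℂ
pochℤ a q (+ n)    = poch a q n
pochℤ a q -[1+ _ ] = 1ℂ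

-- n ‼ j is n_j, counted from 1; only 1 ≤ j ≤ k is ever used.
_‼_ : ∀ {k} → Vec ℕ k → ℕ → ℕ
[]      ‼ _           = 0
(x ∷ n) ‼ 0           = 0
(x ∷ n) ‼ 1           = x
(x ∷ n) ‼ suc (suc j) = n ‼ suc j

N : ∀ {k} → Vec ℕ k → ℕ → ℕ
N {k} n j = ∑ (j ⋯ k) (n ‼_)

square : ℚ → ℚ
square r = r ℚ.* r

-- (k + ½)(n + (2i − 1)/(4k + 2))² − (2kℓ + i + ℓ − ½)²/(4k + 2)
leftExponent : (k i : ℕ) (ℓ n : ℤ) → ℚ
leftExponent k i ℓ n =
  (fromℤ (+ k) ℚ.+ ½) ℚ.* square (fromℤ n ℚ.+ (+ 2 ℤ.* + i ℤ.- + 1) / (2 ℕ.+ 4 ℕ.* k))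
    ℚ.- square (fromℤ (+ 2 ℤ.* + k ℤ.* ℓ ℤ.+ + i ℤ.+ ℓ) ℚ.- ½) ℚ.* (+ 1 / (2 ℕ.+ 4 ℕ.* k))

-- N₁(N₁ + 1)/2 + N₂² + ⋯ + N_k² + ℓN₁ + (2ℓ + 1)(N₂ + ⋯ + N_k)
rightExponent : ∀ {k} → ℤ → Vec ℕ k → ℚ
rightExponent {k} ℓ n =
  + (N n 1 ℕ.* suc (N n 1)) / 2
    ℚ.+ fromℤ (+ ∑ (2 ⋯ k) (λ j → N n j ℕ.* N n j)
               ℤ.+ ℓ ℤ.* + N n 1
               ℤ.+ (+ 2 ℤ.* ℓ ℤ.+ + 1) ℤ.* + ∑ (2 ⋯ k) (N n))

q^ : ℂ → ℚ → ℂ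
q^ τ r = exp (2πi * (r · τ))

-- A is (-q)_∞/(q)_∞ (Σ_{n ≥ |ℓ|} f n − Σ_{n ≤ −|ℓ|−1} f n): S⁺ and S⁻ are the two sums,
-- over n = |ℓ| + m and n = −|ℓ| − 1 − m with m ≥ 0; P is (-q)_∞, Q is (q)_∞ and R is 1/(q)_∞.
IsLeftSide : (q : ℂ) (ℓ : ℤ) (f : ℤ → ℂ) → ℂ → Set
IsLeftSide q ℓ f A = ∃[ P ] ∃[ Q ] ∃[ R ] ∃[ S⁺ ] ∃[ S⁻ ]
  ( poch (- q) q ⟶ P
  × poch q q ⟶ Q
  × Q * R ≈ 1ℂ
  × HasSum (λ m → f (+ (ℤ.∣ ℓ ∣ ℕ.+ m))) S⁺
  × HasSum (λ m → f (ℤ.- (+ ℤ.∣ ℓ ∣) ℤ.- + 1 ℤ.- + m)) S⁻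
  × A ≈ P * R * (S⁺ - S⁻))

-- r m is 1/(q)_m for every m ∈ ℤ, with 1/(q)_m = 0 for m < 0.
IsReciprocal : (q : ℂ) (r : ℤ → ℂ) → Set
IsReciprocal q r = (∀ m → poch q q m * r (+ m) ≈ 1ℂ) × (∀ m → r -[1+ m ] ≈ 0ℂ)

-- A is the sum over n = (n₁, …, n_k) of t n (-q)_{N₁+ℓ} / ((q)_{n₁} ⋯ (q)_{n_k} (q)_{n_k+2ℓ}).
IsRightSide : (q : ℂ) (k : ℕ) (ℓ : ℤ) (t : Vec ℕ k → ℂ) → ℂ → Set
IsRightSide q k ℓ t A = ∃[ r ]
  ( IsReciprocal q r
  × HasSum (λ n → t n * pochℤ (- q) q (+ N n 1 ℤ.+ ℓ)
                  * (∏ (1 ⋯ k) (λ j → r (+ (n ‼ j))) * r (+ (n ‼ k) ℤ.+ + 2 ℤ.* ℓ))) A)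

module Submission where

-- The identity is a Bailey chain followed by a limit. Let ℓ = p ≥ 0 and c = 2 p, and consider the kernel
-- K_t(s) = 1/((q)_{s-t} (q)_{s+t+c}). The innermost factor 1/((q)_{n_k} (q)_{n_k+c}) of the multiple sum is
-- K_0(n_k), and telescoping in t expands it as the sum over t of q ^ (t² + c t) times
-- K′_t = K_t - q ^ (2t + c + 1) K_{t+1} (kernel-telescope). The summation over n_j, with N_j fixed, is the
-- convolution of 1/(q)_n with q ^ (N² + c N), or q ^ (N² + (c + 1) N), times the previous result, where
-- N = N_{j+1}. The Bailey lemma evaluates these convolutions: K_t and K′_t are reproduced up to powers of q
-- (conv-kernel, conv-kernel′), by the limiting q-Chu-Vandermonde sum, which follows from the q-Pascal rule
-- T-suc. The result is β-low while the linear term is (c + 1) N, and β-high afterwards. The last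
-- convolution contains (-q)_{N₁+p} and is evaluated by the full q-Chu-Vandermonde sum (conv-kernel⁺). This
-- gives finite-identity: the sum over all n with N₁ ≤ S, weighted by 1/(q)_{S-N₁}, is (-q)_{p+S-1} times a
-- theta sum weighted by K_t(S).
--
-- Multiply by (q)_S and let S tend to infinity. The weights (q)_S/(q)_{S-N₁} tend to 1 and (q)_S K_t(S) tends
-- to 1/(q)_∞ as the distance of N₁ or t from S grows, and both stay bounded, while the summands decay faster
-- than geometrically because their exponents are quadratic. Dominated convergence (tannery) yields the
-- identity between series, multisum. The sum over n exists unconditionally because the levels N₁ = s have at
-- most exponentially many members (HasSum-graded). For i = k the theta terms are split as X + Y and Y + Z,
-- and Y cancels (identity′⁺).
--
-- For ℓ = - p only vectors with n_k ≥ 2 p contribute. Lowering n_k by 2 p leads back to ℓ = p, up to the factor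
-- q ^ ((2i - 1) p) on both sides (identity-neg).
--
-- All this takes place in an arbitrary complete normed ring. For the complex numbers, with the modulus
-- bounded through disks, it remains to see that q ^ (r + s) = q ^ r q ^ s, where the binomial theorem and
-- dominated convergence give the functional equation of exp (exp-+), and that q has modulus less than 1
-- (q-bound): exp z is the power of exponent n of exp (z / n), which for large n and Re z < 0 is close enough
-- to 1 + z / n. The ring operations on ℂ are made opaque, and the result is finally translated to the given
-- operations.

open import Algebra.Bundles using (CommutativeRing)
open import Algebra.Consequences.Setoid using (comm∧idˡ⇒id; comm∧invˡ⇒inv; comm∧distrˡ⇒distr)
open import Algebra.Definitions using (_DistributesOver_)
import Algebra.Definitions as Operations
import Algebra.Properties.AbelianGroup as AbelianGroupProperties
import Algebra.Properties.Ring as RingProperties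
import Algebra.Properties.Semiring.Mult.TCOptimised as Multiples
import Algebra.Solver.Ring as RingSolver
open import Algebra.Solver.Ring.AlmostCommutativeRing using (fromCommutativeRing; _-Raw-AlmostCommutative⟶_)
open import Algebra.Structures using (IsAbelianGroup; IsCommutativeRing)
open import Data.Empty using (⊥)
open import Data.Integer as ℤ using (ℤ; +_; -[1+_])
import Data.Integer.Properties as ℤₚ
import Data.Integer.Solver as ℤ-Solver
open import Data.List as List using (List; []; _∷_; _++_; foldr; map)
open import Data.List.Membership.Propositional using (_∈_)
open import Data.List.Membership.Propositional.Properties using (∈-∃++; ∈-++⁺ˡ; ∈-++⁺ʳ; ∈-++⁻; ∈-map⁺; ∈-map⁻)
import Data.List.Properties as Listₚ
open import Data.List.Relation.Binary.Permutation.Propositional as Perm using (_↭_)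
open import Data.List.Relation.Binary.Permutation.Propositional.Properties using (∈-resp-↭) renaming (shift to ↭-shift)
open import Data.List.Relation.Binary.Subset.Propositional using (_⊆_)
open import Data.List.Relation.Unary.All as All using (All; []; _∷_)
open import Data.List.Relation.Unary.AllPairs using ([]; _∷_)
open import Data.List.Relation.Unary.Any using (here; there)
open import Data.List.Relation.Unary.Unique.Propositional using (Unique)
open import Data.List.Relation.Unary.Unique.Propositional.Properties using (++⁺; map⁺)
open import Data.Maybe as Maybe using (Maybe; just; nothing)
open import Data.Nat as ℕ using (ℕ; zero; suc; _≤_; _<_; _∸_; z≤n; s≤s)
import Data.Nat.ListAction as ℕL
import Data.Nat.Properties as ℕₚ
open import Data.Nat.Tactic.RingSolver using (solve-∀)
open import Data.Product using (∃-syntax; Σ-syntax; _×_; _,_; proj₁; proj₂)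
open import Data.Rational as ℚ using (ℚ; 0ℚ; 1ℚ; ½)
open import Data.Rational.Literals using (fromℤ)
import Data.Rational.Properties as ℚₚ
open import Data.Rational.Solver using (module +-*-Solver)
import Data.Rational.Solver as ℚ-Solver
import Data.Rational.Unnormalised as ℚᵘ
import Data.Rational.Unnormalised.Properties as ℚᵘₚ
open import Data.Sum using (inj₁; inj₂)
open import Data.Vec as Vec using (Vec; []; _∷_)
open import Data.Vec.Properties using (∷-injectiveʳ)
open import Function using (_∘_; id)
open import Level using (0ℓ)
open import Relation.Binary.Bundles using (Setoid)
open import Relation.Binary.PropositionalEquality as ≡ using (_≡_; cong; cong₂; subst; subst₂)
import Relation.Binary.Reasoning.Setoid as SetoidReasoning
open import Relation.Binary.Structures using (IsEquivalence)
open import Relation.Nullary using (yes; no; contradiction)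
import Defs
open import Defs using (module Estimates; module RealArithmetic)

-- Commutative rings: integer coefficients, finite sums and convolutions

-- The ring solver with integer coefficients, for an arbitrary commutative ring: equality of integers
-- is decidable, so cancellation is recognised although equality in the ring need not be decidable.
module IntegerCoefficients (R : CommutativeRing 0ℓ 0ℓ) where
  open CommutativeRing R
  open RingProperties ring
  open AbelianGroupProperties +-abelianGroup using (⁻¹-∙-comm; ⁻¹-involutive; ε⁻¹≈ε)
  open Multiples semiring using (×-homo-+; ×1-homo-*; 1+×) renaming (_×_ to _×̂_)
  open SetoidReasoning setoid

  -- The unique ring homomorphism from the integers.
  embed : ℤ → Carrier
  embed (+ n)    = n ×̂ 1#
  embed -[1+ n ] = - (suc n ×̂ 1#)

  cancel-one : ∀ a b → a - b ≈ (1# + a) - (1# + b)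
  cancel-one a b = begin
    a - b                  ≈⟨ +-congʳ (+-identityʳ a) ⟨
    (a + 0#) - b           ≈⟨ +-congʳ (+-congˡ (-‿inverseʳ 1#)) ⟨
    (a + (1# - 1#)) - b    ≈⟨ +-congʳ (+-assoc a 1# (- 1#)) ⟨
    ((a + 1#) - 1#) - b    ≈⟨ +-assoc (a + 1#) (- 1#) (- b) ⟩
    (a + 1#) + (- 1# - b)  ≈⟨ +-cong (+-comm a 1#) (⁻¹-∙-comm 1# b) ⟩
    (1# + a) - (1# + b)    ∎

  embed-⊖ : ∀ m n → embed (m ℤ.⊖ n) ≈ m ×̂ 1# - n ×̂ 1#
  embed-⊖ m       zero    = sym (trans (+-congˡ ε⁻¹≈ε) (+-identityʳ (m ×̂ 1#)))
  embed-⊖ zero    (suc n) = sym (+-identityˡ (- (suc n ×̂ 1#)))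
  embed-⊖ (suc m) (suc n) = begin
    embed (suc m ℤ.⊖ suc n)              ≈⟨ reflexive (cong embed (ℤₚ.[1+m]⊖[1+n]≡m⊖n m n)) ⟩
    embed (m ℤ.⊖ n)                      ≈⟨ embed-⊖ m n ⟩
    m ×̂ 1# - n ×̂ 1#                      ≈⟨ cancel-one (m ×̂ 1#) (n ×̂ 1#) ⟩
    (1# + m ×̂ 1#) - (1# + n ×̂ 1#)        ≈⟨ +-cong (1+× m 1#) (-‿cong (1+× n 1#)) ⟨
    suc m ×̂ 1# - suc n ×̂ 1#              ∎

  embed-+ : ∀ i j → embed (i ℤ.+ j) ≈ embed i + embed j
  embed-+ (+ m)    (+ n)    = ×-homo-+ 1# m n
  embed-+ (+ m)    -[1+ n ] = embed-⊖ m (suc n)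
  embed-+ -[1+ m ] (+ n)    = trans (embed-⊖ n (suc m)) (+-comm (n ×̂ 1#) (- (suc m ×̂ 1#)))
  embed-+ -[1+ m ] -[1+ n ] = begin
    - (suc (suc (m ℕ.+ n)) ×̂ 1#)         ≈⟨ -‿cong (reflexive (cong (λ k → suc k ×̂ 1#) (≡.sym (ℕₚ.+-suc m n)))) ⟩
    - ((suc m ℕ.+ suc n) ×̂ 1#)           ≈⟨ -‿cong (×-homo-+ 1# (suc m) (suc n)) ⟩
    - (suc m ×̂ 1# + suc n ×̂ 1#)          ≈⟨ ⁻¹-∙-comm (suc m ×̂ 1#) (suc n ×̂ 1#) ⟨
    - (suc m ×̂ 1#) - suc n ×̂ 1#          ∎

  embed-neg : ∀ i → embed (ℤ.- i) ≈ - embed i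
  embed-neg (+ zero)  = sym ε⁻¹≈ε
  embed-neg (+ suc n) = refl
  embed-neg -[1+ n ]  = sym (⁻¹-involutive (suc n ×̂ 1#))

  embed-*⁺ : ∀ m j → embed (+ m ℤ.* j) ≈ embed (+ m) * embed j
  embed-*⁺ m (+ n)    = trans (reflexive (cong embed (≡.sym (ℤₚ.pos-* m n)))) (×1-homo-* m n)
  embed-*⁺ m -[1+ n ] = begin
    embed (+ m ℤ.* -[1+ n ])            ≈⟨ reflexive (cong embed (≡.sym (ℤₚ.neg-distribʳ-* (+ m) (+ suc n)))) ⟩
    embed (ℤ.- (+ m ℤ.* + suc n))       ≈⟨ embed-neg (+ m ℤ.* + suc n) ⟩
    - embed (+ m ℤ.* + suc n)           ≈⟨ -‿cong (embed-*⁺ m (+ suc n)) ⟩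
    - (embed (+ m) * embed (+ suc n))   ≈⟨ -‿distribʳ-* (embed (+ m)) (embed (+ suc n)) ⟩
    embed (+ m) * - embed (+ suc n)     ∎

  embed-* : ∀ i j → embed (i ℤ.* j) ≈ embed i * embed j
  embed-* (+ m)    j = embed-*⁺ m j
  embed-* -[1+ m ] j = begin
    embed (-[1+ m ] ℤ.* j)              ≈⟨ reflexive (cong embed (≡.sym (ℤₚ.neg-distribˡ-* (+ suc m) j))) ⟩
    embed (ℤ.- (+ suc m ℤ.* j))         ≈⟨ embed-neg (+ suc m ℤ.* j) ⟩
    - embed (+ suc m ℤ.* j)             ≈⟨ -‿cong (embed-*⁺ (suc m) j) ⟩
    - (embed (+ suc m) * embed j)       ≈⟨ -‿distribˡ-* (embed (+ suc m)) (embed j) ⟩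
    - embed (+ suc m) * embed j         ∎

  homomorphism : CommutativeRing.rawRing ℤₚ.+-*-commutativeRing -Raw-AlmostCommutative⟶ fromCommutativeRing R
  homomorphism = record
    { ⟦_⟧    = embed
    ; +-homo = embed-+
    ; *-homo = embed-*
    ; -‿homo = embed-neg
    ; 0-homo = refl
    ; 1-homo = refl
    }

  same-integer : ∀ i j → Maybe (embed i ≈ embed j)
  same-integer i j with i ℤ.≟ j
  ... | yes i≡j = just (reflexive (cong embed i≡j))
  ... | no  _   = nothing

  open RingSolver (CommutativeRing.rawRing ℤₚ.+-*-commutativeRing) (fromCommutativeRing R) homomorphism same-integer public
    using (solve; _:=_; _:+_; _:*_; _:-_; :-_; con)

-- Powers, finite sums and finite convolutions in a commutative ring.
module FiniteSum (R : CommutativeRing 0ℓ 0ℓ) where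
  open CommutativeRing R
  open IntegerCoefficients R
  open SetoidReasoning setoid

  infixr 8 _^_

  _^_ : Carrier → ℕ → Carrier
  x ^ zero  = 1#
  x ^ suc n = x ^ n * x

  ^-+ : ∀ x m n → x ^ (m ℕ.+ n) ≈ x ^ m * x ^ n
  ^-+ x zero    n = sym (*-identityˡ (x ^ n))
  ^-+ x (suc m) n = trans (*-congʳ (^-+ x m n))
    (solve 3 (λ a b c → a :* b :* c := a :* c :* b) refl (x ^ m) (x ^ n) x)

  -- Products of powers are compared through their exponents.
  ^-≡ : ∀ x {m n} → m ≡ n → x ^ m ≈ x ^ n
  ^-≡ x e = reflexive (cong (x ^_) e)

  -- The natural numbers in the ring.
  fromℕ : ℕ → Carrier
  fromℕ zero    = 0#
  fromℕ (suc n) = fromℕ n + 1#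

  -- ∑ n f is f 0 + ⋯ + f (n - 1).
  ∑ : ℕ → (ℕ → Carrier) → Carrier
  ∑ zero    f = 0#
  ∑ (suc n) f = ∑ n f + f n

  ∑-cong : ∀ n {f g} → (∀ j → j < n → f j ≈ g j) → ∑ n f ≈ ∑ n g
  ∑-cong zero    e = refl
  ∑-cong (suc n) e = +-cong (∑-cong n (λ j j<n → e j (ℕₚ.m<n⇒m<1+n j<n))) (e n ℕₚ.≤-refl)

  ∑-+ : ∀ n f g → ∑ n (λ j → f j + g j) ≈ ∑ n f + ∑ n g
  ∑-+ zero    f g = sym (+-identityˡ 0#)
  ∑-+ (suc n) f g = trans (+-congʳ (∑-+ n f g))
    (solve 4 (λ a b c d → a :+ b :+ (c :+ d) := a :+ c :+ (b :+ d)) refl (∑ n f) (∑ n g) (f n) (g n))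

  ∑-* : ∀ n c f → ∑ n (λ j → c * f j) ≈ c * ∑ n f
  ∑-* zero    c f = sym (zeroʳ c)
  ∑-* (suc n) c f = trans (+-congʳ (∑-* n c f)) (sym (distribˡ c (∑ n f) (f n)))

  ∑-- : ∀ n f g → ∑ n (λ j → f j - g j) ≈ ∑ n f - ∑ n g
  ∑-- zero    f g = sym (-‿inverseʳ 0#)
  ∑-- (suc n) f g = trans (+-congʳ (∑-- n f g))
    (solve 4 (λ a b c d → a :- b :+ (c :- d) := a :+ c :- (b :+ d)) refl (∑ n f) (∑ n g) (f n) (g n))

  -- Summation from the front.
  ∑-front : ∀ n f → ∑ (suc n) f ≈ f 0 + ∑ n (f ∘ suc)
  ∑-front zero    f = trans (+-identityˡ (f 0)) (sym (+-identityʳ (f 0)))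
  ∑-front (suc n) f = trans (+-congʳ (∑-front n f)) (+-assoc (f 0) (∑ n (f ∘ suc)) (f (suc n)))

  -- conv f g s is the sum of f i * g j over i + j = s.
  conv : (ℕ → Carrier) → (ℕ → Carrier) → ℕ → Carrier
  conv f g zero    = f 0 * g 0
  conv f g (suc s) = f (suc s) * g 0 + conv f (g ∘ suc) s

  conv-∑ : ∀ f g s → conv f g s ≈ ∑ (suc s) (λ j → f (s ℕ.∸ j) * g j)
  conv-∑ f g zero    = sym (+-identityˡ (f 0 * g 0))
  conv-∑ f g (suc s) = trans (+-congˡ (conv-∑ f (g ∘ suc) s))
    (sym (∑-front (suc s) (λ j → f (suc s ℕ.∸ j) * g j)))

  conv-cong : ∀ s {f f′ g g′} → (∀ j → f j ≈ f′ j) → (∀ j → j ≤ s → g j ≈ g′ j) →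
    conv f g s ≈ conv f′ g′ s
  conv-cong zero    p r = *-cong (p 0) (r 0 z≤n)
  conv-cong (suc s) p r = +-cong (*-cong (p (suc s)) (r 0 z≤n))
    (conv-cong s p (λ j j≤s → r (suc j) (s≤s j≤s)))

  conv-congʳ : ∀ s {f g g′} → (∀ j → j ≤ s → g j ≈ g′ j) → conv f g s ≈ conv f g′ s
  conv-congʳ s = conv-cong s (λ _ → refl)

  conv-+ʳ : ∀ s f g h → conv f (λ j → g j + h j) s ≈ conv f g s + conv f h s
  conv-+ʳ zero    f g h = distribˡ (f 0) (g 0) (h 0)
  conv-+ʳ (suc s) f g h = trans (+-congˡ (conv-+ʳ s f (g ∘ suc) (h ∘ suc)))
    (solve 5 (λ a b c d e → a :* (b :+ c) :+ (d :+ e) := a :* b :+ d :+ (a :* c :+ e)) refl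
      (f (suc s)) (g 0) (h 0) (conv f (g ∘ suc) s) (conv f (h ∘ suc) s))

  conv-*ʳ : ∀ s c f g → conv f (λ j → c * g j) s ≈ c * conv f g s
  conv-*ʳ zero    c f g = solve 3 (λ a b c → a :* (c :* b) := c :* (a :* b)) refl (f 0) (g 0) c
  conv-*ʳ (suc s) c f g = trans (+-congˡ (conv-*ʳ s c f (g ∘ suc)))
    (solve 4 (λ a b c d → a :* (c :* b) :+ c :* d := c :* (a :* b :+ d)) refl
      (f (suc s)) (g 0) c (conv f (g ∘ suc) s))

  conv-*ˡ : ∀ s c f g → conv (λ j → c * f j) g s ≈ c * conv f g s
  conv-*ˡ zero    c f g = *-assoc c (f 0) (g 0)
  conv-*ˡ (suc s) c f g = trans (+-congˡ (conv-*ˡ s c f (g ∘ suc)))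
    (solve 4 (λ a b c d → c :* a :* b :+ c :* d := c :* (a :* b :+ d)) refl
      (f (suc s)) (g 0) c (conv f (g ∘ suc) s))

  conv-0ʳ : ∀ s f → conv f (λ _ → 0#) s ≈ 0#
  conv-0ʳ zero    f = zeroʳ (f 0)
  conv-0ʳ (suc s) f = trans (+-cong (zeroʳ (f (suc s))) (conv-0ʳ s f)) (+-identityˡ 0#)

  conv-∑ʳ : ∀ n s f (g : ℕ → ℕ → Carrier) →
    conv f (λ j → ∑ n (λ t → g t j)) s ≈ ∑ n (λ t → conv f (g t) s)
  conv-∑ʳ zero    s f g = conv-0ʳ s f
  conv-∑ʳ (suc n) s f g = trans (conv-+ʳ s f (λ j → ∑ n (λ t → g t j)) (g n)) (+-congʳ (conv-∑ʳ n s f g))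

  conv--ʳ : ∀ s f g h → conv f (λ j → g j - h j) s ≈ conv f g s - conv f h s
  conv--ʳ s f g h = trans (conv-congʳ s (λ j _ → +-congˡ (neg (h j))))
    (trans (conv-+ʳ s f g (λ j → - 1# * h j))
      (+-congˡ (trans (conv-*ʳ s (- 1#) f h) (sym (neg (conv f h s))))))
    where
    neg : ∀ x → - x ≈ - 1# * x
    neg = solve 1 (λ x → :- x := :- con (+ 1) :* x) refl

  conv--ˡ : ∀ s f g h → conv (λ j → f j - g j) h s ≈ conv f h s - conv g h s
  conv--ˡ zero    f g h = solve 3 (λ a b c → (a :- b) :* c := a :* c :- b :* c) refl (f 0) (g 0) (h 0)
  conv--ˡ (suc s) f g h = trans (+-congˡ (conv--ˡ s f g (h ∘ suc)))
    (solve 5 (λ a b c d e → (a :- b) :* c :+ (d :- e) := a :* c :+ d :- (b :* c :+ e)) refl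
      (f (suc s)) (g (suc s)) (h 0) (conv f (h ∘ suc) s) (conv g (h ∘ suc) s))

  -- Convolutions in which the first term of one factor vanishes.
  conv-head : ∀ s f g → g 0 ≈ 0# → conv f g (suc s) ≈ conv f (g ∘ suc) s
  conv-head s f g e = trans (+-congʳ (trans (*-congˡ e) (zeroʳ (f (suc s))))) (+-identityˡ (conv f (g ∘ suc) s))

  conv-last : ∀ s f g → f 0 ≈ 0# → conv f g (suc s) ≈ conv (f ∘ suc) g s
  conv-last zero    f g e = trans (+-congˡ (trans (*-congʳ e) (zeroˡ (g 1)))) (+-identityʳ (f 1 * g 0))
  conv-last (suc s) f g e = +-congˡ (conv-last s f (g ∘ suc) e)

  conv-power : ∀ s q f g → q ^ s * conv f g s ≈ conv (λ j → q ^ j * f j) (λ j → q ^ j * g j) s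
  conv-power zero    q f g = solve 2 (λ a b → con (+ 1) :* (a :* b) := con (+ 1) :* a :* (con (+ 1) :* b)) refl (f 0) (g 0)
  conv-power (suc s) q f g = begin
    q ^ s * q * (f (suc s) * g 0 + conv f (g ∘ suc) s)
      ≈⟨ solve 5 (λ a b c d e → a :* b :* (c :* d :+ e) := a :* b :* c :* (con (+ 1) :* d) :+ b :* (a :* e)) refl
           (q ^ s) q (f (suc s)) (g 0) (conv f (g ∘ suc) s) ⟩
    q ^ suc s * f (suc s) * (1# * g 0) + q * (q ^ s * conv f (g ∘ suc) s)
      ≈⟨ +-congˡ (*-congˡ (conv-power s q f (g ∘ suc))) ⟩
    q ^ suc s * f (suc s) * (1# * g 0) + q * conv (λ j → q ^ j * f j) (λ j → q ^ j * g (suc j)) s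
      ≈⟨ +-congˡ (conv-*ʳ s q _ _) ⟨
    q ^ suc s * f (suc s) * (1# * g 0) + conv (λ j → q ^ j * f j) (λ j → q * (q ^ j * g (suc j))) s
      ≈⟨ +-congˡ (conv-congʳ s (λ j _ → solve 3 (λ a b c → a :* (b :* c) := b :* a :* c) refl q (q ^ j) (g (suc j)))) ⟩
    conv (λ j → q ^ j * f j) (λ j → q ^ j * g j) (suc s) ∎

  -- The Leibniz rule for the derivation that multiplies the terms of degree s by s.
  conv-Leibniz : ∀ s f g → fromℕ s * conv f g s
    ≈ conv (λ j → fromℕ j * f j) g s + conv f (λ j → fromℕ j * g j) s
  conv-Leibniz zero    f g = solve 2 (λ a b → con (+ 0) :* (a :* b) := con (+ 0) :* a :* b :+ a :* (con (+ 0) :* b)) refl (f 0) (g 0)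
  conv-Leibniz (suc s) f g = begin
    (fromℕ s + 1#) * (f (suc s) * g 0 + conv f (g ∘ suc) s)
      ≈⟨ solve 4 (λ n a b c → (n :+ con (+ 1)) :* (a :* b :+ c) := (n :+ con (+ 1)) :* a :* b :+ n :* c :+ c) refl
           (fromℕ s) (f (suc s)) (g 0) (conv f (g ∘ suc) s) ⟩
    fromℕ (suc s) * f (suc s) * g 0 + fromℕ s * conv f (g ∘ suc) s + conv f (g ∘ suc) s
      ≈⟨ +-congʳ (+-congˡ (conv-Leibniz s f (g ∘ suc))) ⟩
    fromℕ (suc s) * f (suc s) * g 0 + (F + conv f (λ j → fromℕ j * g (suc j)) s) + conv f (g ∘ suc) s
      ≈⟨ solve 6 (λ a f b x y z → a :* b :+ (x :+ y) :+ z := a :* b :+ x :+ (f :* (con (+ 0) :* b) :+ (y :+ z))) refl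
           (fromℕ (suc s) * f (suc s)) (f (suc s)) (g 0) F (conv f (λ j → fromℕ j * g (suc j)) s) (conv f (g ∘ suc) s) ⟩
    fromℕ (suc s) * f (suc s) * g 0 + F
      + (f (suc s) * (0# * g 0) + (conv f (λ j → fromℕ j * g (suc j)) s + conv f (g ∘ suc) s))
      ≈⟨ +-congˡ (+-congˡ (trans (sym (conv-+ʳ s f (λ j → fromℕ j * g (suc j)) (g ∘ suc)))
           (conv-congʳ s (λ j _ → solve 2 (λ n x → n :* x :+ x := (n :+ con (+ 1)) :* x) refl (fromℕ j) (g (suc j)))))) ⟩
    fromℕ (suc s) * f (suc s) * g 0 + F + conv f (λ j → fromℕ j * g j) (suc s) ∎
    where
    F = conv (λ j → fromℕ j * f j) (g ∘ suc) s

  -- The partial sums of a Cauchy product.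
  ∑-conv-partial : ∀ n f g → ∑ (suc n) (conv f g) ≈ conv (λ m → ∑ (suc m) f) g n
  ∑-conv-partial zero    f g = solve 2 (λ a b → con (+ 0) :+ a :* b := (con (+ 0) :+ a) :* b) refl (f 0) (g 0)
  ∑-conv-partial (suc n) f g = trans (+-congʳ (∑-conv-partial n f g)) (sym (step n g))
    where
    F : ℕ → Carrier
    F m = ∑ (suc m) f
    step : ∀ n g → conv F g (suc n) ≈ conv F g n + conv f g (suc n)
    step zero    g = solve 4 (λ a b c d → (con (+ 0) :+ a :+ b) :* c :+ (con (+ 0) :+ a) :* d
      := (con (+ 0) :+ a) :* c :+ (b :* c :+ a :* d)) refl (f 0) (f 1) (g 0) (g 1)
    step (suc n) g = trans (+-congˡ (step n (g ∘ suc)))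
      (solve 5 (λ a b c d e → (a :+ b) :* c :+ (d :+ e) := a :* c :+ d :+ (b :* c :+ e)) refl
        (F (suc n)) (f (suc (suc n))) (g 0) (conv F (g ∘ suc) n) (conv f (g ∘ suc) (suc n)))

  -- Sums over lists.
  sumL : {A : Set} → (A → Carrier) → List A → Carrier
  sumL f xs = foldr _+_ 0# (map f xs)

  sumL-cong : {A : Set} {f g : A → Carrier} (xs : List A) → (∀ {x} → x ∈ xs → f x ≈ g x) → sumL f xs ≈ sumL g xs
  sumL-cong []       e = refl
  sumL-cong (x ∷ xs) e = +-cong (e (here ≡.refl)) (sumL-cong xs (λ m → e (there m)))

  sumL-++ : {A : Set} (f : A → Carrier) (xs ys : List A) → sumL f (xs ++ ys) ≈ sumL f xs + sumL f ys
  sumL-++ f []       ys = sym (+-identityˡ (sumL f ys))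
  sumL-++ f (x ∷ xs) ys = trans (+-congˡ (sumL-++ f xs ys)) (sym (+-assoc (f x) (sumL f xs) (sumL f ys)))

  sumL-↭ : {A : Set} (f : A → Carrier) {xs ys : List A} → xs ↭ ys → sumL f xs ≈ sumL f ys
  sumL-↭ f Perm.refl          = refl
  sumL-↭ f (Perm.prep x p)    = +-congˡ (sumL-↭ f p)
  sumL-↭ f (Perm.swap {ys = ys} x y p) = trans (+-congˡ (+-congˡ (sumL-↭ f p)))
    (solve 3 (λ a b c → a :+ (b :+ c) := b :+ (a :+ c)) refl (f x) (f y) (sumL f ys))
  sumL-↭ f (Perm.trans p r)   = trans (sumL-↭ f p) (sumL-↭ f r)

  sumL-* : {A : Set} (c : Carrier) (f : A → Carrier) (xs : List A) → sumL (λ x → c * f x) xs ≈ c * sumL f xs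
  sumL-* c f []       = sym (zeroʳ c)
  sumL-* c f (x ∷ xs) = trans (+-congˡ (sumL-* c f xs)) (sym (distribˡ c (f x) (sumL f xs)))

-- Finite q-series identities and the Bailey lemma

-- tri n is n (n - 1) / 2.
tri : ℕ → ℕ
tri zero    = 0
tri (suc n) = tri n ℕ.+ n

-- bump i κ is 1 if κ < i and 0 otherwise.
bump : ℕ → ℕ → ℕ
bump zero    κ       = 0
bump (suc i) zero    = 1
bump (suc i) (suc κ) = bump i κ

bump-< : ∀ {i κ} → κ < i → bump i κ ≡ 1
bump-< {suc i} {zero}  (s≤s _) = ≡.refl
bump-< {suc i} {suc κ} (s≤s p) = bump-< p

bump-≥ : ∀ {i κ} → i ≤ κ → bump i κ ≡ 0
bump-≥ z≤n     = ≡.refl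
bump-≥ (s≤s p) = bump-≥ p

-- The exponent that N_j = s contributes for j ≥ 2, where κ = k - j and c = 2 ℓ: the linear term
-- (2 ℓ + 1) N_j loses N_j when j ≤ k - i, that is, when i ≤ κ.
weight : (c i κ s : ℕ) → ℕ
weight c i κ s = s ℕ.* s ℕ.+ c ℕ.* s ℕ.+ bump i κ ℕ.* s

-- The exponent contributed by N₂, …, N_k, where v = (n₂, …, n_k).
tailExponent : (c i : ℕ) → ∀ {κ} → Vec ℕ κ → ℕ
tailExponent c i []              = 0
tailExponent c i {suc κ} (x ∷ v) = weight c i κ (Vec.sum (x ∷ v)) ℕ.+ tailExponent c i v

-- The exponent of the summand at n = (n₁, …, n_k), for ℓ = p ≥ 0 and c = 2 p. Here tri s + bump i κ s
-- is N₁ (N₁ + 1) / 2, less N₁ when 1 ≤ k - i.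
fullExponent : (p c i : ℕ) → ∀ {κ} → Vec ℕ (suc κ) → ℕ
fullExponent p c i {κ} (x ∷ v) = tri s ℕ.+ p ℕ.* s ℕ.+ bump i κ ℕ.* s ℕ.+ tailExponent c i v
  where s = Vec.sum (x ∷ v)

-- The finite q-series identities, for an element q such that every 1 - q ^ (m + 1) is invertible.
module QSeries (R : CommutativeRing 0ℓ 0ℓ) (q : CommutativeRing.Carrier R) (inv : ℕ → CommutativeRing.Carrier R)
  (inv-law : ∀ m → CommutativeRing._≈_ R
    (CommutativeRing._*_ R (CommutativeRing._-_ R (CommutativeRing.1# R) (FiniteSum._^_ R q (suc m))) (inv m))
    (CommutativeRing.1# R)) where
  open CommutativeRing R
  open IntegerCoefficients R
  open FiniteSum R
  open SetoidReasoning setoid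

  -- rr m is 1/(q)_m.
  rr : ℕ → Carrier
  rr zero    = 1#
  rr (suc m) = rr m * inv m

  -- poch⁺ n is (-q)_n.
  poch⁺ : ℕ → Carrier
  poch⁺ zero    = 1#
  poch⁺ (suc n) = poch⁺ n * (1# + q ^ suc n)

  rr-suc : ∀ m → (1# - q ^ suc m) * rr (suc m) ≈ rr m
  rr-suc m = trans (solve 3 (λ a b c → a :* (b :* c) := b :* (a :* c)) refl (1# - q ^ suc m) (rr m) (inv m))
    (trans (*-congˡ (inv-law m)) (*-identityʳ (rr m)))

  -- The factors 1 - q ^ (m + 1) are cancellable.
  cancel : ∀ m {x y} → (1# - q ^ suc m) * x ≈ (1# - q ^ suc m) * y → x ≈ y
  cancel m {x} {y} e = begin
    x                               ≈⟨ undo x ⟨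
    inv m * ((1# - q ^ suc m) * x)  ≈⟨ *-congˡ e ⟩
    inv m * ((1# - q ^ suc m) * y)  ≈⟨ undo y ⟩
    y                               ∎
    where
    undo : ∀ z → inv m * ((1# - q ^ suc m) * z) ≈ z
    undo z = trans (solve 3 (λ a b c → a :* (b :* c) := b :* a :* c) refl (inv m) (1# - q ^ suc m) z)
      (trans (*-congʳ (inv-law m)) (*-identityˡ z))

  -- T D g is the q-binomial sum of the g d over d ≤ D, divided by (q)_D.
  T : ℕ → (ℕ → Carrier) → Carrier
  T D g = conv rr (λ d → rr d * g d) D

  T-cong : ∀ D {g g′} → (∀ d → g d ≈ g′ d) → T D g ≈ T D g′
  T-cong D e = conv-congʳ D (λ d _ → *-congˡ (e d))

  -- The q-Pascal rule, summed against g.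
  T-suc : ∀ D g → (1# - q ^ suc D) * T (suc D) g ≈ T D (λ d → q ^ d * g d + g (suc d))
  T-suc D g = begin
    (1# - q ^ suc D) * T (suc D) g
      ≈⟨ solve 2 (λ a b → (con (+ 1) :- a) :* b := b :- a :* b) refl (q ^ suc D) (T (suc D) g) ⟩
    conv rr h (suc D) - q ^ suc D * conv rr h (suc D)
      ≈⟨ +-congˡ (-‿cong (conv-power (suc D) q rr h)) ⟩
    conv rr h (suc D) - conv qrr qh (suc D)
      ≈⟨ solve 3 (λ a b c → a :- c := b :- c :+ (a :- b)) refl (conv rr h (suc D)) (conv rr qh (suc D)) (conv qrr qh (suc D)) ⟩
    (conv rr qh (suc D) - conv qrr qh (suc D)) + (conv rr h (suc D) - conv rr qh (suc D))
      ≈⟨ +-cong (conv--ˡ (suc D) rr qrr qh) (conv--ʳ (suc D) rr h qh) ⟨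
    conv (λ j → rr j - q ^ j * rr j) qh (suc D) + conv rr (λ j → h j - q ^ j * h j) (suc D)
      ≈⟨ +-cong (conv-last D (λ j → rr j - q ^ j * rr j) qh zero-diff) (conv-head D rr (λ j → h j - q ^ j * h j) zero-diff) ⟩
    conv (λ j → rr (suc j) - q ^ suc j * rr (suc j)) qh D + conv rr (λ j → h (suc j) - q ^ suc j * h (suc j)) D
      ≈⟨ +-cong
           (conv-cong D (λ j → trans (factor (q ^ suc j) (rr (suc j))) (rr-suc j))
             (λ j _ → solve 3 (λ a b c → a :* (b :* c) := b :* (a :* c)) refl (q ^ j) (rr j) (g j)))
           (conv-congʳ D (λ j _ → trans (factor (q ^ suc j) (h (suc j)))
             (trans (sym (*-assoc (1# - q ^ suc j) (rr (suc j)) (g (suc j)))) (*-congʳ (rr-suc j))))) ⟩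
    T D (λ d → q ^ d * g d) + T D (g ∘ suc)
      ≈⟨ conv-+ʳ D rr _ _ ⟨
    conv rr (λ d → rr d * (q ^ d * g d) + rr d * g (suc d)) D
      ≈⟨ conv-congʳ D (λ d _ → distribˡ (rr d) (q ^ d * g d) (g (suc d))) ⟨
    T D (λ d → q ^ d * g d + g (suc d)) ∎
    where
    h qh qrr : ℕ → Carrier
    h d = rr d * g d
    qh d = q ^ d * h d
    qrr d = q ^ d * rr d
    zero-diff : ∀ {x} → x - 1# * x ≈ 0#
    zero-diff {x} = solve 1 (λ x → x :- con (+ 1) :* x := con (+ 0)) refl x
    factor : ∀ x y → y - x * y ≈ (1# - x) * y
    factor = solve 2 (λ x y → y :- x :* y := (con (+ 1) :- x) :* y) refl

  -- The limiting case a → ∞ of the q-Chu-Vandermonde sum. The q-Pascal rule raises c by one.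
  vandermonde : ∀ D c → T D (λ d → q ^ (d ℕ.* d ℕ.+ c ℕ.* d) * rr (c ℕ.+ d)) ≈ rr D * rr (c ℕ.+ D)
  vandermonde zero    c = trans (*-congˡ (*-congˡ (*-congʳ (^-≡ q {c ℕ.* 0} {0} (ℕₚ.*-zeroʳ c)))))
    (solve 1 (λ x → con (+ 1) :* (con (+ 1) :* (con (+ 1) :* x)) := con (+ 1) :* x) refl (rr (c ℕ.+ 0)))
  vandermonde (suc D) c = cancel D (begin
    (1# - q ^ suc D) * T (suc D) (g c)
      ≈⟨ T-suc D (g c) ⟩
    T D (λ d → q ^ d * g c d + g c (suc d))
      ≈⟨ T-cong D step ⟩
    T D (g (suc c))
      ≈⟨ vandermonde D (suc c) ⟩
    rr D * rr (suc c ℕ.+ D)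
      ≈⟨ *-cong (sym (rr-suc D)) (reflexive (cong rr (≡.sym (ℕₚ.+-suc c D)))) ⟩
    (1# - q ^ suc D) * rr (suc D) * rr (c ℕ.+ suc D)
      ≈⟨ *-assoc _ _ _ ⟩
    (1# - q ^ suc D) * (rr (suc D) * rr (c ℕ.+ suc D)) ∎)
    where
    g : ℕ → ℕ → Carrier
    g c d = q ^ (d ℕ.* d ℕ.+ c ℕ.* d) * rr (c ℕ.+ d)
    shift : ∀ d c → suc d ℕ.* suc d ℕ.+ c ℕ.* suc d ≡ (d ℕ.* d ℕ.+ suc c ℕ.* d) ℕ.+ suc (c ℕ.+ d)
    shift = solve-∀
    split : ∀ d c → d ℕ.+ (d ℕ.* d ℕ.+ c ℕ.* d) ≡ d ℕ.* d ℕ.+ suc c ℕ.* d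
    split = solve-∀
    step : ∀ d → q ^ d * g c d + g c (suc d) ≈ g (suc c) d
    step d = begin
      q ^ d * (q ^ (d ℕ.* d ℕ.+ c ℕ.* d) * rr (c ℕ.+ d)) + q ^ (suc d ℕ.* suc d ℕ.+ c ℕ.* suc d) * rr (c ℕ.+ suc d)
        ≈⟨ +-cong (trans (sym (*-assoc _ _ _)) (*-cong (trans (sym (^-+ q d _)) (^-≡ q (split d c))) (sym (rr-suc (c ℕ.+ d)))))
             (*-cong (trans (^-≡ q (shift d c)) (^-+ q (d ℕ.* d ℕ.+ suc c ℕ.* d) (suc (c ℕ.+ d))))
               (reflexive (cong rr (ℕₚ.+-suc c d)))) ⟩
      q ^ (d ℕ.* d ℕ.+ suc c ℕ.* d) * ((1# - q ^ suc (c ℕ.+ d)) * rr (suc (c ℕ.+ d)))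
        + q ^ (d ℕ.* d ℕ.+ suc c ℕ.* d) * q ^ suc (c ℕ.+ d) * rr (suc (c ℕ.+ d))
        ≈⟨ solve 3 (λ a b c → a :* ((con (+ 1) :- b) :* c) :+ a :* b :* c := a :* c) refl
             (q ^ (d ℕ.* d ℕ.+ suc c ℕ.* d)) (q ^ suc (c ℕ.+ d)) (rr (suc (c ℕ.+ d))) ⟩
      g (suc c) d ∎

  -- rise e D is the product of the 1 + q ^ (e + j) over j < D.
  rise : ℕ → ℕ → Carrier
  rise e zero    = 1#
  rise e (suc D) = (1# + q ^ e) * rise (suc e) D

  -- The q-Chu-Vandermonde sum with parameters a = - q ^ (r + 1) and q ^ (r + e + 1). The q-Pascal rule
  -- raises e by one and splits off the factor 1 + q ^ e.
  vandermonde⁺ : ∀ D r e →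
    T D (λ d → q ^ (tri d ℕ.+ e ℕ.* d) * (poch⁺ (r ℕ.+ d) * rr (r ℕ.+ e ℕ.+ d)))
      ≈ rr D * (rise e D * poch⁺ r * rr (r ℕ.+ e ℕ.+ D))
  vandermonde⁺ zero r e = trans (*-congˡ (*-congˡ (*-cong (^-≡ q (ℕₚ.*-zeroʳ e))
      (*-congʳ (reflexive (cong poch⁺ (ℕₚ.+-identityʳ r)))))))
    (solve 2 (λ a b → con (+ 1) :* (con (+ 1) :* (con (+ 1) :* (a :* b))) := con (+ 1) :* (con (+ 1) :* a :* b)) refl
      (poch⁺ r) (rr (r ℕ.+ e ℕ.+ 0)))
  vandermonde⁺ (suc D) r e = cancel D (begin
    (1# - q ^ suc D) * T (suc D) (g e)
      ≈⟨ T-suc D (g e) ⟩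
    T D (λ d → q ^ d * g e d + g e (suc d))
      ≈⟨ T-cong D step ⟩
    T D (λ d → (1# + q ^ e) * g (suc e) d)
      ≈⟨ trans (conv-congʳ D (λ d _ → solve 3 (λ a b c → a :* (b :* c) := b :* (a :* c)) refl (rr d) (1# + q ^ e) (g (suc e) d)))
           (conv-*ʳ D (1# + q ^ e) rr (λ d → rr d * g (suc e) d)) ⟩
    (1# + q ^ e) * T D (g (suc e))
      ≈⟨ *-congˡ (vandermonde⁺ D r (suc e)) ⟩
    (1# + q ^ e) * (rr D * (rise (suc e) D * poch⁺ r * rr (r ℕ.+ suc e ℕ.+ D)))
      ≈⟨ *-congˡ (*-cong (sym (rr-suc D)) (*-congˡ (reflexive (cong rr (swap r e D))))) ⟩
    (1# + q ^ e) * ((1# - q ^ suc D) * rr (suc D) * (rise (suc e) D * poch⁺ r * rr (r ℕ.+ e ℕ.+ suc D)))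
      ≈⟨ solve 6 (λ a b c d e f → a :* (b :* c :* (d :* e :* f)) := b :* (c :* (a :* d :* e :* f))) refl
           (1# + q ^ e) (1# - q ^ suc D) (rr (suc D)) (rise (suc e) D) (poch⁺ r) (rr (r ℕ.+ e ℕ.+ suc D)) ⟩
    (1# - q ^ suc D) * (rr (suc D) * (rise e (suc D) * poch⁺ r * rr (r ℕ.+ e ℕ.+ suc D))) ∎)
    where
    g : ℕ → ℕ → Carrier
    g e d = q ^ (tri d ℕ.+ e ℕ.* d) * (poch⁺ (r ℕ.+ d) * rr (r ℕ.+ e ℕ.+ d))
    swap : ∀ r e D → r ℕ.+ suc e ℕ.+ D ≡ r ℕ.+ e ℕ.+ suc D
    swap = solve-∀
    exponent : ∀ t d e → d ℕ.+ (t ℕ.+ e ℕ.* d) ≡ t ℕ.+ suc e ℕ.* d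
    exponent = solve-∀
    exponent′ : ∀ t d e → (t ℕ.+ d) ℕ.+ e ℕ.* suc d ≡ (t ℕ.+ suc e ℕ.* d) ℕ.+ e
    exponent′ = solve-∀
    last : ∀ r d e → suc (r ℕ.+ e ℕ.+ d) ≡ e ℕ.+ suc (r ℕ.+ d)
    last = solve-∀
    step : ∀ d → q ^ d * g e d + g e (suc d) ≈ (1# + q ^ e) * g (suc e) d
    step d = begin
      q ^ d * (q ^ (tri d ℕ.+ e ℕ.* d) * (poch⁺ (r ℕ.+ d) * rr n))
        + q ^ (tri d ℕ.+ d ℕ.+ e ℕ.* suc d) * (poch⁺ (r ℕ.+ suc d) * rr (r ℕ.+ e ℕ.+ suc d))
        ≈⟨ +-cong
             (trans (sym (*-assoc _ _ _)) (*-cong (trans (sym (^-+ q d _)) (^-≡ q (exponent (tri d) d e)))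
               (*-congˡ (trans (sym (rr-suc n)) (*-congʳ (+-congˡ (-‿cong
                 (trans (^-≡ q (last r d e)) (^-+ q e (suc (r ℕ.+ d)))))))))))
             (*-cong (trans (^-≡ q (exponent′ (tri d) d e)) (^-+ q (tri d ℕ.+ suc e ℕ.* d) e))
               (*-cong (reflexive (cong poch⁺ (ℕₚ.+-suc r d))) (reflexive (cong rr (ℕₚ.+-suc (r ℕ.+ e) d))))) ⟩
      y * (poch⁺ (r ℕ.+ d) * ((1# - q ^ e * x) * rr (suc n)))
        + y * q ^ e * (poch⁺ (r ℕ.+ d) * (1# + x) * rr (suc n))
        ≈⟨ solve 5 (λ y P w x z → y :* (P :* ((con (+ 1) :- w :* x) :* z)) :+ y :* w :* (P :* (con (+ 1) :+ x) :* z)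
                     := (con (+ 1) :+ w) :* (y :* (P :* z))) refl y (poch⁺ (r ℕ.+ d)) (q ^ e) x (rr (suc n)) ⟩
      (1# + q ^ e) * (y * (poch⁺ (r ℕ.+ d) * rr (suc n)))
        ≈⟨ *-congˡ (*-congˡ (*-congˡ (reflexive (cong (λ m → rr (m ℕ.+ d)) (≡.sym (ℕₚ.+-suc r e)))))) ⟩
      (1# + q ^ e) * g (suc e) d ∎
      where
      n = r ℕ.+ e ℕ.+ d
      x = q ^ suc (r ℕ.+ d)
      y = q ^ (tri d ℕ.+ suc e ℕ.* d)

  -- kernel c t s is 1/((q)_{s-t} (q)_{s+t+c}), which vanishes for s < t.
  kernel : ℕ → ℕ → ℕ → Carrier
  kernel c zero    s       = rr s * rr (c ℕ.+ s)
  kernel c (suc t) zero    = 0#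
  kernel c (suc t) (suc s) = kernel (suc (suc c)) t s

  kernel-vanish : ∀ c {t s} → s < t → kernel c t s ≈ 0#
  kernel-vanish c {suc t} {zero}  _       = refl
  kernel-vanish c {suc t} {suc s} (s≤s p) = kernel-vanish (suc (suc c)) p

  kernel-value : ∀ c t d → kernel c t (t ℕ.+ d) ≡ rr d * rr (c ℕ.+ (t ℕ.+ (t ℕ.+ d)))
  kernel-value c zero    d = ≡.refl
  kernel-value c (suc t) d = ≡.trans (kernel-value (suc (suc c)) t d) (cong (λ n → rr d * rr n) (shift c t d))
    where
    shift : ∀ c t d → suc (suc c) ℕ.+ (t ℕ.+ (t ℕ.+ d)) ≡ c ℕ.+ (suc t ℕ.+ (suc t ℕ.+ d))
    shift = solve-∀

  -- kernel c t s - q ^ (2t + c + 1) kernel c (t + 1) s is (1 - q ^ (2t + c + 1)) / ((q)_{s-t} (q)_{s+t+c+1}),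
  -- the kernel of Bailey pairs relative to the other base.
  kernel′ : ℕ → ℕ → ℕ → Carrier
  kernel′ c t s = kernel c t s - q ^ suc (t ℕ.+ t ℕ.+ c) * kernel c (suc t) s

  -- The factor q ^ s leads back from kernel′ to the kernel.
  kernel′-shift : ∀ c t s → q ^ s * kernel′ c t s ≈ q ^ t * (kernel c t s - kernel c (suc t) s)
  kernel′-shift c zero zero = solve 2 (λ k x → con (+ 1) :* (k :- x :* con (+ 0)) := con (+ 1) :* (k :- con (+ 0))) refl
    (kernel c 0 0) (q ^ suc c)
  kernel′-shift c zero (suc s) = begin
    q ^ suc s * (rr (suc s) * rr (c ℕ.+ suc s) - q ^ suc c * (rr s * rr (suc (suc c) ℕ.+ s)))
      ≈⟨ *-congˡ (+-cong first (-‿cong (*-congˡ second))) ⟩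
    x * ((1# - y * x) * K - y * ((1# - x) * K))
      ≈⟨ solve 3 (λ x y K → x :* ((con (+ 1) :- y :* x) :* K :- y :* ((con (+ 1) :- x) :* K))
                   := con (+ 1) :* ((con (+ 1) :- y :* x) :* K :- (con (+ 1) :- x) :* K)) refl x y K ⟩
    1# * ((1# - y * x) * K - (1# - x) * K)
      ≈⟨ *-congˡ (+-cong first (-‿cong second)) ⟨
    1# * (rr (suc s) * rr (c ℕ.+ suc s) - rr s * rr (suc (suc c) ℕ.+ s)) ∎
    where
    x = q ^ suc s
    y = q ^ suc c
    K = rr (suc s) * rr (suc (suc (c ℕ.+ s)))
    first : rr (suc s) * rr (c ℕ.+ suc s) ≈ (1# - y * x) * K
    first = begin
      rr (suc s) * rr (c ℕ.+ suc s)
        ≈⟨ *-congˡ (trans (reflexive (cong rr (ℕₚ.+-suc c s))) (sym (rr-suc (suc (c ℕ.+ s))))) ⟩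
      rr (suc s) * ((1# - q ^ suc (suc (c ℕ.+ s))) * rr (suc (suc (c ℕ.+ s))))
        ≈⟨ *-congˡ (*-congʳ (+-congˡ (-‿cong (trans (^-≡ q (cong suc (≡.sym (ℕₚ.+-suc c s)))) (^-+ q (suc c) (suc s)))))) ⟩
      rr (suc s) * ((1# - y * x) * rr (suc (suc (c ℕ.+ s))))
        ≈⟨ solve 3 (λ a b c → a :* (b :* c) := b :* (a :* c)) refl (rr (suc s)) (1# - y * x) (rr (suc (suc (c ℕ.+ s)))) ⟩
      (1# - y * x) * K ∎
    second : rr s * rr (suc (suc c) ℕ.+ s) ≈ (1# - x) * K
    second = trans (*-congʳ (sym (rr-suc s))) (*-assoc (1# - x) (rr (suc s)) (rr (suc (suc (c ℕ.+ s)))))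
  kernel′-shift c (suc t) zero = solve 2 (λ x y → con (+ 1) :* (con (+ 0) :- x :* con (+ 0)) := y :* (con (+ 0) :- con (+ 0))) refl
    (q ^ suc (suc t ℕ.+ suc t ℕ.+ c)) (q ^ suc t)
  kernel′-shift c (suc t) (suc s) = begin
    q ^ s * q * (A - q ^ suc (suc t ℕ.+ suc t ℕ.+ c) * B)
      ≈⟨ *-congˡ (+-congˡ (-‿cong (*-congʳ (^-≡ q (shift t c))))) ⟩
    q ^ s * q * kernel′ (suc (suc c)) t s
      ≈⟨ solve 3 (λ a b c → a :* b :* c := a :* c :* b) refl (q ^ s) q (kernel′ (suc (suc c)) t s) ⟩
    q ^ s * kernel′ (suc (suc c)) t s * q
      ≈⟨ *-congʳ (kernel′-shift (suc (suc c)) t s) ⟩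
    q ^ t * (A - B) * q
      ≈⟨ solve 3 (λ a b c → a :* c :* b := a :* b :* c) refl (q ^ t) q (A - B) ⟩
    q ^ suc t * (A - B) ∎
    where
    A = kernel (suc (suc c)) t s
    B = kernel (suc (suc c)) (suc t) s
    shift : ∀ t c → suc (suc t ℕ.+ suc t ℕ.+ c) ≡ suc (t ℕ.+ t ℕ.+ suc (suc c))
    shift = solve-∀

  -- The Bailey lemma for the kernel: the kernel as a function of s reproduces itself. Raising t and s
  -- together raises c by two, which reduces the identity to t = 0.
  conv-kernel : ∀ c t s →
    conv rr (λ j → q ^ (j ℕ.* j ℕ.+ c ℕ.* j) * kernel c t j) s ≈ q ^ (t ℕ.* t ℕ.+ c ℕ.* t) * kernel c t s
  conv-kernel c zero s = begin
    conv rr (λ j → q ^ (j ℕ.* j ℕ.+ c ℕ.* j) * (rr j * rr (c ℕ.+ j))) s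
      ≈⟨ conv-congʳ s (λ j _ → solve 3 (λ a b c → a :* (b :* c) := b :* (a :* c)) refl
           (q ^ (j ℕ.* j ℕ.+ c ℕ.* j)) (rr j) (rr (c ℕ.+ j))) ⟩
    T s (λ d → q ^ (d ℕ.* d ℕ.+ c ℕ.* d) * rr (c ℕ.+ d))
      ≈⟨ vandermonde s c ⟩
    kernel c 0 s
      ≈⟨ trans (*-congʳ (^-≡ q (ℕₚ.*-zeroʳ c))) (*-identityˡ (kernel c 0 s)) ⟨
    q ^ (c ℕ.* 0) * kernel c 0 s ∎
  conv-kernel c (suc t) zero = solve 2 (λ x y → con (+ 1) :* (x :* con (+ 0)) := y :* con (+ 0)) refl
    (q ^ (c ℕ.* 0)) (q ^ (suc t ℕ.* suc t ℕ.+ c ℕ.* suc t))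
  conv-kernel c (suc t) (suc s) = begin
    conv rr (λ j → q ^ (j ℕ.* j ℕ.+ c ℕ.* j) * kernel c (suc t) j) (suc s)
      ≈⟨ conv-head s rr (λ j → q ^ (j ℕ.* j ℕ.+ c ℕ.* j) * kernel c (suc t) j) (zeroʳ (q ^ (c ℕ.* 0))) ⟩
    conv rr (λ j → q ^ (suc j ℕ.* suc j ℕ.+ c ℕ.* suc j) * kernel (suc (suc c)) t j) s
      ≈⟨ conv-congʳ s (λ j _ → shift j (kernel (suc (suc c)) t j)) ⟩
    conv rr (λ j → q ^ suc c * (q ^ (j ℕ.* j ℕ.+ suc (suc c) ℕ.* j) * kernel (suc (suc c)) t j)) s
      ≈⟨ conv-*ʳ s (q ^ suc c) rr _ ⟩
    q ^ suc c * conv rr (λ j → q ^ (j ℕ.* j ℕ.+ suc (suc c) ℕ.* j) * kernel (suc (suc c)) t j) s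
      ≈⟨ *-congˡ (conv-kernel (suc (suc c)) t s) ⟩
    q ^ suc c * (q ^ (t ℕ.* t ℕ.+ suc (suc c) ℕ.* t) * kernel (suc (suc c)) t s)
      ≈⟨ shift t (kernel (suc (suc c)) t s) ⟨
    q ^ (suc t ℕ.* suc t ℕ.+ c ℕ.* suc t) * kernel c (suc t) (suc s) ∎
    where
    exponent : ∀ j c → suc j ℕ.* suc j ℕ.+ c ℕ.* suc j ≡ suc c ℕ.+ (j ℕ.* j ℕ.+ suc (suc c) ℕ.* j)
    exponent = solve-∀
    shift : ∀ j x → q ^ (suc j ℕ.* suc j ℕ.+ c ℕ.* suc j) * x ≈ q ^ suc c * (q ^ (j ℕ.* j ℕ.+ suc (suc c) ℕ.* j) * x)
    shift j x = trans (*-congʳ (trans (^-≡ q (exponent j c)) (^-+ q (suc c) _))) (*-assoc _ _ x)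

  rise-poch⁺ : ∀ p D → rise (suc p) D * poch⁺ p ≈ poch⁺ (p ℕ.+ D)
  rise-poch⁺ p zero    = trans (*-identityˡ (poch⁺ p)) (reflexive (cong poch⁺ (≡.sym (ℕₚ.+-identityʳ p))))
  rise-poch⁺ p (suc D) = begin
    (1# + q ^ suc p) * rise (suc (suc p)) D * poch⁺ p
      ≈⟨ solve 3 (λ a b c → a :* b :* c := b :* (c :* a)) refl (1# + q ^ suc p) (rise (suc (suc p)) D) (poch⁺ p) ⟩
    rise (suc (suc p)) D * poch⁺ (suc p)
      ≈⟨ rise-poch⁺ (suc p) D ⟩
    poch⁺ (suc p ℕ.+ D)
      ≈⟨ reflexive (cong poch⁺ (≡.sym (ℕₚ.+-suc p D))) ⟩
    poch⁺ (p ℕ.+ suc D) ∎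

  -- The Bailey lemma with the weight (-q)_{p+j}. The factor poch⁺ m is (-q)_{p+s-1}; the hypothesis on m
  -- excludes p = s = 0.
  conv-kernel⁺ : ∀ p c → c ≡ p ℕ.+ p → ∀ t s m → p ℕ.+ s ≡ suc m →
    conv rr (λ j → q ^ (tri j ℕ.+ p ℕ.* j) * (poch⁺ (p ℕ.+ j) * kernel c t j)) s
      ≈ poch⁺ m * (q ^ (tri t ℕ.+ p ℕ.* t) * (1# + q ^ (p ℕ.+ t)) * kernel c t s)
  conv-kernel⁺ p c ≡.refl zero s m e = begin
    conv rr (λ j → q ^ (tri j ℕ.+ p ℕ.* j) * (poch⁺ (p ℕ.+ j) * (rr j * rr (c ℕ.+ j)))) s
      ≈⟨ conv-congʳ s (λ j _ → solve 4 (λ a b c d → a :* (b :* (c :* d)) := c :* (a :* (b :* d))) refl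
           (q ^ (tri j ℕ.+ p ℕ.* j)) (poch⁺ (p ℕ.+ j)) (rr j) (rr (c ℕ.+ j))) ⟩
    T s (λ d → q ^ (tri d ℕ.+ p ℕ.* d) * (poch⁺ (p ℕ.+ d) * rr (c ℕ.+ d)))
      ≈⟨ vandermonde⁺ s p p ⟩
    rr s * (rise p s * poch⁺ p * rr (c ℕ.+ s))
      ≈⟨ *-congˡ (*-congʳ (top s e)) ⟩
    rr s * ((1# + q ^ p) * poch⁺ m * rr (c ℕ.+ s))
      ≈⟨ solve 4 (λ a b c d → a :* (b :* c :* d) := c :* (con (+ 1) :* b :* (a :* d))) refl
           (rr s) (1# + q ^ p) (poch⁺ m) (rr (c ℕ.+ s)) ⟩
    poch⁺ m * (1# * (1# + q ^ p) * (rr s * rr (c ℕ.+ s)))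
      ≈⟨ *-congˡ (*-congʳ (*-cong (^-≡ q (ℕₚ.*-zeroʳ p)) (+-congˡ (^-≡ q (ℕₚ.+-identityʳ p))))) ⟨
    poch⁺ m * (q ^ (p ℕ.* 0) * (1# + q ^ (p ℕ.+ 0)) * (rr s * rr (c ℕ.+ s))) ∎
    where
    top : ∀ s → p ℕ.+ s ≡ suc m → rise p s * poch⁺ p ≈ (1# + q ^ p) * poch⁺ m
    top zero e rewrite ≡.trans (≡.sym (ℕₚ.+-identityʳ p)) e = trans (*-identityˡ _) (*-comm _ _)
    top (suc s) e = trans (*-assoc _ _ _) (*-congˡ (trans (rise-poch⁺ p s)
      (reflexive (cong poch⁺ (ℕₚ.suc-injective (≡.trans (≡.sym (ℕₚ.+-suc p s)) e))))))
  conv-kernel⁺ p c _ (suc t) zero m e = solve 4 (λ x y z w → con (+ 1) :* (x :* (y :* con (+ 0))) := z :* (w :* con (+ 0))) refl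
    (q ^ (p ℕ.* 0)) (poch⁺ (p ℕ.+ 0)) (poch⁺ m) (q ^ (tri (suc t) ℕ.+ p ℕ.* suc t) * (1# + q ^ (p ℕ.+ suc t)))
  conv-kernel⁺ p c e (suc t) (suc s) m e′ = begin
    conv rr (λ j → q ^ (tri j ℕ.+ p ℕ.* j) * (poch⁺ (p ℕ.+ j) * kernel c (suc t) j)) (suc s)
      ≈⟨ conv-head s rr (λ j → q ^ (tri j ℕ.+ p ℕ.* j) * (poch⁺ (p ℕ.+ j) * kernel c (suc t) j))
           (trans (*-congˡ (zeroʳ (poch⁺ (p ℕ.+ 0)))) (zeroʳ (q ^ (p ℕ.* 0)))) ⟩
    conv rr (λ j → q ^ (tri j ℕ.+ j ℕ.+ p ℕ.* suc j) * (poch⁺ (p ℕ.+ suc j) * kernel c′ t j)) s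
      ≈⟨ conv-congʳ s (λ j _ → trans (*-congˡ (*-congʳ (reflexive (cong poch⁺ (ℕₚ.+-suc p j))))) (shift j _)) ⟩
    conv rr (λ j → q ^ p * (q ^ (tri j ℕ.+ suc p ℕ.* j) * (poch⁺ (suc p ℕ.+ j) * kernel c′ t j))) s
      ≈⟨ conv-*ʳ s (q ^ p) rr _ ⟩
    q ^ p * conv rr (λ j → q ^ (tri j ℕ.+ suc p ℕ.* j) * (poch⁺ (suc p ℕ.+ j) * kernel c′ t j)) s
      ≈⟨ *-congˡ (conv-kernel⁺ (suc p) c′ (≡.trans (cong (suc ∘ suc) e) (cong suc (≡.sym (ℕₚ.+-suc p p)))) t s m
           (≡.trans (≡.sym (ℕₚ.+-suc p s)) e′)) ⟩
    q ^ p * (poch⁺ m * (q ^ (tri t ℕ.+ suc p ℕ.* t) * (1# + q ^ (suc p ℕ.+ t)) * kernel c′ t s))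
      ≈⟨ solve 5 (λ a b c d e → a :* (b :* (c :* d :* e)) := b :* (a :* (c :* (d :* e)))) refl
           (q ^ p) (poch⁺ m) (q ^ (tri t ℕ.+ suc p ℕ.* t)) (1# + q ^ (suc p ℕ.+ t)) (kernel c′ t s) ⟩
    poch⁺ m * (q ^ p * (q ^ (tri t ℕ.+ suc p ℕ.* t) * ((1# + q ^ (suc p ℕ.+ t)) * kernel c′ t s)))
      ≈⟨ *-congˡ (trans (sym (shift t _)) (trans (sym (*-assoc _ _ _))
           (*-congʳ (*-congˡ (+-congˡ (^-≡ q (≡.sym (ℕₚ.+-suc p t)))))))) ⟩
    poch⁺ m * (q ^ (tri (suc t) ℕ.+ p ℕ.* suc t) * (1# + q ^ (p ℕ.+ suc t)) * kernel c (suc t) (suc s)) ∎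
    where
    c′ = suc (suc c)
    exponent : ∀ T j p → T ℕ.+ j ℕ.+ p ℕ.* suc j ≡ p ℕ.+ (T ℕ.+ suc p ℕ.* j)
    exponent = solve-∀
    shift : ∀ j x → q ^ (tri j ℕ.+ j ℕ.+ p ℕ.* suc j) * x ≈ q ^ p * (q ^ (tri j ℕ.+ suc p ℕ.* j) * x)
    shift j x = trans (*-congʳ (trans (^-≡ q (exponent (tri j) j p)) (^-+ q p _))) (*-assoc _ _ x)

-- The Bailey chain

  merge : ∀ m n {k} x → m ℕ.+ n ≡ k → q ^ m * (q ^ n * x) ≈ q ^ k * x
  merge m n x e = trans (sym (*-assoc (q ^ m) (q ^ n) x)) (*-congʳ (trans (sym (^-+ q m n)) (^-≡ q e)))

  ∑-conv : ∀ n s f (w : ℕ → Carrier) (g : ℕ → ℕ → Carrier) →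
    conv f (λ j → ∑ n (λ t → w t * g t j)) s ≈ ∑ n (λ t → w t * conv f (g t) s)
  ∑-conv n s f w g = trans (conv-∑ʳ n s f (λ t j → w t * g t j))
    (∑-cong n (λ t _ → conv-*ʳ s (w t) f (g t)))

  -- The sum of the summand for k = κ + 1 over all n with N₁ = s, without the power of q that belongs to N₁
  -- and without (-q)_{N₁+ℓ}. Each step of the recursion sums over N₂ = j, with n₁ = s - j.
  β : (c i κ s : ℕ) → Carrier
  β c i zero    s = kernel c 0 s
  β c i (suc κ) s = conv rr (λ j → q ^ weight c i κ j * β c i κ j) s

  -- The differences of q ^ (t² + c t) kernel c t s in t are the q ^ (t² + c t) kernel′ c t s.
  kernel-telescope : ∀ c s n → kernel c 0 s
    ≈ ∑ n (λ t → q ^ (t ℕ.* t ℕ.+ c ℕ.* t) * kernel′ c t s) + q ^ (n ℕ.* n ℕ.+ c ℕ.* n) * kernel c n s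
  kernel-telescope c s zero = sym (trans (+-identityˡ _)
    (trans (*-congʳ (^-≡ q (ℕₚ.*-zeroʳ c))) (*-identityˡ (kernel c 0 s))))
  kernel-telescope c s (suc n) = begin
    kernel c 0 s
      ≈⟨ kernel-telescope c s n ⟩
    S + w * kernel c n s
      ≈⟨ solve 5 (λ S w k x l → S :+ w :* k := S :+ w :* (k :- x :* l) :+ w :* x :* l) refl
           S w (kernel c n s) (q ^ suc (n ℕ.+ n ℕ.+ c)) (kernel c (suc n) s) ⟩
    S + w * kernel′ c n s + w * q ^ suc (n ℕ.+ n ℕ.+ c) * kernel c (suc n) s
      ≈⟨ +-congˡ (*-congʳ (trans (sym (^-+ q (n ℕ.* n ℕ.+ c ℕ.* n) (suc (n ℕ.+ n ℕ.+ c)))) (^-≡ q (exponent n c)))) ⟩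
    S + w * kernel′ c n s + q ^ (suc n ℕ.* suc n ℕ.+ c ℕ.* suc n) * kernel c (suc n) s ∎
    where
    S = ∑ n (λ t → q ^ (t ℕ.* t ℕ.+ c ℕ.* t) * kernel′ c t s)
    w = q ^ (n ℕ.* n ℕ.+ c ℕ.* n)
    exponent : ∀ n c → n ℕ.* n ℕ.+ c ℕ.* n ℕ.+ suc (n ℕ.+ n ℕ.+ c) ≡ suc n ℕ.* suc n ℕ.+ c ℕ.* suc n
    exponent = solve-∀

  -- The Bailey lemma for the other base.
  conv-kernel′ : ∀ c t s →
    conv rr (λ j → q ^ (j ℕ.* j ℕ.+ c ℕ.* j ℕ.+ 1 ℕ.* j) * kernel′ c t j) s
      ≈ q ^ (t ℕ.* t ℕ.+ c ℕ.* t ℕ.+ 1 ℕ.* t) * kernel′ c t s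
  conv-kernel′ c t s = begin
    conv rr (λ j → q ^ (E j ℕ.+ 1 ℕ.* j) * kernel′ c t j) s
      ≈⟨ conv-congʳ s (λ j _ → pointwise j) ⟩
    conv rr (λ j → q ^ t * (q ^ E j * kernel c t j - q ^ E j * kernel c (suc t) j)) s
      ≈⟨ trans (conv-*ʳ s (q ^ t) rr _) (*-congˡ (conv--ʳ s rr _ _)) ⟩
    q ^ t * (conv rr (λ j → q ^ E j * kernel c t j) s - conv rr (λ j → q ^ E j * kernel c (suc t) j) s)
      ≈⟨ *-congˡ (+-cong (conv-kernel c t s) (-‿cong (conv-kernel c (suc t) s))) ⟩
    q ^ t * (q ^ E t * kernel c t s - q ^ E (suc t) * kernel c (suc t) s)
      ≈⟨ *-congˡ (+-congˡ (-‿cong (*-congʳ (trans (^-≡ q (exponent t c)) (^-+ q (E t) _))))) ⟩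
    q ^ t * (q ^ E t * kernel c t s - q ^ E t * q ^ suc (t ℕ.+ t ℕ.+ c) * kernel c (suc t) s)
      ≈⟨ solve 5 (λ a b k x l → a :* (b :* k :- b :* x :* l) := b :* a :* (k :- x :* l)) refl
           (q ^ t) (q ^ E t) (kernel c t s) (q ^ suc (t ℕ.+ t ℕ.+ c)) (kernel c (suc t) s) ⟩
    q ^ E t * q ^ t * kernel′ c t s
      ≈⟨ *-congʳ (trans (sym (^-+ q (E t) t)) (^-≡ q (cong (E t ℕ.+_) (≡.sym (ℕₚ.*-identityˡ t))))) ⟩
    q ^ (E t ℕ.+ 1 ℕ.* t) * kernel′ c t s ∎
    where
    E : ℕ → ℕ
    E j = j ℕ.* j ℕ.+ c ℕ.* j
    exponent : ∀ n c → suc n ℕ.* suc n ℕ.+ c ℕ.* suc n ≡ n ℕ.* n ℕ.+ c ℕ.* n ℕ.+ suc (n ℕ.+ n ℕ.+ c)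
    exponent = solve-∀
    pointwise : ∀ j → q ^ (E j ℕ.+ 1 ℕ.* j) * kernel′ c t j
      ≈ q ^ t * (q ^ E j * kernel c t j - q ^ E j * kernel c (suc t) j)
    pointwise j = begin
      q ^ (E j ℕ.+ 1 ℕ.* j) * kernel′ c t j
        ≈⟨ *-congʳ (trans (^-≡ q (cong (E j ℕ.+_) (ℕₚ.*-identityˡ j))) (^-+ q (E j) j)) ⟩
      q ^ E j * q ^ j * kernel′ c t j
        ≈⟨ *-assoc _ _ _ ⟩
      q ^ E j * (q ^ j * kernel′ c t j)
        ≈⟨ *-congˡ (kernel′-shift c t j) ⟩
      q ^ E j * (q ^ t * (kernel c t j - kernel c (suc t) j))
        ≈⟨ solve 4 (λ a b k l → a :* (b :* (k :- l)) := b :* (a :* k :- a :* l)) refl (q ^ E j) (q ^ t) (kernel c t j) (kernel c (suc t) j) ⟩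
      q ^ t * (q ^ E j * kernel c t j - q ^ E j * kernel c (suc t) j) ∎

  -- The first i steps of the chain have the linear term (c + 1) N_j, and preserve kernel′.
  β-low : ∀ c i κ → κ ≤ i → ∀ n s → s < n →
    β c i κ s ≈ ∑ n (λ t → q ^ (suc κ ℕ.* (t ℕ.* t ℕ.+ c ℕ.* t) ℕ.+ κ ℕ.* t) * kernel′ c t s)
  β-low c i zero _ n s s<n = begin
    kernel c 0 s
      ≈⟨ kernel-telescope c s n ⟩
    ∑ n (λ t → q ^ (t ℕ.* t ℕ.+ c ℕ.* t) * kernel′ c t s) + q ^ (n ℕ.* n ℕ.+ c ℕ.* n) * kernel c n s
      ≈⟨ trans (+-congˡ (trans (*-congˡ (kernel-vanish c s<n)) (zeroʳ _))) (+-identityʳ _) ⟩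
    ∑ n (λ t → q ^ (t ℕ.* t ℕ.+ c ℕ.* t) * kernel′ c t s)
      ≈⟨ ∑-cong n (λ t _ → *-congʳ (^-≡ q (exponent (t ℕ.* t ℕ.+ c ℕ.* t) t))) ⟩
    ∑ n (λ t → q ^ (1 ℕ.* (t ℕ.* t ℕ.+ c ℕ.* t) ℕ.+ 0 ℕ.* t) * kernel′ c t s) ∎
    where
    exponent : ∀ x t → x ≡ 1 ℕ.* x ℕ.+ 0 ℕ.* t
    exponent = solve-∀
  β-low c i (suc κ) κ<i n s s<n = begin
    conv rr (λ j → q ^ weight c i κ j * β c i κ j) s
      ≈⟨ conv-congʳ s (λ j j≤s → *-cong (^-≡ q (cong (λ b → E j ℕ.+ b ℕ.* j) (bump-< κ<i)))
           (β-low c i κ (ℕₚ.<⇒≤ κ<i) n j (ℕₚ.≤-<-trans j≤s s<n))) ⟩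
    conv rr (λ j → q ^ (E j ℕ.+ 1 ℕ.* j) * ∑ n (λ t → q ^ X κ t * kernel′ c t j)) s
      ≈⟨ conv-congʳ s (λ j _ → trans (sym (∑-* n _ _)) (∑-cong n (λ t _ →
           solve 3 (λ a b d → a :* (b :* d) := b :* (a :* d)) refl (q ^ (E j ℕ.+ 1 ℕ.* j)) (q ^ X κ t) (kernel′ c t j)))) ⟩
    conv rr (λ j → ∑ n (λ t → q ^ X κ t * (q ^ (E j ℕ.+ 1 ℕ.* j) * kernel′ c t j))) s
      ≈⟨ ∑-conv n s rr _ _ ⟩
    ∑ n (λ t → q ^ X κ t * conv rr (λ j → q ^ (E j ℕ.+ 1 ℕ.* j) * kernel′ c t j) s)
      ≈⟨ ∑-cong n (λ t _ → trans (*-congˡ (conv-kernel′ c t s)) (merge (X κ t) (E t ℕ.+ 1 ℕ.* t) _ (exponent κ (E t) t))) ⟩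
    ∑ n (λ t → q ^ X (suc κ) t * kernel′ c t s) ∎
    where
    E : ℕ → ℕ
    E j = j ℕ.* j ℕ.+ c ℕ.* j
    X : ℕ → ℕ → ℕ
    X κ t = suc κ ℕ.* E t ℕ.+ κ ℕ.* t
    exponent : ∀ κ e t → suc κ ℕ.* e ℕ.+ κ ℕ.* t ℕ.+ (e ℕ.+ 1 ℕ.* t) ≡ suc (suc κ) ℕ.* e ℕ.+ suc κ ℕ.* t
    exponent = solve-∀

  -- In the later steps the linear term is c N_j, and the two parts of kernel′ evolve separately.
  β-high : ∀ c i j n s → s < n → β c i (j ℕ.+ i) s ≈ ∑ n (λ t →
    q ^ (suc i ℕ.* (t ℕ.* t ℕ.+ c ℕ.* t) ℕ.+ i ℕ.* t) *
      (q ^ (j ℕ.* (t ℕ.* t ℕ.+ c ℕ.* t)) * kernel c t s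
       - q ^ (suc (t ℕ.+ t ℕ.+ c) ℕ.+ j ℕ.* (suc t ℕ.* suc t ℕ.+ c ℕ.* suc t)) * kernel c (suc t) s))
  β-high c i zero n s s<n = trans (β-low c i i ℕₚ.≤-refl n s s<n)
    (∑-cong n (λ t _ → *-congˡ (+-cong (sym (*-identityˡ _))
      (-‿cong (*-congʳ (^-≡ q (≡.sym (ℕₚ.+-identityʳ (suc (t ℕ.+ t ℕ.+ c))))))))))
  β-high c i (suc j) n s s<n = begin
    conv rr (λ d → q ^ weight c i (j ℕ.+ i) d * β c i (j ℕ.+ i) d) s
      ≈⟨ conv-congʳ s (λ d d≤s → *-cong
           (^-≡ q (≡.trans (cong (λ b → E d ℕ.+ b ℕ.* d) (bump-≥ (ℕₚ.m≤n+m i j))) (ℕₚ.+-identityʳ (E d))))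
           (β-high c i j n d (ℕₚ.≤-<-trans d≤s s<n))) ⟩
    conv rr (λ d → q ^ E d * ∑ n (λ t → X t * (Y j t * kernel c t d - Z j t * kernel c (suc t) d))) s
      ≈⟨ conv-congʳ s (λ d _ → trans (sym (∑-* n _ _)) (∑-cong n (λ t _ →
           solve 6 (λ e x y z k l → e :* (x :* (y :* k :- z :* l)) := x :* (y :* (e :* k) :- z :* (e :* l))) refl
             (q ^ E d) (X t) (Y j t) (Z j t) (kernel c t d) (kernel c (suc t) d)))) ⟩
    conv rr (λ d → ∑ n (λ t → X t * (Y j t * (q ^ E d * kernel c t d) - Z j t * (q ^ E d * kernel c (suc t) d)))) s
      ≈⟨ ∑-conv n s rr _ _ ⟩
    ∑ n (λ t → X t * conv rr (λ d → Y j t * (q ^ E d * kernel c t d) - Z j t * (q ^ E d * kernel c (suc t) d)) s)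
      ≈⟨ ∑-cong n (λ t _ → *-congˡ (trans (conv--ʳ s rr _ _) (+-cong
           (trans (conv-*ʳ s (Y j t) rr _) (trans (*-congˡ (conv-kernel c t s))
             (merge (j ℕ.* E t) (E t) _ (ℕₚ.+-comm (j ℕ.* E t) (E t)))))
           (-‿cong (trans (conv-*ʳ s (Z j t) rr _) (trans (*-congˡ (conv-kernel c (suc t) s))
             (merge (suc (t ℕ.+ t ℕ.+ c) ℕ.+ j ℕ.* E (suc t)) (E (suc t)) _ (exponent (suc (t ℕ.+ t ℕ.+ c)) j (E (suc t)))))))))) ⟩
    ∑ n (λ t → X t * (Y (suc j) t * kernel c t s - Z (suc j) t * kernel c (suc t) s)) ∎
    where
    E : ℕ → ℕ
    E j = j ℕ.* j ℕ.+ c ℕ.* j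
    X : ℕ → Carrier
    X t = q ^ (suc i ℕ.* E t ℕ.+ i ℕ.* t)
    Y Z : ℕ → ℕ → Carrier
    Y j t = q ^ (j ℕ.* E t)
    Z j t = q ^ (suc (t ℕ.+ t ℕ.+ c) ℕ.+ j ℕ.* E (suc t))
    exponent : ∀ a j e → a ℕ.+ j ℕ.* e ℕ.+ e ≡ a ℕ.+ suc j ℕ.* e
    exponent = solve-∀

  -- The sum of the summand over all n with N₁ = s; here κ = k - 1, ℓ = p and c = 2 p.
  levelSum : (p c i κ s : ℕ) → Carrier
  levelSum p c i κ s = q ^ (tri s ℕ.+ p ℕ.* s ℕ.+ bump i κ ℕ.* s) * (poch⁺ (p ℕ.+ s) * β c i κ s)

  -- The exponents on the left at n = p + t and at n = - p - 1 - t, the latter after the factor 1 + q ^ n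
  -- is replaced by 1 + q ^ (- n); here j = k - i.
  exponent⁺ exponent⁻ : (p c j i t : ℕ) → ℕ
  exponent⁺ p c j i t = (j ℕ.+ i) ℕ.* (t ℕ.* t ℕ.+ c ℕ.* t) ℕ.+ i ℕ.* t ℕ.+ (tri t ℕ.+ p ℕ.* t)
  exponent⁻ p c j i t = (j ℕ.* suc t ℕ.+ i ℕ.* t) ℕ.* (suc t ℕ.+ c) ℕ.+ (tri (suc t) ℕ.+ p ℕ.* suc t)

  -- The summands on the left at n = p + t and at n = - p - 1 - t.
  theta⁺ theta⁻ : (p c j i t : ℕ) → Carrier
  theta⁺ p c j i t = q ^ exponent⁺ p c j i t * (1# + q ^ (p ℕ.+ t))
  theta⁻ p c j i t = q ^ exponent⁻ p c j i t * (1# + q ^ (p ℕ.+ suc t))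

  -- The last step of the chain, for any family a whose expansion in the kernels is known.
  conv-expansion : ∀ p c → c ≡ p ℕ.+ p → ∀ s m → p ℕ.+ s ≡ suc m → (X Y Z e⁺ e⁻ : ℕ → ℕ) (a : ℕ → Carrier) →
    (∀ t → X t ℕ.+ Y t ℕ.+ (tri t ℕ.+ p ℕ.* t) ≡ e⁺ t) →
    (∀ t → X t ℕ.+ Z t ℕ.+ (tri (suc t) ℕ.+ p ℕ.* suc t) ≡ e⁻ t) →
    (∀ d → d < suc s → a d ≈ ∑ (suc s) (λ t → q ^ X t *
      (q ^ Y t * (q ^ (tri d ℕ.+ p ℕ.* d) * (poch⁺ (p ℕ.+ d) * kernel c t d))
       - q ^ Z t * (q ^ (tri d ℕ.+ p ℕ.* d) * (poch⁺ (p ℕ.+ d) * kernel c (suc t) d))))) →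
    conv rr a s ≈ poch⁺ m * ∑ (suc s) (λ t →
      q ^ e⁺ t * (1# + q ^ (p ℕ.+ t)) * kernel c t s - q ^ e⁻ t * (1# + q ^ (p ℕ.+ suc t)) * kernel c (suc t) s)
  conv-expansion p c c≡ s m e X Y Z e⁺ e⁻ a E⁺ E⁻ expansion = begin
    conv rr a s
      ≈⟨ conv-congʳ s (λ d d≤s → expansion d (s≤s d≤s)) ⟩
    conv rr (λ d → ∑ (suc s) (λ t → q ^ X t * (q ^ Y t * W t d - q ^ Z t * W (suc t) d))) s
      ≈⟨ ∑-conv (suc s) s rr _ _ ⟩
    ∑ (suc s) (λ t → q ^ X t * conv rr (λ d → q ^ Y t * W t d - q ^ Z t * W (suc t) d) s)
      ≈⟨ ∑-cong (suc s) (λ t _ → *-congˡ (trans (conv--ʳ s rr _ _) (+-cong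
           (trans (conv-*ʳ s (q ^ Y t) rr _) (*-congˡ (conv-kernel⁺ p c c≡ t s m e)))
           (-‿cong (trans (conv-*ʳ s (q ^ Z t) rr _) (*-congˡ (conv-kernel⁺ p c c≡ (suc t) s m e))))))) ⟩
    ∑ (suc s) (λ t → q ^ X t * (q ^ Y t * V t - q ^ Z t * V (suc t)))
      ≈⟨ ∑-cong (suc s) (λ t _ → trans (solve 3 (λ a b c → a :* (b :- c) := a :* b :- a :* c) refl _ _ _)
           (trans (+-cong (collect (X t) (Y t) _ (U t) (kernel c t s) (E⁺ t))
                    (-‿cong (collect (X t) (Z t) _ (U (suc t)) (kernel c (suc t) s) (E⁻ t))))
             (solve 3 (λ a b c → a :* b :- a :* c := a :* (b :- c)) refl _ _ _))) ⟩
    ∑ (suc s) (λ t → poch⁺ m * (q ^ e⁺ t * U t * kernel c t s - q ^ e⁻ t * U (suc t) * kernel c (suc t) s))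
      ≈⟨ ∑-* (suc s) (poch⁺ m) _ ⟩
    poch⁺ m * ∑ (suc s) (λ t → q ^ e⁺ t * U t * kernel c t s - q ^ e⁻ t * U (suc t) * kernel c (suc t) s) ∎
    where
    W : ℕ → ℕ → Carrier
    W t d = q ^ (tri d ℕ.+ p ℕ.* d) * (poch⁺ (p ℕ.+ d) * kernel c t d)
    U V : ℕ → Carrier
    U t = 1# + q ^ (p ℕ.+ t)
    V t = poch⁺ m * (q ^ (tri t ℕ.+ p ℕ.* t) * U t * kernel c t s)
    collect : ∀ a b v x k {n} → a ℕ.+ b ℕ.+ v ≡ n →
      q ^ a * (q ^ b * (poch⁺ m * (q ^ v * x * k))) ≈ poch⁺ m * (q ^ n * x * k)
    collect a b v x k e = trans
      (solve 6 (λ a b P v x k → a :* (b :* (P :* (v :* x :* k))) := P :* (a :* b :* v :* x :* k)) refl (q ^ a) (q ^ b) (poch⁺ m) (q ^ v) x k)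
      (*-congˡ (*-congʳ (*-congʳ (trans (*-congʳ (sym (^-+ q a b))) (trans (sym (^-+ q (a ℕ.+ b) v)) (^-≡ q e))))))

  -- The finite form of the identity: the summands with N₁ ≤ s, weighted by 1/(q)_{s-N₁}, on the one side,
  -- and the theta series weighted by the kernel on the other. For i = k the factor q ^ N₁ turns kernel′
  -- into a difference of two kernels.
  finite-identity : ∀ p c → c ≡ p ℕ.+ p → ∀ j i κ → j ℕ.+ i ≡ suc κ → ∀ s m → p ℕ.+ s ≡ suc m →
    conv rr (levelSum p c i κ) s ≈ poch⁺ m * ∑ (suc s) (λ t →
      theta⁺ p c j i t * kernel c t s - theta⁻ p c j i t * kernel c (suc t) s)
  finite-identity p c c≡ zero _ κ ≡.refl s m e = conv-expansion p c c≡ s m e (λ t → X t ℕ.+ t) (λ _ → 0) (λ _ → 0) _ _ _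
    (λ t → exponents⁺ κ (t ℕ.* t ℕ.+ c ℕ.* t) t _) (λ t → exponents⁻ κ t c _)
    λ d d<n → begin
      q ^ (tri d ℕ.+ p ℕ.* d ℕ.+ bump (suc κ) κ ℕ.* d) * (poch⁺ (p ℕ.+ d) * β c (suc κ) κ d)
        ≈⟨ *-cong (trans (^-≡ q (≡.trans (cong (λ b → tri d ℕ.+ p ℕ.* d ℕ.+ b ℕ.* d) (bump-< (ℕₚ.n<1+n κ)))
             (cong (tri d ℕ.+ p ℕ.* d ℕ.+_) (ℕₚ.*-identityˡ d)))) (^-+ q (tri d ℕ.+ p ℕ.* d) d))
             (*-congˡ (β-low c (suc κ) κ (ℕₚ.n≤1+n κ) (suc s) d d<n)) ⟩
      W d * q ^ d * (poch⁺ (p ℕ.+ d) * ∑ (suc s) (λ t → q ^ X t * kernel′ c t d))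
        ≈⟨ trans (sym (*-assoc _ _ _)) (sym (∑-* (suc s) _ _)) ⟩
      ∑ (suc s) (λ t → W d * q ^ d * poch⁺ (p ℕ.+ d) * (q ^ X t * kernel′ c t d))
        ≈⟨ ∑-cong (suc s) (λ t _ → begin
             W d * q ^ d * poch⁺ (p ℕ.+ d) * (q ^ X t * kernel′ c t d)
               ≈⟨ solve 5 (λ w a P x k → w :* a :* P :* (x :* k) := x :* (w :* P :* (a :* k))) refl _ _ _ _ _ ⟩
             q ^ X t * (W d * poch⁺ (p ℕ.+ d) * (q ^ d * kernel′ c t d))
               ≈⟨ *-congˡ (*-congˡ (kernel′-shift c t d)) ⟩
             q ^ X t * (W d * poch⁺ (p ℕ.+ d) * (q ^ t * (kernel c t d - kernel c (suc t) d)))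
               ≈⟨ solve 6 (λ x w P a k l → x :* (w :* P :* (a :* (k :- l)))
                    := x :* a :* (con (+ 1) :* (w :* (P :* k)) :- con (+ 1) :* (w :* (P :* l)))) refl _ _ _ _ _ _ ⟩
             q ^ X t * q ^ t * (1# * (W d * (poch⁺ (p ℕ.+ d) * kernel c t d)) - 1# * (W d * (poch⁺ (p ℕ.+ d) * kernel c (suc t) d)))
               ≈⟨ *-congʳ (^-+ q (X t) t) ⟨
             q ^ (X t ℕ.+ t) * (1# * (W d * (poch⁺ (p ℕ.+ d) * kernel c t d)) - 1# * (W d * (poch⁺ (p ℕ.+ d) * kernel c (suc t) d))) ∎) ⟩
      _ ∎
    where
    X : ℕ → ℕ
    X t = suc κ ℕ.* (t ℕ.* t ℕ.+ c ℕ.* t) ℕ.+ κ ℕ.* t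
    W : ℕ → Carrier
    W d = q ^ (tri d ℕ.+ p ℕ.* d)
    exponents⁺ : ∀ κ e t v → suc κ ℕ.* e ℕ.+ κ ℕ.* t ℕ.+ t ℕ.+ 0 ℕ.+ v ≡ (0 ℕ.+ suc κ) ℕ.* e ℕ.+ suc κ ℕ.* t ℕ.+ v
    exponents⁺ = solve-∀
    exponents⁻ : ∀ κ t c v → suc κ ℕ.* (t ℕ.* t ℕ.+ c ℕ.* t) ℕ.+ κ ℕ.* t ℕ.+ t ℕ.+ 0 ℕ.+ v
      ≡ (0 ℕ.* suc t ℕ.+ suc κ ℕ.* t) ℕ.* (suc t ℕ.+ c) ℕ.+ v
    exponents⁻ = solve-∀
  finite-identity p c c≡ (suc j) i _ ≡.refl s m e = conv-expansion p c c≡ s m e X _ _ _ _ _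
    (λ t → exponents⁺ i j (t ℕ.* t ℕ.+ c ℕ.* t) t _) (λ t → exponents⁻ i j t c _)
    λ d d<n → begin
      q ^ (tri d ℕ.+ p ℕ.* d ℕ.+ bump i (j ℕ.+ i) ℕ.* d) * (poch⁺ (p ℕ.+ d) * β c i (j ℕ.+ i) d)
        ≈⟨ *-cong (^-≡ q (≡.trans (cong (λ b → tri d ℕ.+ p ℕ.* d ℕ.+ b ℕ.* d) (bump-≥ (ℕₚ.m≤n+m i j)))
             (ℕₚ.+-identityʳ (tri d ℕ.+ p ℕ.* d))))
             (*-congˡ (β-high c i j (suc s) d d<n)) ⟩
      W d * (poch⁺ (p ℕ.+ d) * ∑ (suc s) (λ t → q ^ X t * (q ^ Y t * kernel c t d - q ^ Z t * kernel c (suc t) d)))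
        ≈⟨ trans (sym (*-assoc _ _ _)) (sym (∑-* (suc s) _ _)) ⟩
      ∑ (suc s) (λ t → W d * poch⁺ (p ℕ.+ d) * (q ^ X t * (q ^ Y t * kernel c t d - q ^ Z t * kernel c (suc t) d)))
        ≈⟨ ∑-cong (suc s) (λ t _ →
             solve 7 (λ w P x y z k l → w :* P :* (x :* (y :* k :- z :* l)) := x :* (y :* (w :* (P :* k)) :- z :* (w :* (P :* l))))
               refl _ _ _ _ _ _ _) ⟩
      _ ∎
    where
    X Y Z : ℕ → ℕ
    X t = suc i ℕ.* (t ℕ.* t ℕ.+ c ℕ.* t) ℕ.+ i ℕ.* t
    Y t = j ℕ.* (t ℕ.* t ℕ.+ c ℕ.* t)
    Z t = suc (t ℕ.+ t ℕ.+ c) ℕ.+ j ℕ.* (suc t ℕ.* suc t ℕ.+ c ℕ.* suc t)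
    W : ℕ → Carrier
    W d = q ^ (tri d ℕ.+ p ℕ.* d)
    exponents⁺ : ∀ i j e t v → suc i ℕ.* e ℕ.+ i ℕ.* t ℕ.+ j ℕ.* e ℕ.+ v ≡ (suc j ℕ.+ i) ℕ.* e ℕ.+ i ℕ.* t ℕ.+ v
    exponents⁺ = solve-∀
    exponents⁻ : ∀ i j t c v → suc i ℕ.* (t ℕ.* t ℕ.+ c ℕ.* t) ℕ.+ i ℕ.* t
        ℕ.+ (suc (t ℕ.+ t ℕ.+ c) ℕ.+ j ℕ.* (suc t ℕ.* suc t ℕ.+ c ℕ.* suc t)) ℕ.+ v
      ≡ (suc j ℕ.* suc t ℕ.+ i ℕ.* t) ℕ.* (suc t ℕ.+ c) ℕ.+ v
    exponents⁻ = solve-∀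

-- Rational estimates

module RationalEstimates where
  open import Data.Rational using (_/_; _+_; _*_; _-_; -_) renaming (_≤_ to _≤q_; _<_ to _<q_)
  open Estimates public using (half-pos; halves; unit-fraction; unit-fraction-pos; archimedean; toℚᵘ-/; *-mono-nonNeg)
  open RealArithmetic using (modulus; modulus-pos; modulus-*)
  open +-*-Solver using (solve; _:+_; _:*_; _:-_; :-_; _:=_; con)
  open FiniteSum ℚₚ.+-*-commutativeRing public using () renaming (_^_ to _^ℚ_; ∑ to ∑ℚ; ∑-* to ∑ℚ-*)

  -- The integers inside the rationals.
  fromℤ-+ : ∀ i j → fromℤ (i ℤ.+ j) ≡ fromℤ i + fromℤ j
  fromℤ-+ i j = ℚₚ.toℚᵘ-injective (ℚᵘₚ.≃-trans
    (ℚᵘ.*≡* (cong (ℤ._* + 1) (cong₂ ℤ._+_ (≡.sym (ℤₚ.*-identityʳ i)) (≡.sym (ℤₚ.*-identityʳ j)))))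
    (ℚᵘₚ.≃-sym (ℚₚ.toℚᵘ-homo-+ (fromℤ i) (fromℤ j))))

  fromℤ-* : ∀ i j → fromℤ (i ℤ.* j) ≡ fromℤ i * fromℤ j
  fromℤ-* i j = ℚₚ.toℚᵘ-injective (ℚᵘₚ.≃-sym (ℚₚ.toℚᵘ-homo-* (fromℤ i) (fromℤ j)))

  fromℤ-neg : ∀ i → fromℤ (ℤ.- i) ≡ - fromℤ i
  fromℤ-neg i = ℚₚ.toℚᵘ-injective (ℚᵘₚ.≃-trans
    (ℚᵘ.*≡* ≡.refl) (ℚᵘₚ.≃-sym (ℚₚ.toℚᵘ-homo‿- (fromℤ i))))

  /-as-* : ∀ i n → i / suc n ≡ fromℤ i * unit-fraction n
  /-as-* i n = ℚₚ.toℚᵘ-injective (ℚᵘₚ.≃-trans (toℚᵘ-/ i n) (ℚᵘₚ.≃-sym (ℚᵘₚ.≃-trans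
    (ℚₚ.toℚᵘ-homo-* (fromℤ i) (unit-fraction n))
    (ℚᵘₚ.≃-trans (ℚᵘₚ.*-congˡ {ℚ.toℚᵘ (fromℤ i)} (toℚᵘ-/ (+ 1) n))
      (ℚᵘ.*≡* (cong₂ ℤ._*_ (ℤₚ.*-identityʳ i) (cong +_ (≡.sym (ℕₚ.+-identityʳ (suc n))))))))))

  unit-fraction-inverse : ∀ n → fromℤ (+ suc n) * unit-fraction n ≡ 1ℚ
  unit-fraction-inverse n = ≡.trans (≡.sym (/-as-* (+ suc n) n))
    (ℚₚ.toℚᵘ-injective (ℚᵘₚ.≃-trans (toℚᵘ-/ (+ suc n) n)
      (ℚᵘ.*≡* (ℤₚ.*-comm (+ suc n) (+ 1)))))

  0≤1 : 0ℚ ≤q 1ℚ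
  0≤1 = ℚₚ.nonNegative⁻¹ 1ℚ

  0≤½ : 0ℚ ≤q ½
  0≤½ = ℚₚ.nonNegative⁻¹ ½

  2ℚ : ℚ
  2ℚ = 1ℚ + 1ℚ

  0≤+ : ∀ {x y} → 0ℚ ≤q x → 0ℚ ≤q y → 0ℚ ≤q x + y
  0≤+ = ℚₚ.+-mono-≤

  0≤2 : 0ℚ ≤q 2ℚ
  0≤2 = 0≤+ 0≤1 0≤1

  0≤* : ∀ {x y} → 0ℚ ≤q x → 0ℚ ≤q y → 0ℚ ≤q x * y
  0≤* {x} {y} p r = subst (_≤q x * y) (ℚₚ.*-zeroˡ y) (ℚₚ.*-monoʳ-≤-nonNeg y {{ℚ.nonNegative r}} p)

  0<* : ∀ {x y} → 0ℚ <q x → 0ℚ <q y → 0ℚ <q x * y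
  0<* {x} {y} p r = subst (_<q x * y) (ℚₚ.*-zeroˡ y) (ℚₚ.*-monoˡ-<-pos y {{ℚ.positive r}} p)

  -- An inequality is certified by a nonnegative expression for the difference.
  ≤-by : ∀ {x y} e → 0ℚ ≤q e → y ≡ x + e → x ≤q y
  ≤-by {x} e 0≤e eq = subst₂ _≤q_ (ℚₚ.+-identityʳ x) (≡.sym eq) (ℚₚ.+-monoʳ-≤ x 0≤e)

  0≤- : ∀ {x y} → x ≤q y → 0ℚ ≤q y - x
  0≤- {x} {y} p = subst (_≤q y - x) (ℚₚ.+-inverseʳ x) (ℚₚ.+-monoˡ-≤ (- x) p)

  0<- : ∀ {x y} → x <q y → 0ℚ <q y - x
  0<- {x} {y} p = subst (_<q y - x) (ℚₚ.+-inverseʳ x) (ℚₚ.+-monoˡ-< (- x) p)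

  *-monoˡ : ∀ {c x y} → 0ℚ ≤q c → x ≤q y → c * x ≤q c * y
  *-monoˡ {c} p = ℚₚ.*-monoˡ-≤-nonNeg c {{ℚ.nonNegative p}}

  *-monoʳ : ∀ {c x y} → 0ℚ ≤q c → x ≤q y → x * c ≤q y * c
  *-monoʳ {c} p = ℚₚ.*-monoʳ-≤-nonNeg c {{ℚ.nonNegative p}}

  -- A tolerance that stays below ε after multiplication by B.
  shrink : ∀ {ε} B → 0ℚ <q ε → 0ℚ ≤q B → ∃[ δ ] (0ℚ <q δ × δ * B ≤q ε)
  shrink {ε} B ε>0 B≥0 = δ , modulus-pos ε>0 B+1>0 ,
    ≤-by (½ * ε + δ) (0≤+ (ℚₚ.<⇒≤ (half-pos ε>0)) (ℚₚ.<⇒≤ (modulus-pos ε>0 B+1>0)))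
      (≡.trans (≡.sym (halves ε)) (≡.trans (cong (_+ ½ * ε) (≡.sym (modulus-* ε>0 B+1>0)))
        (solve 3 (λ d b e → d :* (b :+ con 1ℚ) :+ e := d :* b :+ (e :+ d)) ≡.refl δ B (½ * ε))))
    where
    B+1>0 : 0ℚ <q B + 1ℚ
    B+1>0 = ℚₚ.+-mono-≤-< B≥0 (ℚₚ.positive⁻¹ 1ℚ)
    δ = modulus ε>0 B+1>0

  ^-nonneg : ∀ {x} → 0ℚ ≤q x → ∀ n → 0ℚ ≤q x ^ℚ n
  ^-nonneg p zero    = 0≤1
  ^-nonneg p (suc n) = 0≤* (^-nonneg p n) p

  ^-≤-suc : ∀ {x} → 0ℚ ≤q x → x ≤q 1ℚ → ∀ n → x ^ℚ suc n ≤q x ^ℚ n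
  ^-≤-suc {x} p l n = subst (x ^ℚ n * x ≤q_) (ℚₚ.*-identityʳ (x ^ℚ n)) (*-monoˡ (^-nonneg p n) l)

  ^-antitone : ∀ {x} → 0ℚ ≤q x → x ≤q 1ℚ → ∀ {m n} → m ℕ.≤ n → x ^ℚ n ≤q x ^ℚ m
  ^-antitone {x} p l {m} {n} m≤n = subst (λ k → x ^ℚ k ≤q x ^ℚ m) (ℕₚ.m∸n+n≡m m≤n) (go (n ℕ.∸ m))
    where
    go : ∀ d → x ^ℚ (d ℕ.+ m) ≤q x ^ℚ m
    go zero    = ℚₚ.≤-refl
    go (suc d) = ℚₚ.≤-trans (^-≤-suc p l (d ℕ.+ m)) (go d)

  ^-≤1 : ∀ {x} → 0ℚ ≤q x → x ≤q 1ℚ → ∀ n → x ^ℚ n ≤q 1ℚ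
  ^-≤1 p l n = ^-antitone p l {0} {n} z≤n

  geometric-sum : ∀ x n → (1ℚ - x) * ∑ℚ n (x ^ℚ_) ≡ 1ℚ - x ^ℚ n
  geometric-sum x zero    = ℚₚ.*-zeroʳ (1ℚ - x)
  geometric-sum x (suc n) = ≡.trans (ℚₚ.*-distribˡ-+ (1ℚ - x) (∑ℚ n (x ^ℚ_)) (x ^ℚ n))
    (≡.trans (cong (_+ (1ℚ - x) * x ^ℚ n) (geometric-sum x n))
      (solve 2 (λ x y → con 1ℚ :- y :+ (con 1ℚ :- x) :* y := con 1ℚ :- y :* x) ≡.refl x (x ^ℚ n)))

  -- A number x with 0 ≤ x < 1, and the sum γ of its geometric series.
  module Ratio (x : ℚ) (x≥0 : 0ℚ ≤q x) (x<1 : x <q 1ℚ) where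

    private instance
      1-x-pos : ℚ.Positive (1ℚ - x)
      1-x-pos = ℚ.positive (0<- x<1)
      1-x-nonZero : ℚ.NonZero (1ℚ - x)
      1-x-nonZero = ℚₚ.pos⇒nonZero (1ℚ - x)

    x≤1 : x ≤q 1ℚ
    x≤1 = ℚₚ.<⇒≤ x<1

    γ : ℚ
    γ = ℚ.1/ (1ℚ - x)

    γ≥0 : 0ℚ ≤q γ
    γ≥0 = ℚₚ.<⇒≤ (ℚₚ.positive⁻¹ γ {{ℚₚ.1/pos⇒pos (1ℚ - x)}})

    γ-inverse : γ * (1ℚ - x) ≡ 1ℚ
    γ-inverse = ℚₚ.*-inverseˡ (1ℚ - x)

    powers-sum : ∀ n → ∑ℚ n (x ^ℚ_) ≤q γ
    powers-sum n = ≤-by (γ * x ^ℚ n) (0≤* γ≥0 (^-nonneg x≥0 n)) (≡.sym (begin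
      ∑ℚ n (x ^ℚ_) + γ * x ^ℚ n                  ≡⟨ cong (_+ γ * x ^ℚ n) (≡.sym (≡.trans (cong (_* ∑ℚ n (x ^ℚ_)) γ-inverse) (ℚₚ.*-identityˡ (∑ℚ n (x ^ℚ_))))) ⟩
      γ * (1ℚ - x) * ∑ℚ n (x ^ℚ_) + γ * x ^ℚ n   ≡⟨ cong (_+ γ * x ^ℚ n) (ℚₚ.*-assoc γ (1ℚ - x) (∑ℚ n (x ^ℚ_))) ⟩
      γ * ((1ℚ - x) * ∑ℚ n (x ^ℚ_)) + γ * x ^ℚ n ≡⟨ cong (λ w → γ * w + γ * x ^ℚ n) (geometric-sum x n) ⟩
      γ * (1ℚ - x ^ℚ n) + γ * x ^ℚ n             ≡⟨ solve 2 (λ g p → g :* (con 1ℚ :- p) :+ g :* p := g) ≡.refl γ (x ^ℚ n) ⟩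
      γ                                          ∎))
      where open ≡.≡-Reasoning

    power-step : ∀ n → γ * x ^ℚ n ≡ x ^ℚ n + γ * x ^ℚ suc n
    power-step n = ≡.trans (solve 3 (λ g p x → g :* p := g :* (con 1ℚ :- x) :* p :+ g :* (p :* x)) ≡.refl γ (x ^ℚ n) x)
      (cong (_+ γ * x ^ℚ suc n) (≡.trans (cong (_* x ^ℚ n) γ-inverse) (ℚₚ.*-identityˡ (x ^ℚ n))))

    -- (n + 1) (1 - x) xⁿ ≤ (1 - x) (1 + x + ⋯ + xⁿ) = 1 - xⁿ⁺¹.
    power-decay : ∀ n → fromℤ (+ suc n) * ((1ℚ - x) * x ^ℚ n) ≤q 1ℚ - x ^ℚ suc n
    power-decay zero = ℚₚ.≤-reflexive (solve 1 (λ x → con 1ℚ :* ((con 1ℚ :- x) :* con 1ℚ) := con 1ℚ :- con 1ℚ :* x) ≡.refl x)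
    power-decay (suc n) = ℚₚ.≤-trans
      (ℚₚ.≤-reflexive (≡.trans (cong (_* ((1ℚ - x) * (x ^ℚ n * x))) (fromℤ-+ (+ 1) (+ suc n)))
        (solve 3 (λ m x p → (con 1ℚ :+ m) :* ((con 1ℚ :- x) :* (p :* x)) := m :* ((con 1ℚ :- x) :* p) :* x :+ (con 1ℚ :- x) :* (p :* x))
          ≡.refl (fromℤ (+ suc n)) x (x ^ℚ n))))
      (ℚₚ.≤-trans (ℚₚ.+-monoˡ-≤ _ (*-monoʳ x≥0 (power-decay n)))
        (≤-by ((1ℚ - x) * (1ℚ - x ^ℚ suc n)) (0≤* (0≤- x≤1) (0≤- (^-≤1 x≥0 x≤1 (suc n))))
          (solve 2 (λ x p → con 1ℚ :- p :* x := (con 1ℚ :- p) :* x :+ (con 1ℚ :- x) :* p :+ (con 1ℚ :- x) :* (con 1ℚ :- p)) ≡.refl x (x ^ℚ suc n))))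

    power-bound : ∀ n → x ^ℚ n ≤q unit-fraction n * γ
    power-bound n = begin
      x ^ℚ n
        ≡⟨ ℚₚ.*-identityˡ (x ^ℚ n) ⟨
      1ℚ * x ^ℚ n
        ≡⟨ cong₂ (λ a b → a * b * x ^ℚ n) (≡.sym (unit-fraction-inverse n)) (≡.sym γ-inverse) ⟩
      fromℤ (+ suc n) * unit-fraction n * (γ * (1ℚ - x)) * x ^ℚ n
        ≡⟨ solve 5 (λ m u g x p → m :* u :* (g :* (con 1ℚ :- x)) :* p := u :* g :* (m :* ((con 1ℚ :- x) :* p))) ≡.refl
             (fromℤ (+ suc n)) (unit-fraction n) γ x (x ^ℚ n) ⟩
      unit-fraction n * γ * (fromℤ (+ suc n) * ((1ℚ - x) * x ^ℚ n))
        ≤⟨ *-monoˡ uγ≥0 (ℚₚ.≤-trans (power-decay n) (≤-by (x ^ℚ suc n) (^-nonneg x≥0 (suc n))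
             (solve 1 (λ p → con 1ℚ := con 1ℚ :- p :+ p) ≡.refl (x ^ℚ suc n)))) ⟩
      unit-fraction n * γ * 1ℚ
        ≡⟨ ℚₚ.*-identityʳ (unit-fraction n * γ) ⟩
      unit-fraction n * γ ∎
      where
      open ℚₚ.≤-Reasoning
      uγ≥0 : 0ℚ ≤q unit-fraction n * γ
      uγ≥0 = 0≤* (ℚₚ.<⇒≤ (unit-fraction-pos n)) γ≥0

    -- C xⁿ tends to 0.
    powers→0 : ∀ C → 0ℚ ≤q C → ∀ ε → 0ℚ <q ε → ∃[ N ] ∀ n → N ℕ.≤ n → C * x ^ℚ n ≤q ε
    powers→0 C C≥0 ε ε>0 =
      let (δ , δ>0 , le) = shrink (γ * C) ε>0 (0≤* γ≥0 C≥0)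
          (N , small) = archimedean 1 δ δ>0
      in N , λ n N≤n → ℚₚ.≤-trans (*-monoˡ C≥0 (power-bound n))
           (ℚₚ.≤-trans (ℚₚ.≤-reflexive (solve 3 (λ c u g → c :* (u :* g) := u :* (g :* c)) ≡.refl C (unit-fraction n) γ))
             (ℚₚ.≤-trans (*-monoʳ (0≤* γ≥0 C≥0) (ℚₚ.<⇒≤ (small n N≤n))) le))

  -- The ratio test: a sequence whose ratios are eventually at most θ is O(θⁿ); Θ is 1/θ.
  ratio-test : ∀ θ Θ → 0ℚ ≤q θ → 0ℚ ≤q Θ → Θ * θ ≡ 1ℚ → ∀ J (x : ℕ → ℚ) → (∀ n → 0ℚ ≤q x n) →
    (∀ n → J ℕ.≤ n → x (suc n) ≤q x n * θ) → ∃[ C ] (0ℚ ≤q C × ∀ n → x n ≤q C * θ ^ℚ n)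
  ratio-test θ Θ θ≥0 Θ≥0 inverse zero x x≥0 step = x 0 , x≥0 0 , bound
    where
    bound : ∀ n → x n ≤q x 0 * θ ^ℚ n
    bound zero    = ℚₚ.≤-reflexive (≡.sym (ℚₚ.*-identityʳ (x 0)))
    bound (suc n) = ℚₚ.≤-trans (step n z≤n)
      (ℚₚ.≤-trans (*-monoʳ θ≥0 (bound n)) (ℚₚ.≤-reflexive (ℚₚ.*-assoc (x 0) (θ ^ℚ n) θ)))
  ratio-test θ Θ θ≥0 Θ≥0 inverse (suc J) x x≥0 step =
    let (C , C≥0 , le) = ratio-test θ Θ θ≥0 Θ≥0 inverse J (x ∘ suc) (λ n → x≥0 (suc n)) (λ n J≤n → step (suc n) (s≤s J≤n))
        D = C * Θ + x 0
        D≥0 = 0≤+ (0≤* C≥0 Θ≥0) (x≥0 0)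
        bound : ∀ n → x n ≤q D * θ ^ℚ n
        bound = λ where
          zero    → ≤-by (C * Θ) (0≤* C≥0 Θ≥0) (solve 3 (λ c t x → (c :* t :+ x) :* con 1ℚ := x :+ c :* t) ≡.refl C Θ (x 0))
          (suc n) → ℚₚ.≤-trans (le n) (≤-by (x 0 * θ ^ℚ suc n) (0≤* (x≥0 0) (^-nonneg θ≥0 (suc n)))
            (≡.trans (solve 5 (λ c t x p th → (c :* t :+ x) :* (p :* th) := c :* p :* (t :* th) :+ x :* (p :* th)) ≡.refl C Θ (x 0) (θ ^ℚ n) θ)
              (cong (_+ x 0 * θ ^ℚ suc n) (≡.trans (cong (C * θ ^ℚ n *_) inverse) (ℚₚ.*-identityʳ (C * θ ^ℚ n))))))
    in D , D≥0 , bound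

  ¼ ⅛ : ℚ
  ¼ = + 1 / 4
  ⅛ = + 1 / 8

  ¼-power : ∀ n → ¼ ^ℚ n ≡ ½ ^ℚ n * ½ ^ℚ n
  ¼-power zero    = ≡.refl
  ¼-power (suc n) = ≡.trans (cong (_* ¼) (¼-power n)) (solve 1 (λ x → x :* x :* con ¼ := x :* con ½ :* (x :* con ½)) ≡.refl (½ ^ℚ n))

  ½<1 : ½ <q 1ℚ
  ½<1 = ℚ.*<* (ℤ.+<+ (s≤s (s≤s z≤n)))

  half-sum : ∀ n → ∑ℚ n (½ ^ℚ_) ≤q 2ℚ
  half-sum = Ratio.powers-sum ½ 0≤½ ½<1

-- Complete normed rings

-- A complete normed commutative ring in which the positive integers are invertible. The norm is only
-- accessed through rational upper bounds: x ≼ b says that the norm of x is at most b. The element unit n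
-- is 1/(n + 1).
record NormedRing : Set₁ where
  field
    commutativeRing : CommutativeRing 0ℓ 0ℓ
  open CommutativeRing commutativeRing public
  open FiniteSum commutativeRing public
  infix 4 _≼_
  field
    _≼_       : Carrier → ℚ → Set
    ≼-resp    : ∀ {x y b} → x ≈ y → x ≼ b → y ≼ b
    ≼-mono    : ∀ {x a b} → a ℚ.≤ b → x ≼ a → x ≼ b
    ≼-0       : 0# ≼ 0ℚ
    ≼-1       : 1# ≼ 1ℚ
    ≼-+       : ∀ {x y a b} → x ≼ a → y ≼ b → x + y ≼ a ℚ.+ b
    ≼-neg     : ∀ {x b} → x ≼ b → - x ≼ b
    ≼-*       : ∀ {x y a b} → x ≼ a → y ≼ b → x * y ≼ a ℚ.* b
    ≼-nonneg  : ∀ {x b} → x ≼ b → 0ℚ ℚ.≤ b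
    ≼-closed  : ∀ {x b} → (∀ ε → 0ℚ ℚ.< ε → x ≼ b ℚ.+ ε) → x ≼ b
    ≼-bounded : ∀ x → ∃[ b ] x ≼ b
    ≼0⇒≈      : ∀ {x y} → x - y ≼ 0ℚ → x ≈ y
    complete  : (x : ℕ → Carrier) →
      (∀ ε → 0ℚ ℚ.< ε → ∃[ N ] ∀ m n → N ≤ m → N ≤ n → x m - x n ≼ ε) →
      ∃[ w ] ∀ ε → 0ℚ ℚ.< ε → ∃[ N ] ∀ n → N ≤ n → x n - w ≼ ε
    unit      : ℕ → Carrier
    unit-law  : ∀ n → fromℕ (suc n) * unit n ≈ 1#
    unit-≼    : ∀ n → unit n ≼ RationalEstimates.unit-fraction n

-- Limits, series and products in a complete normed ring.
module Limits (𝔸 : NormedRing) where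
  open NormedRing 𝔸
  open IntegerCoefficients commutativeRing
  open RationalEstimates
  open SetoidReasoning setoid
  module ℚS = ℚ-Solver.+-*-Solver

  ∑-≼ : ∀ n {f g} → (∀ j → j ℕ.< n → f j ≼ g j) → ∑ n f ≼ ∑ℚ n g
  ∑-≼ zero    b = ≼-0
  ∑-≼ (suc n) b = ≼-+ (∑-≼ n (λ j j<n → b j (ℕₚ.m<n⇒m<1+n j<n))) (b n ℕₚ.≤-refl)

  ^-≼ : ∀ {x b} → x ≼ b → ∀ n → x ^ n ≼ b ^ℚ n
  ^-≼ p zero    = ≼-1
  ^-≼ p (suc n) = ≼-* (^-≼ p n) p

  ≼-difference : ∀ {x y a b} → x - y ≼ a → y ≼ b → x ≼ a ℚ.+ b
  ≼-difference {x} {y} p r = ≼-resp (solve 2 (λ x y → (x :- y) :+ y := x) refl x y) (≼-+ p r)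

  -- Convergence of a family along an index set I, as the size μ i of the index grows.
  Conv : {I : Set} → (I → ℕ) → (I → Carrier) → Carrier → Set
  Conv μ x ω = ∀ ε → 0ℚ ℚ.< ε → ∃[ K ] ∀ i → K ≤ μ i → x i - ω ≼ ε

  module _ {I : Set} {μ : I → ℕ} where

    Conv-const : ∀ {ω} → Conv μ (λ _ → ω) ω
    Conv-const {ω} ε ε>0 = 0 , λ i _ → ≼-mono (ℚₚ.<⇒≤ ε>0) (≼-resp (sym (-‿inverseʳ ω)) ≼-0)

    Conv-cong : ∀ {x y ω η} → (∀ i → x i ≈ y i) → ω ≈ η → Conv μ x ω → Conv μ y η
    Conv-cong e e′ c ε ε>0 = let (K , p) = c ε ε>0 in
      K , λ i K≤i → ≼-resp (+-cong (e i) (-‿cong e′)) (p i K≤i)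

    Conv-pull : {J : Set} {ν : J → ℕ} (φ : I → J) → (∀ i → μ i ≤ ν (φ i)) →
      ∀ {x ω} → Conv ν x ω → Conv μ (x ∘ φ) ω
    Conv-pull φ le c ε ε>0 = let (K , p) = c ε ε>0 in K , λ i K≤i → p (φ i) (ℕₚ.≤-trans K≤i (le i))

    Conv-+ : ∀ {x y ω η} → Conv μ x ω → Conv μ y η → Conv μ (λ i → x i + y i) (ω + η)
    Conv-+ {x} {y} {ω} {η} c d ε ε>0 =
      let (K , p) = c (½ ℚ.* ε) (half-pos ε>0)
          (L , r) = d (½ ℚ.* ε) (half-pos ε>0)
      in K ℕ.⊔ L , λ i le → ≼-resp
           (solve 4 (λ a b c d → (a :- b) :+ (c :- d) := a :+ c :- (b :+ d)) refl (x i) ω (y i) η)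
           (subst (_ ≼_) (halves ε)
             (≼-+ (p i (ℕₚ.m⊔n≤o⇒m≤o K L le)) (r i (ℕₚ.m⊔n≤o⇒n≤o K L le))))

    Conv-neg : ∀ {x ω} → Conv μ x ω → Conv μ (λ i → - x i) (- ω)
    Conv-neg {x} {ω} c ε ε>0 = let (K , p) = c ε ε>0 in
      K , λ i K≤i → ≼-resp (solve 2 (λ a b → :- (a :- b) := :- a :- (:- b)) refl (x i) ω) (≼-neg (p i K≤i))

    Conv-- : ∀ {x y ω η} → Conv μ x ω → Conv μ y η → Conv μ (λ i → x i - y i) (ω - η)
    Conv-- c d = Conv-+ c (Conv-neg d)

    Conv-bounded : ∀ {x ω} → Conv μ x ω → ∃[ B ] ∃[ K ] ∀ i → K ≤ μ i → x i ≼ B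
    Conv-bounded {x} {ω} c =
      let (W , w) = ≼-bounded ω
          (K , p) = c 1ℚ (ℚₚ.positive⁻¹ 1ℚ)
      in 1ℚ ℚ.+ W , K , λ i K≤i → ≼-resp (solve 2 (λ a b → a :- b :+ b := a) refl (x i) ω) (≼-+ (p i K≤i) w)

    Conv-* : ∀ {x y ω η} → Conv μ x ω → Conv μ y η → Conv μ (λ i → x i * y i) (ω * η)
    Conv-* {x} {y} {ω} {η} c d ε ε>0 =
      let (W , w) = ≼-bounded ω
          W≥0 = ≼-nonneg w
          (B , L , b) = Conv-bounded d
          B≥0 : 0ℚ ℚ.≤ 1ℚ ℚ.+ (ℚ.∣ B ∣)
          B≥0 = 0≤+ 0≤1 (ℚₚ.0≤∣p∣ B)
          (δ , δ>0 , δB) = shrink (1ℚ ℚ.+ ℚ.∣ B ∣) (half-pos ε>0) B≥0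
          (δ′ , δ′>0 , δW) = shrink W (half-pos ε>0) W≥0
          (K , p) = c δ δ>0
          (M , r) = d δ′ δ′>0
      in K ℕ.⊔ (L ℕ.⊔ M) , λ i le →
        let K≤ = ℕₚ.m⊔n≤o⇒m≤o K (L ℕ.⊔ M) le
            LM = ℕₚ.m⊔n≤o⇒n≤o K (L ℕ.⊔ M) le
            L≤ = ℕₚ.m⊔n≤o⇒m≤o L M LM
            M≤ = ℕₚ.m⊔n≤o⇒n≤o L M LM
            yi = b i L≤
            B≤ : B ℚ.≤ 1ℚ ℚ.+ ℚ.∣ B ∣
            B≤ = ℚₚ.≤-trans (ℚₚ.≤-reflexive (≡.sym (ℚₚ.0≤p⇒∣p∣≡p (≼-nonneg yi))))
                   (≤-by 1ℚ 0≤1 (ℚₚ.+-comm 1ℚ ℚ.∣ B ∣))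
        in ≼-resp (solve 4 (λ a b c d → (a :- b) :* c :+ b :* (c :- d) := a :* c :- b :* d) refl (x i) ω (y i) η)
          (subst (_ ≼_) (halves ε) (≼-+
            (≼-mono δB (≼-* (p i K≤) (≼-mono B≤ yi)))
            (≼-mono (ℚₚ.≤-trans (ℚₚ.≤-reflexive (ℚₚ.*-comm W δ′)) δW) (≼-* w (r i M≤)))))

  -- Convergence of sequences.
  Seq-Conv : (ℕ → Carrier) → Carrier → Set
  Seq-Conv = Conv id

  limit-≼ : ∀ {x ω b} → Seq-Conv x ω → (∃[ K ] ∀ n → K ≤ n → x n ≼ b) → ω ≼ b
  limit-≼ {x} {ω} c (L , p) = ≼-closed λ ε ε>0 →
    let (K , r) = c ε ε>0
        n = K ℕ.⊔ L
    in ≼-resp (solve 2 (λ a b → a :+ (:- (a :- b)) := b) refl (x n) ω)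
         (≼-+ (p n (ℕₚ.m≤n⊔m K L)) (≼-neg (r n (ℕₚ.m≤m⊔n K L))))

  limit-unique : ∀ {x ω η} → Seq-Conv x ω → Seq-Conv x η → ω ≈ η
  limit-unique {x} {ω} {η} c d = ≼0⇒≈ (limit-≼ {ω = ω - η}
    (Conv-cong {x = λ n → x n - x n} (λ n → refl) refl (Conv-- c d))
    (0 , λ n _ → ≼-resp (sym (-‿inverseʳ (x n))) ≼-0))

  -- A shift of the index does not affect the limit.
  Conv-suc : ∀ {x ω} → Seq-Conv x ω → Seq-Conv (x ∘ suc) ω
  Conv-suc = Conv-pull suc ℕₚ.n≤1+n

  Conv-unsuc : ∀ {x ω} → Seq-Conv (x ∘ suc) ω → Seq-Conv x ω
  Conv-unsuc {x} {ω} c ε ε>0 = let (K , p) = c ε ε>0 in suc K , λ where (suc n) (s≤s le) → p n le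

  -- Series dominated by a geometric series.
  module Series (x : ℚ) (x≥0 : 0ℚ ℚ.≤ x) (x<1 : x ℚ.< 1ℚ) where
    open Ratio x x≥0 x<1

    module _ (f : ℕ → Carrier) (C : ℚ) (C≥0 : 0ℚ ℚ.≤ C) (bound : ∀ j → f j ≼ C ℚ.* x ^ℚ j) where

      -- The bound telescopes: γ xⁿ = xⁿ + γ xⁿ⁺¹.
      tail : ∀ d n → ∑ (d ℕ.+ n) f - ∑ n f ≼ C ℚ.* (γ ℚ.* x ^ℚ n ℚ.- γ ℚ.* x ^ℚ (d ℕ.+ n))
      tail zero    n = ≼-mono (ℚₚ.≤-reflexive (≡.sym (≡.trans (cong (C ℚ.*_) (ℚₚ.+-inverseʳ (γ ℚ.* x ^ℚ n))) (ℚₚ.*-zeroʳ C))))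
        (≼-resp (sym (-‿inverseʳ (∑ n f))) ≼-0)
      tail (suc d) n = ≼-mono (ℚₚ.≤-reflexive (≡.trans
          (cong (λ w → C ℚ.* (γ ℚ.* x ^ℚ n ℚ.- w) ℚ.+ C ℚ.* x ^ℚ (d ℕ.+ n)) (power-step (d ℕ.+ n)))
          (ℚS.solve 4 (λ c a b p → c ℚS.:* (a ℚS.:- (p ℚS.:+ b)) ℚS.:+ c ℚS.:* p ℚS.:= c ℚS.:* (a ℚS.:- b)) ≡.refl
            C (γ ℚ.* x ^ℚ n) (γ ℚ.* x ^ℚ suc (d ℕ.+ n)) (x ^ℚ (d ℕ.+ n)))))
        (≼-resp (solve 3 (λ a b c → a :- b :+ c := a :+ c :- b) refl (∑ (d ℕ.+ n) f) (∑ n f) (f (d ℕ.+ n)))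
          (≼-+ (tail d n) (bound (d ℕ.+ n))))

      tail-≼ : ∀ m n → n ≤ m → ∑ m f - ∑ n f ≼ C ℚ.* γ ℚ.* x ^ℚ n
      tail-≼ m n n≤m = subst (λ k → ∑ k f - ∑ n f ≼ C ℚ.* γ ℚ.* x ^ℚ n) (ℕₚ.m∸n+n≡m n≤m)
        (≼-mono (≤-by (C ℚ.* (γ ℚ.* x ^ℚ (m ℕ.∸ n ℕ.+ n))) (0≤* C≥0 (0≤* γ≥0 (^-nonneg x≥0 (m ℕ.∸ n ℕ.+ n))))
            (ℚS.solve 4 (λ c g p r → c ℚS.:* g ℚS.:* p ℚS.:= c ℚS.:* (g ℚS.:* p ℚS.:- r) ℚS.:+ c ℚS.:* r) ≡.refl
              C γ (x ^ℚ n) (γ ℚ.* x ^ℚ (m ℕ.∸ n ℕ.+ n))))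
          (tail (m ℕ.∸ n) n))

      -- Limits are opaque: only their defining property matters, and their unfolding is costly.
      opaque
        series-converges : ∃[ S ] Seq-Conv (λ n → ∑ n f) S
        series-converges = complete (λ n → ∑ n f) λ ε ε>0 →
          let (N , small) = powers→0 (C ℚ.* γ) (0≤* C≥0 γ≥0) ε ε>0
          in N , λ m n N≤m N≤n → cauchy ε N small m n N≤m N≤n
          where
          cauchy : ∀ ε N → (∀ n → N ≤ n → C ℚ.* γ ℚ.* x ^ℚ n ℚ.≤ ε) → ∀ m n → N ≤ m → N ≤ n → ∑ m f - ∑ n f ≼ ε
          cauchy ε N small m n N≤m N≤n with ℕₚ.≤-total n m
          ... | inj₁ n≤m = ≼-mono (small n N≤n) (tail-≼ m n n≤m)
          ... | inj₂ m≤n = ≼-resp (solve 2 (λ a b → :- (a :- b) := b :- a) refl (∑ n f) (∑ m f))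
            (≼-neg (≼-mono (small m N≤m) (tail-≼ n m m≤n)))

      series-≼ : ∀ n → ∑ n f ≼ C ℚ.* γ
      series-≼ n = ≼-mono (ℚₚ.≤-trans (ℚₚ.≤-reflexive (∑ℚ-* n C (x ^ℚ_))) (*-monoˡ C≥0 (powers-sum n)))
        (∑-≼ n (λ j _ → bound j))

    -- 1 - z is invertible when z has norm at most x < 1.
    opaque
      inverse : ∀ {z} → z ≼ x → ∃[ w ] ((1# - z) * w ≈ 1# × w ≼ γ)
      inverse {z} z≼x =
        let bound = λ j → subst (z ^ j ≼_) (≡.sym (ℚₚ.*-identityˡ (x ^ℚ j))) (^-≼ z≼x j)
            (S , c) = series-converges (z ^_) 1ℚ 0≤1 bound
            one : Seq-Conv (λ n → (1# - z) * ∑ n (z ^_)) 1#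
            one = λ ε ε>0 → let (N , small) = powers→0 1ℚ 0≤1 ε ε>0 in
              N , λ n N≤n → ≼-resp (sym (remainder n)) (≼-neg (≼-mono (small n N≤n) (bound n)))
        in S , limit-unique (Conv-* (Conv-const {ω = 1# - z}) c) one
             , limit-≼ c (0 , λ n _ → subst (∑ n (z ^_) ≼_) (ℚₚ.*-identityˡ γ) (series-≼ (z ^_) 1ℚ 0≤1 bound n))
        where
        remainder : ∀ n → (1# - z) * ∑ n (z ^_) - 1# ≈ - z ^ n
        remainder zero    = solve 1 (λ z → (con (+ 1) :- z) :* con (+ 0) :- con (+ 1) := :- con (+ 1)) refl z
        remainder (suc n) = trans (solve 3 (λ z s p → (con (+ 1) :- z) :* (s :+ p) :- con (+ 1) := ((con (+ 1) :- z) :* s :- con (+ 1)) :+ (con (+ 1) :- z) :* p) refl z (∑ n (z ^_)) (z ^ n))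
          (trans (+-congʳ (remainder n)) (solve 2 (λ z p → :- p :+ (con (+ 1) :- z) :* p := :- (p :* z)) refl z (z ^ n)))

    -- Infinite products of 1 + d j, with d j of norm at most G xʲ.
    module Product (d : ℕ → Carrier) (G : ℚ) (G≥0 : 0ℚ ℚ.≤ G) (d-bound : ∀ j → d j ≼ G ℚ.* x ^ℚ j)
      (u : ℕ → Carrier) (u-zero : u 0 ≈ 1#) (u-suc : ∀ n → u (suc n) ≈ u n * (1# + d n)) where

      private
        -- E n is the product of the 1 + g j over j < n, and bounds u n; h n is the sum of the g j over j ≥ n.
        g h E : ℕ → ℚ
        g n = G ℚ.* x ^ℚ n
        h n = G ℚ.* γ ℚ.* x ^ℚ n
        E zero    = 1ℚ
        E (suc n) = E n ℚ.* (1ℚ ℚ.+ g n)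

        g≥0 : ∀ n → 0ℚ ℚ.≤ g n
        g≥0 n = 0≤* G≥0 (^-nonneg x≥0 n)

        h≥0 : ∀ n → 0ℚ ℚ.≤ h n
        h≥0 n = 0≤* (0≤* G≥0 γ≥0) (^-nonneg x≥0 n)

        E≥0 : ∀ n → 0ℚ ℚ.≤ E n
        E≥0 zero    = 0≤1
        E≥0 (suc n) = 0≤* (E≥0 n) (0≤+ 0≤1 (g≥0 n))

        h-step : ∀ n → h n ≡ g n ℚ.+ h (suc n)
        h-step n = ≡.trans (ℚₚ.*-assoc G γ (x ^ℚ n)) (≡.trans (cong (G ℚ.*_) (power-step n))
          (ℚS.solve 4 (λ G p g r → G ℚS.:* (p ℚS.:+ g ℚS.:* r) ℚS.:= G ℚS.:* p ℚS.:+ G ℚS.:* g ℚS.:* r) ≡.refl G (x ^ℚ n) γ (x ^ℚ suc n)))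

        E-mono : ∀ n k → E n ℚ.≤ E (k ℕ.+ n)
        E-mono n zero    = ℚₚ.≤-refl
        E-mono n (suc k) = ℚₚ.≤-trans (E-mono n k) (≤-by (E (k ℕ.+ n) ℚ.* g (k ℕ.+ n)) (0≤* (E≥0 (k ℕ.+ n)) (g≥0 (k ℕ.+ n)))
          (ℚS.solve 2 (λ a b → a ℚS.:* (ℚS.con 1ℚ ℚS.:+ b) ℚS.:= a ℚS.:+ a ℚS.:* b) ≡.refl (E (k ℕ.+ n)) (g (k ℕ.+ n))))

        module Bound (J : ℕ) (hJ≤½ : h J ℚ.≤ ½) where

          -- Beyond J the product grows by at most a factor of 1 + 2 (h J - h n) ≤ 2.
          E-tail : ∀ k → E (k ℕ.+ J) ℚ.≤ E J ℚ.* (1ℚ ℚ.+ 2ℚ ℚ.* (h J ℚ.- h (k ℕ.+ J)))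
          E-tail zero    = ℚₚ.≤-reflexive (ℚS.solve 2 (λ e h → e ℚS.:= e ℚS.:* (ℚS.con 1ℚ ℚS.:+ ℚS.con 2ℚ ℚS.:* (h ℚS.:- h))) ≡.refl (E J) (h J))
          E-tail (suc k) = ℚₚ.≤-trans (*-monoʳ (0≤+ 0≤1 (g≥0 n)) (E-tail k))
            (≤-by (E J ℚ.* (g n ℚ.* (2ℚ ℚ.* (½ ℚ.- h J) ℚ.+ 2ℚ ℚ.* h n)))
              (0≤* (E≥0 J) (0≤* (g≥0 n) (0≤+ (0≤* 0≤2 (0≤- hJ≤½)) (0≤* 0≤2 (h≥0 n)))))
              (≡.trans
                (ℚS.solve 4 (λ e hJ g h′ → e ℚS.:* (ℚS.con 1ℚ ℚS.:+ ℚS.con 2ℚ ℚS.:* (hJ ℚS.:- h′))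
                   ℚS.:= e ℚS.:* (ℚS.con 1ℚ ℚS.:+ ℚS.con 2ℚ ℚS.:* (hJ ℚS.:- (g ℚS.:+ h′))) ℚS.:* (ℚS.con 1ℚ ℚS.:+ g)
                     ℚS.:+ e ℚS.:* (g ℚS.:* (ℚS.con 2ℚ ℚS.:* (ℚS.con ½ ℚS.:- hJ) ℚS.:+ ℚS.con 2ℚ ℚS.:* (g ℚS.:+ h′)))) ≡.refl (E J) (h J) (g n) (h (suc n)))
                (cong (λ w → E J ℚ.* (1ℚ ℚ.+ 2ℚ ℚ.* (h J ℚ.- w)) ℚ.* (1ℚ ℚ.+ g n)
                   ℚ.+ E J ℚ.* (g n ℚ.* (2ℚ ℚ.* (½ ℚ.- h J) ℚ.+ 2ℚ ℚ.* w))) (≡.sym (h-step n)))))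
            where
            n = k ℕ.+ J

          E-bound : ∀ n → E n ℚ.≤ E J ℚ.* 2ℚ
          E-bound n with ℕₚ.≤-total J n
          ... | inj₁ J≤n = subst (λ m → E m ℚ.≤ E J ℚ.* 2ℚ) (ℕₚ.m∸n+n≡m J≤n)
            (ℚₚ.≤-trans (E-tail (n ℕ.∸ J)) (*-monoˡ (E≥0 J)
              (≤-by (2ℚ ℚ.* ((½ ℚ.- h J) ℚ.+ h (n ℕ.∸ J ℕ.+ J))) (0≤* 0≤2 (0≤+ (0≤- hJ≤½) (h≥0 (n ℕ.∸ J ℕ.+ J))))
                (ℚS.solve 2 (λ a b → ℚS.con 2ℚ ℚS.:= ℚS.con 1ℚ ℚS.:+ ℚS.con 2ℚ ℚS.:* (a ℚS.:- b) ℚS.:+ ℚS.con 2ℚ ℚS.:* ((ℚS.con ½ ℚS.:- a) ℚS.:+ b))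
                  ≡.refl (h J) (h (n ℕ.∸ J ℕ.+ J))))))
          ... | inj₂ n≤J = ℚₚ.≤-trans (subst (λ m → E n ℚ.≤ E m) (ℕₚ.m∸n+n≡m n≤J) (E-mono n (J ℕ.∸ n)))
            (≤-by (E J) (E≥0 J) (ℚS.solve 1 (λ e → e ℚS.:* ℚS.con 2ℚ ℚS.:= e ℚS.:+ e) ≡.refl (E J)))

        bound-exists : ∃[ B ] ∀ n → E n ℚ.≤ B
        bound-exists = let (J , small) = powers→0 (G ℚ.* γ) (0≤* G≥0 γ≥0) ½ (ℚₚ.positive⁻¹ ½)
          in E J ℚ.* 2ℚ , Bound.E-bound J (small J ℕₚ.≤-refl)

        u-≼-E : ∀ n → u n ≼ E n
        u-≼-E zero    = ≼-resp (sym u-zero) ≼-1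
        u-≼-E (suc n) = ≼-resp (sym (u-suc n)) (≼-* (u-≼-E n) (≼-+ ≼-1 (d-bound n)))

      B : ℚ
      B = proj₁ bound-exists

      u-bound : ∀ n → u n ≼ B
      u-bound n = ≼-mono (proj₂ bound-exists n) (u-≼-E n)

      B≥0 : 0ℚ ℚ.≤ B
      B≥0 = ≼-nonneg (u-bound 0)

      opaque
        u-converges : ∃[ U ] Seq-Conv u U
        u-converges =
          let (S , c) = series-converges (λ j → u j * d j) (B ℚ.* G) (0≤* B≥0 G≥0)
                (λ j → subst (u j * d j ≼_) (≡.sym (ℚₚ.*-assoc B G (x ^ℚ j))) (≼-* (u-bound j) (d-bound j)))
          in 1# + S , Conv-cong (λ n → sym (partial n)) refl (Conv-+ (Conv-const {ω = 1#}) c)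
          where
          partial : ∀ n → u n ≈ 1# + ∑ n (λ j → u j * d j)
          partial zero    = trans u-zero (sym (+-identityʳ 1#))
          partial (suc n) = trans (u-suc n) (trans
            (solve 2 (λ a b → a :* (con (+ 1) :+ b) := a :+ a :* b) refl (u n) (d n))
            (trans (+-congʳ (partial n)) (+-assoc 1# (∑ n (λ j → u j * d j)) (u n * d n))))

  -- Dominated convergence for ∑_{s ≤ S} w S s * a s, when w S s tends to ω as S - s grows.
  module Tannery (w : ℕ → ℕ → Carrier) (ω : Carrier) (B : ℚ)
    (w-bound : ∀ S s → s ≤ S → w S s ≼ B)
    (w-gap : ∀ ε → 0ℚ ℚ.< ε → ∃[ K ] ∀ S s → s ℕ.+ K ≤ S → w S s - ω ≼ ε)
    (a : ℕ → Carrier) (C : ℚ) (C≥0 : 0ℚ ℚ.≤ C) (a-bound : ∀ s → a s ≼ C ℚ.* ¼ ^ℚ s) where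

    private
      Ω B′ : ℚ
      Ω  = proj₁ (≼-bounded ω)
      B′ = B ℚ.+ Ω

      B′≥0 : 0ℚ ℚ.≤ B′
      B′≥0 = 0≤+ (≼-nonneg (w-bound 0 0 z≤n)) (≼-nonneg (proj₂ (≼-bounded ω)))

      open Ratio ½ 0≤½ ½<1 using (powers→0)

      ½-nonneg : ∀ n → 0ℚ ℚ.≤ ½ ^ℚ n
      ½-nonneg = ^-nonneg 0≤½

      -- The bound for a single term.
      term : ∀ ε K L S → (∀ S s → s ℕ.+ K ≤ S → w S s - ω ≼ ε) → K ℕ.+ L ≤ S → 0ℚ ℚ.≤ ε → ∀ s → s ≤ S →
        (w S s - ω) * a s ≼ C ℚ.* (ε ℚ.+ B′ ℚ.* ½ ^ℚ L) ℚ.* ½ ^ℚ s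
      term ε K L S gap KL≤S ε≥0 s s≤S with s ℕ.+ K ℕₚ.≤? S
      -- Away from the end the weight is within ε of its limit.
      ... | yes sK≤S = ≼-mono (≤-by (ε ℚ.* C ℚ.* (½ ^ℚ s ℚ.* (1ℚ ℚ.- ½ ^ℚ s)) ℚ.+ C ℚ.* (B′ ℚ.* ½ ^ℚ L) ℚ.* ½ ^ℚ s)
            (0≤+ (0≤* (0≤* ε≥0 C≥0) (0≤* (½-nonneg s) (0≤- (^-≤1 0≤½ (ℚₚ.<⇒≤ ½<1) s))))
              (0≤* (0≤* C≥0 (0≤* B′≥0 (½-nonneg L))) (½-nonneg s)))
            (≡.trans
              (ℚS.solve 5 (λ e c b l h → c ℚS.:* (e ℚS.:+ b ℚS.:* l) ℚS.:* h ℚS.:= e ℚS.:* (c ℚS.:* (h ℚS.:* h))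
                ℚS.:+ (e ℚS.:* c ℚS.:* (h ℚS.:* (ℚS.con 1ℚ ℚS.:- h)) ℚS.:+ c ℚS.:* (b ℚS.:* l) ℚS.:* h)) ≡.refl ε C B′ (½ ^ℚ L) (½ ^ℚ s))
              (cong (λ q → ε ℚ.* (C ℚ.* q) ℚ.+ (ε ℚ.* C ℚ.* (½ ^ℚ s ℚ.* (1ℚ ℚ.- ½ ^ℚ s)) ℚ.+ C ℚ.* (B′ ℚ.* ½ ^ℚ L) ℚ.* ½ ^ℚ s)) (≡.sym (¼-power s)))))
          (≼-* (gap S s sK≤S) (a-bound s))
      -- Near the end s exceeds L, so half of the decay of a s is available as the factor 1/2ᴸ.
      ... | no sK≰S = ≼-mono (≤-by (B′ ℚ.* C ℚ.* (½ ^ℚ s ℚ.* (½ ^ℚ L ℚ.- ½ ^ℚ s)) ℚ.+ C ℚ.* ε ℚ.* ½ ^ℚ s)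
            (0≤+ (0≤* (0≤* B′≥0 C≥0) (0≤* (½-nonneg s) (0≤- (^-antitone 0≤½ (ℚₚ.<⇒≤ ½<1) L≤s))))
              (0≤* (0≤* C≥0 ε≥0) (½-nonneg s)))
            (≡.trans
              (ℚS.solve 5 (λ e c b l h → c ℚS.:* (e ℚS.:+ b ℚS.:* l) ℚS.:* h ℚS.:= b ℚS.:* (c ℚS.:* (h ℚS.:* h))
                ℚS.:+ (b ℚS.:* c ℚS.:* (h ℚS.:* (l ℚS.:- h)) ℚS.:+ c ℚS.:* e ℚS.:* h)) ≡.refl ε C B′ (½ ^ℚ L) (½ ^ℚ s))
              (cong (λ q → B′ ℚ.* (C ℚ.* q) ℚ.+ (B′ ℚ.* C ℚ.* (½ ^ℚ s ℚ.* (½ ^ℚ L ℚ.- ½ ^ℚ s)) ℚ.+ C ℚ.* ε ℚ.* ½ ^ℚ s)) (≡.sym (¼-power s)))))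
          (≼-* (≼-+ (w-bound S s s≤S) (≼-neg (proj₂ (≼-bounded ω)))) (a-bound s))
        where
        L≤s : L ≤ s
        L≤s = ℕₚ.+-cancelʳ-≤ K L s (ℕₚ.≤-trans (ℕₚ.≤-reflexive (ℕₚ.+-comm L K)) (ℕₚ.≤-trans KL≤S (ℕₚ.<⇒≤ (ℕₚ.≰⇒> sK≰S))))

      -- The sum of these bounds, with δ for ε.
      total : ∀ ε δ L → δ ℚ.* (C ℚ.* 2ℚ) ℚ.≤ ½ ℚ.* ε → C ℚ.* 2ℚ ℚ.* B′ ℚ.* ½ ^ℚ L ℚ.≤ ½ ℚ.* ε → 0ℚ ℚ.≤ δ →
        ∀ n → ∑ℚ n (λ s → C ℚ.* (δ ℚ.+ B′ ℚ.* ½ ^ℚ L) ℚ.* ½ ^ℚ s) ℚ.≤ ε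
      total ε δ L δC small δ≥0 n = ℚₚ.≤-trans (ℚₚ.≤-reflexive (∑ℚ-* n (C ℚ.* (δ ℚ.+ B′ ℚ.* ½ ^ℚ L)) (½ ^ℚ_)))
        (ℚₚ.≤-trans (*-monoˡ (0≤* C≥0 (0≤+ δ≥0 (0≤* B′≥0 (½-nonneg L)))) (half-sum n))
          (ℚₚ.≤-trans (ℚₚ.≤-reflexive (ℚS.solve 4 (λ c d b l → c ℚS.:* (d ℚS.:+ b ℚS.:* l) ℚS.:* ℚS.con 2ℚ
              ℚS.:= d ℚS.:* (c ℚS.:* ℚS.con 2ℚ) ℚS.:+ c ℚS.:* ℚS.con 2ℚ ℚS.:* b ℚS.:* l) ≡.refl C δ B′ (½ ^ℚ L)))
            (ℚₚ.≤-trans (ℚₚ.+-mono-≤ δC small) (ℚₚ.≤-reflexive (halves ε)))))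

    tannery : Seq-Conv (λ S → ∑ (suc S) (λ s → w S s * a s) - ω * ∑ (suc S) a) 0#
    tannery ε ε>0 =
      let C2≥0 = 0≤* C≥0 0≤2
          (δ , δ>0 , δC) = shrink (C ℚ.* 2ℚ) (half-pos ε>0) C2≥0
          (K , gap) = w-gap δ δ>0
          (L , small) = powers→0 (C ℚ.* 2ℚ ℚ.* B′) (0≤* C2≥0 B′≥0) (½ ℚ.* ε) (half-pos ε>0)
      in K ℕ.+ L , λ S le → ≼-resp
        (begin
          ∑ (suc S) (λ s → (w S s - ω) * a s)
            ≈⟨ ∑-cong (suc S) (λ s _ → solve 3 (λ w o a → (w :- o) :* a := w :* a :- o :* a) refl (w S s) ω (a s)) ⟩
          ∑ (suc S) (λ s → w S s * a s - ω * a s)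
            ≈⟨ ∑-- (suc S) (λ s → w S s * a s) (λ s → ω * a s) ⟩
          ∑ (suc S) (λ s → w S s * a s) - ∑ (suc S) (λ s → ω * a s)
            ≈⟨ +-congˡ (-‿cong (∑-* (suc S) ω a)) ⟩
          ∑ (suc S) (λ s → w S s * a s) - ω * ∑ (suc S) a
            ≈⟨ solve 1 (λ x → x := x :- con (+ 0)) refl (∑ (suc S) (λ s → w S s * a s) - ω * ∑ (suc S) a) ⟩
          ∑ (suc S) (λ s → w S s * a s) - ω * ∑ (suc S) a - 0# ∎)
        (≼-mono (total ε δ L δC (small L ℕₚ.≤-refl) (ℚₚ.<⇒≤ δ>0) (suc S))
          (∑-≼ (suc S) (λ s s<n → term δ K L S gap le (ℚₚ.<⇒≤ δ>0) s (ℕₚ.≤-pred s<n))))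

-- The exponential series

module ExponentialSeries (𝔸 : NormedRing) where
  open NormedRing 𝔸
  open IntegerCoefficients commutativeRing
  open RationalEstimates
  open Limits 𝔸
  open SetoidReasoning setoid

  -- term z j is z ^ j / j !.
  term : Carrier → ℕ → Carrier
  term z zero    = 1#
  term z (suc j) = unit j * (term z j * z)

  -- a is the sum of the exponential series at z.
  IsExp : Carrier → Carrier → Set
  IsExp z a = Seq-Conv (λ n → ∑ n (term z)) a

  term-cong : ∀ {z w} → z ≈ w → ∀ j → term z j ≈ term w j
  term-cong e zero    = refl
  term-cong e (suc j) = *-congˡ (*-cong (term-cong e j) e)

  fromℕ-term : ∀ z j → fromℕ (suc j) * term z (suc j) ≈ z * term z j
  fromℕ-term z j = trans (sym (*-assoc (fromℕ (suc j)) (unit j) (term z j * z)))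
    (trans (*-congʳ (unit-law j)) (trans (*-identityˡ (term z j * z)) (*-comm (term z j) z)))

  fromℕ-cancel : ∀ n {x y} → fromℕ (suc n) * x ≈ fromℕ (suc n) * y → x ≈ y
  fromℕ-cancel n {x} {y} e = trans (sym (undo x)) (trans (*-congˡ e) (undo y))
    where
    undo : ∀ z → unit n * (fromℕ (suc n) * z) ≈ z
    undo z = trans (solve 3 (λ a b c → a :* (b :* c) := b :* a :* c) refl (unit n) (fromℕ (suc n)) z)
      (trans (*-congʳ (unit-law n)) (*-identityˡ z))

  -- The binomial theorem.
  term-+ : ∀ z w n → term (z + w) n ≈ conv (term w) (term z) n
  term-+ z w zero    = sym (*-identityˡ 1#)
  term-+ z w (suc n) = fromℕ-cancel n (begin
    fromℕ (suc n) * term (z + w) (suc n)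
      ≈⟨ fromℕ-term (z + w) n ⟩
    (z + w) * term (z + w) n
      ≈⟨ *-congˡ (term-+ z w n) ⟩
    (z + w) * conv (term w) (term z) n
      ≈⟨ solve 3 (λ z w c → (z :+ w) :* c := w :* c :+ z :* c) refl z w (conv (term w) (term z) n) ⟩
    w * conv (term w) (term z) n + z * conv (term w) (term z) n
      ≈⟨ +-cong (conv-*ˡ n w (term w) (term z)) (conv-*ʳ n z (term w) (term z)) ⟨
    conv (λ j → w * term w j) (term z) n + conv (term w) (λ j → z * term z j) n
      ≈⟨ +-cong (conv-cong n (fromℕ-term w) (λ j _ → refl)) (conv-congʳ n (λ j _ → fromℕ-term z j)) ⟨
    conv (λ j → fromℕ (suc j) * term w (suc j)) (term z) n + conv (term w) (λ j → fromℕ (suc j) * term z (suc j)) n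
      ≈⟨ +-cong (conv-last n (λ j → fromℕ j * term w j) (term z) (zeroˡ 1#))
                (conv-head n (term w) (λ j → fromℕ j * term z j) (zeroˡ 1#)) ⟨
    conv (λ j → fromℕ j * term w j) (term z) (suc n) + conv (term w) (λ j → fromℕ j * term z j) (suc n)
      ≈⟨ conv-Leibniz (suc n) (term w) (term z) ⟨
    fromℕ (suc n) * conv (term w) (term z) (suc n) ∎)

  module _ (b : ℚ) (b≥0 : 0ℚ ℚ.≤ b) where

    -- size j is b ^ j / j !.
    size : ℕ → ℚ
    size zero    = 1ℚ
    size (suc j) = unit-fraction j ℚ.* (size j ℚ.* b)

    size≥0 : ∀ j → 0ℚ ℚ.≤ size j
    size≥0 zero    = 0≤1
    size≥0 (suc j) = 0≤* (ℚₚ.<⇒≤ (unit-fraction-pos j)) (0≤* (size≥0 j) b≥0)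

    term-size : ∀ {z} → z ≼ b → ∀ j → term z j ≼ size j
    term-size p zero    = ≼-1
    term-size p (suc j) = ≼-* (unit-≼ j) (≼-* (term-size p j) p)

    -- The ratio b / (j + 1) is eventually at most 1/4.
    size-decay : ∃[ C ] (0ℚ ℚ.≤ C × ∀ n → size n ℚ.≤ C ℚ.* ¼ ^ℚ n)
    size-decay =
      let (δ , δ>0 , le) = shrink b (ℚₚ.positive⁻¹ ¼) b≥0
          (J , small) = archimedean 1 δ δ>0
      in ratio-test ¼ (+ 4 ℚ./ 1) (ℚₚ.nonNegative⁻¹ ¼) (ℚₚ.nonNegative⁻¹ (+ 4 ℚ./ 1)) ≡.refl J size size≥0
           (λ n J≤n → step n δ le (ℚₚ.<⇒≤ (small n J≤n)))
      where
      step : ∀ n δ → δ ℚ.* b ℚ.≤ ¼ → unit-fraction n ℚ.≤ δ → size (suc n) ℚ.≤ size n ℚ.* ¼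
      step n δ le u≤δ = ℚₚ.≤-trans
        (ℚₚ.≤-reflexive (ℚS.solve 3 (λ u s b → u ℚS.:* (s ℚS.:* b) ℚS.:= s ℚS.:* (u ℚS.:* b)) ≡.refl (unit-fraction n) (size n) b))
        (*-monoˡ (size≥0 n) (ℚₚ.≤-trans (*-monoʳ b≥0 u≤δ) le))

  term-decay : ∀ z → ∃[ C ] (0ℚ ℚ.≤ C × ∀ j → term z j ≼ C ℚ.* ¼ ^ℚ j)
  term-decay z =
    let (b , z≼b) = ≼-bounded z
        (C , C≥0 , le) = size-decay b (≼-nonneg z≼b)
    in C , C≥0 , λ j → ≼-mono (le j) (term-size b (≼-nonneg z≼b) z≼b j)

  -- The Cauchy product of the two series, by dominated convergence.
  exp-+ : ∀ {z w a b c} → IsExp z a → IsExp w b → IsExp (z + w) c → c ≈ b * a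
  exp-+ {z} {w} {a} {b} {c} ez ew ezw =
    let (C , C≥0 , z-bound) = term-decay z
        (D , D≥0 , w-bound) = term-decay w
        module T = Tannery (λ S s → ∑ (suc (S ℕ.∸ s)) (term w)) b (D ℚ.* Ratio.γ ¼ ¼≥0 ¼<1)
          (λ S s _ → Series.series-≼ ¼ ¼≥0 ¼<1 (term w) D D≥0 w-bound (suc (S ℕ.∸ s))) gap
          (term z) C C≥0 z-bound
    in trans (limit-unique (Conv-suc ezw)
         (Conv-cong (λ S → trans
             (solve 2 (λ x y → x :- y :+ y := x) refl (∑ (suc S) (λ s → ∑ (suc (S ℕ.∸ s)) (term w) * term z s)) (b * ∑ (suc S) (term z)))
             (product S)) refl
           (Conv-+ T.tannery (Conv-* (Conv-const {ω = b}) (Conv-suc ez)))))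
         (+-identityˡ (b * a))
    where
    gap : ∀ ε → 0ℚ ℚ.< ε → ∃[ K ] ∀ S s → s ℕ.+ K ℕ.≤ S → ∑ (suc (S ℕ.∸ s)) (term w) - b ≼ ε
    gap ε ε>0 =
      let (K , p) = ew ε ε>0
      in K , λ S s le → p (suc (S ℕ.∸ s))
           (ℕₚ.m≤n⇒m≤1+n (ℕₚ.m+n≤o⇒m≤o∸n K (ℕₚ.≤-trans (ℕₚ.≤-reflexive (ℕₚ.+-comm K s)) le)))
    ¼≥0 : 0ℚ ℚ.≤ ¼
    ¼≥0 = ℚₚ.nonNegative⁻¹ ¼
    ¼<1 : ¼ ℚ.< 1ℚ
    ¼<1 = ℚ.*<* (ℤ.+<+ (s≤s (s≤s z≤n)))
    product : ∀ S → ∑ (suc S) (λ s → ∑ (suc (S ℕ.∸ s)) (term w) * term z s) ≈ ∑ (suc S) (term (z + w))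
    product S = trans (sym (conv-∑ (λ m → ∑ (suc m) (term w)) (term z) S))
      (trans (sym (∑-conv-partial S (term w) (term z))) (∑-cong (suc S) (λ j _ → sym (term-+ z w j))))

  -- The second-order remainder of the exponential series.
  exp-remainder : ∀ {z a β} → z ≼ β → β ℚ.≤ ½ → IsExp z a → a - (1# + z) ≼ β ℚ.* β ℚ.* 2ℚ
  exp-remainder {z} {a} {β} z≼β β≤½ ez = limit-≼
    (Conv-- (Conv-suc (Conv-suc ez)) (Conv-const {ω = 1# + z}))
    (0 , λ n _ → ≼-resp (sym (split n)) (≼-mono (sum-bound n) (∑-≼ n (λ j _ → bound j))))
    where
    β≥0 : 0ℚ ℚ.≤ β
    β≥0 = ≼-nonneg z≼β
    unit-≼1 : ∀ j → unit j ≼ 1ℚ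
    unit-≼1 j = ≼-mono (unit≤1 j) (unit-≼ j)
      where
      unit≤1 : ∀ j → unit-fraction j ℚ.≤ 1ℚ
      unit≤1 j = Defs.Estimates./-antitone 1 {0} {j} z≤n
    power : ∀ j → term z j ≼ β ^ℚ j
    power zero    = ≼-1
    power (suc j) = ≼-mono (ℚₚ.≤-reflexive (ℚₚ.*-identityˡ (β ^ℚ j ℚ.* β))) (≼-* (unit-≼1 j) (≼-* (power j) z≼β))
    halve : ∀ j → β ^ℚ j ℚ.≤ ½ ^ℚ j
    halve zero    = ℚₚ.≤-refl
    halve (suc j) = *-mono-nonNeg β≥0 (^-nonneg 0≤½ j) (halve j) β≤½
    bound : ∀ j → term z (suc (suc j)) ≼ β ℚ.* β ℚ.* ½ ^ℚ j
    bound j = ≼-mono (ℚₚ.≤-trans (ℚₚ.≤-reflexive (ℚS.solve 2 (λ p b → p ℚS.:* b ℚS.:* b ℚS.:= b ℚS.:* b ℚS.:* p) ≡.refl (β ^ℚ j) β))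
      (*-monoˡ (0≤* β≥0 β≥0) (halve j))) (power (suc (suc j)))
    sum-bound : ∀ n → ∑ℚ n (λ j → β ℚ.* β ℚ.* ½ ^ℚ j) ℚ.≤ β ℚ.* β ℚ.* 2ℚ
    sum-bound n = ℚₚ.≤-trans (ℚₚ.≤-reflexive (∑ℚ-* n (β ℚ.* β) (½ ^ℚ_))) (*-monoˡ (0≤* β≥0 β≥0) (half-sum n))
    unit-0 : unit 0 ≈ 1#
    unit-0 = trans (solve 1 (λ u → u := (con (+ 0) :+ con (+ 1)) :* u) refl (unit 0)) (unit-law 0)
    split : ∀ n → ∑ (suc (suc n)) (term z) - (1# + z) ≈ ∑ n (λ j → term z (suc (suc j)))
    split n = begin
      ∑ (suc (suc n)) (term z) - (1# + z)
        ≈⟨ +-congʳ (trans (∑-front (suc n) (term z)) (+-congˡ (∑-front n (term z ∘ suc)))) ⟩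
      1# + (unit 0 * (1# * z) + R) - (1# + z)
        ≈⟨ +-congʳ (+-congˡ (+-congʳ (*-congʳ unit-0))) ⟩
      1# + (1# * (1# * z) + R) - (1# + z)
        ≈⟨ solve 2 (λ z r → con (+ 1) :+ (con (+ 1) :* (con (+ 1) :* z) :+ r) :- (con (+ 1) :+ z) := r) refl z R ⟩
      R ∎
      where R = ∑ n (λ j → term z (suc (suc j)))

  -- A total exponential function.
  module TotalExponential (E : Carrier → Carrier) (E-exp : ∀ z → IsExp z (E z)) where

    E-cong : ∀ {z w} → z ≈ w → E z ≈ E w
    E-cong {z} {w} e = limit-unique (Conv-cong (λ n → ∑-cong n (λ j _ → term-cong e j)) refl (E-exp z)) (E-exp w)

    E-+ : ∀ z w → E (z + w) ≈ E z * E w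
    E-+ z w = trans (exp-+ (E-exp z) (E-exp w) (E-exp (z + w))) (*-comm (E w) (E z))

    E-0 : E 0# ≈ 1#
    E-0 = trans (≼0⇒≈ (exp-remainder ≼-0 0≤½ (E-exp 0#))) (+-identityʳ 1#)

    E-^ : ∀ n z → E (fromℕ n * z) ≈ E z ^ n
    E-^ zero    z = trans (E-cong (zeroˡ z)) E-0
    E-^ (suc n) z = trans (E-cong (solve 2 (λ n z → (n :+ con (+ 1)) :* z := n :* z :+ z) refl (fromℕ n) z))
      (trans (E-+ (fromℕ n * z) z) (*-congʳ (E-^ n z)))

    -- E z is the power of exponent n + 1 of E (z / (n + 1)).
    E-root : ∀ {z ρ} n → E (unit n * z) ≼ ρ → E z ≼ ρ ^ℚ suc n
    E-root {z} n p = ≼-resp (trans (sym (E-^ (suc n) (unit n * z))) (E-cong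
      (trans (sym (*-assoc (fromℕ (suc n)) (unit n) z)) (trans (*-congʳ (unit-law n)) (*-identityˡ z))))) (^-≼ p (suc n))

-- Unconditional sums

-- A list without repetition that is contained in G can be split off from G.
split-⊆ : {I : Set} {F G : List I} → Unique F → F ⊆ G → ∃[ G′ ] G ↭ F ++ G′
split-⊆ {F = []}    {G} _ _ = G , Perm.refl
split-⊆ {F = x ∷ F} {G} (x∉F ∷ F!) F⊆G with ∈-∃++ (F⊆G (here ≡.refl))
... | ys , zs , ≡.refl =
  let (G′ , p) = split-⊆ F! (λ {y} y∈F → strip y∈F (∈-resp-↭ (↭-shift x ys zs) (F⊆G (there y∈F))))
  in G′ , Perm.trans (↭-shift x ys zs) (Perm.prep x p)
  where
  strip : ∀ {y} → y ∈ F → y ∈ x ∷ ys ++ zs → y ∈ ys ++ zs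
  strip y∈F (here ≡.refl) = contradiction ≡.refl (All.lookup x∉F y∈F)
  strip y∈F (there m)     = m

-- Sums of arbitrary families, along the finite subsets of the index set.
module UnconditionalSums (𝔸 : NormedRing) where
  open NormedRing 𝔸
  open IntegerCoefficients commutativeRing
  open RationalEstimates
  open Limits 𝔸
  open SetoidReasoning setoid
  open FiniteSum ℚₚ.+-*-commutativeRing using () renaming (sumL to sumLℚ; sumL-++ to sumLℚ-++; sumL-↭ to sumLℚ-↭)

  -- A is the limit of the finite sums of f along the finite subsets of I.
  HasSum : {I : Set} → (I → Carrier) → Carrier → Set
  HasSum {I} f A = ∀ ε → 0ℚ ℚ.< ε → Σ[ F ∈ List I ] ∀ G → Unique G → F ⊆ G → sumL f G - A ≼ ε

  HasSum-cong : {I : Set} {f g : I → Carrier} {A B : Carrier} → (∀ i → f i ≈ g i) → A ≈ B → HasSum f A → HasSum g B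
  HasSum-cong e e′ h ε ε>0 = let (F , p) = h ε ε>0 in
    F , λ G G! F⊆G → ≼-resp (+-cong (sumL-cong G (λ {i} _ → e i)) (-‿cong e′)) (p G G! F⊆G)

  HasSum-* : {I : Set} {f : I → Carrier} {A : Carrier} → ∀ c → HasSum f A → HasSum (λ i → c * f i) (c * A)
  HasSum-* {f = f} {A} c h ε ε>0 =
    let (W , w) = ≼-bounded c
        (δ , δ>0 , le) = shrink W ε>0 (≼-nonneg w)
        (F , p) = h δ δ>0
    in F , λ G G! F⊆G → ≼-resp
         (trans (solve 3 (λ c s a → c :* (s :- a) := c :* s :- c :* a) refl c (sumL f G) A) (+-congʳ (sym (sumL-* c f G))))
         (≼-mono (ℚₚ.≤-trans (ℚₚ.≤-reflexive (ℚₚ.*-comm W δ)) le) (≼-* w (p G G! F⊆G)))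

  sumL-≼ : {I : Set} {f : I → Carrier} {g : I → ℚ} → (∀ i → f i ≼ g i) → ∀ G → sumL f G ≼ sumLℚ g G
  sumL-≼ b []      = ≼-0
  sumL-≼ b (i ∷ G) = ≼-+ (b i) (sumL-≼ b G)

  sumLℚ-nonneg : {I : Set} {f : I → Carrier} {g : I → ℚ} → (∀ i → f i ≼ g i) → ∀ G → 0ℚ ℚ.≤ sumLℚ g G
  sumLℚ-nonneg b G = ≼-nonneg (sumL-≼ b G)

  -- A family that vanishes outside the image of an injection φ has the same sum as its
  -- restriction along φ; ψ is the partial inverse of φ.
  module Reindex {I J : Set} (φ : J → I) (ψ : I → Maybe J)
    (ψ-just : ∀ {i j} → ψ i ≡ just j → i ≡ φ j) (ψ-φ : ∀ j → ψ (φ j) ≡ just j)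
    (f : I → Carrier) (f-nothing : ∀ i → ψ i ≡ nothing → f i ≈ 0#) where

    private
      -- The indices j with φ j in a given list.
      collect : List I → List J
      collect []      = []
      collect (i ∷ G) with ψ i
      ... | just j  = j ∷ collect G
      ... | nothing = collect G

      collect-sum : ∀ G → sumL (f ∘ φ) (collect G) ≈ sumL f G
      collect-sum []      = refl
      collect-sum (i ∷ G) with ψ i in eq
      ... | just j  = +-cong (reflexive (cong f (≡.sym (ψ-just eq)))) (collect-sum G)
      ... | nothing = trans (collect-sum G) (sym (trans (+-congʳ (f-nothing i eq)) (+-identityˡ (sumL f G))))

      ∈-collect : ∀ {j} G → φ j ∈ G → j ∈ collect G
      ∈-collect {j} (i ∷ G) (here ≡.refl) with ψ (φ j) | ψ-φ j
      ... | just _ | ≡.refl = here ≡.refl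
      ∈-collect {j} (i ∷ G) (there m) with ψ i
      ... | just _  = there (∈-collect G m)
      ... | nothing = ∈-collect G m

      collect-∈ : ∀ {j} G → j ∈ collect G → φ j ∈ G
      collect-∈ (i ∷ G) m with ψ i in eq
      collect-∈ (i ∷ G) (here ≡.refl) | just j  = here (≡.sym (ψ-just eq))
      collect-∈ (i ∷ G) (there m)     | just _  = there (collect-∈ G m)
      collect-∈ (i ∷ G) m             | nothing = there (collect-∈ G m)

      collect-unique : ∀ {G} → Unique G → Unique (collect G)
      collect-unique {[]}    [] = []
      collect-unique {i ∷ G} (i∉G ∷ G!) with ψ i in eq
      ... | just j  = All.tabulate (λ {j′} m e → All.lookup i∉G (collect-∈ G m) (≡.trans (ψ-just eq) (cong φ e))) ∷ collect-unique G!
      ... | nothing = collect-unique G!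

    HasSum-reindex : ∀ {A} → HasSum (f ∘ φ) A → HasSum f A
    HasSum-reindex h ε ε>0 = let (F , p) = h ε ε>0 in
      List.map φ F , λ G G! F⊆G → ≼-resp (+-congʳ (collect-sum G))
        (p (collect G) (collect-unique G!) (λ j∈F → ∈-collect G (F⊆G (∈-map⁺ φ j∈F))))

  -- Summation by levels: deg grades the index set, level s lists the indices of degree s, and
  -- the family is dominated by g, whose sum over level s is at most C / 2ˢ.
  module Graded {I : Set} (deg : I → ℕ) (level : ℕ → List I) (∈-level : ∀ i → i ∈ level (deg i))
    (level-deg : ∀ s {i} → i ∈ level s → deg i ≡ s) (level-unique : ∀ s → Unique (level s))
    (f : I → Carrier) (g : I → ℚ) (f-≼ : ∀ i → f i ≼ g i)
    (C : ℚ) (C≥0 : 0ℚ ℚ.≤ C) (level-bound : ∀ s → sumLℚ g (level s) ℚ.≤ C ℚ.* ½ ^ℚ s) where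

    private
      -- The indices of degree less than n.
      below : ℕ → List I
      below zero    = []
      below (suc n) = below n ++ level n

      below-sum : ∀ n → sumL f (below n) ≈ ∑ n (λ s → sumL f (level s))
      below-sum zero    = refl
      below-sum (suc n) = trans (sumL-++ f (below n) (level n)) (+-congʳ (below-sum n))

      ∈-below : ∀ {i} n → deg i ℕ.< n → i ∈ below n
      ∈-below {i} (suc n) (s≤s le) with ℕₚ.m≤n⇒m<n∨m≡n le
      ... | inj₁ lt     = ∈-++⁺ˡ (∈-below n lt)
      ... | inj₂ ≡.refl = ∈-++⁺ʳ (below n) (∈-level i)

      below-∈ : ∀ {i} n → i ∈ below n → deg i ℕ.< n
      below-∈ (suc n) m with ∈-++⁻ (below n) m
      ... | inj₁ m′ = ℕₚ.m<n⇒m<1+n (below-∈ n m′)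
      ... | inj₂ m′ = s≤s (ℕₚ.≤-reflexive (level-deg n m′))

      below-unique : ∀ n → Unique (below n)
      below-unique zero    = []
      below-unique (suc n) = ++⁺ (below-unique n) (level-unique n)
        (λ (m , m′) → ℕₚ.<-irrefl (level-deg n m′) (below-∈ n m))

      top : List I → ℕ
      top []      = 0
      top (i ∷ G) = suc (deg i) ℕ.⊔ top G

      top-bound : ∀ {i} G → i ∈ G → deg i ℕ.< top G
      top-bound (i ∷ G) (here ≡.refl) = ℕₚ.m≤m⊔n (suc (deg i)) (top G)
      top-bound (i ∷ G) (there m)     = ℕₚ.≤-trans (top-bound G m) (ℕₚ.m≤n⊔m (suc (deg i)) (top G))

      2C : ℚ
      2C = C ℚ.* 2ℚ

      2C≥0 : 0ℚ ℚ.≤ 2C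
      2C≥0 = 0≤* C≥0 0≤2

      -- The dominating sum over a level is at most the drop of the bound 2C / 2ⁿ.
      growth : ∀ M d → sumLℚ g (below (d ℕ.+ M)) ℚ.+ 2C ℚ.* ½ ^ℚ (d ℕ.+ M) ℚ.≤ sumLℚ g (below M) ℚ.+ 2C ℚ.* ½ ^ℚ M
      growth M zero    = ℚₚ.≤-refl
      growth M (suc d) = ℚₚ.≤-trans
        (ℚₚ.+-monoˡ-≤ (2C ℚ.* ½ ^ℚ suc (d ℕ.+ M))
          (ℚₚ.≤-trans (ℚₚ.≤-reflexive (sumLℚ-++ g (below (d ℕ.+ M)) (level (d ℕ.+ M))))
            (ℚₚ.+-monoʳ-≤ (sumLℚ g (below (d ℕ.+ M))) (level-bound (d ℕ.+ M)))))
        (ℚₚ.≤-trans (ℚₚ.≤-reflexive (regroup (sumLℚ g (below (d ℕ.+ M))) C (½ ^ℚ (d ℕ.+ M)))) (growth M d))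
        where
        regroup : ∀ s c h → s ℚ.+ c ℚ.* h ℚ.+ c ℚ.* 2ℚ ℚ.* (h ℚ.* ½) ≡ s ℚ.+ c ℚ.* 2ℚ ℚ.* h
        regroup = ℚS.solve 3 (λ s c h → s ℚS.:+ c ℚS.:* h ℚS.:+ c ℚS.:* ℚS.con 2ℚ ℚS.:* (h ℚS.:* ℚS.con ½)
          ℚS.:= s ℚS.:+ c ℚS.:* ℚS.con 2ℚ ℚS.:* h) ≡.refl

      -- The dominating sum over any finite set disjoint from below M.
      remainder : ∀ M {G G′} → Unique G → G ↭ below M ++ G′ → sumLℚ g G′ ℚ.≤ 2C ℚ.* ½ ^ℚ M
      remainder M {G} {G′} G! p =
        let (G″ , r) = split-⊆ {G = below (top G ℕ.+ M)} G!
              (λ i∈G → ∈-below (top G ℕ.+ M) (ℕₚ.≤-trans (top-bound G i∈G) (ℕₚ.m≤m+n (top G) M)))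
        in ≤-by′ (sumLℚ g (below M)) (sumLℚ g G′) (sumLℚ g G″) (2C ℚ.* ½ ^ℚ M) (2C ℚ.* ½ ^ℚ (top G ℕ.+ M))
             (0≤+ (sumLℚ-nonneg f-≼ G″) (0≤* 2C≥0 (^-nonneg 0≤½ (top G ℕ.+ M))))
             (ℚₚ.≤-trans (ℚₚ.≤-reflexive (cong (ℚ._+ 2C ℚ.* ½ ^ℚ (top G ℕ.+ M)) (≡.sym
                 (≡.trans (sumLℚ-↭ g r) (≡.trans (sumLℚ-++ g G G″) (cong (ℚ._+ sumLℚ g G″)
                   (≡.trans (sumLℚ-↭ g p) (sumLℚ-++ g (below M) G′)))))))) (growth M (top G)))
        where
        ≤-by′ : ∀ a b c t r → 0ℚ ℚ.≤ c ℚ.+ r → a ℚ.+ b ℚ.+ c ℚ.+ r ℚ.≤ a ℚ.+ t → b ℚ.≤ t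
        ≤-by′ a b c t r c+r≥0 le = ≤-by (c ℚ.+ r ℚ.+ ((a ℚ.+ t) ℚ.- (a ℚ.+ b ℚ.+ c ℚ.+ r))) (0≤+ c+r≥0 (0≤- le))
          (ℚS.solve 5 (λ a b c t r → t ℚS.:= b ℚS.:+ (c ℚS.:+ r ℚS.:+ ((a ℚS.:+ t) ℚS.:- (a ℚS.:+ b ℚS.:+ c ℚS.:+ r)))) ≡.refl a b c t r)

    HasSum-graded : ∀ {A} → Seq-Conv (λ n → ∑ n (λ s → sumL f (level s))) A → HasSum f A
    HasSum-graded {A} c ε ε>0 =
      let (K , p) = c (½ ℚ.* ε) (half-pos ε>0)
          (L , small) = Ratio.powers→0 ½ 0≤½ ½<1 2C 2C≥0 (½ ℚ.* ε) (half-pos ε>0)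
      in below (K ℕ.⊔ L) , λ G G! F⊆G →
           finish (K ℕ.⊔ L) ε (p (K ℕ.⊔ L) (ℕₚ.m≤m⊔n K L)) (small (K ℕ.⊔ L) (ℕₚ.m≤n⊔m K L)) G G! F⊆G
      where
      finish : ∀ M ε → ∑ M (λ s → sumL f (level s)) - A ≼ ½ ℚ.* ε → 2C ℚ.* ½ ^ℚ M ℚ.≤ ½ ℚ.* ε →
        ∀ G → Unique G → below M ⊆ G → sumL f G - A ≼ ε
      finish M ε near small G G! F⊆G = let (G′ , p) = split-⊆ (below-unique M) F⊆G in ≼-resp
        (begin
          (∑ M (λ s → sumL f (level s)) - A) + sumL f G′   ≈⟨ +-congʳ (+-congʳ (below-sum M)) ⟨
          (sumL f (below M) - A) + sumL f G′               ≈⟨ solve 3 (λ a b c → a :- b :+ c := a :+ c :- b) refl (sumL f (below M)) A (sumL f G′) ⟩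
          (sumL f (below M) + sumL f G′) - A               ≈⟨ +-congʳ (sumL-++ f (below M) G′) ⟨
          sumL f (below M ++ G′) - A                       ≈⟨ +-congʳ (sumL-↭ f p) ⟨
          sumL f G - A                                     ∎)
        (subst (_ ≼_) (halves ε) (≼-+ near (≼-mono (ℚₚ.≤-trans (remainder M G! p) small) (sumL-≼ f-≼ G′))))

  -- Series indexed by the natural numbers.
  HasSum-series : ∀ {f C A} → 0ℚ ℚ.≤ C → (∀ n → f n ≼ C ℚ.* ½ ^ℚ n) → Seq-Conv (λ n → ∑ n f) A → HasSum f A
  HasSum-series {f} {C} C≥0 b c = Graded.HasSum-graded id (λ s → s ∷ []) (λ i → here ≡.refl)
    (λ { s (here e) → e }) (λ s → [] ∷ []) f (λ n → C ℚ.* ½ ^ℚ n) b C C≥0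
    (λ s → ℚₚ.≤-reflexive (ℚₚ.+-identityʳ (C ℚ.* ½ ^ℚ s)))
    (Conv-cong (λ n → ∑-cong n (λ j _ → sym (+-identityʳ (f j)))) refl c)

-- The q-series and their limits

-- spread h s lists the vectors x ∷ v with v in h j and x + j = s.
spread : ∀ {κ} → (ℕ → List (Vec ℕ κ)) → ℕ → List (Vec ℕ (suc κ))
spread h zero    = List.map (0 ∷_) (h 0)
spread h (suc s) = List.map (suc s ∷_) (h 0) ++ spread (h ∘ suc) s

-- level κ s lists the vectors of length κ + 1 and sum s.
level : ∀ κ → ℕ → List (Vec ℕ (suc κ))
level zero    s = (s ∷ []) ∷ []
level (suc κ) s = spread (level κ) s

-- The levels partition the vectors by their sums.
∈-spread : ∀ {κ} (h : ℕ → List (Vec ℕ κ)) x j {v} → v ∈ h j → x ∷ v ∈ spread h (x ℕ.+ j)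
∈-spread h zero    zero    m = ∈-map⁺ (0 ∷_) m
∈-spread h (suc x) zero    m rewrite ℕₚ.+-identityʳ x = ∈-++⁺ˡ (∈-map⁺ (suc x ∷_) m)
∈-spread h zero    (suc j) m = ∈-++⁺ʳ (List.map (suc j ∷_) (h 0)) (∈-spread (h ∘ suc) zero j m)
∈-spread h (suc x) (suc j) {v} m = ∈-++⁺ʳ (List.map (suc (x ℕ.+ suc j) ∷_) (h 0))
  (subst (λ s → suc x ∷ v ∈ spread (h ∘ suc) s) (≡.sym (ℕₚ.+-suc x j)) (∈-spread (h ∘ suc) (suc x) j m))

spread-∈ : ∀ {κ} (h : ℕ → List (Vec ℕ κ)) s {x v} → x ∷ v ∈ spread h s → ∃[ j ] (x ℕ.+ j ≡ s × v ∈ h j)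
spread-∈ h zero    m with ∈-map⁻ (0 ∷_) m
... | _ , m′ , ≡.refl = 0 , ≡.refl , m′
spread-∈ h (suc s) m with ∈-++⁻ (List.map (suc s ∷_) (h 0)) m
... | inj₂ m′ = let (j , e , m″) = spread-∈ (h ∘ suc) s m′ in suc j , ≡.trans (ℕₚ.+-suc _ j) (cong suc e) , m″
... | inj₁ m′ with ∈-map⁻ (suc s ∷_) m′
...   | _ , m″ , ≡.refl = 0 , ℕₚ.+-identityʳ (suc s) , m″

spread-unique : ∀ {κ} (h : ℕ → List (Vec ℕ κ)) → (∀ j → Unique (h j)) → ∀ s → Unique (spread h s)
spread-unique h h! zero    = map⁺ ∷-injectiveʳ (h! 0)
spread-unique h h! (suc s) = ++⁺ (map⁺ ∷-injectiveʳ (h! 0)) (spread-unique (h ∘ suc) (h! ∘ suc) s) disjoint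
  where
  disjoint : ∀ {v} → v ∈ List.map (suc s ∷_) (h 0) × v ∈ spread (h ∘ suc) s → ⊥
  disjoint {x ∷ v} (m , m′) with ∈-map⁻ (suc s ∷_) m | spread-∈ (h ∘ suc) s m′
  ... | _ , _ , ≡.refl | j , e , _ = ℕₚ.<-irrefl (≡.sym e) (ℕₚ.≤-trans (ℕₚ.n<1+n s) (ℕₚ.m≤m+n (suc s) j))

∈-level : ∀ {κ} (v : Vec ℕ (suc κ)) → v ∈ level κ (Vec.sum v)
∈-level {zero}  (x ∷ [])    = here (cong (_∷ []) (≡.sym (ℕₚ.+-identityʳ x)))
∈-level {suc κ} (x ∷ v)     = ∈-spread (level κ) x (Vec.sum v) (∈-level v)

level-sum : ∀ κ s {v} → v ∈ level κ s → Vec.sum v ≡ s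
level-sum zero    s (here ≡.refl) = ℕₚ.+-identityʳ s
level-sum (suc κ) s {x ∷ v} m with spread-∈ (level κ) s m
... | j , e , m′ = ≡.trans (cong (x ℕ.+_) (level-sum κ j m′)) e

level-unique : ∀ κ s → Unique (level κ s)
level-unique zero    s = [] ∷ []
level-unique (suc κ) s = spread-unique (level κ) (level-unique κ) s

-- The q-series over a complete normed ring, for q of norm at most ρ < 1.
module ThetaLimit (𝔸 : NormedRing) (q : NormedRing.Carrier 𝔸) (ρ : ℚ) (ρ<1 : ρ ℚ.< 1ℚ) (q≼ρ : NormedRing._≼_ 𝔸 q ρ) where
  open NormedRing 𝔸
  open IntegerCoefficients commutativeRing
  open RationalEstimates
  open Limits 𝔸
  open UnconditionalSums 𝔸
  open SetoidReasoning setoid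
  open FiniteSum ℚₚ.+-*-commutativeRing using () renaming (sumL to sumLℚ; sumL-++ to sumLℚ-++; sumL-* to sumLℚ-*; sumL-cong to sumLℚ-cong)

  ρ≥0 : 0ℚ ℚ.≤ ρ
  ρ≥0 = ≼-nonneg q≼ρ

  open Ratio ρ ρ≥0 ρ<1
  open Series ρ ρ≥0 ρ<1

  q^-≼ : ∀ n → q ^ n ≼ ρ ^ℚ n
  q^-≼ = ^-≼ q≼ρ

  q^suc-≼ : ∀ n → q ^ suc n ≼ ρ ^ℚ n
  q^suc-≼ n = ≼-mono (^-≤-suc ρ≥0 x≤1 n) (q^-≼ (suc n))

  q^-≼1 : ∀ n → q ^ n ≼ 1ℚ
  q^-≼1 n = ≼-mono (^-≤1 ρ≥0 x≤1 n) (q^-≼ n)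

  q^suc-≼ρ : ∀ n → q ^ suc n ≼ ρ
  q^suc-≼ρ n = ≼-mono (ℚₚ.≤-trans (*-monoʳ ρ≥0 (^-≤1 ρ≥0 x≤1 n)) (ℚₚ.≤-reflexive (ℚₚ.*-identityˡ ρ))) (q^-≼ (suc n))

  -- 1/(1 - q ^ (m + 1)).
  inv : ℕ → Carrier
  inv m = proj₁ (inverse (q^suc-≼ρ m))

  inv-law : ∀ m → (1# - q ^ suc m) * inv m ≈ 1#
  inv-law m = proj₁ (proj₂ (inverse (q^suc-≼ρ m)))

  open QSeries commutativeRing q inv inv-law public

  -- poch⁻ n is (q)_n.
  poch⁻ : ℕ → Carrier
  poch⁻ zero    = 1#
  poch⁻ (suc n) = poch⁻ n * (1# - q ^ suc n)

  poch⁻-rr : ∀ n → poch⁻ n * rr n ≈ 1#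
  poch⁻-rr zero    = *-identityˡ 1#
  poch⁻-rr (suc n) = trans
    (solve 4 (λ a b c d → a :* b :* (c :* d) := a :* c :* (b :* d)) refl (poch⁻ n) (1# - q ^ suc n) (rr n) (inv n))
    (trans (*-cong (poch⁻-rr n) (inv-law n)) (*-identityˡ 1#))

  1*ρ : ∀ j {x} → x ≼ ρ ^ℚ j → x ≼ 1ℚ ℚ.* ρ ^ℚ j
  1*ρ j {x} = subst (x ≼_) (≡.sym (ℚₚ.*-identityˡ (ρ ^ℚ j)))

  -- The products (-q)_n, (q)_n and 1/(q)_n, the last with factors 1/(1 - x) = 1 + x/(1 - x).
  module Poch⁺ = Product (λ j → q ^ suc j) 1ℚ 0≤1 (λ j → 1*ρ j (q^suc-≼ j)) poch⁺ refl (λ n → refl)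
  module Poch⁻ = Product (λ j → - q ^ suc j) 1ℚ 0≤1 (λ j → 1*ρ j (≼-neg (q^suc-≼ j))) poch⁻ refl (λ n → refl)
  module RR = Product (λ j → q ^ suc j * inv j) γ γ≥0
    (λ j → ≼-mono (ℚₚ.≤-reflexive (ℚₚ.*-comm (ρ ^ℚ j) γ)) (≼-* (q^suc-≼ j) (proj₂ (proj₂ (inverse (q^suc-≼ρ j))))))
    rr refl (λ n → *-congˡ (trans
      (solve 2 (λ x i → i := (con (+ 1) :- x) :* i :+ x :* i) refl (q ^ suc n) (inv n)) (+-congʳ (inv-law n))))

  -- The infinite products (-q)_∞, (q)_∞ and 1/(q)_∞.
  P Q R : Carrier
  P = proj₁ Poch⁺.u-converges
  Q = proj₁ Poch⁻.u-converges
  R = proj₁ RR.u-converges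

  poch⁺→P : Seq-Conv poch⁺ P
  poch⁺→P = proj₂ Poch⁺.u-converges

  poch⁻→Q : Seq-Conv poch⁻ Q
  poch⁻→Q = proj₂ Poch⁻.u-converges

  rr→R : Seq-Conv rr R
  rr→R = proj₂ RR.u-converges

  QR : Q * R ≈ 1#
  QR = limit-unique (Conv-* poch⁻→Q rr→R) (Conv-cong (λ n → sym (poch⁻-rr n)) refl (Conv-const {ω = 1#}))

  -- Convergence in the gap d = S - s, uniformly in s ≤ S, in the form used by dominated convergence.
  gap : ∀ {ω} (w : ℕ → ℕ → Carrier) → Conv (proj₂ {A = ℕ} {B = λ _ → ℕ}) (λ (s , d) → w (s ℕ.+ d) s) ω →
    ∀ ε → 0ℚ ℚ.< ε → ∃[ K ] ∀ S s → s ℕ.+ K ≤ S → w S s - ω ≼ ε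
  gap {ω} w c ε ε>0 = let (K , p) = c ε ε>0 in K , λ S s le →
    subst (λ n → w n s - ω ≼ ε) (ℕₚ.m+[n∸m]≡n (ℕₚ.≤-trans (ℕₚ.m≤m+n s K) le))
      (p (s , S ℕ.∸ s) (ℕₚ.m+n≤o⇒m≤o∸n K (ℕₚ.≤-trans (ℕₚ.≤-reflexive (ℕₚ.+-comm K s)) le)))

  private
    Gap : (ℕ × ℕ → Carrier) → Carrier → Set
    Gap = Conv proj₂

  poch⁻-gap : Gap (λ (s , d) → poch⁻ (s ℕ.+ d)) Q
  poch⁻-gap = Conv-pull (λ (s , d) → s ℕ.+ d) (λ (s , d) → ℕₚ.m≤n+m d s) poch⁻→Q

  rr-gap : Gap (λ (s , d) → rr d) R
  rr-gap = Conv-pull proj₂ (λ _ → ℕₚ.≤-refl) rr→R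

  -- (q)_S kernel c s S tends to (q)_∞ / (q)_∞² as S - s grows, uniformly in s.
  kernel-gap : ∀ c → Gap (λ (s , d) → poch⁻ (s ℕ.+ d) * kernel c s (s ℕ.+ d)) R
  kernel-gap c = Conv-cong {x = λ (s , d) → poch⁻ (s ℕ.+ d) * (rr d * rr (c ℕ.+ (s ℕ.+ (s ℕ.+ d))))}
    (λ (s , d) → *-congˡ (reflexive (≡.sym (kernel-value c s d))))
    (trans (sym (*-assoc Q R R)) (trans (*-congʳ QR) (*-identityˡ R)))
    (Conv-* poch⁻-gap (Conv-* rr-gap (Conv-pull (λ (s , d) → c ℕ.+ (s ℕ.+ (s ℕ.+ d)))
      (λ (s , d) → ℕₚ.≤-trans (ℕₚ.m≤n+m d s) (ℕₚ.≤-trans (ℕₚ.m≤n+m (s ℕ.+ d) s) (ℕₚ.m≤n+m (s ℕ.+ (s ℕ.+ d)) c))) rr→R)))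

  kernel-≼ : ∀ c t s → kernel c t s ≼ RR.B ℚ.* RR.B
  kernel-≼ c zero    s       = ≼-* (RR.u-bound s) (RR.u-bound (c ℕ.+ s))
  kernel-≼ c (suc t) zero    = ≼-mono (0≤* RR.B≥0 RR.B≥0) ≼-0
  kernel-≼ c (suc t) (suc s) = kernel-≼ (suc (suc c)) t s

  -- Quadratic exponents give faster than geometric decay: the ratios ρ ^ n tend to 0.
  quadratic-decay : ∀ θ Θ → 0ℚ ℚ.< θ → 0ℚ ℚ.≤ Θ → Θ ℚ.* θ ≡ 1ℚ → ∃[ C ] (0ℚ ℚ.≤ C × ∀ n → ρ ^ℚ tri n ℚ.≤ C ℚ.* θ ^ℚ n)
  quadratic-decay θ Θ θ>0 Θ≥0 e =
    let (J , small) = powers→0 1ℚ 0≤1 θ θ>0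
    in ratio-test θ Θ (ℚₚ.<⇒≤ θ>0) Θ≥0 e J (λ n → ρ ^ℚ tri n) (λ n → ^-nonneg ρ≥0 (tri n))
         (λ n J≤n → ℚₚ.≤-trans (ℚₚ.≤-reflexive (FiniteSum.^-+ ℚₚ.+-*-commutativeRing ρ (tri n) n))
           (*-monoˡ (^-nonneg ρ≥0 (tri n)) (ℚₚ.≤-trans (ℚₚ.≤-reflexive (≡.sym (ℚₚ.*-identityˡ (ρ ^ℚ n)))) (small n J≤n))))

  q^tri-≼ : ∀ m n → tri n ≤ m → q ^ m ≼ ρ ^ℚ tri n
  q^tri-≼ m n le = ≼-mono (^-antitone ρ≥0 x≤1 le) (q^-≼ m)

  tri-decay¼ : ∃[ C ] (0ℚ ℚ.≤ C × ∀ n → ρ ^ℚ tri n ℚ.≤ C ℚ.* ¼ ^ℚ n)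
  tri-decay¼ = quadratic-decay ¼ (+ 4 ℚ./ 1) (ℚₚ.positive⁻¹ ¼) (ℚₚ.nonNegative⁻¹ (+ 4 ℚ./ 1)) ≡.refl

  tri-decay⅛ : ∃[ C ] (0ℚ ℚ.≤ C × ∀ n → ρ ^ℚ tri n ℚ.≤ C ℚ.* ⅛ ^ℚ n)
  tri-decay⅛ = quadratic-decay ⅛ (+ 8 ℚ./ 1) (ℚₚ.positive⁻¹ ⅛) (ℚₚ.nonNegative⁻¹ (+ 8 ℚ./ 1)) ≡.refl

  C₄ C₈ : ℚ
  C₄ = proj₁ tri-decay¼
  C₈ = proj₁ tri-decay⅛

  C₄≥0 : 0ℚ ℚ.≤ C₄
  C₄≥0 = proj₁ (proj₂ tri-decay¼)

  C₈≥0 : 0ℚ ℚ.≤ C₈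
  C₈≥0 = proj₁ (proj₂ tri-decay⅛)

  -- A power of q whose exponent is at least quadratic.
  quadratic-≼ : ∀ {m} n → tri n ≤ m → q ^ m ≼ C₄ ℚ.* ¼ ^ℚ n
  quadratic-≼ {m} n le = ≼-mono (proj₂ (proj₂ tri-decay¼) n) (q^tri-≼ m n le)

  ¼≤½ : ∀ n → ¼ ^ℚ n ℚ.≤ ½ ^ℚ n
  ¼≤½ zero    = ℚₚ.≤-refl
  ¼≤½ (suc n) = *-mono-nonNeg (ℚₚ.nonNegative⁻¹ ¼) (^-nonneg 0≤½ n) (¼≤½ n)
    (≤-by ¼ (ℚₚ.nonNegative⁻¹ ¼) ≡.refl)

  -- The series of a family dominated by C / 4ⁿ, as a limit and as an unconditional sum.
  module Sum¼ (f : ℕ → Carrier) (C : ℚ) (C≥0 : 0ℚ ℚ.≤ C) (b : ∀ n → f n ≼ C ℚ.* ¼ ^ℚ n) where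
    private
      b½ : ∀ n → f n ≼ C ℚ.* ½ ^ℚ n
      b½ n = ≼-mono (*-monoˡ C≥0 (¼≤½ n)) (b n)

      value : ∃[ S ] Seq-Conv (λ n → ∑ n f) S
      value = Series.series-converges ½ 0≤½ ½<1 f C C≥0 b½

    S : Carrier
    S = proj₁ value

    ∑→S : Seq-Conv (λ n → ∑ n f) S
    ∑→S = proj₂ value

    hasSum : ∀ {A} → Seq-Conv (λ n → ∑ n f) A → HasSum f A
    hasSum = HasSum-series C≥0 b½

  -- The summands of the multiple sum.

  -- 1/((q)_{n₁} ⋯ (q)_{n_k} (q)_{n_k + c}).
  denominators : (c : ℕ) → ∀ {κ} → Vec ℕ (suc κ) → Carrier
  denominators c (x ∷ [])    = rr x * rr (c ℕ.+ x)
  denominators c (x ∷ y ∷ v) = rr x * denominators c (y ∷ v)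

  -- The summand of the multiple sum, for ℓ = p and c = 2 p.
  summand : (p c i : ℕ) → ∀ {κ} → Vec ℕ (suc κ) → Carrier
  summand p c i v = q ^ fullExponent p c i v * (poch⁺ (p ℕ.+ Vec.sum v) * denominators c v)

  -- The summand without the power of q that belongs to N₁ and without (-q)_{N₁+ℓ}.
  inner : (c i : ℕ) → ∀ {κ} → Vec ℕ (suc κ) → Carrier
  inner c i (x ∷ v) = q ^ tailExponent c i v * denominators c (x ∷ v)

  sumL-map : {A B : Set} (f : B → Carrier) (g : A → B) (xs : List A) → sumL f (List.map g xs) ≈ sumL (f ∘ g) xs
  sumL-map f g []       = refl
  sumL-map f g (x ∷ xs) = +-congˡ (sumL-map f g xs)

  -- Summation over a spread is a convolution.
  sumL-spread : ∀ {κ} (f : Vec ℕ (suc κ) → Carrier) (r : ℕ → Carrier) (g : Vec ℕ κ → Carrier) →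
    (∀ x v → f (x ∷ v) ≈ r x * g v) → ∀ h s → sumL f (spread h s) ≈ conv r (λ j → sumL g (h j)) s
  sumL-spread f r g e h zero    = trans (sumL-map f (0 ∷_) (h 0))
    (trans (sumL-cong (h 0) (λ {v} _ → e 0 v)) (sumL-* (r 0) g (h 0)))
  sumL-spread f r g e h (suc s) = trans (sumL-++ f (List.map (suc s ∷_) (h 0)) (spread (h ∘ suc) s))
    (+-cong (trans (sumL-map f (suc s ∷_) (h 0)) (trans (sumL-cong (h 0) (λ {v} _ → e (suc s) v)) (sumL-* (r (suc s)) g (h 0))))
      (sumL-spread f r g e (h ∘ suc) s))

  inner-sum : ∀ c i κ s → sumL (inner c i) (level κ s) ≈ β c i κ s
  inner-sum c i zero    s = trans (+-identityʳ (1# * (rr s * rr (c ℕ.+ s)))) (*-identityˡ (rr s * rr (c ℕ.+ s)))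
  inner-sum c i (suc κ) s = trans
    (sumL-spread (inner c i) rr (λ v → q ^ weight c i κ (Vec.sum v) * inner c i v) split (level κ) s)
    (conv-congʳ s (λ j _ → trans
      (sumL-cong (level κ j) (λ {v} m → *-congʳ (^-≡ q (cong (weight c i κ) (level-sum κ j m)))))
      (trans (sumL-* (q ^ weight c i κ j) (inner c i) (level κ j)) (*-congˡ (inner-sum c i κ j)))))
    where
    split : ∀ x v → inner c i (x ∷ v) ≈ rr x * (q ^ weight c i κ (Vec.sum v) * inner c i v)
    split x (y ∷ v) = trans (*-congʳ (^-+ q (weight c i κ (Vec.sum (y ∷ v))) (tailExponent c i v)))
      (solve 4 (λ a b r d → a :* b :* (r :* d) := r :* (a :* (b :* d))) refl
        (q ^ weight c i κ (Vec.sum (y ∷ v))) (q ^ tailExponent c i v) (rr x) (denominators c (y ∷ v)))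

  summand-sum : ∀ p c i κ s → sumL (summand p c i) (level κ s) ≈ levelSum p c i κ s
  summand-sum p c i κ s = trans (sumL-cong (level κ s) (λ {v} m → pointwise v (level-sum κ s m)))
    (trans (sumL-* (w * poch⁺ (p ℕ.+ s)) (inner c i) (level κ s))
      (trans (*-congˡ (inner-sum c i κ s)) (*-assoc w (poch⁺ (p ℕ.+ s)) (β c i κ s))))
    where
    w = q ^ (tri s ℕ.+ p ℕ.* s ℕ.+ bump i κ ℕ.* s)
    pointwise : ∀ (v : Vec ℕ (suc κ)) → Vec.sum v ≡ s → summand p c i v ≈ w * poch⁺ (p ℕ.+ s) * inner c i v
    pointwise (x ∷ v) ≡.refl = trans (*-congʳ (^-+ q (tri s ℕ.+ p ℕ.* s ℕ.+ bump i κ ℕ.* s) (tailExponent c i v)))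
      (solve 4 (λ a b r d → a :* b :* (r :* d) := a :* r :* (b :* d)) refl
        w (q ^ tailExponent c i v) (poch⁺ (p ℕ.+ s)) (denominators c (x ∷ v)))

  -- Bounds for the summands.

  denominators-bound : ℕ → ℚ
  denominators-bound zero    = RR.B ℚ.* RR.B
  denominators-bound (suc κ) = RR.B ℚ.* denominators-bound κ

  denominators-≼ : ∀ c {κ} (v : Vec ℕ (suc κ)) → denominators c v ≼ denominators-bound κ
  denominators-≼ c (x ∷ [])    = ≼-* (RR.u-bound x) (RR.u-bound (c ℕ.+ x))
  denominators-≼ c (x ∷ y ∷ v) = ≼-* (RR.u-bound x) (denominators-≼ c (y ∷ v))

  module Bound (p c i κ : ℕ) where

    D : ℚ
    D = C₈ ℚ.* (Poch⁺.B ℚ.* denominators-bound κ)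

    D≥0 : 0ℚ ℚ.≤ D
    D≥0 = 0≤* C₈≥0 (0≤* Poch⁺.B≥0 (≼-nonneg (denominators-≼ c {κ} (Vec.replicate (suc κ) 0))))

    size : Vec ℕ (suc κ) → ℚ
    size v = D ℚ.* ⅛ ^ℚ Vec.sum v

    summand-≼ : ∀ v → summand p c i v ≼ size v
    summand-≼ (x ∷ v) = ≼-mono (ℚₚ.≤-reflexive (regroup C₈ (⅛ ^ℚ s) (Poch⁺.B ℚ.* denominators-bound κ)))
      (≼-* (≼-mono (proj₂ (proj₂ tri-decay⅛) s) (q^tri-≼ (fullExponent p c i (x ∷ v)) s tri≤)) (≼-* (Poch⁺.u-bound (p ℕ.+ s)) (denominators-≼ c (x ∷ v))))
      where
      s = Vec.sum (x ∷ v)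
      tri≤ : tri s ≤ fullExponent p c i (x ∷ v)
      tri≤ = ℕₚ.≤-trans (ℕₚ.m≤m+n (tri s) (p ℕ.* s)) (ℕₚ.≤-trans (ℕₚ.m≤m+n (tri s ℕ.+ p ℕ.* s) (bump i κ ℕ.* s))
        (ℕₚ.m≤m+n (tri s ℕ.+ p ℕ.* s ℕ.+ bump i κ ℕ.* s) (tailExponent c i v)))
      regroup : ∀ a b c → a ℚ.* b ℚ.* c ≡ a ℚ.* c ℚ.* b
      regroup = ℚS.solve 3 (λ a b c → a ℚS.:* b ℚS.:* c ℚS.:= a ℚS.:* c ℚS.:* b) ≡.refl

  -- The number of elements of a list, as a rational.
  count : {A : Set} → List A → ℚ
  count = sumLℚ (λ _ → 1ℚ)

  count-map : {A B : Set} (f : A → B) (xs : List A) → count (List.map f xs) ≡ count xs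
  count-map f []       = ≡.refl
  count-map f (x ∷ xs) = cong (1ℚ ℚ.+_) (count-map f xs)

  -- Lists of length at most C 2ʲ spread to lists of length at most 2C 2ˢ - C.
  spread-count : ∀ {κ} C → 0ℚ ℚ.≤ C → (h : ℕ → List (Vec ℕ κ)) → (∀ j → count (h j) ℚ.≤ C ℚ.* 2ℚ ^ℚ j) →
    ∀ s → count (spread h s) ℚ.+ C ℚ.≤ C ℚ.* 2ℚ ℚ.* 2ℚ ^ℚ s
  spread-count C C≥0 h b zero = ℚₚ.≤-trans (ℚₚ.+-monoˡ-≤ C (ℚₚ.≤-trans (ℚₚ.≤-reflexive (count-map (0 ∷_) (h 0))) (b 0)))
    (ℚₚ.≤-reflexive (ℚS.solve 1 (λ c → c ℚS.:* ℚS.con 1ℚ ℚS.:+ c ℚS.:= c ℚS.:* ℚS.con 2ℚ ℚS.:* ℚS.con 1ℚ) ≡.refl C))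
  spread-count C C≥0 h b (suc s) = ℚₚ.≤-trans
    (ℚₚ.+-monoˡ-≤ C (ℚₚ.≤-trans (ℚₚ.≤-reflexive (≡.trans (sumLℚ-++ (λ _ → 1ℚ) (List.map (suc s ∷_) (h 0)) (spread (h ∘ suc) s))
        (cong (ℚ._+ count (spread (h ∘ suc) s)) (count-map (suc s ∷_) (h 0)))))
      (ℚₚ.+-monoˡ-≤ (count (spread (h ∘ suc) s)) (b 0))))
    (arithmetic C (count (spread (h ∘ suc) s)) (2ℚ ^ℚ s)
      (spread-count (C ℚ.* 2ℚ) (0≤* C≥0 0≤2) (h ∘ suc)
        (λ j → ℚₚ.≤-trans (b (suc j)) (ℚₚ.≤-reflexive (ℚS.solve 2 (λ c t → c ℚS.:* (t ℚS.:* ℚS.con 2ℚ) ℚS.:= c ℚS.:* ℚS.con 2ℚ ℚS.:* t) ≡.refl C (2ℚ ^ℚ j)))) s))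
    where
    arithmetic : ∀ C x t → x ℚ.+ C ℚ.* 2ℚ ℚ.≤ C ℚ.* 2ℚ ℚ.* 2ℚ ℚ.* t → C ℚ.* 1ℚ ℚ.+ x ℚ.+ C ℚ.≤ C ℚ.* 2ℚ ℚ.* (t ℚ.* 2ℚ)
    arithmetic C x t le = ℚₚ.≤-trans
      (ℚₚ.≤-reflexive (ℚS.solve 2 (λ c x → c ℚS.:* ℚS.con 1ℚ ℚS.:+ x ℚS.:+ c ℚS.:= x ℚS.:+ c ℚS.:* ℚS.con 2ℚ) ≡.refl C x))
      (ℚₚ.≤-trans le (ℚₚ.≤-reflexive (ℚS.solve 2 (λ c t → c ℚS.:* ℚS.con 2ℚ ℚS.:* ℚS.con 2ℚ ℚS.:* t ℚS.:= c ℚS.:* ℚS.con 2ℚ ℚS.:* (t ℚS.:* ℚS.con 2ℚ)) ≡.refl C t)))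

  2^≥0 : ∀ n → 0ℚ ℚ.≤ 2ℚ ^ℚ n
  2^≥0 = ^-nonneg 0≤2

  level-count : ∀ κ s → count (level κ s) ℚ.≤ 2ℚ ^ℚ κ ℚ.* 2ℚ ^ℚ s
  level-count zero    s = ℚₚ.≤-trans (one s) (ℚₚ.≤-reflexive (≡.sym (ℚₚ.*-identityˡ (2ℚ ^ℚ s))))
    where
    one : ∀ s → 1ℚ ℚ.+ 0ℚ ℚ.≤ 2ℚ ^ℚ s
    one zero    = ℚₚ.≤-refl
    one (suc s) = ℚₚ.≤-trans (one s) (≤-by (2ℚ ^ℚ s) (2^≥0 s)
      (ℚS.solve 1 (λ t → t ℚS.:* ℚS.con 2ℚ ℚS.:= t ℚS.:+ t) ≡.refl (2ℚ ^ℚ s)))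
  level-count (suc κ) s = ℚₚ.≤-trans
    (≤-by (2ℚ ^ℚ κ) (2^≥0 κ) ≡.refl)
    (spread-count (2ℚ ^ℚ κ) (2^≥0 κ) (level κ) (level-count κ) s)

  -- A level has at most 2^κ 2ˢ elements, so bounds 1/8ˢ for its elements add up to O(1/4ˢ).
  level-size : ∀ κ D → 0ℚ ℚ.≤ D → ∀ s → sumLℚ (λ v → D ℚ.* ⅛ ^ℚ Vec.sum v) (level κ s) ℚ.≤ D ℚ.* 2ℚ ^ℚ κ ℚ.* ¼ ^ℚ s
  level-size κ D D≥0 s = ℚₚ.≤-trans
    (ℚₚ.≤-reflexive (≡.trans
      (sumLℚ-cong (level κ s) (λ m → ≡.trans (cong (λ n → D ℚ.* ⅛ ^ℚ n) (level-sum κ s m)) (≡.sym (ℚₚ.*-identityʳ (D ℚ.* ⅛ ^ℚ s)))))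
      (sumLℚ-* (D ℚ.* ⅛ ^ℚ s) (λ _ → 1ℚ) (level κ s))))
    (ℚₚ.≤-trans (*-monoˡ (0≤* D≥0 (^-nonneg (ℚₚ.nonNegative⁻¹ ⅛) s)) (level-count κ s))
      (ℚₚ.≤-reflexive (≡.trans (regroup D (⅛ ^ℚ s) (2ℚ ^ℚ κ) (2ℚ ^ℚ s)) (cong (D ℚ.* 2ℚ ^ℚ κ ℚ.*_) (powers s)))))
    where
    regroup : ∀ a b c d → a ℚ.* b ℚ.* (c ℚ.* d) ≡ a ℚ.* c ℚ.* (b ℚ.* d)
    regroup = ℚS.solve 4 (λ a b c d → a ℚS.:* b ℚS.:* (c ℚS.:* d) ℚS.:= a ℚS.:* c ℚS.:* (b ℚS.:* d)) ≡.refl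
    powers : ∀ s → ⅛ ^ℚ s ℚ.* 2ℚ ^ℚ s ≡ ¼ ^ℚ s
    powers zero    = ≡.refl
    powers (suc s) = ≡.trans (ℚS.solve 2 (λ a b → a ℚS.:* ℚS.con ⅛ ℚS.:* (b ℚS.:* ℚS.con 2ℚ) ℚS.:= a ℚS.:* b ℚS.:* ℚS.con ¼) ≡.refl (⅛ ^ℚ s) (2ℚ ^ℚ s))
      (cong (ℚ._* ¼) (powers s))

-- The multiple sum as a limit

  tri≤exponent⁺ : ∀ p c j i t → tri t ≤ exponent⁺ p c j i t
  tri≤exponent⁺ p c j i t = ℕₚ.≤-trans (ℕₚ.m≤m+n (tri t) (p ℕ.* t))
    (ℕₚ.m≤n+m (tri t ℕ.+ p ℕ.* t) ((j ℕ.+ i) ℕ.* (t ℕ.* t ℕ.+ c ℕ.* t) ℕ.+ i ℕ.* t))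

  tri≤exponent⁻ : ∀ p c j i t → tri t ≤ exponent⁻ p c j i t
  tri≤exponent⁻ p c j i t = ℕₚ.≤-trans (ℕₚ.m≤m+n (tri t) t) (ℕₚ.≤-trans (ℕₚ.m≤m+n (tri (suc t)) (p ℕ.* suc t))
    (ℕₚ.m≤n+m (tri (suc t) ℕ.+ p ℕ.* suc t) ((j ℕ.* suc t ℕ.+ i ℕ.* t) ℕ.* (suc t ℕ.+ c))))

  theta-≼ : ∀ {m} n t → tri t ≤ m → q ^ m * (1# + q ^ n) ≼ C₄ ℚ.* 2ℚ ℚ.* ¼ ^ℚ t
  theta-≼ n t le = ≼-mono
    (ℚₚ.≤-reflexive (ℚS.solve 3 (λ a b c → a ℚS.:* b ℚS.:* c ℚS.:= a ℚS.:* c ℚS.:* b) ≡.refl C₄ (¼ ^ℚ t) 2ℚ))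
    (≼-* (quadratic-≼ t le) (≼-+ ≼-1 (q^-≼1 n)))

  2C₄≥0 : 0ℚ ℚ.≤ C₄ ℚ.* 2ℚ
  2C₄≥0 = 0≤* C₄≥0 0≤2

  module _ (p j i κ : ℕ) (e : j ℕ.+ i ≡ suc κ) where

    private
      c : ℕ
      c = p ℕ.+ p

      f⁺ f⁻ a : ℕ → Carrier
      f⁺ = theta⁺ p c j i
      f⁻ = theta⁻ p c j i
      a = levelSum p c i κ

      open Bound p c i κ

      -- The level sums are dominated by E / 4ˢ.
      E : ℚ
      E = D ℚ.* 2ℚ ^ℚ κ

      E≥0 : 0ℚ ℚ.≤ E
      E≥0 = 0≤* D≥0 (2^≥0 κ)

      a-≼ : ∀ s → a s ≼ E ℚ.* ¼ ^ℚ s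
      a-≼ s = ≼-resp (summand-sum p c i κ s)
        (≼-mono (level-size κ D D≥0 s) (sumL-≼ summand-≼ (level κ s)))

      K² : ℚ
      K² = RR.B ℚ.* RR.B

      next-gap : ∀ ε → 0ℚ ℚ.< ε → ∃[ K ] ∀ S t → t ℕ.+ K ≤ S → poch⁻ S * kernel c (suc t) S - R ≼ ε
      next-gap ε ε>0 = let (K , r) = gap (λ S t → poch⁻ S * kernel c t S) (kernel-gap c) ε ε>0 in
        suc K , λ S t le → r S (suc t) (ℕₚ.≤-trans (ℕₚ.≤-reflexive (≡.sym (ℕₚ.+-suc t K))) le)

      -- Dominated convergence for the multiple sum, with the weights (q)_S / (q)_{S-s}, and for the two
      -- theta series, with the weights (q)_S kernel c t S and (q)_S kernel c (t + 1) S.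
      module T-outer = Tannery (λ S s → poch⁻ S * rr (S ℕ.∸ s)) 1# (Poch⁻.B ℚ.* RR.B)
        (λ S s _ → ≼-* (Poch⁻.u-bound S) (RR.u-bound (S ℕ.∸ s)))
        (gap (λ S s → poch⁻ S * rr (S ℕ.∸ s)) (Conv-cong
          (λ (s , d) → *-congˡ (reflexive (cong rr (≡.sym (ℕₚ.m+n∸m≡n s d))))) QR (Conv-* poch⁻-gap rr-gap)))
        a E E≥0 a-≼

      module T⁺ = Tannery (λ S t → poch⁻ S * kernel c t S) R (Poch⁻.B ℚ.* K²)
        (λ S t _ → ≼-* (Poch⁻.u-bound S) (kernel-≼ c t S))
        (gap (λ S t → poch⁻ S * kernel c t S) (kernel-gap c))
        f⁺ (C₄ ℚ.* 2ℚ) 2C₄≥0 (λ t → theta-≼ (p ℕ.+ t) t (tri≤exponent⁺ p c j i t))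

      module T⁻ = Tannery (λ S t → poch⁻ S * kernel c (suc t) S) R (Poch⁻.B ℚ.* K²)
        (λ S t _ → ≼-* (Poch⁻.u-bound S) (kernel-≼ c (suc t) S))
        next-gap
        f⁻ (C₄ ℚ.* 2ℚ) 2C₄≥0 (λ t → theta-≼ (p ℕ.+ suc t) t (tri≤exponent⁻ p c j i t))

      X Y⁺ Y⁻ : ℕ → Carrier
      X S  = ∑ (suc S) (λ s → poch⁻ S * rr (S ℕ.∸ s) * a s)
      Y⁺ S = ∑ (suc S) (λ t → poch⁻ S * kernel c t S * f⁺ t)
      Y⁻ S = ∑ (suc S) (λ t → poch⁻ S * kernel c (suc t) S * f⁻ t)

      -- The finite identity, multiplied by (q)_S.
      X-value : ∀ S → X (suc S) ≈ poch⁺ (p ℕ.+ S) * (Y⁺ (suc S) - Y⁻ (suc S))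
      X-value S = begin
        X N
          ≈⟨ trans (∑-cong (suc N) (λ s _ → *-assoc (poch⁻ N) (rr (N ℕ.∸ s)) (a s))) (∑-* (suc N) (poch⁻ N) (λ s → rr (N ℕ.∸ s) * a s)) ⟩
        poch⁻ N * ∑ (suc N) (λ s → rr (N ℕ.∸ s) * a s)
          ≈⟨ *-congˡ (trans (sym (conv-∑ rr a N)) (finite-identity p c ≡.refl j i κ e N (p ℕ.+ S) (ℕₚ.+-suc p S))) ⟩
        poch⁻ N * (poch⁺ (p ℕ.+ S) * ∑ (suc N) (λ t → f⁺ t * kernel c t N - f⁻ t * kernel c (suc t) N))
          ≈⟨ solve 3 (λ x y z → x :* (y :* z) := y :* (x :* z)) refl (poch⁻ N) (poch⁺ (p ℕ.+ S)) _ ⟩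
        poch⁺ (p ℕ.+ S) * (poch⁻ N * ∑ (suc N) (λ t → f⁺ t * kernel c t N - f⁻ t * kernel c (suc t) N))
          ≈⟨ *-congˡ (trans (sym (∑-* (suc N) (poch⁻ N) _)) (trans
               (∑-cong (suc N) (λ t _ → solve 5 (λ x f k g l → x :* (f :* k :- g :* l) := x :* k :* f :- x :* l :* g) refl
                 (poch⁻ N) (f⁺ t) (kernel c t N) (f⁻ t) (kernel c (suc t) N)))
               (∑-- (suc N) _ _))) ⟩
        poch⁺ (p ℕ.+ S) * (Y⁺ N - Y⁻ N) ∎
        where N = suc S

    -- The multiple sum in terms of the two theta series: the limit S → ∞ of the finite identity. Since
    -- (q)_S / (q)_{S-s} tends to 1, the left-hand side tends to the sum over all levels.
    multisum : ∀ {S⁺ S⁻} → Seq-Conv (λ n → ∑ n f⁺) S⁺ → Seq-Conv (λ n → ∑ n f⁻) S⁻ →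
      HasSum (summand p c i {κ}) (P * R * (S⁺ - S⁻))
    multisum {S⁺} {S⁻} c⁺ c⁻ = Graded.HasSum-graded Vec.sum (level κ) ∈-level (level-sum κ) (level-unique κ)
      (summand p c i) size summand-≼ E E≥0
      (λ s → ℚₚ.≤-trans (level-size κ D D≥0 s) (*-monoˡ E≥0 (¼≤½ s)))
      (Conv-cong (λ n → ∑-cong n (λ s _ → sym (summand-sum p c i κ s))) refl (Conv-unsuc (Conv-unsuc A→)))
      where
      limit : ∀ {x y : ℕ → Carrier} {ω} → Seq-Conv (λ S → x S - R * y (suc S)) 0# → Seq-Conv y ω → Seq-Conv x (R * ω)
      limit {x} {y} {ω} null c = Conv-cong (λ S → solve 2 (λ a b → a :- b :+ b := a) refl (x S) (R * y (suc S)))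
        (+-identityˡ (R * ω)) (Conv-+ null (Conv-* (Conv-const {ω = R}) (Conv-suc c)))
      X→ : Seq-Conv (X ∘ suc) (P * (R * S⁺ - R * S⁻))
      X→ = Conv-cong (λ S → sym (X-value S)) refl
        (Conv-* (Conv-pull (p ℕ.+_) (λ S → ℕₚ.m≤n+m S p) poch⁺→P)
          (Conv-- (Conv-suc (limit T⁺.tannery c⁺)) (Conv-suc (limit T⁻.tannery c⁻))))
      A→ : Seq-Conv (λ S → ∑ (suc (suc S)) a) (P * R * (S⁺ - S⁻))
      A→ = Conv-cong
        (λ S → solve 2 (λ x y → x :- (x :- con (+ 1) :* y) := y) refl (X (suc S)) (∑ (suc (suc S)) a))
        (solve 4 (λ p r s t → p :* (r :* s :- r :* t) :- con (+ 0) := p :* r :* (s :- t)) refl P R S⁺ S⁻)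
        (Conv-- X→ (Conv-suc T-outer.tannery))

open import Defs using (leftExponent; rightExponent; square; N; _‼_; _⋯_) renaming (∑ to ∑ᴺ)

-- Exponents and index shifts

-- The sums over ranges of indices, by recursion on the vector n.
module RangeSums where

  ⋯-front : ∀ k → 1 ⋯ suc k ≡ 1 ∷ List.map suc (1 ⋯ k)
  ⋯-front k = cong (1 ∷_) (≡.trans (Listₚ.map-applyUpTo suc suc k)
    (≡.sym (≡.trans (cong (List.map suc) (Listₚ.map-applyUpTo (λ n → n) suc k)) (Listₚ.map-applyUpTo suc suc k))))

  ⋯-suc : ∀ a b → suc a ⋯ suc b ≡ List.map suc (a ⋯ b)
  ⋯-suc a b = Listₚ.map-∘ (List.upTo (suc b ℕ.∸ a))

  map-⋯-front : {A : Set} (f : ℕ → A) → ∀ k → List.map f (1 ⋯ suc k) ≡ f 1 ∷ List.map (f ∘ suc) (1 ⋯ k)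
  map-⋯-front f k = ≡.trans (cong (List.map f) (⋯-front k)) (cong (f 1 ∷_) (≡.sym (Listₚ.map-∘ (1 ⋯ k))))

  -- The indices in a range that starts after 0 are successors.
  map-⋯-cong : {A : Set} {f g : ℕ → A} → (∀ j → f (suc j) ≡ g (suc j)) → ∀ a k → List.map f (suc a ⋯ k) ≡ List.map g (suc a ⋯ k)
  map-⋯-cong {f = f} {g} e a k = ≡.trans (≡.sym (Listₚ.map-∘ (List.upTo (k ℕ.∸ a))))
    (≡.trans (Listₚ.map-cong (λ j → e (a ℕ.+ j)) (List.upTo (k ℕ.∸ a))) (Listₚ.map-∘ (List.upTo (k ℕ.∸ a))))

  ∑-front : ∀ f k → ∑ᴺ (1 ⋯ suc k) f ≡ f 1 ℕ.+ ∑ᴺ (1 ⋯ k) (f ∘ suc)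
  ∑-front f k = cong ℕL.sum (map-⋯-front f k)

  ∑-⋯-cong : ∀ {f g} → (∀ j → f (suc j) ≡ g (suc j)) → ∀ k → ∑ᴺ (1 ⋯ k) f ≡ ∑ᴺ (1 ⋯ k) g
  ∑-⋯-cong e k = cong ℕL.sum (map-⋯-cong e 0 k)

  ∑-⋯-2 : ∀ f k → ∑ᴺ (2 ⋯ suc k) f ≡ ∑ᴺ (1 ⋯ k) (f ∘ suc)
  ∑-⋯-2 f k = cong ℕL.sum (≡.trans (cong (List.map f) (⋯-suc 1 k)) (≡.sym (Listₚ.map-∘ (1 ⋯ k))))

  N-tail : ∀ {κ} x (v : Vec ℕ κ) j → N (x ∷ v) (suc (suc j)) ≡ N v (suc j)
  N-tail {κ} x v j = cong ℕL.sum (≡.trans (cong (List.map ((x ∷ v) ‼_)) (⋯-suc (suc j) κ))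
    (≡.trans (≡.sym (Listₚ.map-∘ (suc j ⋯ κ))) (map-⋯-cong (λ _ → ≡.refl) j κ)))

  N-sum : ∀ {κ} (v : Vec ℕ κ) → N v 1 ≡ Vec.sum v
  N-sum []              = ≡.refl
  N-sum {suc κ} (x ∷ v) = ≡.trans (∑-front ((x ∷ v) ‼_) κ)
    (cong (x ℕ.+_) (≡.trans (∑-⋯-cong (λ _ → ≡.refl) κ) (N-sum v)))

  -- The sums of the N_j, and of their squares.
  linear squares : ∀ {κ} → Vec ℕ κ → ℕ
  linear {κ} v = ∑ᴺ (1 ⋯ κ) (N v)
  squares {κ} v = ∑ᴺ (1 ⋯ κ) (λ j → N v j ℕ.* N v j)

  -- N₁ + ⋯ + N_m.
  initial : ∀ {κ} → ℕ → Vec ℕ κ → ℕ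
  initial m v = ∑ᴺ (1 ⋯ m) (N v)

  initial-∷ : ∀ {κ} m x (v : Vec ℕ κ) → initial (suc m) (x ∷ v) ≡ Vec.sum (x ∷ v) ℕ.+ initial m v
  initial-∷ m x v = ≡.trans (∑-front (N (x ∷ v)) m) (cong₂ ℕ._+_ (N-sum (x ∷ v)) (∑-⋯-cong (N-tail x v) m))

  linear-∷ : ∀ {κ} x (v : Vec ℕ κ) → linear (x ∷ v) ≡ Vec.sum (x ∷ v) ℕ.+ linear v
  linear-∷ {κ} x v = initial-∷ κ x v

  linear-2 : ∀ {κ} x (v : Vec ℕ κ) → ∑ᴺ (2 ⋯ suc κ) (N (x ∷ v)) ≡ linear v
  linear-2 {κ} x v = ≡.trans (∑-⋯-2 (N (x ∷ v)) κ) (∑-⋯-cong (N-tail x v) κ)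

  squares-2 : ∀ {κ} x (v : Vec ℕ κ) → ∑ᴺ (2 ⋯ suc κ) (λ j → N (x ∷ v) j ℕ.* N (x ∷ v) j) ≡ squares v
  squares-2 {κ} x v = ≡.trans (∑-⋯-2 (λ j → N (x ∷ v) j ℕ.* N (x ∷ v) j) κ)
    (∑-⋯-cong (λ j → cong₂ ℕ._*_ (N-tail x v j) (N-tail x v j)) κ)

  squares-∷ : ∀ {κ} x (v : Vec ℕ κ) → squares (x ∷ v) ≡ Vec.sum (x ∷ v) ℕ.* Vec.sum (x ∷ v) ℕ.+ squares v
  squares-∷ {κ} x v = ≡.trans (∑-front (λ j → N (x ∷ v) j ℕ.* N (x ∷ v) j) κ)
    (cong₂ ℕ._+_ (cong₂ ℕ._*_ (N-sum (x ∷ v)) (N-sum (x ∷ v)))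
      (∑-⋯-cong (λ j → cong₂ ℕ._*_ (N-tail x v j) (N-tail x v j)) κ))

-- The exponents on both sides as rational numbers.
module ExponentIdentities where
  open RangeSums
  open RationalEstimates using (fromℤ-+; fromℤ-*; fromℤ-neg; /-as-*; unit-fraction; unit-fraction-inverse; 2ℚ)
  open +-*-Solver using (solve; _:+_; _:*_; _:-_; :-_; _:=_; con)

  -- Rational images of natural numbers.
  nat : ℕ → ℚ
  nat n = fromℤ (+ n)

  nat-+ : ∀ m n → nat (m ℕ.+ n) ≡ nat m ℚ.+ nat n
  nat-+ m n = fromℤ-+ (+ m) (+ n)

  nat-* : ∀ m n → nat (m ℕ.* n) ≡ nat m ℚ.* nat n
  nat-* m n = ≡.trans (cong fromℤ (ℤₚ.pos-* m n)) (fromℤ-* (+ m) (+ n))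

  nat-suc : ∀ n → nat (suc n) ≡ 1ℚ ℚ.+ nat n
  nat-suc n = nat-+ 1 n

  -- Evaluation of nat along the structure of an expression.
  infixl 6 _⊹_
  infixl 7 _⊛_

  _⊹_ : ∀ {m n x y} → nat m ≡ x → nat n ≡ y → nat (m ℕ.+ n) ≡ x ℚ.+ y
  _⊹_ {m} {n} e f = ≡.trans (nat-+ m n) (cong₂ ℚ._+_ e f)

  _⊛_ : ∀ {m n x y} → nat m ≡ x → nat n ≡ y → nat (m ℕ.* n) ≡ x ℚ.* y
  _⊛_ {m} {n} e f = ≡.trans (nat-* m n) (cong₂ ℚ._*_ e f)

  -- Leaves of such an expression.
  nat! : ∀ n → nat n ≡ nat n
  nat! n = ≡.refl

  -- The difference of squares in the exponent on the left.
  leftExponent-product : ∀ k i ℓ n → leftExponent k i ℓ n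
    ≡ ½ ℚ.* ((fromℤ n ℚ.- fromℤ ℓ) ℚ.* ((2ℚ ℚ.* nat k ℚ.+ 1ℚ) ℚ.* (fromℤ n ℚ.+ fromℤ ℓ) ℚ.+ (2ℚ ℚ.* nat i ℚ.- 1ℚ)))
  leftExponent-product k i ℓ n = ≡.trans
    (cong₂ (λ a b → (nat k ℚ.+ ½) ℚ.* square (fromℤ n ℚ.+ a) ℚ.- square (b ℚ.- ½) ℚ.* h) shift centre)
    (complete (fromℤ n) (fromℤ ℓ) (nat k) (nat i) h unit)
    where
    h : ℚ
    h = unit-fraction (1 ℕ.+ 4 ℕ.* k)
    unit : (2ℚ ℚ.+ nat 4 ℚ.* nat k) ℚ.* h ≡ 1ℚ
    unit = ≡.trans (cong (ℚ._* h) (≡.sym (≡.trans (nat-+ 2 (4 ℕ.* k)) (cong (2ℚ ℚ.+_) (nat-* 4 k))))) (unit-fraction-inverse (1 ℕ.+ 4 ℕ.* k))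
    shift : (+ 2 ℤ.* + i ℤ.- + 1) ℚ./ (2 ℕ.+ 4 ℕ.* k) ≡ (2ℚ ℚ.* nat i ℚ.- 1ℚ) ℚ.* h
    shift = ≡.trans (/-as-* (+ 2 ℤ.* + i ℤ.- + 1) (1 ℕ.+ 4 ℕ.* k))
      (cong (ℚ._* h) (≡.trans (fromℤ-+ (+ 2 ℤ.* + i) (ℤ.- + 1)) (cong (ℚ._+ (ℚ.- 1ℚ)) (fromℤ-* (+ 2) (+ i)))))
    centre : fromℤ (+ 2 ℤ.* + k ℤ.* ℓ ℤ.+ + i ℤ.+ ℓ) ≡ 2ℚ ℚ.* nat k ℚ.* fromℤ ℓ ℚ.+ nat i ℚ.+ fromℤ ℓ
    centre = ≡.trans (fromℤ-+ (+ 2 ℤ.* + k ℤ.* ℓ ℤ.+ + i) ℓ) (cong (ℚ._+ fromℤ ℓ)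
      (≡.trans (fromℤ-+ (+ 2 ℤ.* + k ℤ.* ℓ) (+ i)) (cong (ℚ._+ nat i)
        (≡.trans (fromℤ-* (+ 2 ℤ.* + k) ℓ) (cong (ℚ._* fromℤ ℓ) (fromℤ-* (+ 2) (+ k)))))))
    -- Terms with a factor (4k + 2) h are cleared with the hypothesis (4k + 2) h = 1.
    complete : ∀ n l k i h → (2ℚ ℚ.+ nat 4 ℚ.* k) ℚ.* h ≡ 1ℚ →
      (k ℚ.+ ½) ℚ.* square (n ℚ.+ (2ℚ ℚ.* i ℚ.- 1ℚ) ℚ.* h) ℚ.- square (2ℚ ℚ.* k ℚ.* l ℚ.+ i ℚ.+ l ℚ.- ½) ℚ.* h
      ≡ ½ ℚ.* ((n ℚ.- l) ℚ.* ((2ℚ ℚ.* k ℚ.+ 1ℚ) ℚ.* (n ℚ.+ l) ℚ.+ (2ℚ ℚ.* i ℚ.- 1ℚ)))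
    complete n l k i h e = ≡.trans (expand n l k i h)
      (≡.trans (cong (λ u → R ℚ.+ (u ℚ.- 1ℚ) ℚ.* S) e) (drop R S))
      where
      x = 2ℚ ℚ.* i ℚ.- 1ℚ
      R = ½ ℚ.* ((n ℚ.- l) ℚ.* ((2ℚ ℚ.* k ℚ.+ 1ℚ) ℚ.* (n ℚ.+ l) ℚ.+ x))
      S = ½ ℚ.* n ℚ.* x ℚ.+ ½ ℚ.* ½ ℚ.* x ℚ.* x ℚ.* h ℚ.- l ℚ.* (l ℚ.* (k ℚ.+ ½)) ℚ.- ½ ℚ.* l ℚ.* x
      drop : ∀ R S → R ℚ.+ (1ℚ ℚ.- 1ℚ) ℚ.* S ≡ R
      drop = solve 2 (λ R S → R :+ (con 1ℚ :- con 1ℚ) :* S := R) ≡.refl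
      expand : ∀ n l k i h → (k ℚ.+ ½) ℚ.* square (n ℚ.+ (2ℚ ℚ.* i ℚ.- 1ℚ) ℚ.* h) ℚ.- square (2ℚ ℚ.* k ℚ.* l ℚ.+ i ℚ.+ l ℚ.- ½) ℚ.* h
        ≡ ½ ℚ.* ((n ℚ.- l) ℚ.* ((2ℚ ℚ.* k ℚ.+ 1ℚ) ℚ.* (n ℚ.+ l) ℚ.+ (2ℚ ℚ.* i ℚ.- 1ℚ)))
          ℚ.+ ((2ℚ ℚ.+ nat 4 ℚ.* k) ℚ.* h ℚ.- 1ℚ) ℚ.* (½ ℚ.* n ℚ.* (2ℚ ℚ.* i ℚ.- 1ℚ)
            ℚ.+ ½ ℚ.* ½ ℚ.* (2ℚ ℚ.* i ℚ.- 1ℚ) ℚ.* (2ℚ ℚ.* i ℚ.- 1ℚ) ℚ.* h ℚ.- l ℚ.* (l ℚ.* (k ℚ.+ ½)) ℚ.- ½ ℚ.* l ℚ.* (2ℚ ℚ.* i ℚ.- 1ℚ))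
      expand = solve 5 (λ n l k i h →
        (k :+ con ½) :* ((n :+ (con 2ℚ :* i :- con 1ℚ) :* h) :* (n :+ (con 2ℚ :* i :- con 1ℚ) :* h))
          :- ((con 2ℚ :* k :* l :+ i :+ l :- con ½) :* (con 2ℚ :* k :* l :+ i :+ l :- con ½)) :* h
        := con ½ :* ((n :- l) :* ((con 2ℚ :* k :+ con 1ℚ) :* (n :+ l) :+ (con 2ℚ :* i :- con 1ℚ)))
          :+ ((con 2ℚ :+ con (nat 4) :* k) :* h :- con 1ℚ) :* (con ½ :* n :* (con 2ℚ :* i :- con 1ℚ)
            :+ con ½ :* con ½ :* (con 2ℚ :* i :- con 1ℚ) :* (con 2ℚ :* i :- con 1ℚ) :* h :- l :* (l :* (k :+ con ½)) :- con ½ :* l :* (con 2ℚ :* i :- con 1ℚ))) ≡.refl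

  nat-tri : ∀ n → nat (tri (suc n)) ≡ ½ ℚ.* (nat n ℚ.* (nat n ℚ.+ 1ℚ))
  nat-tri zero    = ≡.refl
  nat-tri (suc n) = ≡.trans (nat-+ (tri (suc n)) (suc n)) (≡.trans (cong₂ ℚ._+_ (nat-tri n) (nat-suc n))
    (≡.trans (solve 1 (λ n → con ½ :* (n :* (n :+ con 1ℚ)) :+ (con 1ℚ :+ n) := con ½ :* ((con 1ℚ :+ n) :* ((con 1ℚ :+ n) :+ con 1ℚ))) ≡.refl (nat n))
      (cong (λ m → ½ ℚ.* (m ℚ.* (m ℚ.+ 1ℚ))) (≡.sym (nat-suc n)))))

  -- tri itself, without the shift.
  nat-tri′ : ∀ n → nat (tri n) ≡ ½ ℚ.* (nat n ℚ.* (nat n ℚ.- 1ℚ))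
  nat-tri′ zero    = ≡.refl
  nat-tri′ (suc n) = ≡.trans (nat-tri n) (≡.trans
    (solve 1 (λ n → con ½ :* (n :* (n :+ con 1ℚ)) := con ½ :* ((con 1ℚ :+ n) :* ((con 1ℚ :+ n) :- con 1ℚ))) ≡.refl (nat n))
    (cong (λ m → ½ ℚ.* (m ℚ.* (m ℚ.- 1ℚ))) (≡.sym (nat-suc n))))

  -- The exponents of the summands on the left, for ℓ = p ≥ 0.
  left⁺ : ∀ p j i t → leftExponent (j ℕ.+ i) i (+ p) (+ (p ℕ.+ t))
    ≡ nat ((j ℕ.+ i) ℕ.* (t ℕ.* t ℕ.+ (p ℕ.+ p) ℕ.* t) ℕ.+ i ℕ.* t ℕ.+ (tri t ℕ.+ p ℕ.* t))
  left⁺ p j i t = ≡.trans (leftExponent-product (j ℕ.+ i) i (+ p) (+ (p ℕ.+ t)))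
    (≡.trans (cong₂ (λ n k → ½ ℚ.* ((n ℚ.- nat p) ℚ.* ((2ℚ ℚ.* k ℚ.+ 1ℚ) ℚ.* (n ℚ.+ nat p) ℚ.+ (2ℚ ℚ.* nat i ℚ.- 1ℚ))))
        (nat-+ p t) (nat-+ j i))
      (≡.trans (identity (nat p) (nat j) (nat i) (nat t)) (≡.sym expand)))
    where
    identity : ∀ p j i t → ½ ℚ.* ((p ℚ.+ t ℚ.- p) ℚ.* ((2ℚ ℚ.* (j ℚ.+ i) ℚ.+ 1ℚ) ℚ.* (p ℚ.+ t ℚ.+ p) ℚ.+ (2ℚ ℚ.* i ℚ.- 1ℚ)))
      ≡ (j ℚ.+ i) ℚ.* (t ℚ.* t ℚ.+ (p ℚ.+ p) ℚ.* t) ℚ.+ i ℚ.* t ℚ.+ (½ ℚ.* (t ℚ.* (t ℚ.- 1ℚ)) ℚ.+ p ℚ.* t)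
    identity = solve 4 (λ p j i t → con ½ :* ((p :+ t :- p) :* ((con 2ℚ :* (j :+ i) :+ con 1ℚ) :* (p :+ t :+ p) :+ (con 2ℚ :* i :- con 1ℚ)))
      := (j :+ i) :* (t :* t :+ (p :+ p) :* t) :+ i :* t :+ (con ½ :* (t :* (t :- con 1ℚ)) :+ p :* t)) ≡.refl
    expand : nat ((j ℕ.+ i) ℕ.* (t ℕ.* t ℕ.+ (p ℕ.+ p) ℕ.* t) ℕ.+ i ℕ.* t ℕ.+ (tri t ℕ.+ p ℕ.* t))
      ≡ (nat j ℚ.+ nat i) ℚ.* (nat t ℚ.* nat t ℚ.+ (nat p ℚ.+ nat p) ℚ.* nat t) ℚ.+ nat i ℚ.* nat t
        ℚ.+ (½ ℚ.* (nat t ℚ.* (nat t ℚ.- 1ℚ)) ℚ.+ nat p ℚ.* nat t)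
    expand = (nat! j ⊹ nat! i) ⊛ (nat! t ⊛ nat! t ⊹ (nat! p ⊹ nat! p) ⊛ nat! t) ⊹ nat! i ⊛ nat! t
      ⊹ (nat-tri′ t ⊹ nat! p ⊛ nat! t)

  left⁻ : ∀ p j i t → leftExponent (j ℕ.+ i) i (+ p) (ℤ.- (+ (p ℕ.+ suc t)))
    ≡ nat ((j ℕ.* suc t ℕ.+ i ℕ.* t) ℕ.* (suc t ℕ.+ (p ℕ.+ p)) ℕ.+ (tri (suc t) ℕ.+ p ℕ.* suc t)) ℚ.+ nat (p ℕ.+ suc t)
  left⁻ p j i t = ≡.trans (leftExponent-product (j ℕ.+ i) i (+ p) (ℤ.- (+ (p ℕ.+ suc t))))
    (≡.trans (cong₂ (λ n k → ½ ℚ.* ((n ℚ.- nat p) ℚ.* ((2ℚ ℚ.* k ℚ.+ 1ℚ) ℚ.* (n ℚ.+ nat p) ℚ.+ (2ℚ ℚ.* nat i ℚ.- 1ℚ))))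
        (≡.trans (fromℤ-neg (+ (p ℕ.+ suc t))) (cong ℚ.-_ p+suc)) (nat-+ j i))
      (≡.trans (identity (nat p) (nat j) (nat i) (nat t)) (≡.sym (cong₂ ℚ._+_ expand p+suc))))
    where
    p+suc : nat (p ℕ.+ suc t) ≡ nat p ℚ.+ (1ℚ ℚ.+ nat t)
    p+suc = ≡.trans (nat-+ p (suc t)) (cong (nat p ℚ.+_) (nat-suc t))
    identity : ∀ p j i t → ½ ℚ.* ((ℚ.- (p ℚ.+ (1ℚ ℚ.+ t)) ℚ.- p) ℚ.* ((2ℚ ℚ.* (j ℚ.+ i) ℚ.+ 1ℚ) ℚ.* (ℚ.- (p ℚ.+ (1ℚ ℚ.+ t)) ℚ.+ p) ℚ.+ (2ℚ ℚ.* i ℚ.- 1ℚ)))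
      ≡ (j ℚ.* (1ℚ ℚ.+ t) ℚ.+ i ℚ.* t) ℚ.* ((1ℚ ℚ.+ t) ℚ.+ (p ℚ.+ p)) ℚ.+ (½ ℚ.* (t ℚ.* (t ℚ.+ 1ℚ)) ℚ.+ p ℚ.* (1ℚ ℚ.+ t)) ℚ.+ (p ℚ.+ (1ℚ ℚ.+ t))
    identity = solve 4 (λ p j i t → con ½ :* ((:- (p :+ (con 1ℚ :+ t)) :- p) :* ((con 2ℚ :* (j :+ i) :+ con 1ℚ) :* (:- (p :+ (con 1ℚ :+ t)) :+ p) :+ (con 2ℚ :* i :- con 1ℚ)))
      := (j :* (con 1ℚ :+ t) :+ i :* t) :* ((con 1ℚ :+ t) :+ (p :+ p)) :+ (con ½ :* (t :* (t :+ con 1ℚ)) :+ p :* (con 1ℚ :+ t)) :+ (p :+ (con 1ℚ :+ t))) ≡.refl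
    expand : nat ((j ℕ.* suc t ℕ.+ i ℕ.* t) ℕ.* (suc t ℕ.+ (p ℕ.+ p)) ℕ.+ (tri (suc t) ℕ.+ p ℕ.* suc t))
      ≡ (nat j ℚ.* (1ℚ ℚ.+ nat t) ℚ.+ nat i ℚ.* nat t) ℚ.* ((1ℚ ℚ.+ nat t) ℚ.+ (nat p ℚ.+ nat p))
        ℚ.+ (½ ℚ.* (nat t ℚ.* (nat t ℚ.+ 1ℚ)) ℚ.+ nat p ℚ.* (1ℚ ℚ.+ nat t))
    expand = (nat! j ⊛ nat-suc t ⊹ nat! i ⊛ nat! t) ⊛ (nat-suc t ⊹ (nat! p ⊹ nat! p))
      ⊹ (nat-tri t ⊹ nat! p ⊛ nat-suc t)

  -- Replacing ℓ by - ℓ changes the exponents by (2i - 1) ℓ.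
  leftExponent-neg : ∀ k i ℓ n → leftExponent k i (ℤ.- ℓ) n ≡ (2ℚ ℚ.* nat i ℚ.- 1ℚ) ℚ.* fromℤ ℓ ℚ.+ leftExponent k i ℓ n
  leftExponent-neg k i ℓ n = ≡.trans (leftExponent-product k i (ℤ.- ℓ) n)
    (≡.trans (cong (λ l → ½ ℚ.* ((fromℤ n ℚ.- l) ℚ.* ((2ℚ ℚ.* nat k ℚ.+ 1ℚ) ℚ.* (fromℤ n ℚ.+ l) ℚ.+ (2ℚ ℚ.* nat i ℚ.- 1ℚ)))) (fromℤ-neg ℓ))
      (≡.trans (identity (fromℤ n) (fromℤ ℓ) (nat k) (nat i))
        (cong ((2ℚ ℚ.* nat i ℚ.- 1ℚ) ℚ.* fromℤ ℓ ℚ.+_) (≡.sym (leftExponent-product k i ℓ n)))))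
    where
    identity : ∀ n l k i → ½ ℚ.* ((n ℚ.- ℚ.- l) ℚ.* ((2ℚ ℚ.* k ℚ.+ 1ℚ) ℚ.* (n ℚ.+ ℚ.- l) ℚ.+ (2ℚ ℚ.* i ℚ.- 1ℚ)))
      ≡ (2ℚ ℚ.* i ℚ.- 1ℚ) ℚ.* l ℚ.+ ½ ℚ.* ((n ℚ.- l) ℚ.* ((2ℚ ℚ.* k ℚ.+ 1ℚ) ℚ.* (n ℚ.+ l) ℚ.+ (2ℚ ℚ.* i ℚ.- 1ℚ)))
    identity = solve 4 (λ n l k i → con ½ :* ((n :- :- l) :* ((con 2ℚ :* k :+ con 1ℚ) :* (n :+ :- l) :+ (con 2ℚ :* i :- con 1ℚ)))
      := (con 2ℚ :* i :- con 1ℚ) :* l :+ con ½ :* ((n :- l) :* ((con 2ℚ :* k :+ con 1ℚ) :* (n :+ l) :+ (con 2ℚ :* i :- con 1ℚ)))) ≡.refl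

  -- The exponent on the right, as a polynomial in the partial sums.
  rightForm : (S A B L : ℚ) → ℚ
  rightForm S A B L = ½ ℚ.* (S ℚ.* (S ℚ.+ 1ℚ)) ℚ.+ (A ℚ.+ L ℚ.* S ℚ.+ (2ℚ ℚ.* L ℚ.+ 1ℚ) ℚ.* B)

  rightExponent-form : ∀ ℓ {κ} x (v : Vec ℕ κ) → rightExponent ℓ (x ∷ v)
    ≡ rightForm (nat (Vec.sum (x ∷ v))) (nat (squares v)) (nat (linear v)) (fromℤ ℓ)
  rightExponent-form ℓ {κ} x v = ≡.trans
    (≡.trans (cong (λ s → form s (∑ᴺ (2 ⋯ suc κ) (λ j → N (x ∷ v) j ℕ.* N (x ∷ v) j)) (∑ᴺ (2 ⋯ suc κ) (N (x ∷ v)))) (N-sum (x ∷ v)))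
      (cong₂ (form (Vec.sum (x ∷ v))) (squares-2 x v) (linear-2 x v)))
    (cong₂ ℚ._+_ half rest)
    where
    s = Vec.sum (x ∷ v)
    form : ℕ → ℕ → ℕ → ℚ
    form s a b = + (s ℕ.* suc s) ℚ./ 2 ℚ.+ fromℤ (+ a ℤ.+ ℓ ℤ.* + s ℤ.+ (+ 2 ℤ.* ℓ ℤ.+ + 1) ℤ.* + b)
    half : + (s ℕ.* suc s) ℚ./ 2 ≡ ½ ℚ.* (nat s ℚ.* (nat s ℚ.+ 1ℚ))
    half = ≡.trans (/-as-* (+ (s ℕ.* suc s)) 1) (≡.trans (ℚₚ.*-comm (nat (s ℕ.* suc s)) ½)
      (cong (½ ℚ.*_) (≡.trans (nat-* s (suc s)) (cong (nat s ℚ.*_) (≡.trans (nat-suc s) (ℚₚ.+-comm 1ℚ (nat s)))))))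
    rest : fromℤ (+ squares v ℤ.+ ℓ ℤ.* + s ℤ.+ (+ 2 ℤ.* ℓ ℤ.+ + 1) ℤ.* + linear v)
      ≡ nat (squares v) ℚ.+ fromℤ ℓ ℚ.* nat s ℚ.+ (2ℚ ℚ.* fromℤ ℓ ℚ.+ 1ℚ) ℚ.* nat (linear v)
    rest = ≡.trans (fromℤ-+ (+ squares v ℤ.+ ℓ ℤ.* + s) ((+ 2 ℤ.* ℓ ℤ.+ + 1) ℤ.* + linear v)) (cong₂ ℚ._+_
      (≡.trans (fromℤ-+ (+ squares v) (ℓ ℤ.* + s)) (cong (nat (squares v) ℚ.+_) (fromℤ-* ℓ (+ s))))
      (≡.trans (fromℤ-* (+ 2 ℤ.* ℓ ℤ.+ + 1) (+ linear v)) (cong (ℚ._* nat (linear v))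
        (≡.trans (fromℤ-+ (+ 2 ℤ.* ℓ) (+ 1)) (cong (ℚ._+ 1ℚ) (fromℤ-* (+ 2) ℓ))))))

  -- Each N_j is counted either in the linear part of the exponent or in the subtracted N₁ + ⋯ + N_{k-i}.
  bump-initial : ∀ i {κ} x (v : Vec ℕ κ) →
    bump i κ ℕ.* Vec.sum (x ∷ v) ℕ.+ initial (suc κ ℕ.∸ i) (x ∷ v) ≡ Vec.sum (x ∷ v) ℕ.+ initial (κ ℕ.∸ i) v
  bump-initial i {κ} x v with i ℕₚ.≤? κ
  ... | yes i≤κ = cong₂ ℕ._+_ (cong (ℕ._* Vec.sum (x ∷ v)) (bump-≥ i≤κ))
    (≡.trans (cong (λ m → initial m (x ∷ v)) (ℕₚ.+-∸-assoc 1 i≤κ)) (initial-∷ (κ ℕ.∸ i) x v))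
  ... | no  i≰κ = cong₂ ℕ._+_ (≡.trans (cong (ℕ._* Vec.sum (x ∷ v)) (bump-< (ℕₚ.≰⇒> i≰κ))) (ℕₚ.*-identityˡ (Vec.sum (x ∷ v))))
    (≡.trans (cong (λ m → initial m (x ∷ v)) (ℕₚ.m≤n⇒m∸n≡0 (ℕₚ.≰⇒> i≰κ)))
      (cong (λ m → initial m v) (≡.sym (ℕₚ.m≤n⇒m∸n≡0 (ℕₚ.<⇒≤ (ℕₚ.≰⇒> i≰κ))))))

  tailExponent-initial : ∀ c i {κ} (v : Vec ℕ κ) →
    tailExponent c i v ℕ.+ initial (κ ℕ.∸ i) v ≡ squares v ℕ.+ (c ℕ.+ 1) ℕ.* linear v
  tailExponent-initial c i {zero} [] rewrite ℕₚ.0∸n≡0 i = ≡.sym (ℕₚ.*-zeroʳ (c ℕ.+ 1))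
  tailExponent-initial c i {suc κ} (x ∷ v) = ≡.trans
    (regroup (s ℕ.* s ℕ.+ c ℕ.* s) (bump i κ ℕ.* s) (tailExponent c i v) (initial (suc κ ℕ.∸ i) (x ∷ v)))
    (≡.trans (cong (λ m → s ℕ.* s ℕ.+ c ℕ.* s ℕ.+ tailExponent c i v ℕ.+ m) (bump-initial i x v))
      (≡.trans (regroup′ (s ℕ.* s ℕ.+ c ℕ.* s) (tailExponent c i v) s (initial (κ ℕ.∸ i) v))
        (≡.trans (cong (s ℕ.* s ℕ.+ c ℕ.* s ℕ.+ s ℕ.+_) (tailExponent-initial c i v))
          (≡.trans (collect s c (squares v) (linear v))
            (≡.sym (cong₂ (λ a b → a ℕ.+ (c ℕ.+ 1) ℕ.* b) (squares-∷ x v) (linear-∷ x v)))))))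
    where
    s = Vec.sum (x ∷ v)
    regroup : ∀ w b t m → w ℕ.+ b ℕ.+ t ℕ.+ m ≡ w ℕ.+ t ℕ.+ (b ℕ.+ m)
    regroup = solve-∀
    regroup′ : ∀ w t s m → w ℕ.+ t ℕ.+ (s ℕ.+ m) ≡ w ℕ.+ s ℕ.+ (t ℕ.+ m)
    regroup′ = solve-∀
    collect : ∀ s c a b → s ℕ.* s ℕ.+ c ℕ.* s ℕ.+ s ℕ.+ (a ℕ.+ (c ℕ.+ 1) ℕ.* b) ≡ s ℕ.* s ℕ.+ a ℕ.+ (c ℕ.+ 1) ℕ.* (s ℕ.+ b)
    collect = solve-∀

  fullExponent-initial : ∀ p c i {κ} x (v : Vec ℕ κ) →
    fullExponent p c i (x ∷ v) ℕ.+ initial (suc κ ℕ.∸ i) (x ∷ v)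
      ≡ tri (suc (Vec.sum (x ∷ v))) ℕ.+ p ℕ.* Vec.sum (x ∷ v) ℕ.+ (squares v ℕ.+ (c ℕ.+ 1) ℕ.* linear v)
  fullExponent-initial p c i {κ} x v = ≡.trans
    (regroup (tri s ℕ.+ p ℕ.* s) (bump i κ ℕ.* s) (tailExponent c i v) (initial (suc κ ℕ.∸ i) (x ∷ v)))
    (≡.trans (cong (λ m → tri s ℕ.+ p ℕ.* s ℕ.+ tailExponent c i v ℕ.+ m) (bump-initial i x v))
      (≡.trans (regroup′ (tri s) (p ℕ.* s) (tailExponent c i v) s (initial (κ ℕ.∸ i) v))
        (cong (tri s ℕ.+ s ℕ.+ p ℕ.* s ℕ.+_) (tailExponent-initial c i v))))
    where
    s = Vec.sum (x ∷ v)
    regroup : ∀ w b t m → w ℕ.+ b ℕ.+ t ℕ.+ m ≡ w ℕ.+ t ℕ.+ (b ℕ.+ m)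
    regroup = solve-∀
    regroup′ : ∀ w p t s m → w ℕ.+ p ℕ.+ t ℕ.+ (s ℕ.+ m) ≡ w ℕ.+ s ℕ.+ p ℕ.+ (t ℕ.+ m)
    regroup′ = solve-∀

  -- The exponent of the summand on the right, for ℓ = p ≥ 0.
  right⁺ : ∀ p i {κ} (v : Vec ℕ (suc κ)) →
    rightExponent (+ p) v ℚ.- nat (initial (suc κ ℕ.∸ i) v) ≡ nat (fullExponent p (p ℕ.+ p) i v)
  right⁺ p i {κ} (x ∷ v) = move (nat (initial (suc κ ℕ.∸ i) (x ∷ v))) (≡.trans (rightExponent-form (+ p) x v)
    (≡.trans (≡.sym expand) (≡.trans (cong nat (≡.sym (fullExponent-initial p (p ℕ.+ p) i x v)))
      (nat-+ (fullExponent p (p ℕ.+ p) i (x ∷ v)) (initial (suc κ ℕ.∸ i) (x ∷ v))))))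
    where
    s = Vec.sum (x ∷ v)
    move : ∀ {a b} c → a ≡ b ℚ.+ c → a ℚ.- c ≡ b
    move {b = b} c ≡.refl = solve 2 (λ b c → b :+ c :- c := b) ≡.refl b c
    identity : ∀ s a b p → ½ ℚ.* (s ℚ.* (s ℚ.+ 1ℚ)) ℚ.+ p ℚ.* s ℚ.+ (a ℚ.+ ((p ℚ.+ p) ℚ.+ 1ℚ) ℚ.* b) ≡ rightForm s a b p
    identity = solve 4 (λ s a b p → con ½ :* (s :* (s :+ con 1ℚ)) :+ p :* s :+ (a :+ ((p :+ p) :+ con 1ℚ) :* b)
      := con ½ :* (s :* (s :+ con 1ℚ)) :+ (a :+ p :* s :+ (con 2ℚ :* p :+ con 1ℚ) :* b)) ≡.refl
    expand : nat (tri (suc s) ℕ.+ p ℕ.* s ℕ.+ (squares v ℕ.+ ((p ℕ.+ p) ℕ.+ 1) ℕ.* linear v))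
      ≡ rightForm (nat s) (nat (squares v)) (nat (linear v)) (nat p)
    expand = ≡.trans (nat-+ (tri (suc s) ℕ.+ p ℕ.* s) (squares v ℕ.+ ((p ℕ.+ p) ℕ.+ 1) ℕ.* linear v))
      (≡.trans (cong₂ ℚ._+_
        (≡.trans (nat-+ (tri (suc s)) (p ℕ.* s)) (cong₂ ℚ._+_ (nat-tri s) (nat-* p s)))
        (≡.trans (nat-+ (squares v) (((p ℕ.+ p) ℕ.+ 1) ℕ.* linear v)) (cong (nat (squares v) ℚ.+_)
          (≡.trans (nat-* ((p ℕ.+ p) ℕ.+ 1) (linear v)) (cong (ℚ._* nat (linear v))
            (≡.trans (nat-+ (p ℕ.+ p) 1) (cong (ℚ._+ 1ℚ) (nat-+ p p))))))))
        (identity (nat s) (nat (squares v)) (nat (linear v)) (nat p)))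

  -- Adding m to the last entry.
  raise : (m : ℕ) → ∀ {κ} → Vec ℕ (suc κ) → Vec ℕ (suc κ)
  raise m (x ∷ [])    = m ℕ.+ x ∷ []
  raise m (x ∷ y ∷ v) = x ∷ raise m (y ∷ v)

  -- The partial inverse of raise m.
  lower : (m : ℕ) → ∀ {κ} → Vec ℕ (suc κ) → Maybe (Vec ℕ (suc κ))
  lower m (x ∷ []) with m ℕₚ.≤? x
  ... | yes _ = just (x ℕ.∸ m ∷ [])
  ... | no  _ = nothing
  lower m (x ∷ y ∷ v) = Maybe.map (x ∷_) (lower m (y ∷ v))

  raise-lower : ∀ m {κ} {v w : Vec ℕ (suc κ)} → lower m v ≡ just w → v ≡ raise m w
  raise-lower m {v = x ∷ []} e with m ℕₚ.≤? x
  raise-lower m {v = x ∷ []} ≡.refl | yes m≤x = cong (_∷ []) (≡.sym (ℕₚ.m+[n∸m]≡n m≤x))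
  raise-lower m {v = x ∷ y ∷ v} e with lower m (y ∷ v) in eq
  raise-lower m {v = x ∷ y ∷ v} ≡.refl | just (z ∷ w) = cong (x ∷_) (raise-lower m eq)

  lower-raise : ∀ m {κ} (v : Vec ℕ (suc κ)) → lower m (raise m v) ≡ just v
  lower-raise m (x ∷ []) with m ℕₚ.≤? m ℕ.+ x
  ... | yes _  = cong (λ n → just (n ∷ [])) (ℕₚ.m+n∸m≡n m x)
  ... | no  ¬p = contradiction (ℕₚ.m≤m+n m x) ¬p
  lower-raise m (x ∷ y ∷ v) with raise m (y ∷ v) | lower-raise m (y ∷ v)
  ... | z ∷ w | e rewrite e = ≡.refl

  -- The entry n_k.
  last : ∀ {κ} → Vec ℕ (suc κ) → ℕ
  last (x ∷ [])    = x
  last (x ∷ y ∷ v) = last (y ∷ v)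

  ‼-last : ∀ {κ} (v : Vec ℕ (suc κ)) → v ‼ suc κ ≡ last v
  ‼-last (x ∷ [])    = ≡.refl
  ‼-last (x ∷ y ∷ v) = ‼-last (y ∷ v)

  -- The inverse is undefined only where n_k < m, so that 1/(q)_{n_k - m} vanishes.
  lower-nothing : ∀ m {κ} (v : Vec ℕ (suc κ)) → lower m v ≡ nothing → last v < m
  lower-nothing m (x ∷ []) e with m ℕₚ.≤? x
  ... | no m≰x = ℕₚ.≰⇒> m≰x
  lower-nothing m (x ∷ y ∷ v) e with lower m (y ∷ v) in eq
  ... | nothing = lower-nothing m (y ∷ v) eq

  raise-sum : ∀ m {κ} (v : Vec ℕ (suc κ)) → Vec.sum (raise m v) ≡ m ℕ.+ Vec.sum v
  raise-sum m (x ∷ [])    = ℕₚ.+-assoc m x 0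
  raise-sum m (x ∷ y ∷ v) = ≡.trans (cong (x ℕ.+_) (raise-sum m (y ∷ v))) (swap x m (Vec.sum (y ∷ v)))
    where
    swap : ∀ x m s → x ℕ.+ (m ℕ.+ s) ≡ m ℕ.+ (x ℕ.+ s)
    swap = solve-∀

  raise-initial : ∀ m j {κ} (v : Vec ℕ (suc κ)) → j ≤ suc κ → initial j (raise m v) ≡ j ℕ.* m ℕ.+ initial j v
  raise-initial m zero    v _ = ≡.refl
  raise-initial m (suc zero) (x ∷ []) _ = ≡.trans (initial-∷ 0 (m ℕ.+ x) []) (≡.trans (shift m x) (cong (1 ℕ.* m ℕ.+_) (≡.sym (initial-∷ 0 x []))))
    where
    shift : ∀ m x → m ℕ.+ x ℕ.+ 0 ℕ.+ 0 ≡ 1 ℕ.* m ℕ.+ (x ℕ.+ 0 ℕ.+ 0)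
    shift = solve-∀
  raise-initial m (suc (suc j)) (x ∷ []) (s≤s ())
  raise-initial m (suc j) (x ∷ y ∷ v) (s≤s j≤) = ≡.trans (initial-∷ j x (raise m (y ∷ v)))
    (≡.trans (cong₂ ℕ._+_ (raise-sum m (x ∷ y ∷ v)) (raise-initial m j (y ∷ v) j≤))
      (≡.trans (regroup m (Vec.sum (x ∷ y ∷ v)) (j ℕ.* m) (initial j (y ∷ v)))
        (cong (suc j ℕ.* m ℕ.+_) (≡.sym (initial-∷ j x (y ∷ v))))))
    where
    regroup : ∀ m s a b → m ℕ.+ s ℕ.+ (a ℕ.+ b) ≡ m ℕ.+ a ℕ.+ (s ℕ.+ b)
    regroup = solve-∀

  raise-squares : ∀ m {κ} (v : Vec ℕ (suc κ)) → squares (raise m v) ≡ squares v ℕ.+ 2 ℕ.* m ℕ.* linear v ℕ.+ suc κ ℕ.* (m ℕ.* m)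
  raise-squares m (x ∷ []) = ≡.trans (squares-∷ (m ℕ.+ x) []) (≡.trans (expand m x)
    (≡.sym (cong₂ (λ a b → a ℕ.+ 2 ℕ.* m ℕ.* b ℕ.+ 1 ℕ.* (m ℕ.* m)) (squares-∷ x []) (linear-∷ x []))))
    where
    expand : ∀ m x → (m ℕ.+ x ℕ.+ 0) ℕ.* (m ℕ.+ x ℕ.+ 0) ℕ.+ 0 ≡ ((x ℕ.+ 0) ℕ.* (x ℕ.+ 0) ℕ.+ 0) ℕ.+ 2 ℕ.* m ℕ.* (x ℕ.+ 0 ℕ.+ 0) ℕ.+ 1 ℕ.* (m ℕ.* m)
    expand = solve-∀
  raise-squares m {suc κ} (x ∷ y ∷ v) = ≡.trans (squares-∷ x (raise m (y ∷ v)))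
    (≡.trans (cong₂ (λ s a → s ℕ.* s ℕ.+ a) (raise-sum m (x ∷ y ∷ v)) (raise-squares m (y ∷ v)))
      (≡.trans (expand m (Vec.sum (x ∷ y ∷ v)) (squares (y ∷ v)) (linear (y ∷ v)) κ)
        (≡.sym (cong₂ (λ a b → a ℕ.+ 2 ℕ.* m ℕ.* b ℕ.+ suc (suc κ) ℕ.* (m ℕ.* m)) (squares-∷ x (y ∷ v)) (linear-∷ x (y ∷ v))))))
    where
    expand : ∀ m s a b κ → (m ℕ.+ s) ℕ.* (m ℕ.+ s) ℕ.+ (a ℕ.+ 2 ℕ.* m ℕ.* b ℕ.+ suc κ ℕ.* (m ℕ.* m))
      ≡ s ℕ.* s ℕ.+ a ℕ.+ 2 ℕ.* m ℕ.* (s ℕ.+ b) ℕ.+ suc (suc κ) ℕ.* (m ℕ.* m)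
    expand = solve-∀

  tail-squares : ∀ m {κ} (v : Vec ℕ (suc κ)) →
    squares (Vec.tail (raise m v)) ≡ squares (Vec.tail v) ℕ.+ 2 ℕ.* m ℕ.* linear (Vec.tail v) ℕ.+ κ ℕ.* (m ℕ.* m)
  tail-squares m (x ∷ [])    = ≡.sym (≡.trans (ℕₚ.+-identityʳ (2 ℕ.* m ℕ.* 0)) (ℕₚ.*-zeroʳ (2 ℕ.* m)))
  tail-squares m (x ∷ y ∷ v) = raise-squares m (y ∷ v)

  tail-linear : ∀ m {κ} (v : Vec ℕ (suc κ)) → linear (Vec.tail (raise m v)) ≡ κ ℕ.* m ℕ.+ linear (Vec.tail v)
  tail-linear m (x ∷ [])    = ≡.refl
  tail-linear m {suc κ} (x ∷ y ∷ v) = raise-initial m (suc κ) (y ∷ v) ℕₚ.≤-refl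

  rightExponent-tail : ∀ ℓ {κ} (v : Vec ℕ (suc κ)) → rightExponent ℓ v
    ≡ rightForm (nat (Vec.sum v)) (nat (squares (Vec.tail v))) (nat (linear (Vec.tail v))) (fromℤ ℓ)
  rightExponent-tail ℓ (x ∷ v) = rightExponent-form ℓ x v

  -- Replacing ℓ = p by - p and raising n_k by 2 p changes the exponent by (2i - 1) p, as on the left.
  right-raise : ∀ p j i κ → j ℕ.+ i ≡ suc κ → ∀ (v : Vec ℕ (suc κ)) →
    rightExponent (ℤ.- + p) (raise (p ℕ.+ p) v) ℚ.- nat (initial j (raise (p ℕ.+ p) v))
      ≡ (2ℚ ℚ.* nat i ℚ.- 1ℚ) ℚ.* nat p ℚ.+ (rightExponent (+ p) v ℚ.- nat (initial j v))
  right-raise p j i κ e v = ≡.trans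
    (cong₂ ℚ._-_ (≡.trans (rightExponent-tail (ℤ.- + p) (raise m v)) (cong₂ (λ (S , A) (B , L) → rightForm S A B L)
        (cong₂ _,_ (≡.trans (cong nat (raise-sum m v)) (m! ⊹ nat! (Vec.sum v)))
          (≡.trans (cong nat (tail-squares m v)) (nat! (squares w) ⊹ nat! 2 ⊛ m! ⊛ nat! (linear w) ⊹ κ! ⊛ (m! ⊛ m!))))
        (cong₂ _,_ (≡.trans (cong nat (tail-linear m v)) (κ! ⊛ m! ⊹ nat! (linear w))) (fromℤ-neg (+ p)))))
      (≡.trans (cong nat (raise-initial m j v (subst (j ≤_) e (ℕₚ.m≤m+n j i)))) (nat! j ⊛ m! ⊹ nat! (initial j v))))
    (≡.trans (identity (nat (Vec.sum v)) (nat (squares w)) (nat (linear w)) (nat p) (nat j) (nat i) (nat (initial j v)))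
      (cong (λ E → (2ℚ ℚ.* nat i ℚ.- 1ℚ) ℚ.* nat p ℚ.+ (E ℚ.- nat (initial j v))) (≡.sym (rightExponent-tail (+ p) v))))
    where
    m = p ℕ.+ p
    w = Vec.tail v
    m! : nat m ≡ nat p ℚ.+ nat p
    m! = nat! p ⊹ nat! p
    κ! : nat κ ≡ nat j ℚ.+ nat i ℚ.- 1ℚ
    κ! = ≡.trans (drop (nat κ)) (cong (ℚ._- 1ℚ) (≡.trans (≡.sym (nat-suc κ)) (≡.trans (cong nat (≡.sym e)) (nat-+ j i))))
      where
      drop : ∀ x → x ≡ (1ℚ ℚ.+ x) ℚ.- 1ℚ
      drop = solve 1 (λ x → x := (con 1ℚ :+ x) :- con 1ℚ) ≡.refl
    identity : ∀ S A B p j i I →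
      rightForm ((p ℚ.+ p) ℚ.+ S) (A ℚ.+ 2ℚ ℚ.* (p ℚ.+ p) ℚ.* B ℚ.+ (j ℚ.+ i ℚ.- 1ℚ) ℚ.* ((p ℚ.+ p) ℚ.* (p ℚ.+ p)))
          ((j ℚ.+ i ℚ.- 1ℚ) ℚ.* (p ℚ.+ p) ℚ.+ B) (ℚ.- p) ℚ.- (j ℚ.* (p ℚ.+ p) ℚ.+ I)
        ≡ (2ℚ ℚ.* i ℚ.- 1ℚ) ℚ.* p ℚ.+ (rightForm S A B p ℚ.- I)
    identity = solve 7 (λ S A B p j i I →
      let S′ = (p :+ p) :+ S
          A′ = A :+ con 2ℚ :* (p :+ p) :* B :+ (j :+ i :- con 1ℚ) :* ((p :+ p) :* (p :+ p))
          B′ = (j :+ i :- con 1ℚ) :* (p :+ p) :+ B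
      in con ½ :* (S′ :* (S′ :+ con 1ℚ)) :+ (A′ :+ (:- p) :* S′ :+ (con 2ℚ :* (:- p) :+ con 1ℚ) :* B′) :- (j :* (p :+ p) :+ I)
        := (con 2ℚ :* i :- con 1ℚ) :* p :+ ((con ½ :* (S :* (S :+ con 1ℚ)) :+ (A :+ p :* S :+ (con 2ℚ :* p :+ con 1ℚ) :* B)) :- I)) ≡.refl

-- Both sides over a normed ring, and the change of sign of ℓ

-- Both sides of the identity over a normed ring; e r plays the role of q ^ r for rational r.
module Evaluation (𝔸 : NormedRing) (q : NormedRing.Carrier 𝔸) (ρ : ℚ) (ρ<1 : ρ ℚ.< 1ℚ) (q≼ρ : NormedRing._≼_ 𝔸 q ρ)
  (e : ℚ → NormedRing.Carrier 𝔸)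
  (e-+ : ∀ r s → NormedRing._≈_ 𝔸 (e (r ℚ.+ s)) (NormedRing._*_ 𝔸 (e r) (e s)))
  (e-0 : NormedRing._≈_ 𝔸 (e 0ℚ) (NormedRing.1# 𝔸)) (e-1 : NormedRing._≈_ 𝔸 (e 1ℚ) q) where
  open NormedRing 𝔸
  open IntegerCoefficients commutativeRing
  open RationalEstimates
  open Limits 𝔸
  open UnconditionalSums 𝔸
  open ThetaLimit 𝔸 q ρ ρ<1 q≼ρ
  open RangeSums
  open ExponentIdentities
  open SetoidReasoning setoid

  e-≡ : ∀ {r s} → r ≡ s → e r ≈ e s
  e-≡ p = reflexive (cong e p)

  e-nat : ∀ n → e (nat n) ≈ q ^ n
  e-nat zero    = e-0
  e-nat (suc n) = trans (e-≡ (≡.trans (nat-suc n) (ℚₚ.+-comm 1ℚ (nat n))))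
    (trans (e-+ (nat n) 1ℚ) (*-cong (e-nat n) e-1))

  e-cancel : ∀ r → e r * e (ℚ.- r) ≈ 1#
  e-cancel r = trans (sym (e-+ r (ℚ.- r))) (trans (e-≡ (ℚₚ.+-inverseʳ r)) e-0)

  -- 1/(q)_m for integers m.
  rrℤ : ℤ → Carrier
  rrℤ (+ m)    = rr m
  rrℤ -[1+ m ] = 0#

  -- (a ; q)_n, and its extension to integers n.
  poch : Carrier → ℕ → Carrier
  poch a zero    = 1#
  poch a (suc n) = poch a n * (1# - a * q ^ n)

  pochℤ : Carrier → ℤ → Carrier
  pochℤ a (+ n)    = poch a n
  pochℤ a -[1+ _ ] = 1#

  poch-neg : ∀ n → poch (- q) n ≈ poch⁺ n
  poch-neg zero    = refl
  poch-neg (suc n) = *-cong (poch-neg n) (solve 2 (λ q x → con (+ 1) :- (:- q) :* x := con (+ 1) :+ x :* q) refl q (q ^ n))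

  poch-pos : ∀ n → poch q n ≈ poch⁻ n
  poch-pos zero    = refl
  poch-pos (suc n) = *-cong (poch-pos n) (+-congˡ (-‿cong (*-comm q (q ^ n))))

  poch-rr : ∀ n → poch q n * rr n ≈ 1#
  poch-rr n = trans (*-congʳ (poch-pos n)) (poch⁻-rr n)

  poch-neg→P : Seq-Conv (poch (- q)) P
  poch-neg→P = Conv-cong (λ n → sym (poch-neg n)) refl poch⁺→P

  poch-pos→Q : Seq-Conv (poch q) Q
  poch-pos→Q = Conv-cong (λ n → sym (poch-pos n)) refl poch⁻→Q

  ∏ : List ℕ → (ℕ → Carrier) → Carrier
  ∏ js f = foldr _*_ 1# (List.map f js)

  -- The summands on the left, for the general identity and for the simplified case i = k.
  leftTerm : (k i : ℕ) (ℓ n : ℤ) → Carrier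
  leftTerm k i ℓ n = e (leftExponent k i ℓ n) * (1# + e (fromℤ n))

  leftTerm′ : (k : ℕ) (ℓ n : ℤ) → Carrier
  leftTerm′ k ℓ n = e (leftExponent k k ℓ n)

  -- The summand on the right, where t is the power of q.
  rightTerm : ∀ {k} (ℓ : ℤ) → (Vec ℕ k → Carrier) → Vec ℕ k → Carrier
  rightTerm {k} ℓ t v = t v * pochℤ (- q) (+ N v 1 ℤ.+ ℓ)
    * (∏ (1 ⋯ k) (λ j → rrℤ (+ (v ‼ j))) * rrℤ (+ (v ‼ k) ℤ.+ + 2 ℤ.* ℓ))

  -- The terms in another multiplication and addition that agree with those of the ring.
  leftTerm-≡ : (add mul : Carrier → Carrier → Carrier) → (∀ x y → x + y ≡ add x y) → (∀ x y → x * y ≡ mul x y) →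
    ∀ k i ℓ n {x o y} → e (leftExponent k i ℓ n) ≡ x → 1# ≡ o → e (fromℤ n) ≡ y → leftTerm k i ℓ n ≡ mul x (add o y)
  leftTerm-≡ add mul add-≡ mul-≡ k i ℓ n {x} {o} {y} ≡.refl ≡.refl ≡.refl = ≡.trans (mul-≡ x (o + y)) (cong (mul x) (add-≡ o y))

  rightTerm-≡ : (mul : Carrier → Carrier → Carrier) → (∀ x y → x * y ≡ mul x y) →
    ∀ {k} ℓ (t : Vec ℕ k → Carrier) v {x y z u} → t v ≡ x → pochℤ (- q) (+ N v 1 ℤ.+ ℓ) ≡ y →
    ∏ (1 ⋯ k) (λ j → rrℤ (+ (v ‼ j))) ≡ z → rrℤ (+ (v ‼ k) ℤ.+ + 2 ℤ.* ℓ) ≡ u → rightTerm ℓ t v ≡ mul (mul x y) (mul z u)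
  rightTerm-≡ mul mul-≡ {k} ℓ t v {x} {y} {z} {u} ≡.refl ≡.refl ≡.refl ≡.refl = ≡.trans (mul-≡ (x * y) (z * u)) (cong₂ mul (mul-≡ x y) (mul-≡ z u))

  rightPower : ∀ {k} (i : ℕ) (ℓ : ℤ) → Vec ℕ k → Carrier
  rightPower {k} i ℓ v = e (rightExponent ℓ v ℚ.- fromℤ (+ ∑ᴺ (1 ⋯ (k ℕ.∸ i)) (N v)))

  -- The two sums on the left.
  HasLeftSums : (ℤ → Carrier) → ℤ → Carrier → Carrier → Set
  HasLeftSums f ℓ S⁺ S⁻ = HasSum (λ m → f (+ (ℤ.∣ ℓ ∣ ℕ.+ m))) S⁺
    × HasSum (λ m → f (ℤ.- (+ ℤ.∣ ℓ ∣) ℤ.- + 1 ℤ.- + m)) S⁻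

  -- The equality of the two sides, for the terms f on the left and t on the right.
  Identity : ∀ k → ℤ → (ℤ → Carrier) → (Vec ℕ k → Carrier) → Set
  Identity k ℓ f t = ∃[ S⁺ ] ∃[ S⁻ ] (HasLeftSums f ℓ S⁺ S⁻ × HasSum (rightTerm ℓ t) (P * R * (S⁺ - S⁻)))

  -- The product over j of g at n_j, with the extra factor h at n_k.
  product : (g h : ℕ → Carrier) → ∀ {κ} → Vec ℕ (suc κ) → Carrier
  product g h (x ∷ [])    = g x * h x
  product g h (x ∷ y ∷ v) = g x * product g h (y ∷ v)

  product-∷ : ∀ (g h : ℕ → Carrier) x {κ} (v : Vec ℕ (suc κ)) → product g h (x ∷ v) ≡ g x * product g h v
  product-∷ g h x (y ∷ v) = ≡.refl

  ∏-cong : ∀ {f g} → (∀ j → f (suc j) ≡ g (suc j)) → ∀ k → ∏ (1 ⋯ k) f ≡ ∏ (1 ⋯ k) g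
  ∏-cong p k = cong (foldr _*_ 1#) (map-⋯-cong p 0 k)

  ∏-product : ∀ (g h : ℕ → Carrier) {κ} (v : Vec ℕ (suc κ)) →
    ∏ (1 ⋯ suc κ) (λ j → g (v ‼ j)) * h (last v) ≈ product g h v
  ∏-product g h (x ∷ [])            = *-congʳ (*-identityʳ (g x))
  ∏-product g h {suc κ} (x ∷ y ∷ v) = begin
    ∏ (1 ⋯ suc (suc κ)) (λ j → g ((x ∷ y ∷ v) ‼ j)) * h (last (y ∷ v))
      ≈⟨ *-congʳ (reflexive (cong (foldr _*_ 1#) (map-⋯-front (λ j → g ((x ∷ y ∷ v) ‼ j)) (suc κ)))) ⟩
    g x * ∏ (1 ⋯ suc κ) (λ j → g ((x ∷ y ∷ v) ‼ suc j)) * h (last (y ∷ v))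
      ≈⟨ *-congʳ (*-congˡ (reflexive (∏-cong {λ j → g ((x ∷ y ∷ v) ‼ suc j)} {λ j → g ((y ∷ v) ‼ j)} (λ j → ≡.refl) (suc κ)))) ⟩
    g x * ∏ (1 ⋯ suc κ) (λ j → g ((y ∷ v) ‼ j)) * h (last (y ∷ v))
      ≈⟨ *-assoc (g x) (∏ (1 ⋯ suc κ) (λ j → g ((y ∷ v) ‼ j))) (h (last (y ∷ v))) ⟩
    g x * (∏ (1 ⋯ suc κ) (λ j → g ((y ∷ v) ‼ j)) * h (last (y ∷ v)))
      ≈⟨ *-congˡ (∏-product g h (y ∷ v)) ⟩
    g x * product g h (y ∷ v) ∎

  product-denominators : ∀ c (h : ℕ → Carrier) → (∀ x → h x ≈ rr (c ℕ.+ x)) → ∀ {κ} (v : Vec ℕ (suc κ)) →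
    product rr h v ≈ denominators c v
  product-denominators c h p (x ∷ [])    = *-congˡ (p x)
  product-denominators c h p (x ∷ y ∷ v) = *-congˡ (product-denominators c h p (y ∷ v))

  product-raise : ∀ c (h : ℕ → Carrier) → (∀ x → h (c ℕ.+ x) ≈ rr x) → ∀ {κ} (v : Vec ℕ (suc κ)) →
    product rr h (raise c v) ≈ denominators c v
  product-raise c h p (x ∷ [])    = trans (*-congˡ (p x)) (*-comm (rr (c ℕ.+ x)) (rr x))
  product-raise c h p (x ∷ y ∷ v) = trans (reflexive (product-∷ rr h x (raise c (y ∷ v)))) (*-congˡ (product-raise c h p (y ∷ v)))

  factors : ∀ (ℓ : ℤ) {κ} (v : Vec ℕ (suc κ)) →
    ∏ (1 ⋯ suc κ) (λ j → rrℤ (+ (v ‼ j))) * rrℤ (+ (v ‼ suc κ) ℤ.+ + 2 ℤ.* ℓ)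
      ≈ product rr (λ x → rrℤ (+ x ℤ.+ + 2 ℤ.* ℓ)) v
  factors ℓ v = trans (*-congˡ (reflexive (cong (λ x → rrℤ (+ x ℤ.+ + 2 ℤ.* ℓ)) (‼-last v))))
    (∏-product rr (λ x → rrℤ (+ x ℤ.+ + 2 ℤ.* ℓ)) v)

  -- Integer arguments that occur in the two signs of ℓ.

  module ℤS = ℤ-Solver.+-*-Solver

  double⁺ : ∀ p x → + x ℤ.+ + 2 ℤ.* + p ≡ + (p ℕ.+ p ℕ.+ x)
  double⁺ p x = ℤS.solve 2 (λ p x → x ℤS.:+ ℤS.con (+ 2) ℤS.:* p ℤS.:= p ℤS.:+ p ℤS.:+ x) ≡.refl (+ p) (+ x)

  double⁻ : ∀ p x → + (p ℕ.+ p ℕ.+ x) ℤ.+ + 2 ℤ.* (ℤ.- + p) ≡ + x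
  double⁻ p x = ℤS.solve 2 (λ p x → p ℤS.:+ p ℤS.:+ x ℤS.:+ ℤS.con (+ 2) ℤS.:* (ℤS.:- p) ℤS.:= x) ≡.refl (+ p) (+ x)

  below-double : ∀ p x → x < p ℕ.+ p → rrℤ (+ x ℤ.+ + 2 ℤ.* (ℤ.- + p)) ≡ 0#
  below-double p x lt = let (d , eq) = ℕₚ.m≤n⇒∃[o]m+o≡n lt in cong rrℤ (negative d (cong +_ eq))
    where
    negative : ∀ d → ℤ.suc (+ x) ℤ.+ + d ≡ + p ℤ.+ + p → + x ℤ.+ + 2 ℤ.* (ℤ.- + p) ≡ -[1+ d ]
    negative d eq = ≡.trans
      (ℤS.solve 2 (λ p x → x ℤS.:+ ℤS.con (+ 2) ℤS.:* (ℤS.:- p) ℤS.:= x ℤS.:- (p ℤS.:+ p)) ≡.refl (+ p) (+ x))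
      (≡.trans (cong (ℤ._-_ (+ x)) (≡.sym eq))
        (ℤS.solve 2 (λ x d → x ℤS.:- (ℤS.con (+ 1) ℤS.:+ x ℤS.:+ d) ℤS.:= ℤS.:- (ℤS.con (+ 1) ℤS.:+ d)) ≡.refl (+ x) (+ d)))

  negative-index : ∀ p m → ℤ.- (+ p) ℤ.- + 1 ℤ.- + m ≡ ℤ.- + (p ℕ.+ suc m)
  negative-index p m = ℤS.solve 2 (λ p m → ℤS.:- p ℤS.:- ℤS.con (+ 1) ℤS.:- m ℤS.:= ℤS.:- (p ℤS.:+ (ℤS.con (+ 1) ℤS.:+ m))) ≡.refl (+ p) (+ m)

  poch-index : ∀ p s → + (p ℕ.+ p ℕ.+ s) ℤ.+ (ℤ.- + p) ≡ + (p ℕ.+ s)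
  poch-index p s = ℤS.solve 2 (λ p s → p ℤS.:+ p ℤS.:+ s ℤS.:+ (ℤS.:- p) ℤS.:= p ℤS.:+ s) ≡.refl (+ p) (+ s)

  -- The terms for ℓ = p ≥ 0.

  left-power⁺ : ∀ p j i {k} → j ℕ.+ i ≡ k → ∀ t → e (leftExponent k i (+ p) (+ (p ℕ.+ t))) ≈ q ^ exponent⁺ p (p ℕ.+ p) j i t
  left-power⁺ p j i ≡.refl t = trans (e-≡ (left⁺ p j i t)) (e-nat (exponent⁺ p (p ℕ.+ p) j i t))

  left-power⁻ : ∀ p j i {k} → j ℕ.+ i ≡ k → ∀ t → e (leftExponent k i (+ p) (ℤ.- (+ p) ℤ.- + 1 ℤ.- + t))
    ≈ q ^ exponent⁻ p (p ℕ.+ p) j i t * q ^ (p ℕ.+ suc t)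
  left-power⁻ p j i {k} ≡.refl t = trans (e-≡ (≡.trans (cong (leftExponent k i (+ p)) (negative-index p t)) (left⁻ p j i t)))
    (trans (e-+ _ _) (*-cong (e-nat (exponent⁻ p (p ℕ.+ p) j i t)) (e-nat (p ℕ.+ suc t))))

  left-term⁺ : ∀ p j i {k} → j ℕ.+ i ≡ k → ∀ t → leftTerm k i (+ p) (+ (p ℕ.+ t)) ≈ theta⁺ p (p ℕ.+ p) j i t
  left-term⁺ p j i eq t = *-cong (left-power⁺ p j i eq t) (+-congˡ (e-nat (p ℕ.+ t)))

  left-term⁻ : ∀ p j i {k} → j ℕ.+ i ≡ k → ∀ t → leftTerm k i (+ p) (ℤ.- (+ p) ℤ.- + 1 ℤ.- + t) ≈ theta⁻ p (p ℕ.+ p) j i t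
  left-term⁻ p j i eq t = begin
    _ * (1# + e (fromℤ (ℤ.- (+ p) ℤ.- + 1 ℤ.- + t)))
      ≈⟨ *-cong (left-power⁻ p j i eq t) (+-congˡ (e-≡ (≡.trans (cong fromℤ (negative-index p t)) (fromℤ-neg (+ (p ℕ.+ suc t)))))) ⟩
    X * Y * (1# + Z)
      ≈⟨ solve 3 (λ x y z → x :* y :* (con (+ 1) :+ z) := x :* (y :* z :+ y)) refl X Y Z ⟩
    X * (Y * Z + Y)
      ≈⟨ *-congˡ (+-congʳ (trans (*-congʳ (sym (e-nat (p ℕ.+ suc t)))) (e-cancel (nat (p ℕ.+ suc t))))) ⟩
    X * (1# + Y) ∎
    where
    X = q ^ exponent⁻ p (p ℕ.+ p) j i t
    Y = q ^ (p ℕ.+ suc t)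
    Z = e (ℚ.- nat (p ℕ.+ suc t))

  right-term : ∀ p i {κ} (v : Vec ℕ (suc κ)) → rightTerm (+ p) (rightPower i (+ p)) v ≈ summand p (p ℕ.+ p) i v
  right-term p i {κ} v = trans (*-cong
      (*-cong (trans (e-≡ (right⁺ p i v)) (e-nat (fullExponent p (p ℕ.+ p) i v)))
        (trans (poch-neg (N v 1 ℕ.+ p)) (reflexive (cong poch⁺ (≡.trans (ℕₚ.+-comm (N v 1) p) (cong (p ℕ.+_) (N-sum v)))))))
      (trans (factors (+ p) v) (product-denominators (p ℕ.+ p) _ (λ x → reflexive (cong rrℤ (double⁺ p x))) v)))
    (*-assoc _ _ _)

  identity⁺ : ∀ κ p j i → j ℕ.+ i ≡ suc κ → Identity (suc κ) (+ p) (leftTerm (suc κ) i (+ p)) (rightPower i (+ p))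
  identity⁺ κ p j i eq = S+.S , S-.S
    , ( HasSum-cong (λ t → sym (left-term⁺ p j i eq t)) refl (S+.hasSum S+.∑→S)
      , HasSum-cong (λ t → sym (left-term⁻ p j i eq t)) refl (S-.hasSum S-.∑→S))
    , HasSum-cong (λ v → sym (right-term p i v)) refl (multisum p j i κ eq S+.∑→S S-.∑→S)
    where
    c = p ℕ.+ p
    module S+ = Sum¼ (theta⁺ p c j i) (C₄ ℚ.* 2ℚ) 2C₄≥0 (λ t → theta-≼ (p ℕ.+ t) t (tri≤exponent⁺ p c j i t))
    module S- = Sum¼ (theta⁻ p c j i) (C₄ ℚ.* 2ℚ) 2C₄≥0 (λ t → theta-≼ (p ℕ.+ suc t) t (tri≤exponent⁻ p c j i t))

  -- For i = k write the positive terms as X + Y and the negative ones as Y + Z: the Y cancel, and X and Z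
  -- are the terms without the factor 1 + q ^ n.
  identity′⁺ : ∀ κ p → Identity (suc κ) (+ p) (leftTerm′ (suc κ) (+ p)) (rightPower (suc κ) (+ p))
  identity′⁺ κ p = SX.S , SZ.S
    , ( HasSum-cong (λ t → sym (left-power⁺ p 0 i ≡.refl t)) refl (SX.hasSum SX.∑→S)
      , HasSum-cong (λ t → sym (left-power⁻ p 0 i ≡.refl t)) refl (SZ.hasSum SZ.∑→S))
    , HasSum-cong (λ v → sym (right-term p i v))
        (*-congˡ (solve 3 (λ x y z → (x :+ y) :- (y :+ z) := x :- z) refl SX.S SY.S SZ.S))
        (multisum p 0 i κ ≡.refl
          (Conv-cong (λ n → trans (sym (∑-+ n X Y)) (∑-cong n (λ t _ → plus t))) refl (Conv-+ SX.∑→S SY.∑→S))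
          (Conv-cong (λ n → trans (sym (∑-+ n Y Z)) (∑-cong n (λ t _ → minus t))) refl (Conv-+ SY.∑→S SZ.∑→S)))
    where
    i = suc κ
    c = p ℕ.+ p
    X Y Z : ℕ → Carrier
    X t = q ^ exponent⁺ p c 0 i t
    Y t = q ^ exponent⁻ p c 0 i t
    Z t = q ^ exponent⁻ p c 0 i t * q ^ (p ℕ.+ suc t)
    module SX = Sum¼ X C₄ C₄≥0 (λ t → quadratic-≼ t (tri≤exponent⁺ p c 0 i t))
    module SY = Sum¼ Y C₄ C₄≥0 (λ t → quadratic-≼ t (tri≤exponent⁻ p c 0 i t))
    module SZ = Sum¼ Z C₄ C₄≥0 (λ t → ≼-mono (ℚₚ.≤-reflexive (ℚₚ.*-identityʳ (C₄ ℚ.* ¼ ^ℚ t)))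
      (≼-* (quadratic-≼ t (tri≤exponent⁻ p c 0 i t)) (q^-≼1 (p ℕ.+ suc t))))
    exponents : ∀ i t p T → (0 ℕ.+ i) ℕ.* (t ℕ.* t ℕ.+ (p ℕ.+ p) ℕ.* t) ℕ.+ i ℕ.* t ℕ.+ (T ℕ.+ p ℕ.* t) ℕ.+ (p ℕ.+ t)
      ≡ (0 ℕ.* suc t ℕ.+ i ℕ.* t) ℕ.* (suc t ℕ.+ (p ℕ.+ p)) ℕ.+ (T ℕ.+ t ℕ.+ p ℕ.* suc t)
    exponents = solve-∀
    plus : ∀ t → X t + Y t ≈ theta⁺ p c 0 i t
    plus t = trans (+-congˡ (trans (^-≡ q (≡.sym (exponents i t p (tri t)))) (^-+ q (exponent⁺ p c 0 i t) (p ℕ.+ t))))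
      (solve 2 (λ x y → x :+ x :* y := x :* (con (+ 1) :+ y)) refl (X t) (q ^ (p ℕ.+ t)))
    minus : ∀ t → Y t + Z t ≈ theta⁻ p c 0 i t
    minus t = solve 2 (λ x y → x :+ x :* y := x :* (con (+ 1) :+ y)) refl (Y t) (q ^ (p ℕ.+ suc t))

  -- The terms for ℓ = - p differ from those for ℓ = p by this factor, once n_k is raised by 2 p.
  factor : (p i : ℕ) → Carrier
  factor p i = e ((2ℚ ℚ.* nat i ℚ.- 1ℚ) ℚ.* nat p)

  left-power-neg : ∀ p k i n → e (leftExponent k i (ℤ.- + p) n) ≈ factor p i * e (leftExponent k i (+ p) n)
  left-power-neg p k i n = trans (e-≡ (leftExponent-neg k i (+ p) n)) (e-+ _ _)

  right-term-neg : ∀ p j i {κ} → j ℕ.+ i ≡ suc κ → ∀ (v : Vec ℕ (suc κ)) →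
    rightTerm (ℤ.- + p) (rightPower i (ℤ.- + p)) (raise (p ℕ.+ p) v) ≈ factor p i * rightTerm (+ p) (rightPower i (+ p)) v
  right-term-neg p j i {κ} eq v = begin
    rightTerm (ℤ.- + p) (rightPower i (ℤ.- + p)) (raise c v)
      ≈⟨ *-cong (*-cong power pochhammer) (trans (factors (ℤ.- + p) (raise c v))
           (product-raise c _ (λ x → reflexive (cong rrℤ (double⁻ p x))) v)) ⟩
    factor p i * e (rightExponent (+ p) v ℚ.- nat (initial (suc κ ℕ.∸ i) v)) * poch⁺ (p ℕ.+ Vec.sum v) * denominators c v
      ≈⟨ *-congʳ (*-congʳ (*-congˡ (trans (e-≡ (right⁺ p i v)) (e-nat (fullExponent p c i v))))) ⟩
    factor p i * q ^ fullExponent p c i v * poch⁺ (p ℕ.+ Vec.sum v) * denominators c v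
      ≈⟨ solve 4 (λ a b x y → a :* b :* x :* y := a :* (b :* (x :* y))) refl _ _ _ _ ⟩
    factor p i * summand p c i v
      ≈⟨ *-congˡ (right-term p i v) ⟨
    factor p i * rightTerm (+ p) (rightPower i (+ p)) v ∎
    where
    c = p ℕ.+ p
    j≡ : suc κ ℕ.∸ i ≡ j
    j≡ = ≡.trans (cong (ℕ._∸ i) (≡.sym eq)) (ℕₚ.m+n∸n≡m j i)
    power : rightPower i (ℤ.- + p) (raise c v) ≈ factor p i * e (rightExponent (+ p) v ℚ.- nat (initial (suc κ ℕ.∸ i) v))
    power = trans (e-≡ (subst (λ J → rightExponent (ℤ.- + p) (raise c v) ℚ.- nat (initial J (raise c v))
        ≡ (2ℚ ℚ.* nat i ℚ.- 1ℚ) ℚ.* nat p ℚ.+ (rightExponent (+ p) v ℚ.- nat (initial J v))) (≡.sym j≡) (right-raise p j i κ eq v)))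
      (e-+ _ _)
    pochhammer : pochℤ (- q) (+ N (raise c v) 1 ℤ.+ (ℤ.- + p)) ≈ poch⁺ (p ℕ.+ Vec.sum v)
    pochhammer = trans (reflexive (cong (pochℤ (- q)) (≡.trans
        (cong (λ n → + n ℤ.+ (ℤ.- + p)) (≡.trans (N-sum (raise c v)) (raise-sum c v))) (poch-index p (Vec.sum v)))))
      (poch-neg (p ℕ.+ Vec.sum v))

  -- The change of sign of ℓ.
  identity-neg : ∀ κ p′ j i → j ℕ.+ i ≡ suc κ → (f : ℤ → ℤ → Carrier) →
    (∀ n → f (ℤ.- + suc p′) n ≈ factor (suc p′) i * f (+ suc p′) n) →
    Identity (suc κ) (+ suc p′) (f (+ suc p′)) (rightPower i (+ suc p′)) →
    Identity (suc κ) -[1+ p′ ] (f -[1+ p′ ]) (rightPower i -[1+ p′ ])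
  identity-neg κ p′ j i eq f f-neg (S⁺ , S⁻ , (h⁺ , h⁻) , h) = w * S⁺ , w * S⁻
    , ( HasSum-cong (λ m → sym (f-neg _)) refl (HasSum-* w h⁺) , HasSum-cong (λ m → sym (f-neg _)) refl (HasSum-* w h⁻))
    , Reindex.HasSum-reindex (raise c) (lower c) (raise-lower c) (lower-raise c) (rightTerm -[1+ p′ ] (rightPower i -[1+ p′ ]))
        (λ v none → trans (*-congˡ (trans (*-congˡ (reflexive (≡.trans
            (cong (λ x → rrℤ (+ x ℤ.+ + 2 ℤ.* -[1+ p′ ])) (‼-last v)) (below-double p (last v) (lower-nothing c v none))))) (zeroʳ _))) (zeroʳ _))
        (HasSum-cong (λ v → sym (right-term-neg p j i eq v))
          (solve 5 (λ w a b x y → w :* (a :* b :* (x :- y)) := a :* b :* (w :* x :- w :* y)) refl w P R S⁺ S⁻) (HasSum-* w h))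
    where
    p = suc p′
    c = p ℕ.+ p
    w = factor p i

  identity : ∀ κ ℓ i → i ≤ suc κ → Identity (suc κ) ℓ (leftTerm (suc κ) i ℓ) (rightPower i ℓ)
  identity κ (+ p)     i i≤ = identity⁺ κ p (suc κ ℕ.∸ i) i (ℕₚ.m∸n+n≡m i≤)
  identity κ -[1+ p′ ] i i≤ = identity-neg κ p′ (suc κ ℕ.∸ i) i (ℕₚ.m∸n+n≡m i≤) (leftTerm (suc κ) i)
    (λ n → trans (*-congʳ (left-power-neg (suc p′) (suc κ) i n))
      (*-assoc (factor (suc p′) i) (e (leftExponent (suc κ) i (+ suc p′) n)) (1# + e (fromℤ n))))
    (identity⁺ κ (suc p′) (suc κ ℕ.∸ i) i (ℕₚ.m∸n+n≡m i≤))

  rightPower-k : ∀ {k} ℓ (v : Vec ℕ k) → rightPower k ℓ v ≈ e (rightExponent ℓ v)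
  rightPower-k {k} ℓ v = e-≡ (subtract-0 (rightExponent ℓ v) (cong (λ m → ∑ᴺ (1 ⋯ m) (N v)) (ℕₚ.n∸n≡0 k)))
    where
    subtract-0 : ∀ x {n} → n ≡ 0 → x ℚ.- fromℤ (+ n) ≡ x
    subtract-0 x ≡.refl = ℚₚ.+-identityʳ x

  identity′ : ∀ κ ℓ → Identity (suc κ) ℓ (leftTerm′ (suc κ) ℓ) (λ v → e (rightExponent ℓ v))
  identity′ κ ℓ = let (S⁺ , S⁻ , hs , h) = go ℓ in
    S⁺ , S⁻ , hs , HasSum-cong (λ v → *-congʳ (*-congʳ (rightPower-k ℓ v))) refl h
    where
    go : ∀ ℓ → Identity (suc κ) ℓ (leftTerm′ (suc κ) ℓ) (rightPower (suc κ) ℓ)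
    go (+ p)     = identity′⁺ κ p
    go -[1+ p′ ] = identity-neg κ p′ 0 (suc κ) ≡.refl (leftTerm′ (suc κ))
      (λ n → left-power-neg (suc p′) (suc κ) (suc κ) n) (identity′⁺ κ (suc p′))

open import Defs
open import Defs using () renaming (-_ to negℂ)

-- The complex numbers

-- Disks in the rational plane.
module Disks where
  open RationalEstimates
  open import Data.Rational using (∣_∣) renaming (_<_ to _<q_; _≤_ to _≤q_; _+_ to _⊕_; _*_ to _⊗_; _-_ to _⊖_; -_ to ⊖_)
  open +-*-Solver using (solve; _:+_; _:*_; _:-_; :-_; _:=_; con)

  -- The point (x , y) lies in the closed disk of radius r around the origin.
  record Disk (x y r : ℚ) : Set where
    constructor _,_
    field
      radius≥0 : 0ℚ ≤q r
      inside   : x ⊗ x ⊕ y ⊗ y ≤q r ⊗ r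

  square-nonneg : ∀ x → 0ℚ ≤q x ⊗ x
  square-nonneg x with ℚₚ.≤-total 0ℚ x
  ... | inj₁ p = 0≤* p p
  ... | inj₂ p = subst (0ℚ ≤q_) (solve 1 (λ x → :- x :* :- x := x :* x) ≡.refl x) (0≤* 0≤-x 0≤-x)
    where
    0≤-x : 0ℚ ≤q ⊖ x
    0≤-x = ℚₚ.neg-antimono-≤ p

  square-cancel : ∀ {x b} → 0ℚ ≤q b → x ⊗ x ≤q b ⊗ b → x ≤q b
  square-cancel {x} {b} b≥0 le with x ℚₚ.≤? b
  ... | yes p = p
  ... | no ¬p = contradiction (ℚₚ.≤-<-trans le (ℚₚ.≤-<-trans (*-monoˡ b≥0 (ℚₚ.<⇒≤ b<x))
                  (ℚₚ.*-monoˡ-<-pos x {{ℚ.positive (ℚₚ.≤-<-trans b≥0 b<x)}} b<x))) (ℚₚ.<-irrefl ≡.refl)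
    where
    b<x : b <q x
    b<x = ℚₚ.≰⇒> ¬p

  Disk-mono : ∀ {x y a b} → a ≤q b → Disk x y a → Disk x y b
  Disk-mono a≤b (a≥0 , p) = ℚₚ.≤-trans a≥0 a≤b , ℚₚ.≤-trans p (*-mono-nonNeg a≥0 (ℚₚ.≤-trans a≥0 a≤b) a≤b a≤b)

  -- The triangle inequality, by Cauchy-Schwarz.
  Disk-+ : ∀ {x y u v a b} → Disk x y a → Disk u v b → Disk (x ⊕ u) (y ⊕ v) (a ⊕ b)
  Disk-+ {x} {y} {u} {v} {a} {b} (a≥0 , p) (b≥0 , r) = 0≤+ a≥0 b≥0 ,
    ℚₚ.≤-trans (ℚₚ.≤-reflexive (solve 4 (λ x y u v → (x :+ u) :* (x :+ u) :+ (y :+ v) :* (y :+ v)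
        := (x :* x :+ y :* y) :+ (u :* u :+ v :* v) :+ ((x :* u :+ y :* v) :+ (x :* u :+ y :* v))) ≡.refl x y u v))
      (ℚₚ.≤-trans (ℚₚ.+-mono-≤ (ℚₚ.+-mono-≤ p r) (ℚₚ.+-mono-≤ dot dot))
        (ℚₚ.≤-reflexive (solve 2 (λ a b → a :* a :+ b :* b :+ (a :* b :+ a :* b) := (a :+ b) :* (a :+ b)) ≡.refl a b)))
    where
    dot : x ⊗ u ⊕ y ⊗ v ≤q a ⊗ b
    dot = square-cancel (0≤* a≥0 b≥0) (ℚₚ.≤-trans
      (≤-by ((x ⊗ v ⊖ y ⊗ u) ⊗ (x ⊗ v ⊖ y ⊗ u)) (square-nonneg (x ⊗ v ⊖ y ⊗ u))
        (solve 4 (λ x y u v → (x :* x :+ y :* y) :* (u :* u :+ v :* v)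
          := (x :* u :+ y :* v) :* (x :* u :+ y :* v) :+ (x :* v :- y :* u) :* (x :* v :- y :* u)) ≡.refl x y u v))
      (ℚₚ.≤-trans (*-mono-nonNeg (0≤+ (square-nonneg u) (square-nonneg v)) (0≤* a≥0 a≥0) p r)
        (ℚₚ.≤-reflexive (solve 2 (λ a b → a :* a :* (b :* b) := a :* b :* (a :* b)) ≡.refl a b))))

  Disk-* : ∀ {x y u v a b} → Disk x y a → Disk u v b → Disk (x ⊗ u ⊖ y ⊗ v) (x ⊗ v ⊕ y ⊗ u) (a ⊗ b)
  Disk-* {x} {y} {u} {v} {a} {b} (a≥0 , p) (b≥0 , r) = 0≤* a≥0 b≥0 , ℚₚ.≤-trans
    (ℚₚ.≤-reflexive (solve 4 (λ x y u v → (x :* u :- y :* v) :* (x :* u :- y :* v) :+ (x :* v :+ y :* u) :* (x :* v :+ y :* u)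
      := (x :* x :+ y :* y) :* (u :* u :+ v :* v)) ≡.refl x y u v))
    (ℚₚ.≤-trans (*-mono-nonNeg (0≤+ (square-nonneg u) (square-nonneg v)) (0≤* a≥0 a≥0) p r)
      (ℚₚ.≤-reflexive (solve 2 (λ a b → a :* a :* (b :* b) := a :* b :* (a :* b)) ≡.refl a b)))

  Disk-neg : ∀ {x y b} → Disk x y b → Disk (⊖ x) (⊖ y) b
  Disk-neg {x} {y} {b} (b≥0 , p) = b≥0 ,
    subst (_≤q b ⊗ b) (solve 2 (λ x y → x :* x :+ y :* y := :- x :* :- x :+ :- y :* :- y) ≡.refl x y) p

  abs-square : ∀ x → ∣ x ∣ ⊗ ∣ x ∣ ≡ x ⊗ x
  abs-square x = ≡.trans (≡.sym (ℚₚ.∣p*q∣≡∣p∣*∣q∣ x x)) (ℚₚ.0≤p⇒∣p∣≡p (square-nonneg x))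

  Disk⇒re : ∀ {x y b} → Disk x y b → ∣ x ∣ ≤q b
  Disk⇒re {x} {y} (b≥0 , p) = square-cancel b≥0 (ℚₚ.≤-trans (ℚₚ.≤-reflexive (abs-square x))
    (ℚₚ.≤-trans (≤-by (y ⊗ y) (square-nonneg y) ≡.refl) p))

  Disk⇒im : ∀ {x y b} → Disk x y b → ∣ y ∣ ≤q b
  Disk⇒im {x} {y} (b≥0 , p) = square-cancel b≥0 (ℚₚ.≤-trans (ℚₚ.≤-reflexive (abs-square y))
    (ℚₚ.≤-trans (≤-by (x ⊗ x) (square-nonneg x) (ℚₚ.+-comm (x ⊗ x) (y ⊗ y))) p))

  abs⇒Disk : ∀ {x y a b} → ∣ x ∣ ≤q a → ∣ y ∣ ≤q b → Disk x y (a ⊕ b)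
  abs⇒Disk {x} {y} {a} {b} p r = 0≤+ a≥0 b≥0 , ℚₚ.≤-trans
    (ℚₚ.≤-reflexive (cong₂ _⊕_ (≡.sym (abs-square x)) (≡.sym (abs-square y))))
    (ℚₚ.≤-trans (ℚₚ.+-mono-≤ (*-mono-nonNeg (ℚₚ.0≤∣p∣ x) a≥0 p p) (*-mono-nonNeg (ℚₚ.0≤∣p∣ y) b≥0 r r))
      (≤-by (a ⊗ b ⊕ a ⊗ b) (0≤+ (0≤* a≥0 b≥0) (0≤* a≥0 b≥0))
        (solve 2 (λ a b → (a :+ b) :* (a :+ b) := a :* a :+ b :* b :+ (a :* b :+ a :* b)) ≡.refl a b)))
    where
    a≥0 : 0ℚ ≤q a
    a≥0 = ℚₚ.≤-trans (ℚₚ.0≤∣p∣ x) p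
    b≥0 : 0ℚ ≤q b
    b≥0 = ℚₚ.≤-trans (ℚₚ.0≤∣p∣ y) r

-- The complex numbers as a complete normed ring.
module ComplexNorm where
  open RationalEstimates
  open Disks
  open +-*-Solver using (solve; _:+_; _:*_; _:-_; :-_; _:=_; con)
  open ℝ using (seq)

  infix 4 _≼ᶜ_

  -- The modulus of z is at most b: the approximations are eventually in any larger disk. As a record, so
  -- that z and b can be inferred.
  record _≼ᶜ_ (z : ℂ) (b : ℚ) : Set where
    field
      within : ∀ ε → 0ℚ ℚ.< ε → ∃[ N ] ∀ n → N ≤ n → Disk (seq (re z) n) (seq (im z) n) (b ℚ.+ ε)

  open _≼ᶜ_

  -- Equality of all rational approximations.
  infix 4 _≐_
  _≐_ : ℂ → ℂ → Set
  z ≐ w = ∀ n → seq (re z) n ≡ seq (re w) n × seq (im z) n ≡ seq (im w) n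

  ≼ᶜ-≐ : ∀ {z w b} → z ≐ w → z ≼ᶜ b → w ≼ᶜ b
  within (≼ᶜ-≐ {b = b} e p) ε ε>0 = let (N , d) = within p ε ε>0 in
    N , λ n N≤n → subst₂ (λ x y → Disk x y (b ℚ.+ ε)) (proj₁ (e n)) (proj₂ (e n)) (d n N≤n)

  Disk⇒≼ᶜ : ∀ {z b} → (∃[ N ] ∀ n → N ≤ n → Disk (seq (re z) n) (seq (im z) n) b) → z ≼ᶜ b
  within (Disk⇒≼ᶜ {b = b} (N , d)) ε ε>0 = N , λ n N≤n → Disk-mono (≤-by ε (ℚₚ.<⇒≤ ε>0) ≡.refl) (d n N≤n)

  ≼ᶜ-mono : ∀ {z a b} → a ℚ.≤ b → z ≼ᶜ a → z ≼ᶜ b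
  within (≼ᶜ-mono a≤b p) ε ε>0 = let (N , d) = within p ε ε>0 in N , λ n N≤n → Disk-mono (ℚₚ.+-monoˡ-≤ ε a≤b) (d n N≤n)

  ≼ᶜ-0 : 0ℂ ≼ᶜ 0ℚ
  ≼ᶜ-0 = Disk⇒≼ᶜ {z = 0ℂ} (0 , λ n _ → ℚₚ.≤-refl , ℚₚ.≤-refl)

  ≼ᶜ-1 : 1ℂ ≼ᶜ 1ℚ
  ≼ᶜ-1 = Disk⇒≼ᶜ {z = 1ℂ} (0 , λ n _ → 0≤1 , ℚₚ.≤-refl)

  ≼ᶜ-+ : ∀ {z w a b} → z ≼ᶜ a → w ≼ᶜ b → z + w ≼ᶜ a ℚ.+ b
  within (≼ᶜ-+ {a = a} {b} p r) ε ε>0 =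
    let (M , d) = within p (½ ℚ.* ε) (half-pos ε>0)
        (N , d′) = within r (½ ℚ.* ε) (half-pos ε>0)
    in M ℕ.⊔ N , λ n le → Disk-mono
         (ℚₚ.≤-reflexive (solve 3 (λ a b e → a :+ con ½ :* e :+ (b :+ con ½ :* e) := a :+ b :+ e) ≡.refl a b ε))
         (Disk-+ (d n (ℕₚ.m⊔n≤o⇒m≤o M N le)) (d′ n (ℕₚ.m⊔n≤o⇒n≤o M N le)))

  ≼ᶜ-neg : ∀ {z b} → z ≼ᶜ b → - z ≼ᶜ b
  within (≼ᶜ-neg p) ε ε>0 = let (N , d) = within p ε ε>0 in N , λ n N≤n → Disk-neg (d n N≤n)

  ≼ᶜ-nonneg : ∀ {z b} → z ≼ᶜ b → 0ℚ ℚ.≤ b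
  ≼ᶜ-nonneg {z} {b} p with 0ℚ ℚₚ.≤? b
  ... | yes b≥0 = b≥0
  ... | no  b≱0 = let (N , d) = within p (½ ℚ.* (ℚ.- b)) (half-pos -b>0) in
    contradiction (ℚₚ.≤-trans (0≤+ (Disk.radius≥0 (d N ℕₚ.≤-refl)) (Disk.radius≥0 (d N ℕₚ.≤-refl)))
      (ℚₚ.≤-reflexive (solve 1 (λ b → b :+ con ½ :* (:- b) :+ (b :+ con ½ :* (:- b)) := b) ≡.refl b))) b≱0
    where
    -b>0 : 0ℚ ℚ.< ℚ.- b
    -b>0 = ℚₚ.neg-antimono-< (ℚₚ.≰⇒> b≱0)

  ≼ᶜ-* : ∀ {z w a b} → z ≼ᶜ a → w ≼ᶜ b → z * w ≼ᶜ a ℚ.* b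
  within (≼ᶜ-* {z} {w} {a} {b} p r) ε ε>0 =
    let (δ , δ>0 , le) = shrink (a ℚ.+ b ℚ.+ 1ℚ) ε>0 B≥0
        (M , d) = within p (δ ℚ.⊓ 1ℚ) (min-pos δ>0)
        (N , d′) = within r (δ ℚ.⊓ 1ℚ) (min-pos δ>0)
    in M ℕ.⊔ N , λ n le′ → Disk-mono
         (small (δ ℚ.⊓ 1ℚ) (ℚₚ.<⇒≤ (min-pos δ>0)) (ℚₚ.p⊓q≤q δ 1ℚ)
           (ℚₚ.≤-trans (*-monoʳ B≥0 (ℚₚ.p⊓q≤p δ 1ℚ)) le))
         (Disk-* (d n (ℕₚ.m⊔n≤o⇒m≤o M N le′)) (d′ n (ℕₚ.m⊔n≤o⇒n≤o M N le′)))
    where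
    B≥0 : 0ℚ ℚ.≤ a ℚ.+ b ℚ.+ 1ℚ
    B≥0 = 0≤+ (0≤+ (≼ᶜ-nonneg {z} p) (≼ᶜ-nonneg {w} r)) 0≤1
    min-pos : ∀ {δ} → 0ℚ ℚ.< δ → 0ℚ ℚ.< δ ℚ.⊓ 1ℚ
    min-pos {δ} δ>0 with ℚₚ.⊓-sel δ 1ℚ
    ... | inj₁ e = subst (0ℚ ℚ.<_) (≡.sym e) δ>0
    ... | inj₂ e = subst (0ℚ ℚ.<_) (≡.sym e) (ℚₚ.positive⁻¹ 1ℚ)
    small : ∀ δ → 0ℚ ℚ.≤ δ → δ ℚ.≤ 1ℚ → δ ℚ.* (a ℚ.+ b ℚ.+ 1ℚ) ℚ.≤ ε → (a ℚ.+ δ) ℚ.* (b ℚ.+ δ) ℚ.≤ a ℚ.* b ℚ.+ ε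
    small δ δ≥0 δ≤1 le = ℚₚ.≤-trans
      (≤-by (δ ℚ.* (1ℚ ℚ.- δ)) (0≤* δ≥0 (0≤- δ≤1))
        (solve 3 (λ a b d → a :* b :+ d :* (a :+ b :+ con 1ℚ) := (a :+ d) :* (b :+ d) :+ d :* (con 1ℚ :- d)) ≡.refl a b δ))
      (ℚₚ.+-monoʳ-≤ (a ℚ.* b) le)

  ≼ᶜ-closed : ∀ {z b} → (∀ ε → 0ℚ ℚ.< ε → z ≼ᶜ b ℚ.+ ε) → z ≼ᶜ b
  within (≼ᶜ-closed {b = b} p) ε ε>0 =
    let (N , d) = within (p (½ ℚ.* ε) (half-pos ε>0)) (½ ℚ.* ε) (half-pos ε>0)
    in N , λ n N≤n → Disk-mono
         (ℚₚ.≤-reflexive (solve 2 (λ b e → b :+ con ½ :* e :+ con ½ :* e := b :+ e) ≡.refl b ε)) (d n N≤n)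

  ≼ᶜ-bounded : ∀ z → ∃[ b ] z ≼ᶜ b
  ≼ᶜ-bounded z =
    let (A , _ , M , a) = RealArithmetic.eventually-bounded (re z)
        (B , _ , N , b) = RealArithmetic.eventually-bounded (im z)
    in A ℚ.+ B , Disk⇒≼ᶜ {z} (M ℕ.⊔ N , λ n le → abs⇒Disk
         (ℚₚ.<⇒≤ (a n (ℕₚ.m⊔n≤o⇒m≤o M N le))) (ℚₚ.<⇒≤ (b n (ℕₚ.m⊔n≤o⇒n≤o M N le))))

  ≈⇒≼0 : ∀ {z w} → z ≈ w → z - w ≼ᶜ 0ℚ
  within (≈⇒≼0 (p , r)) ε ε>0 =
    let (M , a) = p (½ ℚ.* ε) (half-pos ε>0)
        (N , b) = r (½ ℚ.* ε) (half-pos ε>0)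
    in M ℕ.⊔ N , λ n le → Disk-mono
         (ℚₚ.≤-reflexive (≡.trans (halves ε) (≡.sym (ℚₚ.+-identityˡ ε))))
         (abs⇒Disk (ℚₚ.<⇒≤ (a n (ℕₚ.m⊔n≤o⇒m≤o M N le))) (ℚₚ.<⇒≤ (b n (ℕₚ.m⊔n≤o⇒n≤o M N le))))

  ≼0⇒≈ᶜ : ∀ {z w} → z - w ≼ᶜ 0ℚ → z ≈ w
  ≼0⇒≈ᶜ p = (λ ε ε>0 → let (N , d) = within p (½ ℚ.* ε) (half-pos ε>0) in N , λ n N≤n → below ε ε>0 (Disk⇒re (d n N≤n)))
          , (λ ε ε>0 → let (N , d) = within p (½ ℚ.* ε) (half-pos ε>0) in N , λ n N≤n → below ε ε>0 (Disk⇒im (d n N≤n)))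
    where
    below : ∀ ε → 0ℚ ℚ.< ε → ∀ {x} → x ℚ.≤ 0ℚ ℚ.+ ½ ℚ.* ε → x ℚ.< ε
    below ε ε>0 le = ℚₚ.≤-<-trans le (subst (ℚ._< ε) (≡.sym (ℚₚ.+-identityˡ (½ ℚ.* ε))) (Estimates.half-< ε>0))

  -- Equality laws, from the equality of all approximations or from the norm.
  ≐⇒≈ : ∀ {z w} → z ≐ w → z ≈ w
  ≐⇒≈ {z} {w} e = ≼0⇒≈ᶜ {z} {w} (≼ᶜ-≐ {0ℂ} {z - w}
    (λ n → zero-diff (proj₁ (e n)) , zero-diff (proj₂ (e n))) ≼ᶜ-0)
    where
    zero-diff : ∀ {x y} → x ≡ y → 0ℚ ≡ x ℚ.- y
    zero-diff {x} ≡.refl = ≡.sym (ℚₚ.+-inverseʳ x)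

  ≈-sym : ∀ {z w} → z ≈ w → w ≈ z
  ≈-sym {z} {w} e = ≼0⇒≈ᶜ {w} {z} (≼ᶜ-≐ { - (z - w)} {w - z}
    (λ n → flip (seq (re z) n) (seq (re w) n) , flip (seq (im z) n) (seq (im w) n)) (≼ᶜ-neg {z - w} (≈⇒≼0 {z} {w} e)))
    where
    flip : ∀ a b → ℚ.- (a ℚ.- b) ≡ b ℚ.- a
    flip = solve 2 (λ a b → :- (a :- b) := b :- a) ≡.refl

  ≈-trans : ∀ {z w v} → z ≈ w → w ≈ v → z ≈ v
  ≈-trans {z} {w} {v} e e′ = ≼0⇒≈ᶜ {z} {v} (≼ᶜ-≐ {(z - w) + (w - v)} {z - v}
    (λ n → join (seq (re z) n) (seq (re w) n) (seq (re v) n) , join (seq (im z) n) (seq (im w) n) (seq (im v) n))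
    (≼ᶜ-+ {z - w} {w - v} (≈⇒≼0 {z} {w} e) (≈⇒≼0 {w} {v} e′)))
    where
    join : ∀ a b c → (a ℚ.- b) ℚ.+ (b ℚ.- c) ≡ a ℚ.- c
    join = solve 3 (λ a b c → (a :- b) :+ (b :- c) := a :- c) ≡.refl

  +-congᶜ : ∀ {z z′ w w′} → z ≈ z′ → w ≈ w′ → z + w ≈ z′ + w′
  +-congᶜ {z} {z′} {w} {w′} e e′ = ≼0⇒≈ᶜ {z + w} {z′ + w′} (≼ᶜ-≐ {(z - z′) + (w - w′)} {(z + w) - (z′ + w′)}
    (λ n → swap (seq (re z) n) (seq (re z′) n) (seq (re w) n) (seq (re w′) n)
         , swap (seq (im z) n) (seq (im z′) n) (seq (im w) n) (seq (im w′) n))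
    (≼ᶜ-+ {z - z′} {w - w′} (≈⇒≼0 {z} {z′} e) (≈⇒≼0 {w} {w′} e′)))
    where
    swap : ∀ a b c d → (a ℚ.- b) ℚ.+ (c ℚ.- d) ≡ (a ℚ.+ c) ℚ.- (b ℚ.+ d)
    swap = solve 4 (λ a b c d → (a :- b) :+ (c :- d) := (a :+ c) :- (b :+ d)) ≡.refl

  neg-congᶜ : ∀ {z w} → z ≈ w → - z ≈ - w
  neg-congᶜ {z} {w} e = ≼0⇒≈ᶜ { - z} { - w} (≼ᶜ-≐ { - (z - w)} { - z - - w}
    (λ n → push (seq (re z) n) (seq (re w) n) , push (seq (im z) n) (seq (im w) n)) (≼ᶜ-neg {z - w} (≈⇒≼0 {z} {w} e)))
    where
    push : ∀ a b → ℚ.- (a ℚ.- b) ≡ ℚ.- a ℚ.- ℚ.- b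
    push = solve 2 (λ a b → :- (a :- b) := :- a :- (:- b)) ≡.refl

  *-congᶜ : ∀ {z z′ w w′} → z ≈ z′ → w ≈ w′ → z * w ≈ z′ * w′
  *-congᶜ {z} {z′} {w} {w′} e e′ =
    let (A , a) = ≼ᶜ-bounded z′
        (B , b) = ≼ᶜ-bounded w
    in ≼0⇒≈ᶜ {z * w} {z′ * w′} (≼ᶜ-≐ {(z - z′) * w + z′ * (w - w′)} {(z * w) - (z′ * w′)}
      (λ n → real (seq (re z) n) (seq (re z′) n) (seq (re w) n) (seq (re w′) n) (seq (im z) n) (seq (im z′) n) (seq (im w) n) (seq (im w′) n)
           , imag (seq (re z) n) (seq (re z′) n) (seq (re w) n) (seq (re w′) n) (seq (im z) n) (seq (im z′) n) (seq (im w) n) (seq (im w′) n))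
      (≼ᶜ-mono {(z - z′) * w + z′ * (w - w′)} (ℚₚ.≤-reflexive (cong₂ ℚ._+_ (ℚₚ.*-zeroˡ B) (ℚₚ.*-zeroʳ A)))
        (≼ᶜ-+ {(z - z′) * w} {z′ * (w - w′)} (≼ᶜ-* {z - z′} {w} (≈⇒≼0 {z} {z′} e) b) (≼ᶜ-* {z′} {w - w′} a (≈⇒≼0 {w} {w′} e′)))))
    where
    real : ∀ a a′ c c′ b b′ d d′ → ((a ℚ.- a′) ℚ.* c ℚ.- (b ℚ.- b′) ℚ.* d) ℚ.+ (a′ ℚ.* (c ℚ.- c′) ℚ.- b′ ℚ.* (d ℚ.- d′))
      ≡ (a ℚ.* c ℚ.- b ℚ.* d) ℚ.- (a′ ℚ.* c′ ℚ.- b′ ℚ.* d′)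
    real = solve 8 (λ a a′ c c′ b b′ d d′ → ((a :- a′) :* c :- (b :- b′) :* d) :+ (a′ :* (c :- c′) :- b′ :* (d :- d′))
      := (a :* c :- b :* d) :- (a′ :* c′ :- b′ :* d′)) ≡.refl
    imag : ∀ a a′ c c′ b b′ d d′ → ((a ℚ.- a′) ℚ.* d ℚ.+ (b ℚ.- b′) ℚ.* c) ℚ.+ (a′ ℚ.* (d ℚ.- d′) ℚ.+ b′ ℚ.* (c ℚ.- c′))
      ≡ (a ℚ.* d ℚ.+ b ℚ.* c) ℚ.- (a′ ℚ.* d′ ℚ.+ b′ ℚ.* c′)
    imag = solve 8 (λ a a′ c c′ b b′ d d′ → ((a :- a′) :* d :+ (b :- b′) :* c) :+ (a′ :* (d :- d′) :+ b′ :* (c :- c′))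
      := (a :* d :+ b :* c) :- (a′ :* d′ :+ b′ :* c′)) ≡.refl

  -- The ring laws hold for the approximations.
  +-assocᶜ : ∀ z w v → (z + w) + v ≈ z + (w + v)
  +-assocᶜ z w v = ≐⇒≈ {(z + w) + v} {z + (w + v)} λ n →
      ℚₚ.+-assoc (seq (re z) n) (seq (re w) n) (seq (re v) n)
    , ℚₚ.+-assoc (seq (im z) n) (seq (im w) n) (seq (im v) n)

  +-commᶜ : ∀ z w → z + w ≈ w + z
  +-commᶜ z w = ≐⇒≈ {z + w} {w + z} λ n →
      ℚₚ.+-comm (seq (re z) n) (seq (re w) n) , ℚₚ.+-comm (seq (im z) n) (seq (im w) n)

  +-identityˡᶜ : ∀ z → 0ℂ + z ≈ z
  +-identityˡᶜ z = ≐⇒≈ {0ℂ + z} {z} λ n → ℚₚ.+-identityˡ (seq (re z) n) , ℚₚ.+-identityˡ (seq (im z) n)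

  +-inverseˡᶜ : ∀ z → - z + z ≈ 0ℂ
  +-inverseˡᶜ z = ≐⇒≈ { - z + z} {0ℂ} λ n → ℚₚ.+-inverseˡ (seq (re z) n) , ℚₚ.+-inverseˡ (seq (im z) n)

  *-assocᶜ : ∀ z w v → (z * w) * v ≈ z * (w * v)
  *-assocᶜ z w v = ≐⇒≈ {(z * w) * v} {z * (w * v)} λ n →
      real (seq (re z) n) (seq (im z) n) (seq (re w) n) (seq (im w) n) (seq (re v) n) (seq (im v) n)
    , imag (seq (re z) n) (seq (im z) n) (seq (re w) n) (seq (im w) n) (seq (re v) n) (seq (im v) n)
    where
    real : ∀ a b c d e f → (a ℚ.* c ℚ.- b ℚ.* d) ℚ.* e ℚ.- (a ℚ.* d ℚ.+ b ℚ.* c) ℚ.* f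
      ≡ a ℚ.* (c ℚ.* e ℚ.- d ℚ.* f) ℚ.- b ℚ.* (c ℚ.* f ℚ.+ d ℚ.* e)
    real = solve 6 (λ a b c d e f → (a :* c :- b :* d) :* e :- (a :* d :+ b :* c) :* f
      := a :* (c :* e :- d :* f) :- b :* (c :* f :+ d :* e)) ≡.refl
    imag : ∀ a b c d e f → (a ℚ.* c ℚ.- b ℚ.* d) ℚ.* f ℚ.+ (a ℚ.* d ℚ.+ b ℚ.* c) ℚ.* e
      ≡ a ℚ.* (c ℚ.* f ℚ.+ d ℚ.* e) ℚ.+ b ℚ.* (c ℚ.* e ℚ.- d ℚ.* f)
    imag = solve 6 (λ a b c d e f → (a :* c :- b :* d) :* f :+ (a :* d :+ b :* c) :* e
      := a :* (c :* f :+ d :* e) :+ b :* (c :* e :- d :* f)) ≡.refl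

  *-commᶜ : ∀ z w → z * w ≈ w * z
  *-commᶜ z w = ≐⇒≈ {z * w} {w * z} λ n →
      real (seq (re z) n) (seq (im z) n) (seq (re w) n) (seq (im w) n)
    , imag (seq (re z) n) (seq (im z) n) (seq (re w) n) (seq (im w) n)
    where
    real : ∀ a b c d → a ℚ.* c ℚ.- b ℚ.* d ≡ c ℚ.* a ℚ.- d ℚ.* b
    real = solve 4 (λ a b c d → a :* c :- b :* d := c :* a :- d :* b) ≡.refl
    imag : ∀ a b c d → a ℚ.* d ℚ.+ b ℚ.* c ≡ c ℚ.* b ℚ.+ d ℚ.* a
    imag = solve 4 (λ a b c d → a :* d :+ b :* c := c :* b :+ d :* a) ≡.refl

  *-identityˡᶜ : ∀ z → 1ℂ * z ≈ z
  *-identityˡᶜ z = ≐⇒≈ {1ℂ * z} {z} λ n →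
    real (seq (re z) n) (seq (im z) n) , imag (seq (re z) n) (seq (im z) n)
    where
    real : ∀ a b → 1ℚ ℚ.* a ℚ.- 0ℚ ℚ.* b ≡ a
    real = solve 2 (λ a b → con 1ℚ :* a :- con 0ℚ :* b := a) ≡.refl
    imag : ∀ a b → 1ℚ ℚ.* b ℚ.+ 0ℚ ℚ.* a ≡ b
    imag = solve 2 (λ a b → con 1ℚ :* b :+ con 0ℚ :* a := b) ≡.refl

  distribˡᶜ : ∀ z w v → z * (w + v) ≈ z * w + z * v
  distribˡᶜ z w v = ≐⇒≈ {z * (w + v)} {z * w + z * v} λ n →
      real (seq (re z) n) (seq (im z) n) (seq (re w) n) (seq (im w) n) (seq (re v) n) (seq (im v) n)
    , imag (seq (re z) n) (seq (im z) n) (seq (re w) n) (seq (im w) n) (seq (re v) n) (seq (im v) n)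
    where
    real : ∀ a b c d e f → a ℚ.* (c ℚ.+ e) ℚ.- b ℚ.* (d ℚ.+ f) ≡ (a ℚ.* c ℚ.- b ℚ.* d) ℚ.+ (a ℚ.* e ℚ.- b ℚ.* f)
    real = solve 6 (λ a b c d e f → a :* (c :+ e) :- b :* (d :+ f) := (a :* c :- b :* d) :+ (a :* e :- b :* f)) ≡.refl
    imag : ∀ a b c d e f → a ℚ.* (d ℚ.+ f) ℚ.+ b ℚ.* (c ℚ.+ e) ≡ (a ℚ.* d ℚ.+ b ℚ.* c) ℚ.+ (a ℚ.* f ℚ.+ b ℚ.* e)
    imag = solve 6 (λ a b c d e f → a :* (d :+ f) :+ b :* (c :+ e) := (a :* d :+ b :* c) :+ (a :* f :+ b :* e)) ≡.refl

  ≈-refl : ∀ {z} → z ≈ z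
  ≈-refl {z} = ≐⇒≈ {z} {z} λ _ → ≡.refl , ≡.refl

  ≈-isEquivalence : IsEquivalence _≈_
  ≈-isEquivalence = record
    { refl  = λ {z} → ≈-refl {z}
    ; sym   = λ {z} {w} → ≈-sym {z} {w}
    ; trans = λ {z} {w} {v} → ≈-trans {z} {w} {v}
    }

  ≈-setoid : Setoid 0ℓ 0ℓ
  ≈-setoid = record { isEquivalence = ≈-isEquivalence }

  +-isAbelianGroupᶜ : IsAbelianGroup _≈_ _+_ 0ℂ negℂ
  +-isAbelianGroupᶜ = record
    { isGroup = record
      { isMonoid = record
        { isSemigroup = record
          { isMagma = record
            { isEquivalence = ≈-isEquivalence
            ; ∙-cong        = λ {z} {z′} {w} {w′} → +-congᶜ {z} {z′} {w} {w′}
            }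
          ; assoc = +-assocᶜ
          }
        ; identity = comm∧idˡ⇒id ≈-setoid {_+_} +-commᶜ {0ℂ} +-identityˡᶜ
        }
      ; inverse = comm∧invˡ⇒inv ≈-setoid {_+_} {negℂ} {0ℂ} +-commᶜ +-inverseˡᶜ
      ; ⁻¹-cong = λ {z} {w} → neg-congᶜ {z} {w}
      }
    ; comm = +-commᶜ
    }

  *-identityᶜ : Operations.Identity _≈_ 1ℂ _*_
  *-identityᶜ = comm∧idˡ⇒id ≈-setoid {_*_} *-commᶜ {1ℂ} *-identityˡᶜ

  distribᶜ : _DistributesOver_ _≈_ _*_ _+_
  distribᶜ = comm∧distrˡ⇒distr ≈-setoid {_*_} {_+_} (λ {z} {z′} {w} {w′} → +-congᶜ {z} {z′} {w} {w′}) *-commᶜ distribˡᶜ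

  isCommutativeRingᶜ : IsCommutativeRing _≈_ _+_ _*_ negℂ 0ℂ 1ℂ
  isCommutativeRingᶜ = record
    { isRing = record
      { +-isAbelianGroup = +-isAbelianGroupᶜ
      ; *-cong           = λ {z} {z′} {w} {w′} → *-congᶜ {z} {z′} {w} {w′}
      ; *-assoc          = *-assocᶜ
      ; *-identity       = *-identityᶜ
      ; distrib          = distribᶜ
      }
    ; *-comm = *-commᶜ
    }

  ≼ᶜ-resp : ∀ {z w b} → z ≈ w → z ≼ᶜ b → w ≼ᶜ b
  ≼ᶜ-resp {z} {w} {b} e p = ≼ᶜ-≐ {z + - (z - w)} {w}
    (λ n → undo (seq (re z) n) (seq (re w) n) , undo (seq (im z) n) (seq (im w) n))
    (≼ᶜ-mono {z + - (z - w)} (ℚₚ.≤-reflexive (ℚₚ.+-identityʳ b)) (≼ᶜ-+ {z} { - (z - w)} p (≼ᶜ-neg {z - w} (≈⇒≼0 {z} {w} e))))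
    where
    undo : ∀ a b → a ℚ.+ ℚ.- (a ℚ.- b) ≡ b
    undo = solve 2 (λ a b → a :+ (:- (a :- b)) := b) ≡.refl

  -- Comparison with the componentwise notion of closeness.
  Close⇒≼ᶜ : ∀ {ε z w} → Close ε z w → z - w ≼ᶜ ε ℚ.+ ε
  Close⇒≼ᶜ {ε} {z} {w} ((δ , δ>0 , M , p) , (δ′ , δ′>0 , N , r)) = Disk⇒≼ᶜ {z - w} (M ℕ.⊔ N , λ n le → abs⇒Disk
    (drop δ>0 (p n (ℕₚ.m⊔n≤o⇒m≤o M N le))) (drop δ′>0 (r n (ℕₚ.m⊔n≤o⇒n≤o M N le))))
    where
    drop : ∀ {δ x} → 0ℚ ℚ.< δ → x ℚ.+ δ ℚ.< ε → x ℚ.≤ ε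
    drop δ>0 p = ℚₚ.≤-trans (≤-by _ (ℚₚ.<⇒≤ δ>0) ≡.refl) (ℚₚ.<⇒≤ p)

  ≼ᶜ⇒Close : ∀ {ε z w} → 0ℚ ℚ.< ε → z - w ≼ᶜ ½ ℚ.* ε → Close ε z w
  ≼ᶜ⇒Close {ε} {z} {w} ε>0 p =
    let (N , d) = within p (½ ℚ.* (½ ℚ.* ε)) (half-pos (half-pos ε>0))
    in (η , η>0 , N , λ n N≤n → below (Disk⇒re (d n N≤n))) , (η , η>0 , N , λ n N≤n → below (Disk⇒im (d n N≤n)))
    where
    η : ℚ
    η = ½ ℚ.* (½ ℚ.* (½ ℚ.* ε))
    η>0 : 0ℚ ℚ.< η
    η>0 = half-pos (half-pos (half-pos ε>0))
    below : ∀ {x} → x ℚ.≤ ½ ℚ.* ε ℚ.+ ½ ℚ.* (½ ℚ.* ε) → x ℚ.+ η ℚ.< ε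
    below {x} le = ℚₚ.≤-<-trans (ℚₚ.+-monoˡ-≤ η le)
      (subst₂ ℚ._<_ (ℚₚ.+-identityʳ _) (gather ε) (ℚₚ.+-monoʳ-< (½ ℚ.* ε ℚ.+ ½ ℚ.* (½ ℚ.* ε) ℚ.+ η) η>0))
      where
      gather : ∀ e → ½ ℚ.* e ℚ.+ ½ ℚ.* (½ ℚ.* e) ℚ.+ ½ ℚ.* (½ ℚ.* (½ ℚ.* e)) ℚ.+ ½ ℚ.* (½ ℚ.* (½ ℚ.* e)) ≡ e
      gather = solve 1 (λ e → con ½ :* e :+ con ½ :* (con ½ :* e) :+ con ½ :* (con ½ :* (con ½ :* e)) :+ con ½ :* (con ½ :* (con ½ :* e)) := e) ≡.refl

  -- Convergence of the real and imaginary parts.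
  parts-converge : (x : ℕ → ℂ) (a b : ℝ) →
    (∀ ε → 0ℚ ℚ.< ε → ∃[ N ] ∀ n → N ≤ n → ∣ re (x n) -ᴿ a ∣ᴿ <ᴿ ofℚ ε) →
    (∀ ε → 0ℚ ℚ.< ε → ∃[ N ] ∀ n → N ≤ n → ∣ im (x n) -ᴿ b ∣ᴿ <ᴿ ofℚ ε) →
    ∀ ε → 0ℚ ℚ.< ε → ∃[ N ] ∀ n → N ≤ n → x n - mkℂ a b ≼ᶜ ε
  parts-converge x a b p r ε ε>0 =
    let (M , p′) = p (½ ℚ.* ε) (half-pos ε>0)
        (N , r′) = r (½ ℚ.* ε) (half-pos ε>0)
    in M ℕ.⊔ N , λ n le → ≼ᶜ-mono {x n - mkℂ a b} {½ ℚ.* ε ℚ.+ ½ ℚ.* ε} {ε} (ℚₚ.≤-reflexive (halves ε))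
         (Close⇒≼ᶜ {½ ℚ.* ε} {x n} {mkℂ a b} (p′ n (ℕₚ.m⊔n≤o⇒m≤o M N le) , r′ n (ℕₚ.m⊔n≤o⇒n≤o M N le)))

  module _ (x : ℕ → ℂ) (c : ∀ ε → 0ℚ ℚ.< ε → ∃[ N ] ∀ m n → N ≤ m → N ≤ n → x m - x n ≼ᶜ ε) where

    re-cauchy : IsCauchyᴿ (λ n → re (x n))
    re-cauchy ε ε>0 = let (N , p) = c (½ ℚ.* ε) (half-pos ε>0) in
      N , λ m n N≤m N≤n → proj₁ (≼ᶜ⇒Close {ε} {x m} {x n} ε>0 (p m n N≤m N≤n))

    im-cauchy : IsCauchyᴿ (λ n → im (x n))
    im-cauchy ε ε>0 = let (N , p) = c (½ ℚ.* ε) (half-pos ε>0) in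
      N , λ m n N≤m N≤n → proj₂ (≼ᶜ⇒Close {ε} {x m} {x n} ε>0 (p m n N≤m N≤n))

    completeᶜ : ∃[ w ] ∀ ε → 0ℚ ℚ.< ε → ∃[ N ] ∀ n → N ≤ n → x n - w ≼ᶜ ε
    completeᶜ = mkℂ (lim (λ n → re (x n)) re-cauchy) (lim (λ n → im (x n)) im-cauchy)
      , parts-converge x (lim (λ n → re (x n)) re-cauchy) (lim (λ n → im (x n)) im-cauchy)
          (Completeness.limit-correct (λ n → re (x n)) re-cauchy)
          (Completeness.limit-correct (λ n → im (x n)) im-cauchy)

  -- The operations and laws are made opaque, so that the Cauchy moduli of composite
  -- expressions are never unfolded.
  opaque
    addᶜ mulᶜ : ℂ → ℂ → ℂ
    addᶜ = _+_
    mulᶜ = _*_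

    oppᶜ : ℂ → ℂ
    oppᶜ = negℂ

    add-≡ : ∀ z w → addᶜ z w ≡ z + w
    add-≡ z w = ≡.refl

    mul-≡ : ∀ z w → mulᶜ z w ≡ z * w
    mul-≡ z w = ≡.refl

    opp-≡ : ∀ z → oppᶜ z ≡ - z
    opp-≡ z = ≡.refl

    ring-laws : IsCommutativeRing _≈_ addᶜ mulᶜ oppᶜ 0ℂ 1ℂ
    ring-laws = isCommutativeRingᶜ

  add-≡′ : ∀ z w v → w ≡ v → addᶜ z w ≡ z + v
  add-≡′ z w v e = subst (λ u → addᶜ z u ≡ z + v) (≡.sym e) (add-≡ z v)

  sub-≡ : ∀ z w → addᶜ z (oppᶜ w) ≡ z + - w
  sub-≡ z w = add-≡′ z (oppᶜ w) (- w) (opp-≡ w)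

  ℂ-commutativeRing : CommutativeRing 0ℓ 0ℓ
  ℂ-commutativeRing = record { isCommutativeRing = ring-laws }

  -- The complex number 1/(n + 1).
  unitᶜ : ℕ → ℂ
  unitᶜ n = mkℂ (ofℚ (unit-fraction n)) 0ᴿ

  open FiniteSum ℂ-commutativeRing using (fromℕ)

  fromℕ-seq : ∀ n t → seq (re (fromℕ n)) t ≡ fromℤ (+ n) × seq (im (fromℕ n)) t ≡ 0ℚ
  fromℕ-seq zero    t = ≡.refl , ≡.refl
  fromℕ-seq (suc n) t = ≡.trans (cong (λ z → seq (re z) t) (add-≡ (fromℕ n) 1ℂ))
      (≡.trans (cong (ℚ._+ 1ℚ) (proj₁ (fromℕ-seq n t)))
        (≡.trans (ℚₚ.+-comm (fromℤ (+ n)) 1ℚ) (≡.sym (fromℤ-+ (+ 1) (+ n)))))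
    , ≡.trans (cong (λ z → seq (im z) t) (add-≡ (fromℕ n) 1ℂ)) (cong (ℚ._+ 0ℚ) (proj₂ (fromℕ-seq n t)))

  unit-lawᶜ : ∀ n → mulᶜ (fromℕ (suc n)) (unitᶜ n) ≈ 1ℂ
  unit-lawᶜ n = subst (_≈ 1ℂ) (≡.sym (mul-≡ (fromℕ (suc n)) (unitᶜ n)))
    (≐⇒≈ {fromℕ (suc n) * unitᶜ n} {1ℂ} λ t → let (r , i) = fromℕ-seq (suc n) t in
        ≡.trans (cong₂ (λ a b → a ℚ.* unit-fraction n ℚ.- b ℚ.* 0ℚ) r i)
          (≡.trans (real (fromℤ (+ suc n)) (unit-fraction n)) (unit-fraction-inverse n))
      , ≡.trans (cong₂ (λ a b → a ℚ.* 0ℚ ℚ.+ b ℚ.* unit-fraction n) r i) (imag (fromℤ (+ suc n)) (unit-fraction n)))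
    where
    real : ∀ a u → a ℚ.* u ℚ.- 0ℚ ℚ.* 0ℚ ≡ a ℚ.* u
    real = solve 2 (λ a u → a :* u :- con 0ℚ :* con 0ℚ := a :* u) ≡.refl
    imag : ∀ a u → a ℚ.* 0ℚ ℚ.+ 0ℚ ℚ.* u ≡ 0ℚ
    imag = solve 2 (λ a u → a :* con 0ℚ :+ con 0ℚ :* u := con 0ℚ) ≡.refl

  unit-≼ᶜ : ∀ n → unitᶜ n ≼ᶜ unit-fraction n
  unit-≼ᶜ n = Disk⇒≼ᶜ {unitᶜ n} (0 , λ t _ → ℚₚ.<⇒≤ (unit-fraction-pos n) ,
    ℚₚ.≤-reflexive (solve 1 (λ u → u :* u :+ con 0ℚ :* con 0ℚ := u :* u) ≡.refl (unit-fraction n)))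

  ≼ᶜ-subst : ∀ {z w b} → z ≡ w → z ≼ᶜ b → w ≼ᶜ b
  ≼ᶜ-subst ≡.refl p = p

  ≼-add : ∀ {z w a b} → z ≼ᶜ a → w ≼ᶜ b → addᶜ z w ≼ᶜ a ℚ.+ b
  ≼-add {z} {w} p r = ≼ᶜ-subst {z + w} {addᶜ z w} (≡.sym (add-≡ z w)) (≼ᶜ-+ {z} {w} p r)

  ≼-mul : ∀ {z w a b} → z ≼ᶜ a → w ≼ᶜ b → mulᶜ z w ≼ᶜ a ℚ.* b
  ≼-mul {z} {w} p r = ≼ᶜ-subst {z * w} {mulᶜ z w} (≡.sym (mul-≡ z w)) (≼ᶜ-* {z} {w} p r)

  ≼-opp : ∀ {z b} → z ≼ᶜ b → oppᶜ z ≼ᶜ b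
  ≼-opp {z} p = ≼ᶜ-subst { - z} {oppᶜ z} (≡.sym (opp-≡ z)) (≼ᶜ-neg {z} p)

  -- Bounds for the opaque difference and for the given one.
  sub⇒ : ∀ z w {b} → addᶜ z (oppᶜ w) ≼ᶜ b → z - w ≼ᶜ b
  sub⇒ z w p = ≼ᶜ-subst {addᶜ z (oppᶜ w)} {z + - w} (sub-≡ z w) p

  sub⇐ : ∀ z w {b} → z - w ≼ᶜ b → addᶜ z (oppᶜ w) ≼ᶜ b
  sub⇐ z w p = ≼ᶜ-subst {z + - w} {addᶜ z (oppᶜ w)} (≡.sym (sub-≡ z w)) p

  -- ℂ with the modulus.
  ℂ-normed : NormedRing
  ℂ-normed = record
    { commutativeRing = ℂ-commutativeRing
    ; _≼_       = _≼ᶜ_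
    ; ≼-resp    = λ {z} {w} → ≼ᶜ-resp {z} {w}
    ; ≼-mono    = λ {z} → ≼ᶜ-mono {z}
    ; ≼-0       = ≼ᶜ-0
    ; ≼-1       = ≼ᶜ-1
    ; ≼-+       = λ {z} {w} → ≼-add {z} {w}
    ; ≼-neg     = λ {z} → ≼-opp {z}
    ; ≼-*       = λ {z} {w} → ≼-mul {z} {w}
    ; ≼-nonneg  = ≼ᶜ-nonneg
    ; ≼-closed  = ≼ᶜ-closed
    ; ≼-bounded = ≼ᶜ-bounded
    ; ≼0⇒≈      = λ {z} {w} p → ≼0⇒≈ᶜ {z} {w} (sub⇒ z w p)
    ; complete  = λ x c →
        let (w , p) = completeᶜ x (λ ε ε>0 → let (N , r) = c ε ε>0 in N , λ m n N≤m N≤n → sub⇒ (x m) (x n) (r m n N≤m N≤n))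
        in w , λ ε ε>0 → let (N , r) = p ε ε>0 in N , λ n N≤n → sub⇐ (x n) w (r n N≤n)
    ; unit      = unitᶜ
    ; unit-law  = unit-lawᶜ
    ; unit-≼    = unit-≼ᶜ
    }

-- The complex exponential and the modulus of q

module ComplexExponential where
  open RationalEstimates
  open Disks
  open ComplexNorm
  open +-*-Solver using (solve; _:+_; _:*_; _:-_; :-_; _:=_; con)
  open ℝ using (seq)
  open FiniteSum ℂ-commutativeRing using () renaming (∑ to ∑ᶜ)
  open Limits ℂ-normed using (Seq-Conv; Conv-cong; ≼-difference)
  open ExponentialSeries ℂ-normed using (term; IsExp; exp-remainder; module TotalExponential)

  add-seq : ∀ z w t → seq (re (addᶜ z w)) t ≡ seq (re z) t ℚ.+ seq (re w) t × seq (im (addᶜ z w)) t ≡ seq (im z) t ℚ.+ seq (im w) t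
  add-seq z w t = cong (λ v → seq (re v) t) (add-≡ z w) , cong (λ v → seq (im v) t) (add-≡ z w)

  mul-seq : ∀ z w t → seq (re (mulᶜ z w)) t ≡ seq (re z) t ℚ.* seq (re w) t ℚ.- seq (im z) t ℚ.* seq (im w) t
    × seq (im (mulᶜ z w)) t ≡ seq (re z) t ℚ.* seq (im w) t ℚ.+ seq (im z) t ℚ.* seq (re w) t
  mul-seq z w t = cong (λ v → seq (re v) t) (mul-≡ z w) , cong (λ v → seq (im v) t) (mul-≡ z w)

  term-≐ : ∀ z j → term z j ≐ expTerm z j
  term-≐ z zero    t = ≡.refl , ≡.refl
  term-≐ z (suc j) t =
    let (r , i)   = mul-seq (unitᶜ j) (mulᶜ (term z j) z) t
        (r′ , i′) = mul-seq (term z j) z t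
        (r″ , i″) = term-≐ z j t
    in ≡.trans r (real (unit-fraction j) {b = seq (im (mulᶜ (term z j) z)) t} (≡.trans r′ (cong₂ (λ a b → a ℚ.* seq (re z) t ℚ.- b ℚ.* seq (im z) t) r″ i″)))
     , ≡.trans i (imag (unit-fraction j) {b = seq (re (mulᶜ (term z j) z)) t} (≡.trans i′ (cong₂ (λ a b → a ℚ.* seq (im z) t ℚ.+ b ℚ.* seq (re z) t) r″ i″)))
    where
    real : ∀ u {a a′ b} → a ≡ a′ → u ℚ.* a ℚ.- 0ℚ ℚ.* b ≡ u ℚ.* a′
    real u {a} {b = b} ≡.refl = solve 3 (λ u a b → u :* a :- con 0ℚ :* b := u :* a) ≡.refl u a b
    imag : ∀ u {a a′ b} → a ≡ a′ → u ℚ.* a ℚ.+ 0ℚ ℚ.* b ≡ u ℚ.* a′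
    imag u {a} {b = b} ≡.refl = solve 3 (λ u a b → u :* a :+ con 0ℚ :* b := u :* a) ≡.refl u a b

  -- The partial sums whose limit is exp z.
  partials : ℂ → ℕ → ℂ
  partials z n = mkℂ (partialSum (re ∘ expTerm z) n) (partialSum (im ∘ expTerm z) n)

  ∑-partials : ∀ z n → ∑ᶜ n (term z) ≐ partials z n
  ∑-partials z zero    t = ≡.refl , ≡.refl
  ∑-partials z (suc n) t =
    let (r , i)   = add-seq (∑ᶜ n (term z)) (term z n) t
        (r′ , i′) = ∑-partials z n t
        (r″ , i″) = term-≐ z n t
    in ≡.trans r (cong₂ ℚ._+_ r′ r″) , ≡.trans i (cong₂ ℚ._+_ i′ i″)

  Seq-Conv-parts : (x : ℕ → ℂ) (a b : ℝ) →
    (∀ ε → 0ℚ ℚ.< ε → ∃[ N ] ∀ n → N ≤ n → ∣ re (x n) -ᴿ a ∣ᴿ <ᴿ ofℚ ε) →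
    (∀ ε → 0ℚ ℚ.< ε → ∃[ N ] ∀ n → N ≤ n → ∣ im (x n) -ᴿ b ∣ᴿ <ᴿ ofℚ ε) → Seq-Conv x (mkℂ a b)
  Seq-Conv-parts x a b p r ε ε>0 = let (N , c) = parts-converge x a b p r ε ε>0 in
    N , λ n N≤n → sub⇐ (x n) (mkℂ a b) (c n N≤n)

  exp-isExp : ∀ z → IsExp z (exp z)
  exp-isExp z = Conv-cong {x = partials z} {y = λ n → ∑ᶜ n (term z)} {ω = exp z} {η = exp z}
    (λ n → ≈-sym {∑ᶜ n (term z)} {partials z n} (≐⇒≈ {∑ᶜ n (term z)} {partials z n} (∑-partials z n)))
    (≈-refl {exp z})
    (Seq-Conv-parts (partials z) _ _
      (Completeness.limit-correct (partialSum (re ∘ expTerm z)) (Convergence.exp-re-cauchy z))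
      (Completeness.limit-correct (partialSum (im ∘ expTerm z)) (Convergence.exp-im-cauchy z)))

  -- Opaque for the same reason as the ring operations.
  opaque
    expᶜ : ℂ → ℂ
    expᶜ = exp

    exp-≡ : ∀ z → expᶜ z ≡ exp z
    exp-≡ z = ≡.refl

    expᶜ-isExp : ∀ z → IsExp z (expᶜ z)
    expᶜ-isExp = exp-isExp

  open TotalExponential expᶜ expᶜ-isExp public

  -- The exponential of a number in the left half-plane has modulus less than 1: for small h,
  -- exp (h z) is close to 1 + h z, which lies in a smaller disk, and exp z is a power of exp (h z).
  module LeftHalfPlane (z : ℂ) (δ : ℚ) (δ>0 : 0ℚ ℚ.< δ) (T : ℕ) (left : ∀ t → T ≤ t → seq (re z) t ℚ.≤ ℚ.- δ) where

    private
      8ℚ : ℚ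
      8ℚ = + 8 ℚ./ 1

    module Step (B : ℚ) (B≥0 : 0ℚ ℚ.≤ B) (z≼B : z ≼ᶜ B) (M : ℕ) (disk : ∀ t → M ≤ t → Disk (seq (re z) t) (seq (im z) t) B)
      (n : ℕ) (small : unit-fraction n ℚ.* (8ℚ ℚ.* (B ℚ.* B)) ℚ.≤ δ) (half : unit-fraction n ℚ.* B ℚ.≤ ½) where

      h : ℚ
      h = unit-fraction n

      h>0 : 0ℚ ℚ.< h
      h>0 = unit-fraction-pos n

      h≥0 : 0ℚ ℚ.≤ h
      h≥0 = ℚₚ.<⇒≤ h>0

      δ≥0 : 0ℚ ℚ.≤ δ
      δ≥0 = ℚₚ.<⇒≤ δ>0

      w : ℂ
      w = mulᶜ (unitᶜ n) z

      -- Bounds for 1 + h z and exp (h z). As 8 h B² ≤ δ, the bound 2 (h B)² for the remainder of the series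
      -- is at most h δ / 4, so that ρ ≤ 1 - h δ / 4.
      r ρ : ℚ
      r = 1ℚ ℚ.- ½ ℚ.* (h ℚ.* δ)
      ρ = h ℚ.* B ℚ.* (h ℚ.* B) ℚ.* 2ℚ ℚ.+ r

      δ≤B : δ ℚ.≤ B
      δ≤B = ℚₚ.≤-trans (ℚₚ.≤-reflexive (solve 1 (λ d → d := :- (:- d)) ≡.refl δ))
        (ℚₚ.≤-trans (ℚₚ.neg-antimono-≤ (left (T ℕ.⊔ M) (ℕₚ.m≤m⊔n T M)))
          (ℚₚ.≤-trans (below-abs (seq (re z) (T ℕ.⊔ M))) (Disk⇒re (disk (T ℕ.⊔ M) (ℕₚ.m≤n⊔m T M)))))
        where
        below-abs : ∀ x → ℚ.- x ℚ.≤ ℚ.∣ x ∣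
        below-abs x = subst (ℚ.- x ℚ.≤_) (ℚₚ.∣-p∣≡∣p∣ x) (p≤∣p∣ (ℚ.- x))
          where
          p≤∣p∣ : ∀ p → p ℚ.≤ ℚ.∣ p ∣
          p≤∣p∣ p = square-cancel (ℚₚ.0≤∣p∣ p) (ℚₚ.≤-reflexive (≡.sym (abs-square p)))

      r≥0 : 0ℚ ℚ.≤ r
      r≥0 = subst (0ℚ ℚ.≤_) (identity h B δ) (0≤+ (0≤* 0≤½ (0≤* h≥0 (0≤- δ≤B))) (0≤+ (0≤* 0≤½ (0≤- half)) 3/4≥0))
        where
        3/4≥0 : 0ℚ ℚ.≤ 1ℚ ℚ.- ½ ℚ.* ½
        3/4≥0 = ℚₚ.nonNegative⁻¹ (1ℚ ℚ.- ½ ℚ.* ½)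
        identity : ∀ h B d → ½ ℚ.* (h ℚ.* (B ℚ.- d)) ℚ.+ (½ ℚ.* (½ ℚ.- h ℚ.* B) ℚ.+ (1ℚ ℚ.- ½ ℚ.* ½)) ≡ 1ℚ ℚ.- ½ ℚ.* (h ℚ.* d)
        identity = solve 3 (λ h B d → con ½ :* (h :* (B :- d)) :+ (con ½ :* (con ½ :- h :* B) :+ (con 1ℚ :- con ½ :* con ½)) := con 1ℚ :- con ½ :* (h :* d)) ≡.refl

      B²≥0 : 0ℚ ℚ.≤ B ℚ.* B
      B²≥0 = 0≤* B≥0 B≥0

      -- (1 + h a)² + (h b)² = 1 + 2 h a + h² (a² + b²), where a ≤ - δ.
      inner-disk : ∀ a b → a ℚ.≤ ℚ.- δ → Disk a b B → Disk (1ℚ ℚ.+ h ℚ.* a) (h ℚ.* b) r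
      inner-disk a b a≤ (_ , in-disk) = r≥0 , ≤-by
        (2ℚ ℚ.* (h ℚ.* (ℚ.- δ ℚ.- a)) ℚ.+ h ℚ.* (δ ℚ.- h ℚ.* (8ℚ ℚ.* (B ℚ.* B)))
          ℚ.+ (h ℚ.* h ℚ.* (7ℚ ℚ.* (B ℚ.* B)) ℚ.+ h ℚ.* h ℚ.* (B ℚ.* B ℚ.- (a ℚ.* a ℚ.+ b ℚ.* b))) ℚ.+ ½ ℚ.* (h ℚ.* δ) ℚ.* (½ ℚ.* (h ℚ.* δ)))
        (0≤+ (0≤+ (0≤+ (0≤* 0≤2 (0≤* h≥0 (0≤- a≤))) (0≤* h≥0 (0≤- small)))
            (0≤+ (0≤* (0≤* h≥0 h≥0) (0≤* (ℚₚ.nonNegative⁻¹ 7ℚ) B²≥0)) (0≤* (0≤* h≥0 h≥0) (0≤- in-disk))))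
          (0≤* ½hδ≥0 ½hδ≥0))
        (identity h a b B δ)
        where
        7ℚ : ℚ
        7ℚ = + 7 ℚ./ 1
        ½hδ≥0 : 0ℚ ℚ.≤ ½ ℚ.* (h ℚ.* δ)
        ½hδ≥0 = 0≤* 0≤½ (0≤* h≥0 δ≥0)
        identity : ∀ h a b B d → (1ℚ ℚ.- ½ ℚ.* (h ℚ.* d)) ℚ.* (1ℚ ℚ.- ½ ℚ.* (h ℚ.* d))
          ≡ (1ℚ ℚ.+ h ℚ.* a) ℚ.* (1ℚ ℚ.+ h ℚ.* a) ℚ.+ h ℚ.* b ℚ.* (h ℚ.* b) ℚ.+
            (2ℚ ℚ.* (h ℚ.* (ℚ.- d ℚ.- a)) ℚ.+ h ℚ.* (d ℚ.- h ℚ.* (8ℚ ℚ.* (B ℚ.* B)))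
              ℚ.+ (h ℚ.* h ℚ.* (7ℚ ℚ.* (B ℚ.* B)) ℚ.+ h ℚ.* h ℚ.* (B ℚ.* B ℚ.- (a ℚ.* a ℚ.+ b ℚ.* b))) ℚ.+ ½ ℚ.* (h ℚ.* d) ℚ.* (½ ℚ.* (h ℚ.* d)))
        identity = solve 5 (λ h a b B d → (con 1ℚ :- con ½ :* (h :* d)) :* (con 1ℚ :- con ½ :* (h :* d))
          := (con 1ℚ :+ h :* a) :* (con 1ℚ :+ h :* a) :+ h :* b :* (h :* b) :+
            (con 2ℚ :* (h :* (:- d :- a)) :+ h :* (d :- h :* (con 8ℚ :* (B :* B)))
              :+ (h :* h :* (con 7ℚ :* (B :* B)) :+ h :* h :* (B :* B :- (a :* a :+ b :* b))) :+ con ½ :* (h :* d) :* (con ½ :* (h :* d)))) ≡.refl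

      1+w : addᶜ 1ℂ w ≼ᶜ r
      1+w = Disk⇒≼ᶜ {addᶜ 1ℂ w} (T ℕ.⊔ M , λ t le →
        let (x , y)   = add-seq 1ℂ w t
            (x′ , y′) = mul-seq (unitᶜ n) z t
        in subst₂ (λ a b → Disk a b r)
             (≡.sym (≡.trans x (cong (λ a → 1ℚ ℚ.+ a) (≡.trans x′ (drop₁ h (seq (re z) t) (seq (im z) t))))))
             (≡.sym (≡.trans y (≡.trans (cong (λ a → 0ℚ ℚ.+ a) y′) (drop₂ h (seq (re z) t) (seq (im z) t)))))
             (inner-disk (seq (re z) t) (seq (im z) t) (left t (ℕₚ.m⊔n≤o⇒m≤o T M le)) (disk t (ℕₚ.m⊔n≤o⇒n≤o T M le))))
        where
        drop₁ : ∀ h a b → h ℚ.* a ℚ.- 0ℚ ℚ.* b ≡ h ℚ.* a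
        drop₁ = solve 3 (λ h a b → h :* a :- con 0ℚ :* b := h :* a) ≡.refl
        drop₂ : ∀ h a b → 0ℚ ℚ.+ (h ℚ.* b ℚ.+ 0ℚ ℚ.* a) ≡ h ℚ.* b
        drop₂ = solve 3 (λ h a b → con 0ℚ :+ (h :* b :+ con 0ℚ :* a) := h :* b) ≡.refl

      exp-w : expᶜ w ≼ᶜ ρ
      exp-w = ≼-difference {expᶜ w} {addᶜ 1ℂ w} (exp-remainder {w} {expᶜ w} (≼-mul {unitᶜ n} {z} (unit-≼ᶜ n) z≼B) half (expᶜ-isExp w)) 1+w

      ρ<1 : ρ ℚ.< 1ℚ
      ρ<1 = ℚₚ.≤-<-trans
        (≤-by (½ ℚ.* ½ ℚ.* (h ℚ.* (δ ℚ.- h ℚ.* (8ℚ ℚ.* (B ℚ.* B))))) (0≤* (0≤* 0≤½ 0≤½) (0≤* h≥0 (0≤- small))) (identity h B δ))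
        (subst₂ ℚ._<_ (ℚₚ.+-identityʳ (1ℚ ℚ.- c)) (cancel 1ℚ c) (ℚₚ.+-monoʳ-< (1ℚ ℚ.- c) (half-pos (half-pos (0<* h>0 δ>0)))))
        where
        c : ℚ
        c = ½ ℚ.* (½ ℚ.* (h ℚ.* δ))
        cancel : ∀ a b → a ℚ.- b ℚ.+ b ≡ a
        cancel = solve 2 (λ a b → a :- b :+ b := a) ≡.refl
        identity : ∀ h B d → 1ℚ ℚ.- ½ ℚ.* (½ ℚ.* (h ℚ.* d))
          ≡ h ℚ.* B ℚ.* (h ℚ.* B) ℚ.* 2ℚ ℚ.+ (1ℚ ℚ.- ½ ℚ.* (h ℚ.* d)) ℚ.+ ½ ℚ.* ½ ℚ.* (h ℚ.* (d ℚ.- h ℚ.* (8ℚ ℚ.* (B ℚ.* B))))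
        identity = solve 3 (λ h B d → con 1ℚ :- con ½ :* (con ½ :* (h :* d))
          := h :* B :* (h :* B) :* con 2ℚ :+ (con 1ℚ :- con ½ :* (h :* d)) :+ con ½ :* con ½ :* (h :* (d :- h :* (con 8ℚ :* (B :* B))))) ≡.refl

      exp-z : expᶜ z ≼ᶜ ρ
      exp-z = ≼ᶜ-mono {expᶜ z} power≤ (E-root {z} n exp-w)
        where
        ρ≥0 : 0ℚ ℚ.≤ ρ
        ρ≥0 = ≼ᶜ-nonneg exp-w
        power≤ : ρ ^ℚ suc n ℚ.≤ ρ
        power≤ = ℚₚ.≤-trans (*-monoʳ ρ≥0 (^-≤1 ρ≥0 (ℚₚ.<⇒≤ ρ<1) n)) (ℚₚ.≤-reflexive (ℚₚ.*-identityˡ ρ))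

    exp-bound : ∃[ ρ ] (ρ ℚ.< 1ℚ × expᶜ z ≼ᶜ ρ)
    exp-bound =
      let (A , z≼A) = ≼ᶜ-bounded z
          (M , disk) = _≼ᶜ_.within z≼A 1ℚ (ℚₚ.positive⁻¹ 1ℚ)
          B = A ℚ.+ 1ℚ
          B≥0 = 0≤+ (≼ᶜ-nonneg z≼A) 0≤1
          z≼B = ≼ᶜ-mono {z} {A} {B} (≤-by 1ℚ 0≤1 ≡.refl) z≼A
          (δ₁ , δ₁>0 , le₁) = shrink (8ℚ ℚ.* (B ℚ.* B)) δ>0 (0≤* (ℚₚ.nonNegative⁻¹ 8ℚ) (0≤* B≥0 B≥0))
          (δ₂ , δ₂>0 , le₂) = shrink B (ℚₚ.positive⁻¹ ½) B≥0
          (n₁ , a₁) = archimedean 1 δ₁ δ₁>0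
          (n₂ , a₂) = archimedean 1 δ₂ δ₂>0
          n = n₁ ℕ.⊔ n₂
          small = ℚₚ.≤-trans (*-monoʳ (0≤* (ℚₚ.nonNegative⁻¹ 8ℚ) (0≤* B≥0 B≥0)) (ℚₚ.<⇒≤ (a₁ n (ℕₚ.m≤m⊔n n₁ n₂)))) le₁
          half = ℚₚ.≤-trans (*-monoʳ B≥0 (ℚₚ.<⇒≤ (a₂ n (ℕₚ.m≤n⊔m n₁ n₂)))) le₂
      in Step.ρ B B≥0 z≼B M disk n small half , Step.ρ<1 B B≥0 z≼B M disk n small half , Step.exp-z B B≥0 z≼B M disk n small half

  -- The rational powers of q.

  leibniz-nonneg : ∀ j → 0ℚ ℚ.≤ leibnizTerm j
  leibniz-nonneg j = 0≤- (Estimates./-antitone 4 (ℕₚ.m≤n+m (4 ℕ.* j) 2))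

  -- The first partial sum of Leibniz' series for π is 4 - 4/3, and its terms are positive.
  π≥1 : ∀ t → 1 ≤ t → 1ℚ ℚ.≤ seq π t
  π≥1 (suc zero)    _ = ≤-by (+ 5 ℚ./ 3) (ℚₚ.nonNegative⁻¹ (+ 5 ℚ./ 3)) ≡.refl
  π≥1 (suc (suc t)) _ = ℚₚ.≤-trans (π≥1 (suc t) (s≤s z≤n)) (≤-by (leibnizTerm (suc t)) (leibniz-nonneg (suc t)) ≡.refl)

  -- q ^ r, with the opaque exponential.
  qᶜ : ℂ → ℚ → ℂ
  qᶜ τ r = expᶜ (2πi * (r · τ))

  qᶜ-≡ : ∀ τ r → qᶜ τ r ≡ q^ τ r
  qᶜ-≡ τ r = exp-≡ (2πi * (r · τ))

  qᶜ-+ : ∀ τ r s → NormedRing._≈_ ℂ-normed (qᶜ τ (r ℚ.+ s)) (mulᶜ (qᶜ τ r) (qᶜ τ s))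
  qᶜ-+ τ r s = ≈-trans {qᶜ τ (r ℚ.+ s)} {expᶜ (addᶜ zr zs)} {mulᶜ (qᶜ τ r) (qᶜ τ s)}
    (E-cong {2πi * ((r ℚ.+ s) · τ)} {addᶜ zr zs} (≐⇒≈ {2πi * ((r ℚ.+ s) · τ)} {addᶜ zr zs} λ t →
      let (x , y) = add-seq zr zs t in
        ≡.trans (real 0ℚ (fromℤ (+ 2) ℚ.* seq π t) r s (seq (re τ) t) (seq (im τ) t)) (≡.sym x)
      , ≡.trans (imag 0ℚ (fromℤ (+ 2) ℚ.* seq π t) r s (seq (re τ) t) (seq (im τ) t)) (≡.sym y)))
    (E-+ zr zs)
    where
    zr zs : ℂ
    zr = 2πi * (r · τ)
    zs = 2πi * (s · τ)
    real : ∀ z c r s x y → z ℚ.* ((r ℚ.+ s) ℚ.* x) ℚ.- c ℚ.* ((r ℚ.+ s) ℚ.* y)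
      ≡ (z ℚ.* (r ℚ.* x) ℚ.- c ℚ.* (r ℚ.* y)) ℚ.+ (z ℚ.* (s ℚ.* x) ℚ.- c ℚ.* (s ℚ.* y))
    real = solve 6 (λ z c r s x y → z :* ((r :+ s) :* x) :- c :* ((r :+ s) :* y)
      := (z :* (r :* x) :- c :* (r :* y)) :+ (z :* (s :* x) :- c :* (s :* y))) ≡.refl
    imag : ∀ z c r s x y → z ℚ.* ((r ℚ.+ s) ℚ.* y) ℚ.+ c ℚ.* ((r ℚ.+ s) ℚ.* x)
      ≡ (z ℚ.* (r ℚ.* y) ℚ.+ c ℚ.* (r ℚ.* x)) ℚ.+ (z ℚ.* (s ℚ.* y) ℚ.+ c ℚ.* (s ℚ.* x))
    imag = solve 6 (λ z c r s x y → z :* ((r :+ s) :* y) :+ c :* ((r :+ s) :* x)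
      := (z :* (r :* y) :+ c :* (r :* x)) :+ (z :* (s :* y) :+ c :* (s :* x))) ≡.refl

  qᶜ-0 : ∀ τ → qᶜ τ 0ℚ ≈ 1ℂ
  qᶜ-0 τ = ≈-trans {qᶜ τ 0ℚ} {expᶜ 0ℂ} {1ℂ}
    (E-cong {2πi * (0ℚ · τ)} {0ℂ} (≐⇒≈ {2πi * (0ℚ · τ)} {0ℂ} λ t →
        real (fromℤ (+ 2) ℚ.* seq π t) (seq (re τ) t) (seq (im τ) t)
      , imag (fromℤ (+ 2) ℚ.* seq π t) (seq (re τ) t) (seq (im τ) t)))
    E-0
    where
    real : ∀ c x y → 0ℚ ℚ.* (0ℚ ℚ.* x) ℚ.- c ℚ.* (0ℚ ℚ.* y) ≡ 0ℚ
    real = solve 3 (λ c x y → con 0ℚ :* (con 0ℚ :* x) :- c :* (con 0ℚ :* y) := con 0ℚ) ≡.refl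
    imag : ∀ c x y → 0ℚ ℚ.* (0ℚ ℚ.* y) ℚ.+ c ℚ.* (0ℚ ℚ.* x) ≡ 0ℚ
    imag = solve 3 (λ c x y → con 0ℚ :* (con 0ℚ :* y) :+ c :* (con 0ℚ :* x) := con 0ℚ) ≡.refl

  -- The real part of 2πi τ is - 2π im τ < 0, whence q has modulus less than 1.
  q-bound : ∀ τ → 0ᴿ <ᴿ im τ → ∃[ ρ ] (ρ ℚ.< 1ℚ × qᶜ τ 1ℚ ≼ᶜ ρ)
  q-bound τ (δ , δ>0 , T , positive) = LeftHalfPlane.exp-bound (2πi * (1ℚ · τ)) δ δ>0 (T ℕ.⊔ 1) λ t le →
    bound (seq π t) (seq (re τ) t) (seq (im τ) t) (π≥1 t (ℕₚ.m⊔n≤o⇒n≤o T 1 le))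
      (ℚₚ.≤-trans (ℚₚ.≤-reflexive (≡.sym (ℚₚ.+-identityˡ δ))) (ℚₚ.<⇒≤ (positive t (ℕₚ.m⊔n≤o⇒m≤o T 1 le))))
    where
    bound : ∀ p x y → 1ℚ ℚ.≤ p → δ ℚ.≤ y → 0ℚ ℚ.* (1ℚ ℚ.* x) ℚ.- 2ℚ ℚ.* p ℚ.* (1ℚ ℚ.* y) ℚ.≤ ℚ.- δ
    bound p x y 1≤p δ≤y = ≤-by (2ℚ ℚ.* ((p ℚ.- 1ℚ) ℚ.* y) ℚ.+ (2ℚ ℚ.* (y ℚ.- δ) ℚ.+ δ))
      (0≤+ (0≤* 0≤2 (0≤* (0≤- 1≤p) (ℚₚ.≤-trans (ℚₚ.<⇒≤ δ>0) δ≤y)))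
        (0≤+ (0≤* 0≤2 (0≤- δ≤y)) (ℚₚ.<⇒≤ δ>0)))
      (solve 4 (λ p x y d → :- d := con 0ℚ :* (con 1ℚ :* x) :- con 2ℚ :* p :* (con 1ℚ :* y)
        :+ (con 2ℚ :* ((p :- con 1ℚ) :* y) :+ (con 2ℚ :* (y :- d) :+ d))) ≡.refl p x y δ)

-- The given operations and the theorem

-- The passage from the opaque operations to the given ones.
module Translation where
  open RationalEstimates
  open ComplexNorm
  open FiniteSum ℂ-commutativeRing using (sumL) renaming (_^_ to _^ᶜ_)
  open Limits ℂ-normed using (Seq-Conv)
  open UnconditionalSums ℂ-normed using () renaming (HasSum to HasSumᶜ)

  add-cong : ∀ {z w} z′ w′ → z ≡ z′ → w ≡ w′ → addᶜ z w ≡ z′ + w′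
  add-cong z w ≡.refl ≡.refl = add-≡ z w

  mul-cong : ∀ {z w} z′ w′ → z ≡ z′ → w ≡ w′ → mulᶜ z w ≡ z′ * w′
  mul-cong z w ≡.refl ≡.refl = mul-≡ z w

  sub-cong : ∀ {z w} z′ w′ → z ≡ z′ → w ≡ w′ → addᶜ z (oppᶜ w) ≡ z′ - w′
  sub-cong z w ≡.refl ≡.refl = sub-≡ z w

  ≡⇒≈ : ∀ {z w} → z ≡ w → z ≈ w
  ≡⇒≈ {z} ≡.refl = ≈-refl {z}

  ^-translate : ∀ z n → z ^ᶜ n ≡ z ^ n
  ^-translate z zero    = ≡.refl
  ^-translate z (suc n) = mul-cong (z ^ n) z (^-translate z n) ≡.refl

  foldr-cong : {A : Set} {f g : A → A → A} {e : A} → (∀ x y → f x y ≡ g x y) → ∀ xs → List.foldr f e xs ≡ List.foldr g e xs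
  foldr-cong         p []       = ≡.refl
  foldr-cong {g = g} p (x ∷ xs) = ≡.trans (p x _) (cong (g x) (foldr-cong p xs))

  sum-translate : {I : Set} (f : I → ℂ) (G : List I) → List.foldr addᶜ 0ℂ (List.map f G) ≡ List.foldr _+_ 0ℂ (List.map f G)
  sum-translate f G = foldr-cong {f = addᶜ} {g = _+_} {e = 0ℂ} add-≡ (List.map f G)

  close-translate : ∀ {ε z w} → 0ℚ ℚ.< ε → addᶜ z (oppᶜ w) ≼ᶜ ½ ℚ.* ε → Close ε z w
  close-translate {ε} {z} {w} ε>0 p = ≼ᶜ⇒Close {ε} {z} {w} ε>0 (sub⇒ z w p)

  limit-translate : ∀ {x y : ℕ → ℂ} {w} → (∀ n → x n ≡ y n) → Seq-Conv x w → y ⟶ w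
  limit-translate {x} {y} {w} e c ε ε>0 = let (N , p) = c (½ ℚ.* ε) (half-pos ε>0) in
    N , λ n N≤n → subst (λ z → Close ε z w) (e n) (close-translate {ε} {x n} {w} ε>0 (p n N≤n))

  hasSum-translate : {I : Set} {f g : I → ℂ} {A : ℂ} → (∀ i → f i ≡ g i) → HasSumᶜ f A → HasSum g A
  hasSum-translate {f = f} {g} {A} e h ε ε>0 = let (F , p) = h (½ ℚ.* ε) (half-pos ε>0) in
    F , λ G G! F⊆G → subst (λ z → Close ε z A) (≡.trans (sums G) (sum-translate g G))
      (close-translate {ε} {sumL f G} {A} ε>0 (p G G! F⊆G))
    where
    sums : ∀ G → sumL f G ≡ sumL g G
    sums []      = ≡.refl
    sums (i ∷ G) = cong₂ addᶜ (e i) (sums G)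

  left-translate : ∀ {q ℓ} {f g : ℤ → ℂ} {u v : ℕ → ℂ} → (∀ n → f n ≡ g n) →
    (∀ n → u n ≡ poch (- q) q n) → (∀ n → v n ≡ poch q q n) →
    ∀ P Q R S⁺ S⁻ → Seq-Conv u P → Seq-Conv v Q → mulᶜ Q R ≈ 1ℂ →
    HasSumᶜ (λ m → f (+ (ℤ.∣ ℓ ∣ ℕ.+ m))) S⁺ → HasSumᶜ (λ m → f (ℤ.- (+ ℤ.∣ ℓ ∣) ℤ.- + 1 ℤ.- + m)) S⁻ →
    IsLeftSide q ℓ g (mulᶜ (mulᶜ P R) (addᶜ S⁺ (oppᶜ S⁻)))
  left-translate {ℓ = ℓ} e eu ev P Q R S⁺ S⁻ cP cQ QR h⁺ h⁻ = P , Q , R , S⁺ , S⁻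
    , limit-translate eu cP
    , limit-translate ev cQ
    , subst (_≈ 1ℂ) (mul-≡ Q R) QR
    , hasSum-translate (λ m → e (+ (ℤ.∣ ℓ ∣ ℕ.+ m))) h⁺
    , hasSum-translate (λ m → e (ℤ.- (+ ℤ.∣ ℓ ∣) ℤ.- + 1 ℤ.- + m)) h⁻
    , ≡⇒≈ {mulᶜ (mulᶜ P R) (addᶜ S⁺ (oppᶜ S⁻))} {P * R * (S⁺ - S⁻)} (mul-cong (P * R) (S⁺ - S⁻) (mul-≡ P R) (sub-cong S⁺ S⁻ ≡.refl ≡.refl))

  -- Here e r is q ^ r for the opaque exponential, and e′ r is q ^ r for the given one.
  module WithNome (q : ℂ) (ρ : ℚ) (ρ<1 : ρ ℚ.< 1ℚ) (q≼ρ : q ≼ᶜ ρ) (e e′ : ℚ → ℂ) (e≡e′ : ∀ r → e r ≡ e′ r)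
    (e-+ : ∀ r s → e (r ℚ.+ s) ≈ mulᶜ (e r) (e s)) (e-0 : e 0ℚ ≈ 1ℂ) (e-1 : e 1ℚ ≈ q) where

    module E = Evaluation ℂ-normed q ρ ρ<1 q≼ρ e e-+ e-0 e-1
    open ThetaLimit ℂ-normed q ρ ρ<1 q≼ρ using (P; Q; R; QR)

    poch-translate : ∀ {a a′} → a ≡ a′ → ∀ n → E.poch a n ≡ poch a′ q n
    poch-translate a≡ zero    = ≡.refl
    poch-translate {a′ = a} a≡ (suc n) = mul-cong (poch a q n) (1ℂ - a * q ^ n) (poch-translate a≡ n)
      (sub-cong 1ℂ (a * q ^ n) ≡.refl (mul-cong a (q ^ n) a≡ (^-translate q n)))

    pochℤ-translate : ∀ n → E.pochℤ (oppᶜ q) n ≡ pochℤ (- q) q n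
    pochℤ-translate (+ n)    = poch-translate (opp-≡ q) n
    pochℤ-translate -[1+ _ ] = ≡.refl

    ∏-translate : ∀ js {f g : ℕ → ℂ} → (∀ j → f j ≡ g j) → E.∏ js f ≡ ∏ js g
    ∏-translate js {f} {g} e = ≡.trans (foldr-cong {f = mulᶜ} {g = _*_} {e = 1ℂ} mul-≡ (List.map f js))
      (cong (List.foldr _*_ 1ℂ) (Listₚ.map-cong e js))

    module _ (r : ℤ → ℂ) (r≡ : ∀ i → E.rrℤ i ≡ r i) where

      reciprocal : ∀ m → poch q q m * r (+ m) ≈ 1ℂ
      reciprocal m = subst (_≈ 1ℂ) (mul-cong {E.poch q m} {E.rrℤ (+ m)} (poch q q m) (r (+ m)) (poch-translate ≡.refl m) (r≡ (+ m)))
        (E.poch-rr m)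

      vanishing : ∀ m → r -[1+ m ] ≈ 0ℂ
      vanishing m = ≡⇒≈ {r -[1+ m ]} {0ℂ} (≡.sym (r≡ -[1+ m ]))

      rightTerm-factors : ∀ {k} (ℓ : ℤ) (t : Vec ℕ k → ℂ) v (x y z u : ℂ) → t v ≡ x → E.pochℤ (oppᶜ q) (+ N v 1 ℤ.+ ℓ) ≡ y →
        E.∏ (1 ⋯ k) (λ j → E.rrℤ (+ (v ‼ j))) ≡ z → E.rrℤ (+ (v ‼ k) ℤ.+ + 2 ℤ.* ℓ) ≡ u → E.rightTerm ℓ t v ≡ x * y * (z * u)
      rightTerm-factors ℓ t v x y z u = E.rightTerm-≡ _*_ mul-≡ ℓ t v {x} {y} {z} {u}

      rightTerm-translate : ∀ {k} (ℓ : ℤ) (t t′ : Vec ℕ k → ℂ) → (∀ v → t v ≡ t′ v) → ∀ v → E.rightTerm ℓ t v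
        ≡ t′ v * pochℤ (- q) q (+ N v 1 ℤ.+ ℓ) * (∏ (1 ⋯ k) (λ j → r (+ (v ‼ j))) * r (+ (v ‼ k) ℤ.+ + 2 ℤ.* ℓ))
      rightTerm-translate {k} ℓ t t′ e v = rightTerm-factors ℓ t v
        (t′ v) (pochℤ (- q) q (+ N v 1 ℤ.+ ℓ)) (∏ (1 ⋯ k) (λ j → r (+ (v ‼ j)))) (r (+ (v ‼ k) ℤ.+ + 2 ℤ.* ℓ))
        (e v) (pochℤ-translate (+ N v 1 ℤ.+ ℓ)) (∏-translate (1 ⋯ k) (λ j → r≡ (+ (v ‼ j)))) (r≡ (+ (v ‼ k) ℤ.+ + 2 ℤ.* ℓ))

      right-translate : ∀ {k} (ℓ : ℤ) (t t′ : Vec ℕ k → ℂ) → (∀ v → t v ≡ t′ v) → ∀ A → HasSumᶜ (E.rightTerm ℓ t) A → IsRightSide q k ℓ t′ A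
      right-translate {k} ℓ t t′ e A h = r , (reciprocal , vanishing)
        , hasSum-translate {f = E.rightTerm ℓ t}
            {g = λ v → t′ v * pochℤ (- q) q (+ N v 1 ℤ.+ ℓ) * (∏ (1 ⋯ k) (λ j → r (+ (v ‼ j))) * r (+ (v ‼ k) ℤ.+ + 2 ℤ.* ℓ))}
            {A = A} (rightTerm-translate ℓ t t′ e) h

    leftTerm-translate : ∀ k i ℓ n → E.leftTerm k i ℓ n ≡ e′ (leftExponent k i ℓ n) * (1ℂ + e′ (fromℤ n))
    leftTerm-translate k i ℓ n = E.leftTerm-≡ _+_ _*_ add-≡ mul-≡ k i ℓ n
      {e′ (leftExponent k i ℓ n)} {1ℂ} {e′ (fromℤ n)} (e≡e′ (leftExponent k i ℓ n)) ≡.refl (e≡e′ (fromℤ n))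

    translate : ∀ k ℓ {f g : ℤ → ℂ} {t t′ : Vec ℕ k → ℂ} → (∀ n → f n ≡ g n) → (∀ v → t v ≡ t′ v) → E.Identity k ℓ f t →
      ∃[ A ] (IsLeftSide q ℓ g A × IsRightSide q k ℓ t′ A)
    translate k ℓ {f} {g} {t} {t′} ef et (S⁺ , S⁻ , (h⁺ , h⁻) , h) = mulᶜ (mulᶜ P R) (addᶜ S⁺ (oppᶜ S⁻))
      , left-translate {q} {ℓ} {f} {g} {E.poch (oppᶜ q)} {E.poch q} ef (poch-translate (opp-≡ q)) (poch-translate ≡.refl)
          P Q R S⁺ S⁻ E.poch-neg→P E.poch-pos→Q QR h⁺ h⁻
      , right-translate E.rrℤ (λ i → ≡.refl) ℓ t t′ et (mulᶜ (mulᶜ P R) (addᶜ S⁺ (oppᶜ S⁻))) h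

    -- Both parts of the theorem for k = κ + 1.
    both : ∀ κ ℓ →
      ((i : ℕ) → i ≤ suc κ →
        ∃[ A ] (IsLeftSide q ℓ (λ n → e′ (leftExponent (suc κ) i ℓ n) * (1ℂ + e′ (fromℤ n))) A
              × IsRightSide q (suc κ) ℓ (λ n → e′ (rightExponent ℓ n ℚ.- fromℤ (+ ∑ (1 ⋯ (suc κ ∸ i)) (N n)))) A))
      × ∃[ A ] (IsLeftSide q ℓ (λ n → e′ (leftExponent (suc κ) (suc κ) ℓ n)) A
              × IsRightSide q (suc κ) ℓ (λ n → e′ (rightExponent ℓ n)) A)
    both κ ℓ =
        (λ i i≤ → translate (suc κ) ℓ (leftTerm-translate (suc κ) i ℓ)
          (λ v → e≡e′ (rightExponent ℓ v ℚ.- fromℤ (+ ∑ (1 ⋯ (suc κ ∸ i)) (N v)))) (E.identity κ ℓ i i≤))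
      , translate (suc κ) ℓ (λ n → e≡e′ (leftExponent (suc κ) (suc κ) ℓ n)) (λ v → e≡e′ (rightExponent ℓ v)) (E.identity′ κ ℓ)

open ComplexExponential
open ComplexNorm

proposition3p2 : (τ : ℂ) → 0ᴿ <ᴿ im τ → (k : ℕ) → 1 ≤ k → (ℓ : ℤ) →
  ((i : ℕ) → i ≤ k →
    ∃[ A ] (IsLeftSide (q^ τ ℚ.1ℚ) ℓ (λ n → q^ τ (leftExponent k i ℓ n) * (1ℂ + q^ τ (fromℤ n))) A
          × IsRightSide (q^ τ ℚ.1ℚ) k ℓ
              (λ n → q^ τ (rightExponent ℓ n ℚ.- fromℤ (+ ∑ (1 ⋯ (k ∸ i)) (N n)))) A))
  × ∃[ A ] (IsLeftSide (q^ τ ℚ.1ℚ) ℓ (λ n → q^ τ (leftExponent k k ℓ n)) A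
          × IsRightSide (q^ τ ℚ.1ℚ) k ℓ (λ n → q^ τ (rightExponent ℓ n)) A)
proposition3p2 τ im>0 (suc κ) _ ℓ = let (ρ , ρ<1 , bound) = q-bound τ im>0 in
  Translation.WithNome.both (q^ τ 1ℚ) ρ ρ<1 (≼ᶜ-subst {qᶜ τ 1ℚ} {q^ τ 1ℚ} (qᶜ-≡ τ 1ℚ) bound)
    (qᶜ τ) (q^ τ) (qᶜ-≡ τ) (qᶜ-+ τ) (qᶜ-0 τ) (Translation.≡⇒≈ {qᶜ τ 1ℚ} {q^ τ 1ℚ} (qᶜ-≡ τ 1ℚ)) κ ℓ
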